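{- Let $W$ be a finite irreducible Coxeter group with simple reflections $S=\{s_1,\dots,s_n\}$, and let $c\in W$ be a Coxeter element. For $w\in\mathrm{Camb}_c$, the following are equivalent: (1) $w$ is in the image of $\mathrm{pop}^{\downarrow}_{\mathrm{Camb}_c}$; (2) the descents of $w$ pairwise commute, and $w$ has no left inversions in common with $c^{ -1}$; (3) the interval $[\mathrm{pop}^{\downarrow}_{\mathrm{Camb}_c}(w),w]$ of $\mathrm{Camb}_c$ is a Boolean lattice, and $p_i\not\le w$ for all $i\in[n]$.
   Context: For a finite Coxeter system $(W,S)$: $\ell$ is the length function; a reflection is a conjugate of a simple reflection; a left inversion of $w$ is a reflection $t$ with $\ell(tw)<\ell(w)$; a descent of $w$ is $s\in S$ with $\ell(ws)<\ell(w)$. The (right) weak order has $u\le v$ iff every left inversion of $u$ is a left inversion of $v$. A Coxeter element is a product of all simple reflections, each appearing once, in some order. Fix a reduced word $\mathsf c$ for $c$; the $c$-sorting word of $w$ is the reduced word for $w$ that is lexicographically first (by positions) as a subword of $\mathsf c^\infty=\mathsf c\mathsf c\mathsf c\cdots$; let $I^{(k)}(w)$ be the set of simple reflections used from the $k$-th copy of $\mathsf c$. $w$ is $c$-sortable if $I^{(1)}(w)\supseteq I^{(2)}(w)\supseteq\cdots$ (independent of the choice of $\mathsf c$). $\mathrm{Camb}_c$ is the set of $c$-sortable elements with the weak order; it is a sublattice of the weak order. For a finite lattice $L$, $\mathrm{pop}^{\downarrow}_L(x)=x\wedge\bigwedge\{y\mid y\lessdot x\}$. For $i\in[n]$, $\Theta_i=\{x\in\mathrm{Camb}_c\mid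 s_i\le x,\ s_j\not\le x\ \forall j\ne i\}$ and $p_i=\bigvee\Theta_i$ (join in $\mathrm{Camb}_c$). -}

module Defs where

open import Data.Nat using (ℕ; zero; suc; _≤_; _<_)
open import Data.Fin using (Fin; toℕ)
open import Data.Fin.Subset using (Subset; _⊆_)
open import Data.List using (List; []; _∷_; _++_; length; reverse; map; [_])
open import Data.List.Relation.Unary.Any using (Any)
open import Data.List.Relation.Unary.Linked using (Linked)
open import Data.List.Membership.Propositional using (_∈_)
open import Data.Product using (Σ; ∃; ∃-syntax; _×_; _,_)
open import Data.Sum using (_⊎_)
open import Relation.Nullary using (¬_)
open import Relation.Binary.PropositionalEquality using (_≡_; _≢_)
open import Relation.Binary.Construct.Closure.Equivalence using (EqClosure)
open import Relation.Binary.Construct.Closure.ReflexiveTransitive using (Star)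
open import Function.Definitions using (Injective)
open import Function.Bundles using (_⇔_)

-- Coxeter matrices on the index set Fin n (simple reflections s_0..s_{n-1}).
-- Entries are natural numbers (m = ∞ is excluded; it never occurs for
-- finite W anyway).

record IsCoxeterMatrix {n : ℕ} (m : Fin n → Fin n → ℕ) : Set where
  field
    diag : ∀ i → m i i ≡ 1
    offdiag : ∀ i j → i ≢ j → 2 ≤ m i j
    symm : ∀ i j → m i j ≡ m j i

module Coxeter {n : ℕ} (m : Fin n → Fin n → ℕ) where

  Word : Set
  Word = List (Fin n)

  alt : Fin n → Fin n → ℕ → Word
  alt i j zero = []
  alt i j (suc k) = i ∷ alt j i k

  data Rule : Word → Word → Set where
    del   : ∀ i → Rule (i ∷ i ∷ []) []
    braid : ∀ i j → Rule (alt i j (m i j)) (alt j i (m i j))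

  data Step : Word → Word → Set where
    step : ∀ a b {l r} → Rule l r → Step (a ++ l ++ b) (a ++ r ++ b)

  -- equality in W  (W = words modulo the Coxeter relations)
  _≈_ : Word → Word → Set
  _≈_ = EqClosure Step

  infix 4 _≈_ _≤W_

  Finite : Set
  Finite = ∃[ L ] (∀ (w : Word) → Any (w ≈_) L)

  Adj : Fin n → Fin n → Set
  Adj i j = 3 ≤ m i j

  Irreducible : Set
  Irreducible = ∀ i j → Star Adj i j

  Len : Word → ℕ → Set
  Len w k = (∃[ u ] (u ≈ w × length u ≡ k)) × (∀ u → u ≈ w → k ≤ length u)

  LenLt : Word → Word → Set
  LenLt a b = ∃[ k ] ∃[ k' ] (Len a k × Len b k' × k < k')

  Reduced : Word → Set
  Reduced u = Len u (length u)

  Reflection : Word → Set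
  Reflection t = ∃[ w ] ∃[ s ] (t ≈ w ++ [ s ] ++ reverse w)

  LeftInv : Word → Word → Set
  LeftInv t w = Reflection t × LenLt (t ++ w) w

  Descent : Fin n → Word → Set
  Descent s w = LenLt (w ++ [ s ]) w

  _≤W_ : Word → Word → Set
  u ≤W v = ∀ t → LeftInv t u → LeftInv t v

  -- Cambrian lattice.  A Coxeter element c is given by a reduced word
  --   c = s_{σ 0} s_{σ 1} ... s_{σ (n-1)},  σ injective (hence bijective).
  module Cambrian (σ : Fin n → Fin n) where

    cw : Word
    cw = map σ (Data.List.allFin n)
      where import Data.List

    cinv : Word
    cinv = reverse cw

    -- a position in c^∞ : (copy index k, position j inside the copy);
    -- the letter at (k , j) is s_{σ j}
    Pos : Set
    Pos = ℕ × Fin n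

    _<P_ : Pos → Pos → Set
    (k , j) <P (k' , j') = k < k' ⊎ (k ≡ k' × toℕ j < toℕ j')

    letterAt : Pos → Fin n
    letterAt (k , j) = σ j

    subword : List Pos → Word
    subword ps = map letterAt ps

    data LexLe : List Pos → List Pos → Set where
      nil  : ∀ {qs} → LexLe [] qs
      less : ∀ {p q ps qs} → p <P q → LexLe (p ∷ ps) (q ∷ qs)
      same : ∀ {p ps qs} → LexLe ps qs → LexLe (p ∷ ps) (p ∷ qs)

    Admissible : Word → List Pos → Set
    Admissible w ps = Linked _<P_ ps × Reduced (subword ps) × subword ps ≈ w

    SortingPositions : Word → List Pos → Set
    SortingPositions w ps =
      Admissible w ps × (∀ qs → Admissible w qs → LexLe ps qs)

    -- c-sortable: I⁽¹⁾(w) ⊇ I⁽²⁾(w) ⊇ ⋯ , i.e. whenever the letter at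
    -- position j of copy k+1 is used, so is the one of copy k
    Sortable : Word → Set
    Sortable w = ∃[ ps ] (SortingPositions w ps ×
                   (∀ k j → (suc k , j) ∈ ps → (k , j) ∈ ps))

    CoverC : Word → Word → Set
    CoverC y x = Sortable y × Sortable x × y ≤W x × ¬ (x ≤W y) ×
      (∀ z → Sortable z → y ≤W z → z ≤W x → z ≤W y ⊎ x ≤W z)

    PopDown : Word → Word → Set
    PopDown x z = Sortable z × z ≤W x × (∀ y → CoverC y x → z ≤W y) ×
      (∀ z' → Sortable z' → z' ≤W x → (∀ y → CoverC y x → z' ≤W y) → z' ≤W z)

    IsJoinC : (Word → Set) → Word → Set
    IsJoinC P p = Sortable p × (∀ x → Sortable x → P x → x ≤W p) ×
      (∀ q → Sortable q → (∀ x → Sortable x → P x → x ≤W q) → p ≤W q)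

    -- Θ_i  (membership of Camb_c is imposed in IsJoinC)
    Θ : Fin n → Word → Set
    Θ i x = [ i ] ≤W x × (∀ j → j ≢ i → ¬ ([ j ] ≤W x))

    BooleanInterval : Word → Word → Set
    BooleanInterval z w = ∃[ k ] Σ (Subset k → Word) λ f →
      (∀ A → Sortable (f A) × z ≤W f A × f A ≤W w) ×
      (∀ x → Sortable x → z ≤W x → x ≤W w → ∃[ A ] (f A ≈ x)) ×
      (∀ A B → (f A ≤W f B) ⇔ (A ⊆ B))

{-# OPTIONS --safe #-}
-- For a Coxeter word c = s c′, the c-sortable elements obey a recursion in which an initial letter s is
-- either dropped or moved to the end of c; the Euler form E of c is invariant under this rotation, and
-- everything is proved along it.  Each sortable w has a set Up w of upper labels, and t is an inversion
-- of w iff E(t, γ) ≤ 0 for all γ ∈ Up w.  A counting argument shows that s has a join with every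
-- c′-sortable element; therefore Up w is the set of cover reflections of some sortable element, the roof
-- of w, and w is in the image of pop iff w lies below its roof.  Under E the inversion d⁻¹ s d of c⁻¹
-- (for c = … s d) represents the coordinate at s, which turns the last condition into (2); moreover this
-- inversion belongs to w iff p_s ≤ w.  Finally, the interval [pop w, w] is Boolean when the cover
-- reflections of w commute, and a non-commuting pair of them yields a fifth element above the meet of
-- the two corresponding lower covers.
module Submission where

open import Defs
open import Data.Bool using (Bool; true; false; not)
import Data.Bool.Properties as Boolₚ
open import Data.Empty using (⊥; ⊥-elim)
open import Data.Fin as Fin using (Fin; punchIn; punchOut)
import Data.Fin.Properties as Finₚ
open import Data.Fin.Subset as Subset using (Subset; _⊆_; _∪_; _∩_)
import Data.Fin.Subset.Properties as Subsetₚ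
open import Data.Integer as ℤ using (ℤ; +_; -_; 0ℤ; 1ℤ; +≤+)
import Data.Integer.Properties as ℤₚ
open import Data.Integer.Tactic.RingSolver using (solve-∀)
open import Data.List using (List; []; _∷_; _++_; [_]; reverse; length; map; allFin; foldl; filter; lookup)
import Data.List.Properties as Listₚ
open import Data.List.Membership.Propositional using (_∈_; _∉_; find; lose)
open import Data.List.Membership.Propositional.Properties using (∈-allFin; ∈-map⁺; ∈-map⁻; ∈-++⁺ˡ; ∈-++⁺ʳ; ∈-++⁻; ∈-filter⁺; ∈-filter⁻; ∈-lookup)
open import Data.List.Relation.Unary.All as All using (All; []; _∷_)
import Data.List.Relation.Unary.All.Properties as Allₚ
open import Data.List.Relation.Unary.AllPairs using (AllPairs; []; _∷_)
import Data.List.Relation.Unary.AllPairs.Properties as AllPairsₚ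
open import Data.List.Relation.Unary.Any as Any using (Any; here; there)
import Data.List.Relation.Unary.Any.Properties as Anyₚ
import Data.List.Relation.Unary.Linked.Properties as Linkedₚ
open import Data.List.Relation.Unary.Unique.Propositional using (Unique)
import Data.List.Relation.Unary.Unique.Propositional.Properties as Uniqueₚ
open import Data.Nat as ℕ using (ℕ; zero; suc; _≤_; _<_; z≤n; s≤s)
open import Data.Nat.DivMod using (_%_; _/_; m≡m%n+[m/n]*n; [m+kn]%n≡m%n; m<n⇒m%n≡m; m%n<n; n%n≡0; m*n%n≡0; n%1≡0)
open import Data.Nat.Divisibility using (∣-trans) renaming (_∣_ to _divides_; divides to mult)
open import Data.Nat.ListAction using (product)
open import Data.Nat.ListAction.Properties using (∈⇒∣product; product≢0)
import Data.Nat.Properties as ℕₚ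
open import Data.Product using (Σ; ∃-syntax; _×_; _,_; proj₁; proj₂)
open import Data.Sum using (_⊎_; inj₁; inj₂)
open import Data.Unit using (⊤)
import Data.Vec as Vec
open import Function using (_∘_)
open import Function.Bundles using (_⇔_; mk⇔; Equivalence)
open import Function.Definitions using (Injective)
import Relation.Binary.Construct.Closure.Equivalence as EqC
import Relation.Binary.Construct.Closure.ReflexiveTransitive as Star
import Relation.Binary.Construct.Closure.Symmetric as Sym
open import Relation.Binary.PropositionalEquality using (_≡_; _≢_; _≗_; refl; sym; trans; cong; cong₂; subst)
open import Relation.Nullary using (¬_; Dec; yes; no)
open import Relation.Nullary.Decidable using (_×-dec_; map′; ¬?)

-- Real roots would have irrational coordinates; each is replaced by a family of integer vectors
-- (`Rv`), and conditions such as `Ok` quantify over the whole family. The recursion terminates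
-- because dropping the initial letter shortens `c` and rotating it shortens `w`, so
-- `length c + ℓ w` decreases. It sees only the initial letter s, and the delicate case is that s is
-- a cover reflection of w. There `Cov-initial` puts all other cover reflections into the parabolic
-- subgroup without s, which turns questions about `w` into questions about `w ∣ c`. When an element
-- without s has to be compared with one above s, it is first enlarged to its join with s; this is
-- where the counting argument enters, and it replaces any appeal to the classification. Lower
-- covers, pop, and the elements of a Boolean interval [pop w, w] are one construction, `Avoids`:
-- the largest sortable element below w that avoids prescribed cover reflections.

-- Words modulo the Coxeter relations, and a finite enumeration of `W`.

module Words {n : ℕ} (m : Fin n → Fin n → ℕ) where
  open Coxeter m

  ≈-refl : ∀ {u} → u ≈ u
  ≈-refl = EqC.reflexive Step

  ≈-sym : ∀ {u v} → u ≈ v → v ≈ u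
  ≈-sym = EqC.symmetric Step

  ≈-trans : ∀ {u v w} → u ≈ v → v ≈ w → u ≈ w
  ≈-trans = EqC.transitive Step

  ≡⇒≈ : ∀ {u v} → u ≡ v → u ≈ v
  ≡⇒≈ refl = ≈-refl

  rule : ∀ {l r} → Rule l r → l ≈ r
  rule {l} {r} x = EqC.return
    (subst (λ z → Step z (r)) (Listₚ.++-identityʳ l)
      (subst (Step (l ++ [])) (Listₚ.++-identityʳ r) (step [] [] x)))

  step-++ʳ : ∀ {u v} w → Step u v → Step (u ++ w) (v ++ w)
  step-++ʳ w (step a b {l} {r} x)
    rewrite Listₚ.++-assoc a (l ++ b) w | Listₚ.++-assoc l b w
          | Listₚ.++-assoc a (r ++ b) w | Listₚ.++-assoc r b w = step a (b ++ w) x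

  step-++ˡ : ∀ {u v} w → Step u v → Step (w ++ u) (w ++ v)
  step-++ˡ w (step a b {l} {r} x)
    rewrite sym (Listₚ.++-assoc w a (l ++ b)) | sym (Listₚ.++-assoc w a (r ++ b)) = step (w ++ a) b x

  ++-congʳ : ∀ {u v} w → u ≈ v → u ++ w ≈ v ++ w
  ++-congʳ w = EqC.gmap (_++ w) (step-++ʳ w)

  ++-congˡ : ∀ {u v} w → u ≈ v → w ++ u ≈ w ++ v
  ++-congˡ w = EqC.gmap (w ++_) (step-++ˡ w)

  ++-cong : ∀ {u u′ v v′} → u ≈ u′ → v ≈ v′ → u ++ v ≈ u′ ++ v′
  ++-cong {u′ = u′} {v = v} p q = ≈-trans (++-congʳ v p) (++-congˡ u′ q)

  reverse-inverseˡ : ∀ u → reverse u ++ u ≈ []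
  reverse-inverseˡ [] = ≈-refl
  reverse-inverseˡ (i ∷ u) =
    ≈-trans (≡⇒≈ (trans (cong (_++ i ∷ u) (Listₚ.unfold-reverse i u)) (Listₚ.++-assoc (reverse u) [ i ] (i ∷ u))))
    (≈-trans (++-congˡ (reverse u) (++-congʳ u (rule (del i)))) (reverse-inverseˡ u))

  reverse-inverseʳ : ∀ u → u ++ reverse u ≈ []
  reverse-inverseʳ u = subst (λ z → z ++ reverse u ≈ []) (Listₚ.reverse-involutive u) (reverse-inverseˡ (reverse u))

  ≈-invariant : ∀ {A : Set} (F : Word → A) → (∀ {u v} → Step u v → F u ≡ F v) → ∀ {u v} → u ≈ v → F u ≡ F v
  ≈-invariant F p Star.ε = refl
  ≈-invariant F p (Sym.fwd x Star.◅ xs) = trans (p x) (≈-invariant F p xs)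
  ≈-invariant F p (Sym.bwd x Star.◅ xs) = trans (sym (p x)) (≈-invariant F p xs)

  -- `Finite` yields a list that meets every class of words, but no decision of `≈`. A table has
  -- exactly one index per element of `W`, so that equality in `W` becomes the decidable equality of
  -- `Fin N`.
  record Table : Set where
    field
      N : ℕ
      word : Fin N → Word
      ψ : Word → Fin N
      ψ-resp : ∀ {u v} → u ≈ v → ψ u ≡ ψ v
      word-ψ : ∀ u → word (ψ u) ≈ u
      ψ-word : ∀ g → ψ (word g) ≡ g

  -- Todd–Coxeter: an enumeration either is consistent with all the relations or
  -- contains two equal elements, one of which can be dropped.
  module Enumeration (N : ℕ) (L : Fin N → Word) (idx : Word → Fin N) (L-idx : ∀ u → L (idx u) ≈ u) where

    next : Fin N → Fin n → Fin N
    next x i = idx (L x ++ [ i ])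

    run : Fin N → Word → Fin N
    run = foldl next

    L-run : ∀ x u → L (run x u) ≈ L x ++ u
    L-run x [] = ≡⇒≈ (sym (Listₚ.++-identityʳ (L x)))
    L-run x (i ∷ u) = ≈-trans (L-run (next x i) u)
      (≈-trans (++-congʳ u (L-idx (L x ++ [ i ]))) (≡⇒≈ (Listₚ.++-assoc (L x) [ i ] u)))

    run-++ : ∀ x u v → run x (u ++ v) ≡ run (run x u) v
    run-++ x u v = Listₚ.foldl-++ next x u v

    Collision : Set
    Collision = ∃[ x ] ∃[ y ] (x ≢ y × L x ≈ L y)

    start : Fin N
    start = idx []

    rules-or-collision : ∀ {l r} → Rule l r → (∀ x → run x l ≡ run x r) ⊎ Collision
    rules-or-collision {l} {r} ρ with Finₚ.all? (λ x → run x l Finₚ.≟ run x r)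
    ... | yes p = inj₁ p
    ... | no ¬p with Finₚ.¬∀⟶∃¬ N _ (λ x → run x l Finₚ.≟ run x r) ¬p
    -- Both indices name `L x` followed by one side of the relation, hence the same element of `W`.
    ... | x , q = inj₂ (run x l , run x r , q ,
            ≈-trans (L-run x l) (≈-trans (++-congˡ (L x) (rule ρ)) (≈-sym (L-run x r))))

    all-or : ∀ {k} {P : Fin k → Set} {C : Set} → (∀ i → P i ⊎ C) → (∀ i → P i) ⊎ C
    all-or {zero} f = inj₁ λ ()
    all-or {suc k} {P} f with f Fin.zero | all-or (λ i → f (Fin.suc i))
    ... | inj₂ c | _ = inj₂ c
    ... | inj₁ _ | inj₂ c = inj₂ c
    ... | inj₁ p | inj₁ q = inj₁ λ { Fin.zero → p ; (Fin.suc i) → q i }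

    reach-or-collision : (∀ x → run start (L x) ≡ x) ⊎ Collision
    reach-or-collision = all-or λ x → helper x (run start (L x) Finₚ.≟ x)
      where
      helper : ∀ x → Dec (run start (L x) ≡ x) → (run start (L x) ≡ x) ⊎ Collision
      helper x (yes p) = inj₁ p
      helper x (no ¬p) = inj₂ (_ , x , ¬p , ≈-trans (L-run start (L x)) (++-congʳ (L x) (L-idx [])))

    table-or-collision : Table ⊎ Collision
    table-or-collision with all-or (λ i → rules-or-collision (del i))
                          | all-or (λ i → all-or λ j → rules-or-collision (braid i j))
                          | reach-or-collision
    ... | inj₂ c | _ | _ = inj₂ c
    ... | inj₁ _ | inj₂ c | _ = inj₂ c
    ... | inj₁ _ | inj₁ _ | inj₂ c = inj₂ c
    ... | inj₁ d | inj₁ b | inj₁ r = inj₁ record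
      { N = N ; word = L ; ψ = run start
      ; ψ-resp = ≈-invariant (run start) resp
      ; word-ψ = λ u → ≈-trans (L-run start u) (++-congʳ u (L-idx []))
      ; ψ-word = r }
      where
      rl : ∀ {l r} → Rule l r → ∀ x → run x l ≡ run x r
      rl (del i) = d i
      rl (braid i j) = b i j
      resp : ∀ {u v} → Step u v → run start u ≡ run start v
      resp (step a z {l} {r} ρ) =
        trans (run-++ start a (l ++ z)) (trans (run-++ (run start a) l z)
        (trans (cong (λ y → run y z) (rl ρ (run start a)))
        (sym (trans (run-++ start a (r ++ z)) (run-++ (run start a) r z)))))

  -- A collision removes the name `y` and sends to `x` whatever was sent to `y`. The number of names
  -- drops, so a consistent enumeration is reached; it cannot drop to zero, since `idx []` is a
  -- name.
  table : (N : ℕ) (L : Fin N → Word) (idx : Word → Fin N) → (∀ u → L (idx u) ≈ u) → Table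
  table zero L idx p with idx []
  ... | ()
  table (suc N) L idx p with Enumeration.table-or-collision (suc N) L idx p
  ... | inj₁ t = t
  ... | inj₂ (x , y , x≢y , q) = table N (L ∘ punchIn y) idx′ p′
    where
    y≢x : y ≢ x
    y≢x e = x≢y (sym e)
    idx′ : Word → Fin N
    idx′ u with y Finₚ.≟ idx u
    ... | yes _ = punchOut y≢x
    ... | no ne = punchOut ne
    p′ : ∀ u → L (punchIn y (idx′ u)) ≈ u
    p′ u with y Finₚ.≟ idx u
    ... | yes e rewrite Finₚ.punchIn-punchOut y≢x = ≈-trans q (≈-trans (≡⇒≈ (cong L e)) (p u))
    ... | no ne rewrite Finₚ.punchIn-punchOut ne = p u

  finite⇒table : Finite → Table
  finite⇒table (L , p) = table (length L) (lookup L) (λ u → Any.index (p u)) (λ u → ≈-sym (Anyₚ.lookup-index (p u)))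

least-number : (P : ℕ → Set) → (∀ k → Dec (P k)) → ∀ b → P b → ∃[ k ] (P k × (∀ j → P j → k ≤ j))
least-number P P? zero p = zero , p , λ _ _ → z≤n
least-number P P? (suc b) p with P? zero
... | yes p₀ = zero , p₀ , λ _ _ → z≤n
... | no ¬p₀ with least-number (λ k → P (suc k)) (λ k → P? (suc k)) b p
... | k , q , min = suc k , q , λ { zero p₀ → ⊥-elim (¬p₀ p₀) ; (suc j) r → s≤s (min j r) }

-- The group and its length function.

module Group {n : ℕ} (m : Fin n → Fin n → ℕ) (T : Words.Table m) where
  open Coxeter m
  open Words m
  open Words.Table T public

  G : Set
  G = Fin N

  infixl 7 _∙_
  infix 9 _⁻¹

  abstract
    e : G
    e = ψ []

    gen : Fin n → G
    gen i = ψ [ i ]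

    _∙_ : G → G → G
    g ∙ h = ψ (word g ++ word h)

    _⁻¹ : G → G
    g ⁻¹ = ψ (reverse (word g))

    ψ-[] : ψ [] ≡ e
    ψ-[] = refl

    ψ-[_] : ∀ i → ψ [ i ] ≡ gen i
    ψ-[ i ] = refl

    ψ-++ : ∀ u v → ψ (u ++ v) ≡ ψ u ∙ ψ v
    ψ-++ u v = ψ-resp (++-cong (≈-sym (word-ψ u)) (≈-sym (word-ψ v)))

    assoc : ∀ a b c → (a ∙ b) ∙ c ≡ a ∙ (b ∙ c)
    assoc a b c = ψ-resp (≈-trans (++-congʳ (word c) (word-ψ (word a ++ word b)))
      (≈-trans (≡⇒≈ (Listₚ.++-assoc (word a) (word b) (word c)))
               (++-congˡ (word a) (≈-sym (word-ψ (word b ++ word c))))))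

    idˡ : ∀ a → e ∙ a ≡ a
    idˡ a = trans (ψ-resp (++-congʳ (word a) (word-ψ []))) (ψ-word a)

    idʳ : ∀ a → a ∙ e ≡ a
    idʳ a = trans (ψ-resp (≈-trans (++-congˡ (word a) (word-ψ [])) (≡⇒≈ (Listₚ.++-identityʳ (word a))))) (ψ-word a)

    invˡ : ∀ a → a ⁻¹ ∙ a ≡ e
    invˡ a = ψ-resp (≈-trans (++-congʳ (word a) (word-ψ (reverse (word a)))) (reverse-inverseˡ (word a)))

    invʳ : ∀ a → a ∙ a ⁻¹ ≡ e
    invʳ a = ψ-resp (≈-trans (++-congˡ (word a) (word-ψ (reverse (word a)))) (reverse-inverseʳ (word a)))

    gen² : ∀ i → gen i ∙ gen i ≡ e
    gen² i = trans (sym (ψ-++ [ i ] [ i ])) (ψ-resp (rule (del i)))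

  ψ-∷ : ∀ i u → ψ (i ∷ u) ≡ gen i ∙ ψ u
  ψ-∷ i u = trans (ψ-++ [ i ] u) (cong (_∙ ψ u) ψ-[ i ])

  ψ-∷ʳ : ∀ u i → ψ (u ++ [ i ]) ≡ ψ u ∙ gen i
  ψ-∷ʳ u i = trans (ψ-++ u [ i ]) (cong (ψ u ∙_) ψ-[ i ])

  ψ⇒≈ : ∀ {u v} → ψ u ≡ ψ v → u ≈ v
  ψ⇒≈ {u} {v} p = ≈-trans (≈-sym (word-ψ u)) (≈-trans (≡⇒≈ (cong word p)) (word-ψ v))

  cancel⁻ˡ : ∀ a b → a ⁻¹ ∙ (a ∙ b) ≡ b
  cancel⁻ˡ a b = trans (sym (assoc _ _ _)) (trans (cong (_∙ b) (invˡ a)) (idˡ b))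

  cancelˡ : ∀ a b → a ∙ (a ⁻¹ ∙ b) ≡ b
  cancelˡ a b = trans (sym (assoc _ _ _)) (trans (cong (_∙ b) (invʳ a)) (idˡ b))

  cancelʳ : ∀ a b → (a ∙ b) ∙ b ⁻¹ ≡ a
  cancelʳ a b = trans (assoc _ _ _) (trans (cong (a ∙_) (invʳ b)) (idʳ a))

  cancel⁻ʳ : ∀ a b → (a ∙ b ⁻¹) ∙ b ≡ a
  cancel⁻ʳ a b = trans (assoc _ _ _) (trans (cong (a ∙_) (invˡ b)) (idʳ a))

  gg : ∀ i b → gen i ∙ (gen i ∙ b) ≡ b
  gg i b = trans (sym (assoc _ _ _)) (trans (cong (_∙ b) (gen² i)) (idˡ b))

  ggʳ : ∀ b i → (b ∙ gen i) ∙ gen i ≡ b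
  ggʳ b i = trans (assoc _ _ _) (trans (cong (b ∙_) (gen² i)) (idʳ b))

  inv-unique : ∀ a b → a ∙ b ≡ e → b ≡ a ⁻¹
  inv-unique a b p = trans (sym (cancel⁻ˡ a b)) (trans (cong (a ⁻¹ ∙_) p) (idʳ _))

  inv-inv : ∀ a → (a ⁻¹) ⁻¹ ≡ a
  inv-inv a = sym (inv-unique (a ⁻¹) a (invˡ a))

  inv-∙ : ∀ a b → (a ∙ b) ⁻¹ ≡ b ⁻¹ ∙ a ⁻¹
  inv-∙ a b = sym (inv-unique (a ∙ b) (b ⁻¹ ∙ a ⁻¹)
    (trans (assoc _ _ _) (trans (cong (a ∙_) (cancelˡ b (a ⁻¹))) (invʳ a))))

  inv-gen : ∀ i → gen i ⁻¹ ≡ gen i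
  inv-gen i = sym (inv-unique _ _ (gen² i))

  inv-e : e ⁻¹ ≡ e
  inv-e = sym (inv-unique e e (idˡ e))

  ∙-injˡ : ∀ a {b c} → a ∙ b ≡ a ∙ c → b ≡ c
  ∙-injˡ a {b} {c} p = trans (sym (cancel⁻ˡ a b)) (trans (cong (a ⁻¹ ∙_) p) (cancel⁻ˡ a c))

  ∙-injʳ : ∀ a {b c} → b ∙ a ≡ c ∙ a → b ≡ c
  ∙-injʳ a {b} {c} p = trans (sym (cancelʳ b a)) (trans (cong (_∙ a ⁻¹) p) (cancelʳ c a))

  Reach : ℕ → G → Set
  Reach k g = ∃[ u ] (length u ≡ k × ψ u ≡ g)

  reach? : ∀ k g → Dec (Reach k g)
  reach? zero g with ψ [] Finₚ.≟ g
  ... | yes p = yes ([] , refl , p)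
  ... | no ¬p = no λ { ([] , _ , p) → ¬p p }
  reach? (suc k) g with Finₚ.any? (λ i → reach? k (gen i ∙ g))
  ... | yes (i , u , l , p) = yes (i ∷ u , cong suc l , trans (ψ-∷ i u) (trans (cong (gen i ∙_) p) (gg i g)))
  ... | no ¬p = no λ { (i ∷ u , l , p) → ¬p (i , u , ℕₚ.suc-injective l ,
          trans (sym (gg i (ψ u))) (cong (gen i ∙_) (trans (sym (ψ-∷ i u)) p))) }

  private
    minimal : ∀ g → ∃[ k ] (Reach k g × (∀ j → Reach j g → k ≤ j))
    minimal g = least-number (λ k → Reach k g) (λ k → reach? k g) (length (word g)) (word g , refl , ψ-word g)

  abstract
    ℓ : G → ℕ
    ℓ g = proj₁ (minimal g)

    ℓ-word : ∀ g → Reach (ℓ g) g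
    ℓ-word g = proj₁ (proj₂ (minimal g))

    ℓ-min : ∀ u → ℓ (ψ u) ≤ length u
    ℓ-min u = proj₂ (proj₂ (minimal (ψ u))) (length u) (u , refl , refl)

  ℓ-e : ℓ e ≡ 0
  ℓ-e = ℕₚ.n≤0⇒n≡0 (subst (λ g → ℓ g ≤ 0) ψ-[] (ℓ-min []))

  ℓ≡0 : ∀ g → ℓ g ≡ 0 → g ≡ e
  ℓ≡0 g p with ℓ-word g
  ... | [] , _ , q = trans (sym q) ψ-[]
  ... | _ ∷ _ , l , _ with trans l p
  ... | ()

  ℓ-inv≤ : ∀ g → ℓ (g ⁻¹) ≤ ℓ g
  ℓ-inv≤ g with ℓ-word g
  ... | u , l , p = subst (ℓ (g ⁻¹) ≤_) (trans (Listₚ.length-reverse u) l)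
         (subst (λ z → ℓ z ≤ length (reverse u)) q (ℓ-min (reverse u)))
    where
    q : ψ (reverse u) ≡ g ⁻¹
    q = inv-unique g (ψ (reverse u)) (trans (cong (_∙ ψ (reverse u)) (sym p))
          (trans (sym (ψ-++ u (reverse u))) (trans (ψ-resp (reverse-inverseʳ u)) ψ-[])))

  ℓ-inv : ∀ g → ℓ (g ⁻¹) ≡ ℓ g
  ℓ-inv g = ℕₚ.≤-antisym (ℓ-inv≤ g) (subst (λ z → ℓ z ≤ ℓ (g ⁻¹)) (inv-inv g) (ℓ-inv≤ (g ⁻¹)))

  ℓ-∙ : ∀ g h → ℓ (g ∙ h) ≤ ℓ g ℕ.+ ℓ h
  ℓ-∙ g h with ℓ-word g | ℓ-word h
  ... | u , l , p | v , l′ , p′ =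
    subst (_≤ ℓ g ℕ.+ ℓ h) (cong ℓ (trans (ψ-++ u v) (cong₂ _∙_ p p′)))
      (ℕₚ.≤-trans (ℓ-min (u ++ v)) (ℕₚ.≤-reflexive (trans (Listₚ.length-++ u) (cong₂ ℕ._+_ l l′))))

  ℓ-gen≤ : ∀ i → ℓ (gen i) ≤ 1
  ℓ-gen≤ i = subst (λ g → ℓ g ≤ 1) ψ-[ i ] (ℓ-min [ i ])

  ℓ-gen∙ : ∀ i g → ℓ (gen i ∙ g) ≤ suc (ℓ g)
  ℓ-gen∙ i g = ℕₚ.≤-trans (ℓ-∙ (gen i) g) (ℕₚ.+-monoˡ-≤ (ℓ g) (ℓ-gen≤ i))

  ℓ-∙gen : ∀ g i → ℓ (g ∙ gen i) ≤ suc (ℓ g)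
  ℓ-∙gen g i = ℕₚ.≤-trans (ℓ-∙ g (gen i)) (ℕₚ.≤-trans (ℕₚ.+-monoʳ-≤ (ℓ g) (ℓ-gen≤ i)) (ℕₚ.≤-reflexive (ℕₚ.+-comm (ℓ g) 1)))

  private
    parity : ℕ → Bool
    parity zero = false
    parity (suc k) = not (parity k)

    parity-+ : ∀ a b c → parity b ≡ parity c → parity (a ℕ.+ b) ≡ parity (a ℕ.+ c)
    parity-+ zero b c p = p
    parity-+ (suc a) b c p = cong not (parity-+ a b c p)

    length-alt : ∀ i j k → length (alt i j k) ≡ k
    length-alt i j zero = refl
    length-alt i j (suc k) = cong suc (length-alt j i k)

    rule-parity : ∀ {l r} → Rule l r → ∀ b → parity (length l ℕ.+ b) ≡ parity (length r ℕ.+ b)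
    rule-parity (del i) b = Boolₚ.not-involutive _
    rule-parity (braid i j) b = cong (λ z → parity (z ℕ.+ b)) (trans (length-alt i j (m i j)) (sym (length-alt j i (m i j))))

    step-parity : ∀ {u v} → Step u v → parity (length u) ≡ parity (length v)
    step-parity (step a b {l} {r} x) =
      trans (cong parity (Listₚ.length-++ a))
      (trans (parity-+ (length a) (length (l ++ b)) (length (r ++ b))
        (trans (cong parity (Listₚ.length-++ l)) (trans (rule-parity x (length b)) (sym (cong parity (Listₚ.length-++ r))))))
      (sym (cong parity (Listₚ.length-++ a))))

    ℓ-parity : ∀ u → parity (ℓ (ψ u)) ≡ parity (length u)
    ℓ-parity u with ℓ-word (ψ u)
    ... | v , l , p = trans (cong parity (sym l)) (≈-invariant (λ z → parity (length z)) step-parity (ψ⇒≈ p))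

  -- Every relation preserves the parity of the length of a word, `braid` because its two sides are
  -- equally long; one more letter therefore changes the parity of `ℓ`.
  ℓ-∙gen≢ : ∀ g i → ℓ (g ∙ gen i) ≢ ℓ g
  ℓ-∙gen≢ g i p = Boolₚ.not-¬ refl (trans (trans (sym (ℓ-parity (word g))) (trans (cong (λ z → parity (ℓ z)) (ψ-word g)) (cong parity (sym p))))
     (trans (cong (λ z → parity (ℓ z)) (trans (cong (_∙ gen i) (sym (ψ-word g))) (sym (ψ-∷ʳ (word g) i))))
     (trans (ℓ-parity (word g ++ [ i ])) (cong parity (trans (Listₚ.length-++ (word g)) (ℕₚ.+-comm (length (word g)) 1))))))

  -- P g i says that the root g α_i is positive.
  P : G → Fin n → Set
  P g i = ℓ g < ℓ (g ∙ gen i)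

  P? : ∀ g i → Dec (P g i)
  P? g i = ℓ g ℕₚ.<? ℓ (g ∙ gen i)

  ¬P⇒< : ∀ g i → ¬ P g i → ℓ (g ∙ gen i) < ℓ g
  ¬P⇒< g i ¬p = ℕₚ.≤∧≢⇒< (ℕₚ.≮⇒≥ ¬p) (ℓ-∙gen≢ g i)

  P⇒ℓ : ∀ g i → P g i → ℓ (g ∙ gen i) ≡ suc (ℓ g)
  P⇒ℓ g i p = ℕₚ.≤-antisym (ℓ-∙gen g i) p

  ¬P⇒ℓ : ∀ g i → ¬ P g i → suc (ℓ (g ∙ gen i)) ≡ ℓ g
  ¬P⇒ℓ g i ¬p = ℕₚ.≤-antisym (¬P⇒< g i ¬p) (subst (_≤ suc (ℓ (g ∙ gen i))) (cong ℓ (ggʳ g i)) (ℓ-∙gen (g ∙ gen i) i))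

  ¬P-flip : ∀ g i → ¬ P g i → P (g ∙ gen i) i
  ¬P-flip g i ¬p = subst (ℓ (g ∙ gen i) <_) (cong ℓ (sym (ggʳ g i))) (¬P⇒< g i ¬p)

  P-flip : ∀ g i → P g i → ¬ P (g ∙ gen i) i
  P-flip g i p q = ℕₚ.<-asym p (subst (ℓ (g ∙ gen i) <_) (cong ℓ (ggʳ g i)) q)

  ℓ-flip : ∀ i g → ℓ (g ⁻¹ ∙ gen i) ≡ ℓ (gen i ∙ g)
  ℓ-flip i g = trans (sym (ℓ-inv (g ⁻¹ ∙ gen i))) (cong ℓ (trans (inv-∙ (g ⁻¹) (gen i)) (cong₂ _∙_ (inv-gen i) (inv-inv g))))

  abstract
    last-letter : ∀ g → ℓ g ≢ 0 → ∃[ i ] ¬ P g i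
    last-letter g ne with ℓ-word (g ⁻¹)
    ... | [] , l , p = ⊥-elim (ne (trans (sym (ℓ-inv g)) (sym l)))
    ... | i ∷ u , l , p = i , λ q → ℕₚ.<-irrefl refl (ℕₚ.<-≤-trans q (ℕₚ.≤-trans (ℕₚ.≤-reflexive eq)
          (ℕₚ.≤-trans (ℓ-min u) (ℕₚ.≤-trans (ℕₚ.n≤1+n _) (ℕₚ.≤-reflexive (trans l (ℓ-inv g)))))))
      where
      eq : ℓ (g ∙ gen i) ≡ ℓ (ψ u)
      eq = trans (sym (ℓ-inv _)) (cong ℓ (trans (inv-∙ g (gen i)) (trans (cong₂ _∙_ (inv-gen i) (trans (sym p) (ψ-∷ i u))) (gg i (ψ u)))))

  all-P⇒e : ∀ g → (∀ i → P g i) → g ≡ e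
  all-P⇒e g p with ℓ g ℕₚ.≟ 0
  ... | yes z = ℓ≡0 g z
  ... | no ne with last-letter g ne
  ... | i , ¬p = ⊥-elim (¬p (p i))

-- Integer rows, and Chebyshev polynomials of the adjacency operator of paths.

Row : Set
Row = ℕ → ℤ

infixl 6 _⊞_ _⊟_
_⊞_ _⊟_ : Row → Row → Row
(f ⊞ g) k = f k ℤ.+ g k
(f ⊟ g) k = f k ℤ.- g k

⊖_ : Row → Row
(⊖ f) k = - f k

0ʳ : Row
0ʳ _ = 0ℤ

unit : ℕ → Row
unit zero zero = 1ℤ
unit zero (suc k) = 0ℤ
unit (suc l) zero = 0ℤ
unit (suc l) (suc k) = unit l k

unit-refl : ∀ l → unit l l ≡ 1ℤ
unit-refl zero = refl
unit-refl (suc l) = unit-refl l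

unit-≢ : ∀ l k → l ≢ k → unit l k ≡ 0ℤ
unit-≢ zero zero p = ⊥-elim (p refl)
unit-≢ zero (suc k) p = refl
unit-≢ (suc l) zero p = refl
unit-≢ (suc l) (suc k) p = unit-≢ l k (λ e → p (cong suc e))

unit-swap : (g : Row) → ∀ l k → g k ℤ.* unit l k ≡ g l ℤ.* unit l k
unit-swap g l k with l ℕₚ.≟ k
... | yes refl = refl
... | no ne rewrite unit-≢ l k ne = trans (ℤₚ.*-zeroʳ (g k)) (sym (ℤₚ.*-zeroʳ (g l)))

unit≥0 : ∀ l k → 0ℤ ℤ.≤ unit l k
unit≥0 zero zero = +≤+ z≤n
unit≥0 zero (suc k) = +≤+ z≤n
unit≥0 (suc l) zero = +≤+ z≤n
unit≥0 (suc l) (suc k) = unit≥0 l k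

NonNeg : Row → Set
NonNeg f = ∀ k → 0ℤ ℤ.≤ f k

0≤+ : ∀ {a b} → 0ℤ ℤ.≤ a → 0ℤ ℤ.≤ b → 0ℤ ℤ.≤ a ℤ.+ b
0≤+ = ℤₚ.+-mono-≤

0≤* : ∀ {a b} → 0ℤ ℤ.≤ a → 0ℤ ℤ.≤ b → 0ℤ ℤ.≤ a ℤ.* b
0≤* {+ a} {+ b} (+≤+ _) (+≤+ _) = subst (0ℤ ℤ.≤_) (ℤₚ.pos-* a b) (+≤+ z≤n)

-- Rows are functions on all of ℕ, so that operators are plain index formulas; finite-dimensionality
-- is imposed by this predicate only where it matters.
Bounded : ℕ → Row → Set
Bounded κ f = ∀ k → κ ≤ k → f k ≡ 0ℤ

infixr 7 _·_
_·_ : ℤ → Row → Row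
(c · f) k = c ℤ.* f k

module _ (Q : Row → Set) (resp : ∀ {f g} → f ≗ g → Q f → Q g) (Q-0 : Q 0ʳ)
         (Q-⊞ : ∀ {f g} → Q f → Q g → Q (f ⊞ g)) where

  private
    r₀ : ∀ c f → c ℤ.* f ℤ.+ f ≡ (1ℤ ℤ.+ c) ℤ.* f
    r₀ = solve-∀
    r₁ : ∀ a b → (a ℤ.- b) ℤ.+ b ≡ a
    r₁ = solve-∀

  scaled⁺ : ∀ c f → Q f → Q (+ c · f)
  scaled⁺ zero f q = resp (λ _ → refl) Q-0
  scaled⁺ (suc c) f q = resp (λ k → r₀ (+ c) (f k)) (Q-⊞ (scaled⁺ c f q) q)

  scaled : (∀ {f} → Q f → Q (⊖ f)) → ∀ c f → Q f → Q (c · f)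
  scaled neg (+ c) f q = scaled⁺ c f q
  scaled neg ℤ.-[1+ c ] f q = resp (λ k → ℤₚ.neg-distribˡ-* (+ suc c) (f k)) (neg (scaled⁺ (suc c) f q))

  -- Induction on the bound: subtracting the multiple of the top unit row lowers it by one.
  row-span : ∀ {κ} f → (∀ l → l < κ → Q (f l · unit l)) → Bounded κ f → Q f
  row-span {zero} f q bd = resp (λ k → sym (bd k z≤n)) Q-0
  row-span {suc κ} f q bd = resp (λ k → r₁ (f k) (f κ ℤ.* unit κ k)) (Q-⊞ (row-span f′ q′ bd′) (q κ ℕₚ.≤-refl))
    where
    f′ : Row
    f′ = f ⊟ (f κ · unit κ)
    z : ∀ l → κ ≢ l → f′ l ≡ f l
    z l ne rewrite unit-≢ κ l ne | ℤₚ.*-zeroʳ (f κ) = ℤₚ.+-identityʳ (f l)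
    q′ : ∀ l → l < κ → Q (f′ l · unit l)
    q′ l l< = resp (λ k → cong (ℤ._* unit l k) (sym (z l (λ e → ℕₚ.<-irrefl (sym e) l<)))) (q l (ℕₚ.≤-trans l< (ℕₚ.n≤1+n κ)))
    bd′ : Bounded κ f′
    bd′ k κ≤k with κ ℕₚ.≟ k
    ... | yes refl rewrite unit-refl κ | ℤₚ.*-identityʳ (f κ) = ℤₚ.+-inverseʳ (f κ)
    ... | no ne = trans (z k ne) (bd k (ℕₚ.≤∧≢⇒< κ≤k ne))

  row-cone : ∀ {κ} → (∀ l → l < κ → Q (unit l)) → ∀ f → NonNeg f → Bounded κ f → Q f
  row-cone q f f≥0 = row-span f λ l l< → go (f l) {l} (f≥0 l) (q l l<)
    where
    go : ∀ c {l} → 0ℤ ℤ.≤ c → Q (unit l) → Q (c · unit l)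
    go (+ c) {l} _ = scaled⁺ c (unit l)

-- Adjacency operator of a disjoint union of paths with suc M vertices each.
module Path (M : ℕ) where

  -- The weight of the edge between `k - 1` and `k`. It vanishes at the multiples of `suc M`, which
  -- cuts ℕ into paths; `δ 0 = 0` also makes the value `ℕ.pred 0 = 0` in `X` harmless.
  δ : ℕ → ℤ
  δ k with k % suc M
  ... | zero = 0ℤ
  ... | suc _ = 1ℤ

  δ-0 : ∀ k → k % suc M ≡ 0 → δ k ≡ 0ℤ
  δ-0 k p with k % suc M
  δ-0 k refl | .0 = refl

  δ-1 : ∀ k → k % suc M ≢ 0 → δ k ≡ 1ℤ
  δ-1 k p with k % suc M
  ... | zero = ⊥-elim (p refl)
  ... | suc _ = refl

  δ≥0 : ∀ k → 0ℤ ℤ.≤ δ k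
  δ≥0 k with k % suc M
  ... | zero = +≤+ z≤n
  ... | suc _ = +≤+ z≤n

  -- On a path with `suc M` vertices the largest eigenvalue of this operator is 2cos(π/(M+2)), the
  -- number that it stands for.
  X : Row → Row
  X f k = δ k ℤ.* f (ℕ.pred k) ℤ.+ δ (suc k) ℤ.* f (suc k)

  X-cong : ∀ {f g} → f ≗ g → X f ≗ X g
  X-cong p k = cong₂ (λ a b → δ k ℤ.* a ℤ.+ δ (suc k) ℤ.* b) (p _) (p _)

  private
    r₁ : ∀ a b x y z w → a ℤ.* (x ℤ.+ y) ℤ.+ b ℤ.* (z ℤ.+ w) ≡ (a ℤ.* x ℤ.+ b ℤ.* z) ℤ.+ (a ℤ.* y ℤ.+ b ℤ.* w)
    r₁ = solve-∀
    r₂ : ∀ a b x y z w → a ℤ.* (x ℤ.- y) ℤ.+ b ℤ.* (z ℤ.- w) ≡ (a ℤ.* x ℤ.+ b ℤ.* z) ℤ.- (a ℤ.* y ℤ.+ b ℤ.* w)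
    r₂ = solve-∀
    r₃ : ∀ a b x z → a ℤ.* (- x) ℤ.+ b ℤ.* (- z) ≡ - (a ℤ.* x ℤ.+ b ℤ.* z)
    r₃ = solve-∀
    r₄ : ∀ a b → a ℤ.* 0ℤ ℤ.+ b ℤ.* 0ℤ ≡ 0ℤ
    r₄ = solve-∀

  X-⊞ : ∀ f g → X (f ⊞ g) ≗ X f ⊞ X g
  X-⊞ f g k = r₁ (δ k) (δ (suc k)) (f _) (g _) (f _) (g _)

  X-⊟ : ∀ f g → X (f ⊟ g) ≗ X f ⊟ X g
  X-⊟ f g k = r₂ (δ k) (δ (suc k)) (f _) (g _) (f _) (g _)

  X-⊖ : ∀ f → X (⊖ f) ≗ ⊖ X f
  X-⊖ f k = r₃ (δ k) (δ (suc k)) (f _) (f _)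

  X-0 : X 0ʳ ≗ 0ʳ
  X-0 k = r₄ (δ k) (δ (suc k))

  X≥0 : ∀ {f} → NonNeg f → NonNeg (X f)
  X≥0 p k = 0≤+ (0≤* (δ≥0 k) (p _)) (0≤* (δ≥0 (suc k)) (p _))

  δ-mult : ∀ {κ} → suc M divides κ → δ κ ≡ 0ℤ
  δ-mult (mult q refl) = δ-0 (q ℕ.* suc M) (m*n%n≡0 q (suc M))

  X-bounded : ∀ {κ} → suc M divides κ → ∀ {f} → Bounded κ f → Bounded κ (X f)
  X-bounded {κ} d {f} p k κ≤k with ℕₚ.m≤n⇒m<n∨m≡n κ≤k
  ... | inj₂ refl rewrite δ-mult d | p (suc κ) (ℕₚ.n≤1+n κ) | ℤₚ.*-zeroʳ (δ (suc κ)) = ℤₚ.+-identityʳ _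
  ... | inj₁ (s≤s {_} {k′} q) rewrite p k′ q | p (suc (suc k′)) (ℕₚ.≤-trans κ≤k (ℕₚ.n≤1+n _)) = r₄ (δ (suc k′)) (δ (suc (suc k′)))

  X-unit : ∀ l k → X (unit l) k ≡ δ l ℤ.* unit (ℕ.pred l) k ℤ.+ δ (suc l) ℤ.* unit (suc l) k
  X-unit l k = trans (cong₂ ℤ._+_ (left k) (right l)) (ℤₚ.+-comm (δ (suc l) ℤ.* unit (suc l) k) _)
    where
    left : ∀ k → δ k ℤ.* unit l (ℕ.pred k) ≡ δ (suc l) ℤ.* unit (suc l) k
    left zero = sym (ℤₚ.*-zeroʳ (δ (suc l)))
    left (suc k) = unit-swap (λ z → δ (suc z)) l k
    right : ∀ l → δ (suc k) ℤ.* unit l (suc k) ≡ δ l ℤ.* unit (ℕ.pred l) k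
    right zero = ℤₚ.*-zeroʳ (δ (suc k))
    right (suc l) = unit-swap (λ z → δ (suc z)) l k

  -- W a is the Chebyshev polynomial U_(a-1) evaluated at X.
  W : ℕ → Row → Row
  W zero f = 0ʳ
  W (suc zero) f = f
  W (suc (suc a)) f = X (W (suc a) f) ⊟ W a f

  W-cong : ∀ a {f g} → f ≗ g → W a f ≗ W a g
  W-cong zero p k = refl
  W-cong (suc zero) p = p
  W-cong (suc (suc a)) p k = cong₂ ℤ._-_ (X-cong (W-cong (suc a) p) k) (W-cong a p k)

  private
    r₆ : ∀ a b c d → (a ℤ.+ b) ℤ.- (c ℤ.+ d) ≡ (a ℤ.- c) ℤ.+ (b ℤ.- d)
    r₆ = solve-∀
    r₇ : ∀ a b → (- a) ℤ.- (- b) ≡ - (a ℤ.- b)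
    r₇ = solve-∀

  W-⊞ : ∀ a f g → W a (f ⊞ g) ≗ W a f ⊞ W a g
  W-⊞ zero f g k = refl
  W-⊞ (suc zero) f g k = refl
  W-⊞ (suc (suc a)) f g k =
    trans (cong₂ ℤ._-_ (trans (X-cong (W-⊞ (suc a) f g) k) (X-⊞ (W (suc a) f) (W (suc a) g) k)) (W-⊞ a f g k))
          (r₆ (X (W (suc a) f) k) (X (W (suc a) g) k) (W a f k) (W a g k))

  W-⊖ : ∀ a f → W a (⊖ f) ≗ ⊖ W a f
  W-⊖ zero f k = refl
  W-⊖ (suc zero) f k = refl
  W-⊖ (suc (suc a)) f k =
    trans (cong₂ ℤ._-_ (trans (X-cong (W-⊖ (suc a) f) k) (X-⊖ (W (suc a) f) k)) (W-⊖ a f k))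
          (r₇ (X (W (suc a) f) k) (W a f k))

  W-0 : ∀ a → W a 0ʳ ≗ 0ʳ
  W-0 zero k = refl
  W-0 (suc zero) k = refl
  W-0 (suc (suc a)) k = cong₂ ℤ._-_ (trans (X-cong (W-0 (suc a)) k) (X-0 k)) (W-0 a k)

  W-X : ∀ a f → W a (X f) ≗ X (W a f)
  W-X zero f k = sym (X-0 k)
  W-X (suc zero) f k = refl
  W-X (suc (suc a)) f k =
    trans (cong₂ ℤ._-_ (X-cong (W-X (suc a) f) k) (W-X a f k)) (sym (X-⊟ (X (W (suc a) f)) (W a f) k))

  W-bounded : ∀ {κ} → suc M divides κ → ∀ a {f} → Bounded κ f → Bounded κ (W a f)
  W-bounded d zero p k _ = refl
  W-bounded d (suc zero) p = p
  W-bounded d (suc (suc a)) p k q = cong₂ ℤ._-_ (X-bounded d (W-bounded d (suc a) p) k q) (W-bounded d a p k q)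

  -- One path: ε p is the p-th vertex (1 ≤ p ≤ suc M) of the block starting at c * suc M.
  module Block (c : ℕ) where
    b : ℕ
    b = c ℕ.* suc M

    ε : ℕ → Row
    ε zero = 0ʳ
    ε (suc q) with q ℕₚ.<? suc M
    ... | yes _ = unit (b ℕ.+ q)
    ... | no _ = 0ʳ

    ε-in : ∀ q → q < suc M → ε (suc q) ≗ unit (b ℕ.+ q)
    ε-in q p k with q ℕₚ.<? suc M
    ... | yes _ = refl
    ... | no ¬p = ⊥-elim (¬p p)

    ε-out : ∀ q → ¬ (q < suc M) → ε (suc q) ≗ 0ʳ
    ε-out q p k with q ℕₚ.<? suc M
    ... | yes p′ = ⊥-elim (p p′)
    ... | no _ = refl

    ε≥0 : ∀ p → NonNeg (ε p)
    ε≥0 zero k = +≤+ z≤n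
    ε≥0 (suc q) k with q ℕₚ.<? suc M
    ... | yes _ = unit≥0 (b ℕ.+ q) k
    ... | no _ = +≤+ z≤n

    residue : ∀ q → (b ℕ.+ q) % suc M ≡ q % suc M
    residue q = trans (cong (_% suc M) (ℕₚ.+-comm b q)) ([m+kn]%n≡m%n q c (suc M))

    X-ε : ∀ q → q < suc M → X (ε (suc q)) ≗ ε q ⊞ ε (suc (suc q))
    X-ε q q<M k = trans (X-cong (ε-in q q<M) k) (trans (X-unit (b ℕ.+ q) k) (cong₂ ℤ._+_ (left q q<M) right))
      where
      left : ∀ q → q < suc M → δ (b ℕ.+ q) ℤ.* unit (ℕ.pred (b ℕ.+ q)) k ≡ ε q k
      left zero p = trans (cong (ℤ._* unit (ℕ.pred (b ℕ.+ 0)) k) (δ-0 (b ℕ.+ 0) (trans (residue 0) refl))) refl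
      left (suc q) p = trans (cong₂ ℤ._*_ (δ-1 (b ℕ.+ suc q) ne) (cong (λ z → unit (ℕ.pred z) k) (ℕₚ.+-suc b q)))
                         (trans (ℤₚ.*-identityˡ _) (sym (ε-in q (ℕₚ.<-trans (ℕₚ.n<1+n q) p) k)))
        where
        ne : (b ℕ.+ suc q) % suc M ≢ 0
        ne z with trans (sym (trans (residue (suc q)) (m<n⇒m%n≡m p))) z
        ... | ()
      right : δ (suc (b ℕ.+ q)) ℤ.* unit (suc (b ℕ.+ q)) k ≡ ε (suc (suc q)) k
      right with suc q ℕₚ.<? suc M
      ... | yes p = trans (cong₂ ℤ._*_ (trans (cong δ (sym (ℕₚ.+-suc b q))) (δ-1 (b ℕ.+ suc q) ne)) (cong (λ z → unit z k) (sym (ℕₚ.+-suc b q)))) (ℤₚ.*-identityˡ _)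
        where
        ne : (b ℕ.+ suc q) % suc M ≢ 0
        ne z with trans (sym (trans (residue (suc q)) (m<n⇒m%n≡m p))) z
        ... | ()
      ... | no ¬p = cong (ℤ._* unit (suc (b ℕ.+ q)) k) (trans (cong δ (trans (sym (ℕₚ.+-suc b q)) (cong (b ℕ.+_) eq)))
                      (δ-0 (b ℕ.+ suc M) (trans (residue (suc M)) (n%n≡0 (suc M)))))
        where
        eq : suc q ≡ suc M
        eq = ℕₚ.≤-antisym q<M (ℕₚ.≮⇒≥ ¬p)

    private
      r₈ : ∀ a b → (a ℤ.+ b) ℤ.- a ≡ b
      r₈ = solve-∀
      r₉ : ∀ A E w e f g → A ℤ.+ (f ℤ.+ E) ℤ.- (w ℤ.+ E) ≡ (A ℤ.- w) ℤ.+ f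
      r₉ = solve-∀

    W-ε₁ : ∀ p → p ≤ suc (suc M) → W p (ε 1) ≗ ε p
    W-ε₁ zero _ k = refl
    W-ε₁ (suc zero) _ k = refl
    W-ε₁ (suc (suc p)) (s≤s p≤) k =
      trans (cong₂ ℤ._-_ (trans (X-cong (W-ε₁ (suc p) (ℕₚ.≤-trans p≤ (ℕₚ.n≤1+n _))) k) (X-ε p p≤ k))
                         (W-ε₁ p (ℕₚ.≤-trans (ℕₚ.n≤1+n p) (ℕₚ.≤-trans p≤ (ℕₚ.n≤1+n _))) k))
            (r₈ (ε p k) (ε (suc (suc p)) k))

    -- Both sides are `W a (W p (ε 1))`, as polynomials in `X` commute and `W p` carries the end
    -- vertex to the `p`-th one.
    W-sym : ∀ a p → a ≤ suc (suc M) → p ≤ suc (suc M) → W a (ε p) ≗ W p (ε a)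
    W-sym zero p _ _ k = sym (W-0 p k)
    W-sym (suc zero) p _ p≤ k = sym (W-ε₁ p p≤ k)
    W-sym (suc (suc a)) p (s≤s a≤) p≤ k =
      trans (cong₂ ℤ._-_ (X-cong (W-sym (suc a) p (ℕₚ.≤-trans a≤ (ℕₚ.n≤1+n _)) p≤) k)
                         (W-sym a p (ℕₚ.≤-trans (ℕₚ.n≤1+n a) (ℕₚ.≤-trans a≤ (ℕₚ.n≤1+n _))) p≤ k))
      (trans (cong (ℤ._- W p (ε a) k) (trans (sym (W-X p (ε (suc a)) k)) (trans (W-cong p (X-ε a a≤) k) (W-⊞ p (ε a) (ε (suc (suc a))) k))))
             (r₈ (W p (ε a) k) (W p (ε (suc (suc a))) k)))

    -- The fusion rule U_a U_q = U_(a-1) U_(q+1) + U_(q-a), applied to the end vertex. Iterated, it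
    -- writes `W a (ε p)` for `a ≤ p` as a sum of vertices, whence nonnegativity.
    W-shift : ∀ a q → suc a ≤ suc q → q < suc M → W (suc a) (ε (suc q)) ≗ W a (ε (suc (suc q))) ⊞ ε (suc q ℕ.∸ a)
    W-shift zero q _ _ k = sym (ℤₚ.+-identityˡ _)
    W-shift (suc zero) (suc q) (s≤s (s≤s _)) q< k =
      trans (ℤₚ.+-identityʳ _) (trans (X-ε (suc q) q< k) (ℤₚ.+-comm (ε (suc q) k) _))
    W-shift (suc zero) zero (s≤s ()) _
    W-shift (suc (suc a)) q (s≤s a≤) q< k =
      trans (cong₂ ℤ._-_
        (trans (X-cong (W-shift (suc a) q (s≤s (ℕₚ.≤-trans (ℕₚ.n≤1+n (suc a)) a≤)) q<) k)
               (trans (X-⊞ (W (suc a) (ε (suc (suc q)))) (ε (suc q ℕ.∸ suc a)) k)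
                      (cong (λ t → X (W (suc a) (ε (suc (suc q)))) k ℤ.+ t)
                        (trans (X-cong (λ z → cong (λ t → ε t z) e₁) k) (trans (X-ε (q ℕ.∸ suc a) (ℕₚ.≤-<-trans (ℕₚ.m∸n≤m q (suc a)) q<) k)
                           (cong (λ t → ε (q ℕ.∸ suc a) k ℤ.+ ε t k) e₂))))))
        (W-shift a q (s≤s (ℕₚ.≤-trans (ℕₚ.n≤1+n a) (ℕₚ.≤-trans (ℕₚ.n≤1+n (suc a)) a≤))) q< k))
      (r₉ (X (W (suc a) (ε (suc (suc q)))) k) (ε (suc q ℕ.∸ a) k) (W a (ε (suc (suc q))) k) 0ℤ (ε (q ℕ.∸ suc a) k) 0ℤ)
      where
      e₁ : q ℕ.∸ a ≡ suc (q ℕ.∸ suc a)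
      e₁ = ℕₚ.+-∸-assoc 1 (ℕₚ.≤-trans (ℕₚ.n≤1+n (suc a)) a≤)
      e₂ : suc (suc (q ℕ.∸ suc a)) ≡ suc q ℕ.∸ a
      e₂ = trans (cong suc (sym e₁)) (sym (ℕₚ.+-∸-assoc 1 (ℕₚ.≤-trans (ℕₚ.n≤1+n a) (ℕₚ.≤-trans (ℕₚ.n≤1+n (suc a)) a≤))))

    W≥0-small : ∀ a q → a ≤ suc q → NonNeg (W a (ε (suc q)))
    W≥0-small zero q _ k = +≤+ z≤n
    W≥0-small (suc a) q a≤ k with q ℕₚ.<? suc M
    ... | no ¬p = ℤₚ.≤-reflexive (sym (trans (W-cong (suc a) (λ _ → refl) k) (W-0 (suc a) k)))
    ... | yes p = subst (0ℤ ℤ.≤_) (sym (trans (sym (W-cong (suc a) (ε-in q p) k)) (W-shift a q a≤ p k)))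
                    (0≤+ (W≥0-small a (suc q) (ℕₚ.≤-trans (ℕₚ.n≤1+n a) (ℕₚ.≤-trans a≤ (ℕₚ.n≤1+n _))) k) (ε≥0 (suc q ℕ.∸ a) k))

    W≥0-block : ∀ a q → a ≤ suc (suc M) → q < suc M → NonNeg (W a (ε (suc q)))
    W≥0-block a q a≤ q< k with ℕₚ.≤-total a (suc q)
    ... | inj₁ p = W≥0-small a q p k
    W≥0-block (suc a) q a≤ q< k | inj₂ p =
      subst (0ℤ ℤ.≤_) (sym (W-sym (suc a) (suc q) a≤ (ℕₚ.≤-trans q< (ℕₚ.n≤1+n _)) k)) (W≥0-small (suc q) a p k)

    -- By `W-sym` the operator is traded for one applied to `ε (suc (suc M))`, which is off the path
    -- and zero. This is the counterpart of U_(m-1)(2cos(π/m)) = 0 for m = M + 2.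
    W-vanish-block : ∀ q → q < suc M → W (suc (suc M)) (ε (suc q)) ≗ 0ʳ
    W-vanish-block q q< k = trans (W-sym (suc (suc M)) (suc q) ℕₚ.≤-refl (ℕₚ.≤-trans q< (ℕₚ.n≤1+n _)) k)
      (trans (W-cong (suc q) (ε-out (suc M) (ℕₚ.<-irrefl refl)) k) (W-0 (suc q) k))

  block-unit : ∀ l → unit l ≗ Block.ε (l / suc M) (suc (l % suc M))
  block-unit l k = trans (cong (λ z → unit z k) (trans (m≡m%n+[m/n]*n l (suc M)) (ℕₚ.+-comm (l % suc M) _)))
    (sym (Block.ε-in (l / suc M) (l % suc M) (m%n<n l (suc M)) k))

  W-unit≥0 : ∀ a l → a ≤ suc (suc M) → NonNeg (W a (unit l))
  W-unit≥0 a l a≤ k = subst (0ℤ ℤ.≤_) (sym (W-cong a (block-unit l) k))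
    (Block.W≥0-block (l / suc M) a (l % suc M) a≤ (m%n<n l (suc M)) k)

  W-unit-vanish : ∀ l → W (suc (suc M)) (unit l) ≗ 0ʳ
  W-unit-vanish l k = trans (W-cong (suc (suc M)) (block-unit l) k) (Block.W-vanish-block (l / suc M) (l % suc M) (m%n<n l (suc M)) k)

  W-vanish : ∀ {κ} f → Bounded κ f → W (suc (suc M)) f ≗ 0ʳ
  W-vanish f = row-span (λ g → W (suc (suc M)) g ≗ 0ʳ)
    (λ p q k → trans (sym (W-cong (suc (suc M)) p k)) (q k))
    (W-0 (suc (suc M)))
    (λ {g} {h} p q k → trans (W-⊞ (suc (suc M)) g h k) (cong₂ ℤ._+_ (p k) (q k)))
    f (λ l _ → scaled (λ g → W (suc (suc M)) g ≗ 0ʳ)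
      (λ p q k → trans (sym (W-cong (suc (suc M)) p k)) (q k))
      (W-0 (suc (suc M)))
      (λ {g} {h} p q k → trans (W-⊞ (suc (suc M)) g h k) (cong₂ ℤ._+_ (p k) (q k)))
      (λ {g} p k → trans (W-⊖ (suc (suc M)) g k) (cong -_ (p k)))
      (f l) (unit l) (W-unit-vanish l))

-- Finite sums over letters, and the Kronecker symbol.

sumL : ∀ {n} → List (Fin n) → (Fin n → ℤ) → ℤ
sumL [] F = 0ℤ
sumL (j ∷ c) F = F j ℤ.+ sumL c F

module _ {n : ℕ} where
  private
    interchange : ∀ a b c d → (a ℤ.+ b) ℤ.+ (c ℤ.+ d) ≡ (a ℤ.+ c) ℤ.+ (b ℤ.+ d)
    interchange = solve-∀

  sumL-cong : ∀ (c : List (Fin n)) {F H} → (∀ j → j ∈ c → F j ≡ H j) → sumL c F ≡ sumL c H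
  sumL-cong [] p = refl
  sumL-cong (j ∷ c) p = cong₂ ℤ._+_ (p j (here refl)) (sumL-cong c (λ i q → p i (there q)))

  sumL-+ : ∀ (c : List (Fin n)) F H → sumL c (λ j → F j ℤ.+ H j) ≡ sumL c F ℤ.+ sumL c H
  sumL-+ [] F H = refl
  sumL-+ (j ∷ c) F H = trans (cong (λ t → F j ℤ.+ H j ℤ.+ t) (sumL-+ c F H)) (interchange (F j) (H j) (sumL c F) (sumL c H))

  sumL-neg : ∀ (c : List (Fin n)) F → sumL c (λ j → - F j) ≡ - sumL c F
  sumL-neg [] F = refl
  sumL-neg (j ∷ c) F = trans (cong (λ t → - F j ℤ.+ t) (sumL-neg c F)) (sym (ℤₚ.neg-distrib-+ (F j) (sumL c F)))

  sumL-0 : ∀ (c : List (Fin n)) {F} → (∀ j → j ∈ c → F j ≡ 0ℤ) → sumL c F ≡ 0ℤ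
  sumL-0 [] p = refl
  sumL-0 (j ∷ c) p = cong₂ ℤ._+_ (p j (here refl)) (sumL-0 c (λ i q → p i (there q)))

  sumL≥0 : ∀ (c : List (Fin n)) {F} → (∀ j → 0ℤ ℤ.≤ F j) → 0ℤ ℤ.≤ sumL c F
  sumL≥0 [] p = +≤+ z≤n
  sumL≥0 (j ∷ c) p = 0≤+ (p j) (sumL≥0 c p)

  sumL-single : ∀ (c : List (Fin n)) {F i} → Unique c → i ∈ c → (∀ j → j ≢ i → F j ≡ 0ℤ) → sumL c F ≡ F i
  sumL-single (j ∷ c) {F} (u ∷ _) (here refl) p =
    trans (cong (λ t → F j ℤ.+ t) (sumL-0 c λ i q → p i λ e → All.lookup u q (sym e))) (ℤₚ.+-identityʳ (F j))
  sumL-single (j ∷ c) {F} {i} (u ∷ us) (there q) p =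
    trans (cong₂ ℤ._+_ (p j (λ e → All.lookup u q e)) (sumL-single c us q p)) (ℤₚ.+-identityˡ (F i))

  sumL-restrict : ∀ (c : List (Fin n)) {F} → Unique c → (∀ j → j ∉ c → F j ≡ 0ℤ) → sumL (allFin n) F ≡ sumL c F
  sumL-restrict [] u p = sumL-0 (allFin n) (λ j _ → p j (λ ()))
  sumL-restrict (i ∷ c) {F} (u ∷ us) p =
    trans (sumL-cong (allFin n) (λ j _ → split j))
    (trans (sumL-+ (allFin n) at off)
    (cong₂ ℤ._+_ (trans (sumL-single (allFin n) (Uniqueₚ.allFin⁺ n) (∈-allFin i) at≢) at-i)
                 (trans (sumL-restrict c us off∉) (sumL-cong c λ j q → off≢ j λ e → All.lookup u q (sym e)))))
    where
    at off : Fin n → ℤ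
    at j with j Finₚ.≟ i
    ... | yes _ = F j
    ... | no _ = 0ℤ
    off j with j Finₚ.≟ i
    ... | yes _ = 0ℤ
    ... | no _ = F j
    split : ∀ j → F j ≡ at j ℤ.+ off j
    split j with j Finₚ.≟ i
    ... | yes _ = sym (ℤₚ.+-identityʳ (F j))
    ... | no _ = sym (ℤₚ.+-identityˡ (F j))
    at≢ : ∀ j → j ≢ i → at j ≡ 0ℤ
    at≢ j ne with j Finₚ.≟ i
    ... | yes e = ⊥-elim (ne e)
    ... | no _ = refl
    at-i : at i ≡ F i
    at-i with i Finₚ.≟ i
    ... | yes _ = refl
    ... | no ne = ⊥-elim (ne refl)
    off≢ : ∀ j → j ≢ i → off j ≡ F j
    off≢ j ne with j Finₚ.≟ i
    ... | yes e = ⊥-elim (ne e)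
    ... | no _ = refl
    off∉ : ∀ j → j ∉ c → off j ≡ 0ℤ
    off∉ j j∉ with j Finₚ.≟ i
    ... | yes _ = refl
    ... | no ne = p j λ { (here e) → ne e ; (there q) → j∉ q }

module Kronecker where
  abstract
    kron : ∀ {n} → Fin n → Fin n → ℤ
    kron i j with i Finₚ.≟ j
    ... | yes _ = 1ℤ
    ... | no _ = 0ℤ

    kron-refl : ∀ {n} (i : Fin n) → kron i i ≡ 1ℤ
    kron-refl i with i Finₚ.≟ i
    ... | yes _ = refl
    ... | no ne = ⊥-elim (ne refl)

    kron-≢ : ∀ {n} {i j : Fin n} → i ≢ j → kron i j ≡ 0ℤ
    kron-≢ {i = i} {j} ne with i Finₚ.≟ j
    ... | yes e = ⊥-elim (ne e)
    ... | no _ = refl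

    kron≥0 : ∀ {n} (i j : Fin n) → 0ℤ ℤ.≤ kron i j
    kron≥0 i j with i Finₚ.≟ j
    ... | yes _ = +≤+ z≤n
    ... | no _ = +≤+ z≤n

open Kronecker

-- The representation of W on V, which unfolds the geometric representation: the
-- irrational number 2cos(π/m) is replaced by the adjacency operator of a path
-- with m - 1 vertices, which has the same Chebyshev relations.

module Representation {n : ℕ} (m : Fin n → Fin n → ℕ) (cox : IsCoxeterMatrix m) where
  open Coxeter m
  open Words m
  open IsCoxeterMatrix cox

  V : Set
  V = Fin n → Row

  infix 4 _≋_
  _≋_ : V → V → Set
  v ≋ w = ∀ j k → v j k ≡ w j k

  ≋-refl : ∀ {v} → v ≋ v
  ≋-refl j k = refl
  ≋-sym : ∀ {v w} → v ≋ w → w ≋ v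
  ≋-sym p j k = sym (p j k)
  ≋-trans : ∀ {u v w} → u ≋ v → v ≋ w → u ≋ w
  ≋-trans p q j k = trans (p j k) (q j k)

  infixl 6 _⊕_ _⊝_
  _⊕_ _⊝_ : V → V → V
  (v ⊕ w) j k = v j k ℤ.+ w j k
  (v ⊝ w) j k = v j k ℤ.- w j k

  neg : V → V
  neg v j k = - v j k

  αv : Fin n → Row → V
  αv s y j k = kron s j ℤ.* y k

  αv-at : ∀ s y k → αv s y s k ≡ y k
  αv-at s y k = trans (cong (ℤ._* y k) (kron-refl s)) (ℤₚ.*-identityˡ (y k))

  αv-off : ∀ {s j} y k → s ≢ j → αv s y j k ≡ 0ℤ
  αv-off y k ne = cong (ℤ._* y k) (kron-≢ ne)

  α : Fin n → ℕ → V
  α i k = αv i (unit k)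

  -- A path for the order m has m - 1 = `suc (M i j)` vertices. Truncated subtraction gives 0 on the
  -- diagonal as for commuting letters: isolated vertices, on which `X` is zero.
  M : Fin n → Fin n → ℕ
  M i j = m i j ℕ.∸ 2

  X : Fin n → Fin n → Row → Row
  X i j = Path.X (M i j)

  X-degenerate : ∀ {i j} → M i j ≡ 0 → ∀ f → X i j f ≗ 0ʳ
  X-degenerate {i} {j} p f k rewrite p =
    cong₂ (λ a b → a ℤ.* f (ℕ.pred k) ℤ.+ b ℤ.* f (suc k)) (Path.δ-0 0 k (n%1≡0 k)) (Path.δ-0 0 (suc k) (n%1≡0 (suc k)))

  X-diag : ∀ s f → X s s f ≗ 0ʳ
  X-diag s = X-degenerate {s} {s} (cong (ℕ._∸ 2) (diag s))

  -- A common multiple of all path lengths: for every pair of letters the paths tile the indices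
  -- below `κ` exactly, so each `X i j` preserves `Bounded κ`.
  κ : ℕ
  κ = product (map (λ i → product (map (λ j → suc (M i j)) (allFin n))) (allFin n))

  M∣κ : ∀ i j → suc (M i j) divides κ
  M∣κ i j = ∣-trans (∈⇒∣product (∈-map⁺ (λ j → suc (M i j)) (∈-allFin j)))
                    (∈⇒∣product (∈-map⁺ (λ i → product (map (λ j → suc (M i j)) (allFin n))) (∈-allFin i)))

  0<κ : 0 < κ
  0<κ = ℕₚ.n≢0⇒n>0 (ℕ.≢-nonZero⁻¹ κ {{product≢0 (Allₚ.map⁺ (All.universal (λ i → product≢0 (Allₚ.map⁺ (All.universal (λ j → _) (allFin n)))) (allFin n)))}})

  Bd : V → Set
  Bd v = ∀ j → Bounded κ (v j)

  Nb : Fin n → V → Row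
  Nb s v k = sumL (allFin n) (λ j → X s j (v j) k)

  -- The pairing with the coroot of s: twice the coordinate at s minus the neighbouring coordinates
  -- weighted by the operators that replace 2cos(π/m).
  fire : Fin n → V → Row
  fire s v k = (v s k ℤ.+ v s k) ℤ.- Nb s v k

  infixr 8 _▷_
  _▷_ : Fin n → V → V
  s ▷ v = v ⊝ αv s (fire s v)

  Nb-cong : ∀ s {v w} → v ≋ w → Nb s v ≗ Nb s w
  Nb-cong s p k = sumL-cong (allFin n) (λ j _ → Path.X-cong (M s j) (p j) k)

  fire-cong : ∀ s {v w} → v ≋ w → fire s v ≗ fire s w
  fire-cong s p k = cong₂ ℤ._-_ (cong₂ ℤ._+_ (p s k) (p s k)) (Nb-cong s p k)

  ▷-cong : ∀ s {v w} → v ≋ w → s ▷ v ≋ s ▷ w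
  ▷-cong s p j k = cong₂ (λ a b → a ℤ.- kron s j ℤ.* b) (p j k) (fire-cong s p k)

  Nb-⊕ : ∀ s v w → Nb s (v ⊕ w) ≗ Nb s v ⊞ Nb s w
  Nb-⊕ s v w k = trans (sumL-cong (allFin n) (λ j _ → Path.X-⊞ (M s j) (v j) (w j) k)) (sumL-+ (allFin n) _ _)

  Nb-neg : ∀ s v → Nb s (neg v) ≗ ⊖ Nb s v
  Nb-neg s v k = trans (sumL-cong (allFin n) (λ j _ → Path.X-⊖ (M s j) (v j) k)) (sumL-neg (allFin n) _)

  Nb-αv : ∀ t s y → Nb t (αv s y) ≗ X t s y
  Nb-αv t s y k = trans (sumL-single (allFin n) (Uniqueₚ.allFin⁺ n) (∈-allFin s)
      (λ j ne → trans (Path.X-cong (M t j) (λ q → αv-off y q (λ e → ne (sym e))) k) (Path.X-0 (M t j) k)))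
    (Path.X-cong (M t s) (αv-at s y) k)

  private
    r₂ : ∀ a b c d → (a ℤ.+ b) ℤ.+ (a ℤ.+ b) ℤ.- (c ℤ.+ d) ≡ (a ℤ.+ a ℤ.- c) ℤ.+ (b ℤ.+ b ℤ.- d)
    r₂ = solve-∀
    r₃ : ∀ a c → (- a) ℤ.+ (- a) ℤ.- (- c) ≡ - (a ℤ.+ a ℤ.- c)
    r₃ = solve-∀
    r₄ : ∀ a b k x y → (a ℤ.+ b) ℤ.- k ℤ.* (x ℤ.+ y) ≡ (a ℤ.- k ℤ.* x) ℤ.+ (b ℤ.- k ℤ.* y)
    r₄ = solve-∀
    r₅ : ∀ a k x → (- a) ℤ.- k ℤ.* (- x) ≡ - (a ℤ.- k ℤ.* x)
    r₅ = solve-∀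

  fire-⊕ : ∀ s v w → fire s (v ⊕ w) ≗ fire s v ⊞ fire s w
  fire-⊕ s v w k = trans (cong (λ t → (v s k ℤ.+ w s k) ℤ.+ (v s k ℤ.+ w s k) ℤ.- t) (Nb-⊕ s v w k)) (r₂ (v s k) (w s k) (Nb s v k) (Nb s w k))

  fire-neg : ∀ s v → fire s (neg v) ≗ ⊖ fire s v
  fire-neg s v k = trans (cong (λ t → (- v s k) ℤ.+ (- v s k) ℤ.- t) (Nb-neg s v k)) (r₃ (v s k) (Nb s v k))

  fire-αv-diag : ∀ s y → fire s (αv s y) ≗ y ⊞ y
  fire-αv-diag s y k = trans (cong₂ ℤ._-_ (cong₂ ℤ._+_ (αv-at s y k) (αv-at s y k)) (trans (Nb-αv s s y k) (X-diag s y k))) (ℤₚ.+-identityʳ _)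

  fire-αv-off : ∀ t s y → s ≢ t → fire t (αv s y) ≗ ⊖ X t s y
  fire-αv-off t s y ne k = trans (cong₂ ℤ._-_ (cong₂ ℤ._+_ (αv-off y k ne) (αv-off y k ne)) (Nb-αv t s y k)) (ℤₚ.+-identityˡ _)

  ▷-⊕ : ∀ s v w → s ▷ (v ⊕ w) ≋ (s ▷ v) ⊕ (s ▷ w)
  ▷-⊕ s v w j k = trans (cong (λ t → v j k ℤ.+ w j k ℤ.- kron s j ℤ.* t) (fire-⊕ s v w k)) (r₄ (v j k) (w j k) (kron s j) (fire s v k) (fire s w k))

  ▷-neg : ∀ s v → s ▷ neg v ≋ neg (s ▷ v)
  ▷-neg s v j k = trans (cong (λ t → (- v j k) ℤ.- kron s j ℤ.* t) (fire-neg s v k)) (r₅ (v j k) (kron s j) (fire s v k))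

  ▷-off : ∀ {s j} v k → s ≢ j → (s ▷ v) j k ≡ v j k
  ▷-off {s} {j} v k ne = trans (cong (λ t → v j k ℤ.- t) (αv-off (fire s v) k ne)) (ℤₚ.+-identityʳ _)

  private
    r₆ : ∀ a b → a ℤ.- (a ℤ.+ a ℤ.- b) ≡ (- a) ℤ.+ b
    r₆ = solve-∀
    r₇ : ∀ a k → k ℤ.* a ℤ.- k ℤ.* (a ℤ.+ a) ≡ - (k ℤ.* a)
    r₇ = solve-∀
    r₈ : ∀ a k → a ℤ.- k ≡ a ℤ.+ (- k)
    r₈ = solve-∀
    r₉ : ∀ a k x → (a ℤ.- k ℤ.* x) ℤ.- k ℤ.* (- x) ≡ a
    r₉ = solve-∀
    r₁₀ : ∀ x → x ℤ.+ - (x ℤ.+ x) ≡ - x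
    r₁₀ = solve-∀

  ▷-at : ∀ s v k → (s ▷ v) s k ≡ (- v s k) ℤ.+ Nb s v k
  ▷-at s v k = trans (cong (λ t → v s k ℤ.- t) (αv-at s (fire s v) k)) (r₆ (v s k) (Nb s v k))

  ▷-αv : ∀ s y → s ▷ αv s y ≋ neg (αv s y)
  ▷-αv s y j k = trans (cong (λ t → kron s j ℤ.* y k ℤ.- kron s j ℤ.* t) (fire-αv-diag s y k)) (r₇ (y k) (kron s j))

  fire-shift : ∀ t v s y → fire t (v ⊝ αv s y) ≗ fire t v ⊞ fire t (neg (αv s y))
  fire-shift t v s y k = trans (fire-cong t (λ j q → r₈ (v j q) (αv s y j q)) k) (fire-⊕ t v (neg (αv s y)) k)

  fire-▷-diag : ∀ s v → fire s (s ▷ v) ≗ ⊖ fire s v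
  fire-▷-diag s v k = trans (fire-shift s v s (fire s v) k)
    (trans (cong (λ t → fire s v k ℤ.+ t) (trans (fire-neg s (αv s (fire s v)) k) (cong -_ (fire-αv-diag s (fire s v) k)))) (r₁₀ (fire s v k)))

  fire-▷-off : ∀ t s v → s ≢ t → fire t (s ▷ v) ≗ fire t v ⊞ X t s (fire s v)
  fire-▷-off t s v ne k = trans (fire-shift t v s (fire s v) k)
    (cong (λ z → fire t v k ℤ.+ z) (trans (fire-neg t (αv s (fire s v)) k) (trans (cong -_ (fire-αv-off t s (fire s v) ne k)) (ℤₚ.neg-involutive _))))

  ▷-involutive : ∀ s v → s ▷ s ▷ v ≋ v
  ▷-involutive s v j k = trans (cong (λ t → (v j k ℤ.- kron s j ℤ.* fire s v k) ℤ.- kron s j ℤ.* t) (fire-▷-diag s v k)) (r₉ (v j k) (kron s j) (fire s v k))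

  Nb-bounded : ∀ s {v} → Bd v → Bounded κ (Nb s v)
  Nb-bounded s p k q = sumL-0 (allFin n) (λ j _ → Path.X-bounded (M s j) (M∣κ s j) (p j) k q)

  fire-bounded : ∀ s {v} → Bd v → Bounded κ (fire s v)
  fire-bounded s p k q = cong₂ ℤ._-_ (cong₂ ℤ._+_ (p s k q) (p s k q)) (Nb-bounded s p k q)

  αv-bounded : ∀ s {y} → Bounded κ y → Bd (αv s y)
  αv-bounded s p j k q = trans (cong (kron s j ℤ.*_) (p k q)) (ℤₚ.*-zeroʳ (kron s j))

  ▷-bounded : ∀ s {v} → Bd v → Bd (s ▷ v)
  ▷-bounded s p j k q = cong₂ ℤ._-_ (p j k q) (αv-bounded s (fire-bounded s p) j k q)

  α-bounded : ∀ i {k} → k < κ → Bd (α i k)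
  α-bounded i {k} k< = αv-bounded i (λ q κ≤q → unit-≢ k q (λ e → ℕₚ.<-irrefl e (ℕₚ.<-≤-trans k< κ≤q)))

  infixl 7 _◂_
  _◂_ : V → Word → V
  v ◂ [] = v
  v ◂ (i ∷ u) = (i ▷ v) ◂ u

  ◂-cong : ∀ u {v w} → v ≋ w → v ◂ u ≋ w ◂ u
  ◂-cong [] p = p
  ◂-cong (i ∷ u) p = ◂-cong u (▷-cong i p)

  ◂-++ : ∀ v u w → v ◂ (u ++ w) ≡ (v ◂ u) ◂ w
  ◂-++ v [] w = refl
  ◂-++ v (i ∷ u) w = ◂-++ (i ▷ v) u w

  ◂-bounded : ∀ u {v} → Bd v → Bd (v ◂ u)
  ◂-bounded [] p = p
  ◂-bounded (i ∷ u) p = ◂-bounded u (▷-bounded i p)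

  ◂-⊕ : ∀ u v w → (v ⊕ w) ◂ u ≋ (v ◂ u) ⊕ (w ◂ u)
  ◂-⊕ [] v w = ≋-refl
  ◂-⊕ (i ∷ u) v w = ≋-trans (◂-cong u (▷-⊕ i v w)) (◂-⊕ u (i ▷ v) (i ▷ w))

  ◂-neg : ∀ u v → neg v ◂ u ≋ neg (v ◂ u)
  ◂-neg [] v = ≋-refl
  ◂-neg (i ∷ u) v = ≋-trans (◂-cong u (▷-neg i v)) (◂-neg u (i ▷ v))

  -- The braid relations: both sides fire i and j by the same total amounts.

  module Braid (K : ℕ) where
    open Path K renaming (X to Y)

    par : ℕ → Bool
    par zero = false
    par (suc t) = not (par t)

    pick : Bool → Bool → Row → Row
    pick true true f = f
    pick false false f = f
    pick true false f = 0ʳ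
    pick false true f = 0ʳ

    -- The sum of the `W q f` over `q < t` of one parity; alternate firing of two letters
    -- distributes the Chebyshev terms by parity.
    Sg : Bool → ℕ → Row → Row
    Sg b zero f = 0ʳ
    Sg b (suc t) f = Sg b t f ⊞ pick (par t) b (W t f)

    start : Bool → Row → Row
    start true f = f
    start false f = 0ʳ

    -- The totals fired at the first and at the second letter by an alternating word of length `t`,
    -- when the initial firing amounts are `x` and `y`. Firing the first letter changes them to
    -- `- x` and `y + Y x`, after which the letters exchange roles.
    A B : ℕ → Row → Row → Row
    A zero x y = 0ʳ
    A (suc t) x y = x ⊞ B t (y ⊞ Y x) (⊖ x)
    B zero x y = 0ʳ
    B (suc t) x y = A t (y ⊞ Y x) (⊖ x)

    pick-cong : ∀ p b {f g} → f ≗ g → pick p b f ≗ pick p b g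
    pick-cong true true q = q
    pick-cong false false q = q
    pick-cong true false q k = refl
    pick-cong false true q k = refl

    pick-⊞ : ∀ p b f g → pick p b (f ⊞ g) ≗ pick p b f ⊞ pick p b g
    pick-⊞ true true f g k = refl
    pick-⊞ false false f g k = refl
    pick-⊞ true false f g k = refl
    pick-⊞ false true f g k = refl

    pick-⊖ : ∀ p b f → pick p b (⊖ f) ≗ ⊖ pick p b f
    pick-⊖ true true f k = refl
    pick-⊖ false false f k = refl
    pick-⊖ true false f k = refl
    pick-⊖ false true f k = refl

    pick-0 : ∀ p b → pick p b 0ʳ ≗ 0ʳ
    pick-0 true true k = refl
    pick-0 false false k = refl
    pick-0 true false k = refl
    pick-0 false true k = refl

    private
      q₁ : ∀ a b c d → (a ℤ.+ b) ℤ.+ (c ℤ.+ d) ≡ (a ℤ.+ c) ℤ.+ (b ℤ.+ d)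
      q₁ = solve-∀
      q₂ : ∀ s p q z w → s ℤ.+ p ℤ.+ (z ℤ.+ w) ≡ (s ℤ.+ z) ℤ.+ (p ℤ.+ w)
      q₂ = solve-∀
      q₃ : ∀ a b → (a ℤ.- b) ℤ.+ b ≡ a
      q₃ = solve-∀
      q₄ : ∀ x s t u v → u ℤ.+ v ≡ x ℤ.+ t → x ℤ.+ (s ℤ.+ t ℤ.+ (- v)) ≡ u ℤ.+ s
      q₄ x s t u v p = trans (h₁ x s t v) (trans (cong (λ z → z ℤ.- v ℤ.+ s) (sym p)) (h₂ u v s))
        where
        h₁ : ∀ x s t v → x ℤ.+ (s ℤ.+ t ℤ.+ (- v)) ≡ (x ℤ.+ t) ℤ.- v ℤ.+ s
        h₁ = solve-∀
        h₂ : ∀ u v s → (u ℤ.+ v) ℤ.- v ℤ.+ s ≡ u ℤ.+ s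
        h₂ = solve-∀

    Sg-⊞ : ∀ b t f g → Sg b t (f ⊞ g) ≗ Sg b t f ⊞ Sg b t g
    Sg-⊞ b zero f g k = refl
    Sg-⊞ b (suc t) f g k = trans (cong₂ ℤ._+_ (Sg-⊞ b t f g k)
        (trans (pick-cong (par t) b (W-⊞ t f g) k) (pick-⊞ (par t) b (W t f) (W t g) k)))
      (q₁ (Sg b t f k) (Sg b t g k) (pick (par t) b (W t f) k) (pick (par t) b (W t g) k))

    Sg-⊖ : ∀ b t f → Sg b t (⊖ f) ≗ ⊖ Sg b t f
    Sg-⊖ b zero f k = refl
    Sg-⊖ b (suc t) f k = trans (cong₂ ℤ._+_ (Sg-⊖ b t f k)
        (trans (pick-cong (par t) b (W-⊖ t f) k) (pick-⊖ (par t) b (W t f) k)))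
      (sym (ℤₚ.neg-distrib-+ (Sg b t f k) _))

    pick-step : ∀ p b (f g h : Row) → f ⊞ h ≗ g → pick (not (not p)) b f ⊞ pick p b h ≗ pick (not p) (not b) g
    pick-step true true f g h e = e
    pick-step false false f g h e = e
    pick-step true false f g h e k = refl
    pick-step false true f g h e k = refl

    -- The Chebyshev recursion `W (t+2) + W t = Y (W (t+1))` summed over one parity; `start` is the
    -- term `W 1`, which has no predecessor and is odd.
    Sg-rec : ∀ b t f → Sg b (suc (suc t)) f ⊞ Sg b t f ≗ start b f ⊞ Sg (not b) (suc t) (Y f)
    Sg-rec true zero f k = trans (ℤₚ.+-identityʳ _) (trans (ℤₚ.+-identityˡ (f k)) (sym (ℤₚ.+-identityʳ (f k))))
    Sg-rec false zero f k = refl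
    Sg-rec b (suc t) f k =
      trans (q₂ (Sg b (suc (suc t)) f k) (pick (par (suc (suc t))) b (W (suc (suc t)) f) k) 0ℤ (Sg b t f k) (pick (par t) b (W t f) k))
      (trans (cong₂ ℤ._+_ (Sg-rec b t f k)
         (pick-step (par t) b (W (suc (suc t)) f) (W (suc t) (Y f)) (W t f)
           (λ q → trans (q₃ (Y (W (suc t) f) q) (W t f q)) (sym (W-X (suc t) f q))) k))
       (ℤₚ.+-assoc (start b f k) _ _))

    closed : ∀ t x y → (A t x y ≗ Sg true (suc t) x ⊞ Sg false t y) × (B t x y ≗ Sg false (suc t) x ⊞ Sg true t y)
    closed zero x y = (λ k → refl) , (λ k → refl)
    closed (suc t) x y = a , b
      where
      IH = closed t (y ⊞ Y x) (⊖ x)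
      a : A (suc t) x y ≗ Sg true (suc (suc t)) x ⊞ Sg false (suc t) y
      a k = trans (cong (λ z → x k ℤ.+ z) (trans (proj₂ IH k)
              (cong₂ ℤ._+_ (Sg-⊞ false (suc t) y (Y x) k) (Sg-⊖ true t x k))))
            (q₄ (x k) (Sg false (suc t) y k) (Sg false (suc t) (Y x) k) (Sg true (suc (suc t)) x k) (Sg true t x k) (Sg-rec true t x k))
      b : B (suc t) x y ≗ Sg false (suc (suc t)) x ⊞ Sg true (suc t) y
      b k = trans (proj₁ IH k) (trans (cong₂ ℤ._+_ (Sg-⊞ true (suc t) y (Y x) k) (Sg-⊖ false t x k))
            (trans (sym (ℤₚ.+-identityˡ _)) (q₄ 0ℤ (Sg true (suc t) y k) (Sg true (suc t) (Y x) k) (Sg false (suc (suc t)) x k) (Sg false t x k) (Sg-rec false t x k))))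

    -- At length `K + 2`, the order of the two letters, the top term `W (K + 2)` vanishes, and the
    -- closed forms for the two starting letters then agree.
    A≗B : ∀ x y → Bounded κ x → Bounded κ y → A (suc (suc K)) x y ≗ B (suc (suc K)) y x
    A≗B x y bx by k = trans (proj₁ (closed (suc (suc K)) x y) k)
      (trans (cong (λ z → z ℤ.+ Sg false (suc (suc K)) y k) (top true x bx k))
      (trans (ℤₚ.+-comm (Sg true (suc (suc K)) x k) _)
      (trans (cong (λ z → z ℤ.+ Sg true (suc (suc K)) x k) (sym (top false y by k))) (sym (proj₂ (closed (suc (suc K)) y x) k)))))
      where
      top : ∀ b f → Bounded κ f → Sg b (suc (suc (suc K))) f ≗ Sg b (suc (suc K)) f
      top b f p q = trans (cong (λ z → Sg b (suc (suc K)) f q ℤ.+ z) (trans (pick-cong (par (suc (suc K))) b (W-vanish f p) q) (pick-0 (par (suc (suc K))) b q))) (ℤₚ.+-identityʳ _)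

    private
      q₆ : ∀ v a x b y z → (v ℤ.- a ℤ.* x) ℤ.- b ℤ.* y ℤ.- a ℤ.* z ≡ v ℤ.- a ℤ.* (x ℤ.+ z) ℤ.- b ℤ.* y
      q₆ = solve-∀

    A-cong : ∀ t {x x′ y y′} → x ≗ x′ → y ≗ y′ → (A t x y ≗ A t x′ y′) × (B t x y ≗ B t x′ y′)
    A-cong zero p q = (λ _ → refl) , (λ _ → refl)
    A-cong (suc t) {x} {x′} {y} {y′} p q = (λ k → cong₂ ℤ._+_ (p k) (proj₂ IH k)) , proj₁ IH
      where
      IH = A-cong t {y ⊞ Y x} {y′ ⊞ Y x′} {⊖ x} {⊖ x′} (λ k → cong₂ ℤ._+_ (q k) (X-cong p k)) (λ k → cong -_ (p k))

    alt-closed : ∀ i j → i ≢ j → M i j ≡ K → M j i ≡ K → ∀ t v →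
                 v ◂ alt i j t ≋ v ⊝ αv i (A t (fire i v) (fire j v)) ⊝ αv j (B t (fire i v) (fire j v))
    alt-closed i j ne p q zero v a k = sym (h (v a k) (kron i a) (kron j a))
      where
      h : ∀ v a b → v ℤ.- a ℤ.* 0ℤ ℤ.- b ℤ.* 0ℤ ≡ v
      h = solve-∀
    alt-closed i j ne p q (suc t) v a k =
      trans (alt-closed j i (λ e → ne (sym e)) q p t (i ▷ v) a k)
      (trans (cong₂ (λ z w → (v a k ℤ.- kron i a ℤ.* fire i v k) ℤ.- kron j a ℤ.* z ℤ.- kron i a ℤ.* w)
               (proj₁ e k) (proj₂ e k))
        (q₆ (v a k) (kron i a) (fire i v k) (kron j a) _ _))
      where
      fj : fire j (i ▷ v) ≗ fire j v ⊞ Y (fire i v)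
      fj z = trans (fire-▷-off j i v ne z) (cong (λ w → fire j v z ℤ.+ Path.X w (fire i v) z) q)
      e = A-cong t {fire j (i ▷ v)} {fire j v ⊞ Y (fire i v)} {fire i (i ▷ v)} {⊖ fire i v} fj (fire-▷-diag i v)

  private
    z₁ : ∀ v a x b y → v ℤ.- a ℤ.* x ℤ.- b ℤ.* y ≡ v ℤ.- b ℤ.* y ℤ.- a ℤ.* x
    z₁ = solve-∀

  braid-◂ : ∀ i j {v} → Bd v → v ◂ alt i j (m i j) ≋ v ◂ alt j i (m i j)
  braid-◂ i j {v} bd a k with i Finₚ.≟ j
  ... | yes refl = refl
  ... | no ne = subst (λ t → (v ◂ alt i j t) a k ≡ (v ◂ alt j i t) a k) eq
      (trans (alt-closed i j ne refl Mji (suc (suc (M i j))) v a k)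
      (trans (z₁ (v a k) (kron i a) (A (suc (suc (M i j))) (fire i v) (fire j v) k) (kron j a) (B (suc (suc (M i j))) (fire i v) (fire j v) k))
      (trans (cong₂ (λ x y → v a k ℤ.- kron j a ℤ.* x ℤ.- kron i a ℤ.* y)
         (sym (A≗B (fire j v) (fire i v) (fire-bounded j bd) (fire-bounded i bd) k))
         (A≗B (fire i v) (fire j v) (fire-bounded i bd) (fire-bounded j bd) k))
        (sym (alt-closed j i (λ e → ne (sym e)) Mji refl (suc (suc (M i j))) v a k)))))
    where
    open Braid (M i j)
    Mji : M j i ≡ M i j
    Mji = cong (ℕ._∸ 2) (symm j i)
    eq : suc (suc (M i j)) ≡ m i j
    eq = ℕₚ.m+[n∸m]≡n (offdiag i j ne)

  rule-◂ : ∀ {l r} → Rule l r → ∀ {v} → Bd v → v ◂ l ≋ v ◂ r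
  rule-◂ (del i) {v} bd = ▷-involutive i v
  rule-◂ (braid i j) bd = braid-◂ i j bd

  private
    R : Word → Word → Set
    R u w = ∀ v → Bd v → v ◂ u ≋ v ◂ w

  ◂-resp : ∀ {u w} → u ≈ w → ∀ v → Bd v → v ◂ u ≋ v ◂ w
  ◂-resp = EqC.fold {S = R} record { refl = λ _ _ → ≋-refl ; sym = λ p v bd → ≋-sym (p v bd) ; trans = λ p q v bd → ≋-trans (p v bd) (q v bd) } st
    where
    st : ∀ {u w} → Step u w → R u w
    st (step a b {l} {r} x) v bd rewrite ◂-++ v a (l ++ b) | ◂-++ v a (r ++ b) | ◂-++ (v ◂ a) l b | ◂-++ (v ◂ a) r b =
      ◂-cong b (rule-◂ x (◂-bounded a bd))

-- The action on root vectors: signs and length.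

module Roots {n : ℕ} (m : Fin n → Fin n → ℕ) (cox : IsCoxeterMatrix m) (T : Words.Table m) where
  open Coxeter m
  open Words m hiding (module Table; Table; table)
  open Group m T public
  open Representation m cox public
  open IsCoxeterMatrix cox

  infixr 8 _⋆_
  _⋆_ : G → V → V
  g ⋆ v = v ◂ reverse (word g)

  ψ-reverse : ∀ u → ψ (reverse u) ≡ ψ u ⁻¹
  ψ-reverse u = inv-unique (ψ u) (ψ (reverse u))
    (trans (sym (ψ-++ u (reverse u))) (trans (ψ-resp (reverse-inverseʳ u)) ψ-[]))

  ⋆-ψ : ∀ u {v} → Bd v → ψ u ⋆ v ≋ v ◂ reverse u
  ⋆-ψ u {v} bd = ◂-resp (ψ⇒≈ (trans (ψ-reverse (word (ψ u))) (trans (cong _⁻¹ (ψ-word (ψ u))) (sym (ψ-reverse u))))) v bd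

  ⋆-cong : ∀ g {v w} → v ≋ w → g ⋆ v ≋ g ⋆ w
  ⋆-cong g = ◂-cong (reverse (word g))

  ⋆-bounded : ∀ g {v} → Bd v → Bd (g ⋆ v)
  ⋆-bounded g = ◂-bounded (reverse (word g))

  ⋆-⊕ : ∀ g v w → g ⋆ (v ⊕ w) ≋ (g ⋆ v) ⊕ (g ⋆ w)
  ⋆-⊕ g = ◂-⊕ (reverse (word g))

  ⋆-neg : ∀ g v → g ⋆ neg v ≋ neg (g ⋆ v)
  ⋆-neg g = ◂-neg (reverse (word g))

  ⋆-e : ∀ {v} → Bd v → e ⋆ v ≋ v
  ⋆-e {v} bd = subst (λ g → g ⋆ v ≋ v) ψ-[] (⋆-ψ [] bd)

  ⋆-∙ : ∀ g h {v} → Bd v → (g ∙ h) ⋆ v ≋ g ⋆ h ⋆ v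
  ⋆-∙ g h {v} bd j k =
    trans (cong (λ z → (z ⋆ v) j k) (trans (cong₂ _∙_ (sym (ψ-word g)) (sym (ψ-word h))) (sym (ψ-++ (word g) (word h)))))
    (trans (⋆-ψ (word g ++ word h) bd j k)
    (trans (cong (λ z → (v ◂ z) j k) (Listₚ.reverse-++ (word g) (word h)))
           (cong (λ z → z j k) (◂-++ v (reverse (word h)) (reverse (word g))))))

  ⋆-gen : ∀ s {v} → Bd v → gen s ⋆ v ≋ s ▷ v
  ⋆-gen s {v} bd = subst (λ g → g ⋆ v ≋ s ▷ v) ψ-[ s ] (⋆-ψ [ s ] bd)

  ⋆-gen∙ : ∀ s g {v} → Bd v → (gen s ∙ g) ⋆ v ≋ s ▷ g ⋆ v
  ⋆-gen∙ s g bd = ≋-trans (⋆-∙ (gen s) g bd) (⋆-gen s (⋆-bounded g bd))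

  ⋆-∙gen : ∀ g s {v} → Bd v → (g ∙ gen s) ⋆ v ≋ g ⋆ s ▷ v
  ⋆-∙gen g s bd = ≋-trans (⋆-∙ g (gen s) bd) (⋆-cong g (⋆-gen s bd))

  ⋆-inv : ∀ g {v} → Bd v → g ⁻¹ ⋆ g ⋆ v ≋ v
  ⋆-inv g {v} bd = ≋-trans (≋-sym (⋆-∙ (g ⁻¹) g bd)) (subst (λ z → z ⋆ v ≋ v) (sym (invˡ g)) (⋆-e bd))

  NN : V → Set
  NN v = ∀ j k → 0ℤ ℤ.≤ v j k

  NN-⊕ : ∀ {v w} → NN v → NN w → NN (v ⊕ w)
  NN-⊕ p q j k = 0≤+ (p j k) (q j k)

  NN-resp : ∀ {v w} → v ≋ w → NN v → NN w
  NN-resp e p j k = subst (0ℤ ℤ.≤_) (e j k) (p j k)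

  0ᵛ : V
  0ᵛ j k = 0ℤ

  ⋆-0 : ∀ g → g ⋆ 0ᵛ ≋ 0ᵛ
  ⋆-0 g j k = trans (h₁ a) (trans (cong (ℤ._- a) (sym (⋆-⊕ g 0ᵛ 0ᵛ j k))) (ℤₚ.+-inverseʳ a))
    where
    a = (g ⋆ 0ᵛ) j k
    h₁ : ∀ a → a ≡ (a ℤ.+ a) ℤ.- a
    h₁ = solve-∀

  NN-αv : ∀ i {y} → NonNeg y → NN (αv i y)
  NN-αv i p j k = 0≤* (kron≥0 i j) (p k)

  αv-cong : ∀ i {y z} → y ≗ z → αv i y ≋ αv i z
  αv-cong i p j k = cong (kron i j ℤ.*_) (p k)

  αv-⊞ : ∀ i y z → αv i (y ⊞ z) ≋ αv i y ⊕ αv i z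
  αv-⊞ i y z j k = ℤₚ.*-distribˡ-+ (kron i j) (y k) (z k)

  αv-⊖ : ∀ i y → αv i (⊖ y) ≋ neg (αv i y)
  αv-⊖ i y j k = sym (ℤₚ.neg-distribʳ-* (kron i j) (y k))

  αv-0 : ∀ i → αv i 0ʳ ≋ 0ᵛ
  αv-0 i j k = ℤₚ.*-zeroʳ (kron i j)

  -- Carries a property closed under addition from the vectors `α i k` to nonnegative bounded
  -- vectors; sign statements about simple roots reach all positive ones through it.
  module Cone (Q : V → Set) (resp : ∀ {v w} → v ≋ w → Q v → Q w) (Q-0 : Q 0ᵛ)
              (Q-⊕ : ∀ {v w} → Q v → Q w → Q (v ⊕ w)) where
    private
      module Rw (i : Fin n) where
        Q′ : Row → Set
        Q′ y = Q (αv i y)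
        resp′ : ∀ {f g} → f ≗ g → Q′ f → Q′ g
        resp′ p = resp (αv-cong i p)
        Q′-0 : Q′ 0ʳ
        Q′-0 = resp (≋-sym (αv-0 i)) Q-0
        Q′-⊞ : ∀ {f g} → Q′ f → Q′ g → Q′ (f ⊞ g)
        Q′-⊞ {f} {g} p q = resp (≋-sym (αv-⊞ i f g)) (Q-⊕ p q)

    cone-αv : ∀ i → (∀ k → k < κ → Q (α i k)) → ∀ y → NonNeg y → Bounded κ y → Q (αv i y)
    cone-αv i q = row-cone Q′ resp′ Q′-0 (λ {f} {g} → Q′-⊞ {f} {g}) {κ} q
      where open Rw i

    span-αv : (∀ {v} → Q v → Q (neg v)) → ∀ i → (∀ k → k < κ → Q (α i k)) → ∀ y → Bounded κ y → Q (αv i y)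
    span-αv Q-neg i q y = row-span Q′ resp′ Q′-0 (λ {f} {g} → Q′-⊞ {f} {g}) y
      (λ l l< → scaled Q′ resp′ Q′-0 (λ {f} {g} → Q′-⊞ {f} {g}) (λ {f} p → resp (≋-sym (αv-⊖ i f)) (Q-neg p)) (y l) (unit l) (q l l<))
      where open Rw i

    cone : ∀ L v → (∀ j → j ∉ L → v j ≗ 0ʳ) → NN v → Bd v → (∀ i → i ∈ L → ∀ k → k < κ → Q (α i k)) → Q v
    cone [] v z p bd q = resp (λ j k → sym (z j (λ ()) k)) Q-0
    cone (i ∷ L) v z p bd q = resp (λ j k → h (v j k) (αv i (v i) j k))
        (Q-⊕ (cone L v′ z′ p′ bd′ (λ l l∈ → q l (there l∈))) (cone-αv i (q i (here refl)) (v i) (p i) (bd i)))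
      where
      h : ∀ a b → (a ℤ.- b) ℤ.+ b ≡ a
      h = solve-∀
      v′ : V
      v′ = v ⊝ αv i (v i)
      at : ∀ k → v′ i k ≡ 0ℤ
      at k = trans (cong (λ t → v i k ℤ.- t) (αv-at i (v i) k)) (ℤₚ.+-inverseʳ (v i k))
      off : ∀ j k → i ≢ j → v′ j k ≡ v j k
      off j k ne = trans (cong (λ t → v j k ℤ.- t) (αv-off (v i) k ne)) (ℤₚ.+-identityʳ (v j k))
      z′ : ∀ j → j ∉ L → v′ j ≗ 0ʳ
      z′ j j∉ k with i Finₚ.≟ j
      ... | yes refl = at k
      ... | no ne = trans (off j k ne) (z j (λ { (here e) → ne (sym e) ; (there x) → j∉ x }) k)
      p′ : NN v′
      p′ j k with i Finₚ.≟ j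
      ... | yes refl = ℤₚ.≤-reflexive (sym (at k))
      ... | no ne = subst (0ℤ ℤ.≤_) (sym (off j k ne)) (p j k)
      bd′ : Bd v′
      bd′ j k q = cong₂ ℤ._-_ (bd j k q) (αv-bounded i (bd i) j k q)

  private
    b₂ : ∀ k a x b → (k ℤ.* a ℤ.+ b) ℤ.- k ℤ.* (a ℤ.+ a ℤ.+ - x) ≡ b ℤ.+ k ℤ.* (x ℤ.- a)
    b₂ = solve-∀

  -- In a rank two subsystem consecutive roots have consecutive Chebyshev coefficients: the new
  -- coefficient at `x` is `X (W (t+1) f) - W t f`.
  dihedral-step : ∀ {K} x y → x ≢ y → M x y ≡ K → ∀ t f →
    x ▷ (αv x (Path.W K t f) ⊕ αv y (Path.W K (suc t) f)) ≋ αv y (Path.W K (suc t) f) ⊕ αv x (Path.W K (suc (suc t)) f)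
  dihedral-step {K} x y ne refl t f j k =
    trans (cong (λ z → (kron x j ℤ.* a k ℤ.+ kron y j ℤ.* b k) ℤ.- kron x j ℤ.* z)
       (trans (fire-⊕ x (αv x a) (αv y b) k) (cong₂ ℤ._+_ (fire-αv-diag x a k) (fire-αv-off x y b (λ e → ne (sym e)) k))))
     (b₂ (kron x j) (a k) (X x y b k) (kron y j ℤ.* b k))
    where
    a = Path.W K t f
    b = Path.W K (suc t) f

  private
    -- A last letter j of g exists, and i and j are stripped alternately from the right of g while
    -- this shortens it. The remaining h is shortened by neither, and `g ⋆ α i k` is h applied to a
    -- combination of the two simple roots with Chebyshev coefficients, which are nonnegative as
    -- long as fewer than `m i j` letters are stripped. Induction on length applies to h.
    module Positive (g : G) (i j : Fin n) (i≢j : i ≢ j) (Pi : P g i) (¬Pj : ¬ P g j)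
                    (IH : ∀ h → ℓ h < ℓ g → ∀ x → P h x → ∀ k → k < κ → NN (h ⋆ α x k))
                    (k : ℕ) (k< : k < κ) where
      K m₀ : ℕ
      K = M i j
      m₀ = m i j
      W : ℕ → Row
      W t = Path.W K t (unit k)
      m₀-eq : suc (suc K) ≡ m₀
      m₀-eq = ℕₚ.m+[n∸m]≡n (offdiag i j i≢j)
      unit-bounded : Bounded κ (unit k)
      unit-bounded q κ≤q = unit-≢ k q (λ e → ℕₚ.<-irrefl e (ℕₚ.<-≤-trans k< κ≤q))
      W-bd : ∀ t → Bounded κ (W t)
      W-bd t = Path.W-bounded K (M∣κ i j) t unit-bounded
      pair : Fin n → Fin n → ℕ → V
      pair x y t = αv x (W t) ⊕ αv y (W (suc t))
      pair-bd : ∀ x y t → Bd (pair x y t)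
      pair-bd x y t a q r = cong₂ ℤ._+_ (αv-bounded x (W-bd t) a q r) (αv-bounded y (W-bd (suc t)) a q r)

      nn-⋆ : ∀ h x → P h x → ℓ h < ℓ g → ∀ y → NonNeg y → Bounded κ y → NN (h ⋆ αv x y)
      nn-⋆ h x p h< = Cone.cone-αv (λ v → NN (h ⋆ v)) (λ e → NN-resp (⋆-cong h e))
        (NN-resp (≋-sym (⋆-0 h)) (λ _ _ → +≤+ z≤n))
        (λ {v} {w} p q → NN-resp (≋-sym (⋆-⊕ h v w)) (NN-⊕ p q)) x (λ k k< → IH h h< x p k k<)

      -- `x` is the letter to be tried next, `y` the one stripped last, and `t + suc f = m₀` counts
      -- how far the alternating word may still grow.
      strip : ∀ f x y t h → t ℕ.+ suc f ≡ m₀ → x ≢ y → M x y ≡ K → M y x ≡ K → m x y ≡ m₀ → m y x ≡ m₀ →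
              ℓ h ℕ.+ suc t ≡ suc (ℓ g) → 0 < t → g ≡ h ∙ ψ (alt y x t) → (∃[ u ] alt x y t ≡ u ++ [ i ]) → P h y →
              g ⋆ α i k ≋ h ⋆ pair x y t → NN (g ⋆ α i k)
      strip f x y t h tf ne Mxy Myx mxy myx ℓh 0<t geq (u , ueq) Py veq with P? h x
      ... | yes Px = NN-resp (≋-sym (≋-trans veq (⋆-⊕ h (αv x (W t)) (αv y (W (suc t))))))
              (NN-⊕ (nn-⋆ h x Px h< (W t) (Path.W-unit≥0 K t k (ℕₚ.≤-trans (ℕₚ.n≤1+n t) t<m)) (W-bd t))
                    (nn-⋆ h y Py h< (W (suc t)) (Path.W-unit≥0 K (suc t) k t<m) (W-bd (suc t))))
        where
        t<m : suc t ≤ suc (suc K)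
        t<m = ℕₚ.≤-trans (s≤s (ℕₚ.m≤m+n t f)) (ℕₚ.≤-reflexive (trans (sym (ℕₚ.+-suc t f)) (trans tf (sym m₀-eq))))
        h< : ℓ h < ℓ g
        h< = ℕₚ.≤-trans (ℕₚ.m<m+n (ℓ h) 0<t) (ℕₚ.≤-reflexive (ℕₚ.suc-injective (trans (sym (ℕₚ.+-suc (ℓ h) t)) ℓh)))
      ... | no ¬Px = next f tf
        where
        h′ : G
        h′ = h ∙ gen x
        ℓh′ : ℓ h′ ℕ.+ suc (suc t) ≡ suc (ℓ g)
        ℓh′ = trans (ℕₚ.+-suc (ℓ h′) (suc t)) (trans (cong (ℕ._+ suc t) (¬P⇒ℓ h x ¬Px)) ℓh)
        geq′ : g ≡ h′ ∙ ψ (alt x y (suc t))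
        geq′ = trans geq (sym (trans (cong (h′ ∙_) (ψ-∷ x (alt y x t))) (trans (assoc h (gen x) _) (cong (h ∙_) (gg x _)))))
        veq′ : g ⋆ α i k ≋ h′ ⋆ pair y x (suc t)
        veq′ = ≋-trans veq (≋-trans (⋆-cong h (≋-sym (▷-involutive x (pair x y t))))
          (≋-trans (≋-sym (⋆-∙gen h x (▷-bounded x (pair-bd x y t)))) (⋆-cong h′ (dihedral-step x y ne Mxy t (unit k)))))
        next : ∀ f → t ℕ.+ suc f ≡ m₀ → NN (g ⋆ α i k)
        next (suc f) tf = strip f y x (suc t) h′ (trans (sym (ℕₚ.+-suc t (suc f))) tf) (λ e → ne (sym e)) Myx Mxy myx mxy
          ℓh′ (s≤s z≤n) geq′ (y ∷ u , cong (y ∷_) ueq) (¬P-flip h x ¬Px) veq′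
        -- All `m₀` letters have been stripped. The braid relation rewrites the alternating word to
        -- one that ends in i, so i would shorten g, against `P g i`.
        next zero tf = ⊥-elim (ℕₚ.<-irrefl refl (ℕₚ.<-≤-trans Pi short))
          where
          t≡ : suc t ≡ m₀
          t≡ = trans (sym (ℕₚ.+-comm t 1)) tf
          gi : g ∙ gen i ≡ h′ ∙ ψ (y ∷ u)
          gi = trans (cong (_∙ gen i) (trans geq′ (cong (h′ ∙_) (ψ-resp (≈-trans (≡⇒≈ (cong (alt x y) (trans t≡ (sym mxy)))) (≈-trans (rule (braid x y)) (≡⇒≈ (cong (alt y x) (trans mxy (sym t≡))))))))))
                (trans (cong (λ z → (h′ ∙ z) ∙ gen i) (trans (cong (λ z → ψ (y ∷ z)) ueq) (ψ-∷ʳ (y ∷ u) i)))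
                (trans (assoc h′ _ (gen i)) (cong (h′ ∙_) (ggʳ (ψ (y ∷ u)) i))))
          len : length (y ∷ u) ≡ t
          len = ℕₚ.suc-injective (trans (sym (trans (Listₚ.length-++ (y ∷ u)) (ℕₚ.+-comm (length (y ∷ u)) 1))) (trans (cong length (sym (cong (y ∷_) ueq))) (len-alt y x (suc t))))
            where
            len-alt : ∀ i j k → length (alt i j k) ≡ k
            len-alt i j zero = refl
            len-alt i j (suc k) = cong suc (len-alt j i k)
          short : ℓ (g ∙ gen i) ≤ ℓ g
          short = ℕₚ.≤-trans (ℕₚ.≤-reflexive (cong ℓ gi)) (ℕₚ.≤-trans (ℓ-∙ h′ _) (ℕₚ.≤-trans (ℕₚ.+-monoʳ-≤ (ℓ h′) (ℕₚ.≤-trans (ℓ-min (y ∷ u)) (ℕₚ.≤-reflexive len)))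
             (ℕₚ.≤-trans (ℕₚ.+-monoʳ-≤ (ℓ h′) (ℕₚ.n≤1+n t)) (ℕₚ.≤-reflexive (ℕₚ.suc-injective (trans (sym (ℕₚ.+-suc (ℓ h′) (suc t))) ℓh′))))))

      result : NN (g ⋆ α i k)
      result = strip K i j 1 (g ∙ gen j) m₀-eq i≢j refl Mji refl (symm j i)
        (trans (ℕₚ.+-comm (ℓ (g ∙ gen j)) 2) (cong suc (¬P⇒ℓ g j ¬Pj))) (s≤s z≤n)
        (sym (trans (cong ((g ∙ gen j) ∙_) ψ-[ j ]) (ggʳ g j))) ([] , refl) (¬P-flip g j ¬Pj) veq
        where
        Mji : M j i ≡ M i j
        Mji = cong (ℕ._∸ 2) (symm j i)
        start : α i k ≋ pair j i 0
        start a q = sym (trans (cong (ℤ._+ αv i (unit k) a q) (ℤₚ.*-zeroʳ (kron j a))) (ℤₚ.+-identityˡ _))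
        veq : g ⋆ α i k ≋ (g ∙ gen j) ⋆ pair i j 1
        veq = ≋-trans (⋆-cong g (≋-trans (≋-sym (▷-involutive j (α i k))) ≋-refl))
          (≋-trans (≋-sym (⋆-∙gen g j (▷-bounded j (α-bounded i k<))))
          (⋆-cong (g ∙ gen j) (≋-trans (▷-cong j start) (dihedral-step j i (λ e → i≢j (sym e)) Mji 0 (unit k)))))

    positive-rec : ∀ b g → ℓ g < b → ∀ i → P g i → ∀ k → k < κ → NN (g ⋆ α i k)
    positive-rec (suc b) g (s≤s ℓ≤) i Pi k k< with ℓ g ℕₚ.≟ 0
    ... | yes z = NN-resp (≋-sym (subst (λ h → h ⋆ α i k ≋ α i k) (sym (ℓ≡0 g z)) (⋆-e (α-bounded i k<)))) (NN-αv i (unit≥0 k))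
    ... | no nz with last-letter g nz
    ... | j , ¬Pj = Positive.result g i j (λ { refl → ¬Pj Pi }) Pi ¬Pj (λ h h< → positive-rec b h (ℕₚ.<-≤-trans h< ℓ≤)) k k<

  abstract
    positive : ∀ g i → P g i → ∀ k → k < κ → NN (g ⋆ α i k)
    positive g = positive-rec (suc (ℓ g)) g ℕₚ.≤-refl

  abstract
    negative : ∀ g i → ¬ P g i → ∀ k → k < κ → NN (neg (g ⋆ α i k))
    negative g i ¬p k k< = NN-resp (≋-trans (⋆-∙gen g i (α-bounded i k<)) (≋-trans (⋆-cong g (▷-αv i (unit k))) (⋆-neg g (α i k))))
      (positive (g ∙ gen i) i (¬P-flip g i ¬p) k k<)

  squeeze : ∀ a → 0ℤ ℤ.≤ a → 0ℤ ℤ.≤ - a → a ≡ 0ℤ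
  squeeze (+ zero) _ _ = refl
  squeeze (+ suc a) _ ()

  -- The only positive root that s makes negative is α_s.
  abstract
    support : ∀ s g i → P g i → ¬ P (gen s ∙ g) i → ∀ k → k < κ → ∀ j q → s ≢ j → (g ⋆ α i k) j q ≡ 0ℤ
    support s g i p ¬p k k< j q ne = squeeze _ (positive g i p k k< j q)
      (subst (λ z → 0ℤ ℤ.≤ - z) (trans (⋆-gen∙ s g (α-bounded i k<) j q) (▷-off (g ⋆ α i k) q ne)) (negative (gen s ∙ g) i ¬p k k< j q))

  abstract
    -- The exchange condition. In the unfolding `g ⋆ α i k` is known only to be supported at s, so
    -- it cannot be equated with a simple root. Instead x = g⁻¹ s g s_i is shown to be trivial: for
    -- each j the coordinate of `x ⋆ α j 0` at (j, 0) is 1, so no simple root becomes negative under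
    -- x.
    folding : ∀ s g i → P g i → ¬ P (gen s ∙ g) i → gen s ∙ g ≡ g ∙ gen i
    folding s g i p ¬p = trans (cong (gen s ∙_) (sym sgi)) (gg s (g ∙ gen i))
      where
      sg> : ℓ g < ℓ (gen s ∙ g)
      sg> = ℕₚ.≤-<-trans (ℕₚ.≤-pred (subst (_≤ suc (ℓ (gen s ∙ (g ∙ gen i)))) (P⇒ℓ g i p) (subst (λ z → ℓ z ≤ suc (ℓ (gen s ∙ (g ∙ gen i)))) (gg s (g ∙ gen i)) (ℓ-gen∙ s (gen s ∙ (g ∙ gen i))))))
              (subst (_< ℓ (gen s ∙ g)) (cong ℓ (assoc (gen s) g (gen i))) (¬P⇒< (gen s ∙ g) i ¬p))
      p′ : P (g ⁻¹) s
      p′ = subst (λ z → ℓ (g ⁻¹) < z) (sym (ℓ-flip s g)) (subst (_< ℓ (gen s ∙ g)) (sym (ℓ-inv g)) sg>)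
      ¬p′ : ¬ P (gen i ∙ g ⁻¹) s
      ¬p′ q = ℕₚ.<-irrefl refl (ℕₚ.<-≤-trans q (ℕₚ.≤-trans (ℕₚ.≤-reflexive e₁) (ℕₚ.≤-trans (ℕₚ.<⇒≤ (¬P⇒< (gen s ∙ g) i ¬p)) (ℕₚ.≤-trans (ℓ-gen∙ s g) (ℕₚ.≤-reflexive e₂)))))
        where
        e₁ : ℓ (gen i ∙ g ⁻¹ ∙ gen s) ≡ ℓ (gen s ∙ g ∙ gen i)
        e₁ = trans (sym (ℓ-inv _)) (cong ℓ (trans (inv-∙ _ _) (trans (cong₂ _∙_ (inv-gen s) (trans (inv-∙ _ _) (cong₂ _∙_ (inv-inv g) (inv-gen i)))) (sym (assoc _ _ _)))))
        e₂ : suc (ℓ g) ≡ ℓ (gen i ∙ g ⁻¹)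
        e₂ = trans (sym (P⇒ℓ g i p)) (trans (sym (ℓ-inv _)) (cong ℓ (trans (inv-∙ _ _) (cong (_∙ g ⁻¹) (inv-gen i)))))
      x : G
      x = g ⁻¹ ∙ (gen s ∙ (g ∙ gen i))
      x⋆ : ∀ {v} → Bd v → x ⋆ v ≋ g ⁻¹ ⋆ s ▷ g ⋆ i ▷ v
      x⋆ bd = ≋-trans (⋆-∙ (g ⁻¹) _ bd) (⋆-cong (g ⁻¹) (≋-trans (⋆-gen∙ s (g ∙ gen i) bd) (▷-cong s (⋆-∙gen g i bd))))
      off-i : ∀ j → i ≢ j → ∀ y → Bounded κ y → ∀ q → (g ⁻¹ ⋆ αv s y) j q ≡ 0ℤ
      off-i j ne y by q = Cone.span-αv (λ v → ∀ q → (g ⁻¹ ⋆ v) j q ≡ 0ℤ)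
        (λ e z q → trans (sym (⋆-cong (g ⁻¹) e j q)) (z q))
        (⋆-0 (g ⁻¹) j)
        (λ {v} {w} a b q → trans (⋆-⊕ (g ⁻¹) v w j q) (cong₂ ℤ._+_ (a q) (b q)))
        (λ {v} a q → trans (⋆-neg (g ⁻¹) v j q) (cong -_ (a q))) s
        (λ k k< q → support i (g ⁻¹) s p′ ¬p′ k k< j q ne) y by q
      coordinate : ∀ j → (x ⋆ α j 0) j 0 ≡ 1ℤ
      coordinate j with i Finₚ.≟ j
      ... | yes refl = trans (x⋆ (α-bounded i 0<κ) i 0)
            (trans (⋆-cong (g ⁻¹) (≋-trans (▷-cong s (≋-trans (⋆-cong g (▷-αv i (unit 0))) (≋-trans (⋆-neg g (α i 0)) (λ a q → cong -_ (shape a q)))))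
                 (≋-trans (▷-neg s (αv s y₀)) (≋-trans (λ a q → cong -_ (▷-αv s y₀ a q)) (λ a q → trans (ℤₚ.neg-involutive _) (sym (shape a q)))))) i 0)
            (trans (⋆-inv g (α-bounded i 0<κ) i 0) (αv-at i (unit 0) 0)))
        where
        y₀ : Row
        y₀ = (g ⋆ α i 0) s
        shape : g ⋆ α i 0 ≋ αv s y₀
        shape a q with s Finₚ.≟ a
        ... | yes refl = sym (αv-at s y₀ q)
        ... | no ne = trans (support s g i p ¬p 0 0<κ a q ne) (sym (αv-off y₀ q ne))
      ... | no ne = trans (x⋆ (α-bounded j 0<κ) j 0)
            (trans (⋆-cong (g ⁻¹) (λ a q → refl) j 0)
            (trans (⋆-⊕ (g ⁻¹) w (neg (αv s y)) j 0)
            (trans (cong₂ ℤ._+_ (trans (⋆-inv g (▷-bounded i (α-bounded j 0<κ)) j 0) (trans (▷-off (α j 0) 0 ne) (αv-at j (unit 0) 0)))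
                                (trans (⋆-neg (g ⁻¹) (αv s y) j 0) (cong -_ (off-i j ne y (fire-bounded s (⋆-bounded g (▷-bounded i (α-bounded j 0<κ)))) 0))))
              refl)))
        where
        w : V
        w = g ⋆ i ▷ α j 0
        y : Row
        y = fire s w
      x≡e : x ≡ e
      x≡e = all-P⇒e x pos
        where
        pos : ∀ j → P x j
        pos j with P? x j
        ... | yes q = q
        ... | no ¬q with subst (λ z → 0ℤ ℤ.≤ - z) (coordinate j) (negative x j ¬q 0 0<κ j 0)
        ... | ()
      sgi : gen s ∙ (g ∙ gen i) ≡ g
      sgi = trans (sym (cancelˡ g _)) (trans (cong (g ∙_) x≡e) (idʳ g))

-- Reflections, inversions and the weak order.

module Weak {n : ℕ} (m : Fin n → Fin n → ℕ) (cox : IsCoxeterMatrix m) (T : Words.Table m) where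
  open Roots m cox T public

  _≟G_ : (g h : G) → Dec (g ≡ h)
  _≟G_ = Finₚ._≟_

  ref : G → Fin n → G
  ref g i = g ∙ gen i ∙ g ⁻¹

  ref-∙ : ∀ g i h → ref g i ∙ h ≡ g ∙ (gen i ∙ (g ⁻¹ ∙ h))
  ref-∙ g i h = trans (assoc _ _ _) (assoc _ _ _)

  ref-self : ∀ g i → ref g i ∙ g ≡ g ∙ gen i
  ref-self g i = cancel⁻ʳ (g ∙ gen i) g

  ref-unique : ∀ t g i → t ∙ g ≡ g ∙ gen i → t ≡ ref g i
  ref-unique t g i p = ∙-injʳ g (trans p (sym (ref-self g i)))

  ref² : ∀ g i → ref g i ∙ ref g i ≡ e
  ref² g i = trans (ref-∙ g i _) (trans (cong (λ z → g ∙ (gen i ∙ z)) (trans (cong (g ⁻¹ ∙_) (assoc _ _ _)) (cancel⁻ˡ g _)))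
    (trans (cong (g ∙_) (gg i _)) (invʳ g)))

  ref-flip : ∀ g i → ref (g ∙ gen i) i ≡ ref g i
  ref-flip g i = sym (ref-unique _ _ _ (trans (sym (assoc _ _ _)) (cong (_∙ gen i) (ref-self g i))))

  ref-e : ∀ s → ref e s ≡ gen s
  ref-e s = sym (ref-unique (gen s) e s (trans (idʳ _) (sym (idˡ _))))

  IsRef : G → Set
  IsRef t = ∃[ g ] ∃[ i ] t ≡ ref g i

  isRef? : ∀ t → Dec (IsRef t)
  isRef? t = Finₚ.any? λ g → Finₚ.any? λ i → t ≟G ref g i

  isRef-gen : ∀ s → IsRef (gen s)
  isRef-gen s = e , s , sym (ref-e s)

  Inv : G → G → Set
  Inv w t = IsRef t × ℓ (t ∙ w) < ℓ w

  Inv? : ∀ w t → Dec (Inv w t)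
  Inv? w t = isRef? t ×-dec (ℓ (t ∙ w) ℕₚ.<? ℓ w)

  abstract
    left-letter : ∀ w → ℓ w ≢ 0 → ∃[ s ] ℓ (gen s ∙ w) < ℓ w
    left-letter w nz with last-letter (w ⁻¹) (λ z → nz (trans (sym (ℓ-inv w)) z))
    ... | s , ¬p = s , subst (_< ℓ w) (ℓ-flip s w) (subst (λ z → ℓ (w ⁻¹ ∙ gen s) < z) (ℓ-inv w) (¬P⇒< (w ⁻¹) s ¬p))

  private
    inv-root⇐-rec : ∀ b w → ℓ w < b → ∀ g i → P g i → ¬ P (w ⁻¹ ∙ g) i → ℓ (ref g i ∙ w) < ℓ w
    inv-root⇐-rec (suc b) w (s≤s ℓ≤) g i p ¬p with ℓ w ℕₚ.≟ 0
    ... | yes z = ⊥-elim (¬p (subst (λ h → P h i) (sym (trans (cong (_∙ g) (trans (cong _⁻¹ (ℓ≡0 w z)) inv-e)) (idˡ g))) p))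
    ... | no nz with left-letter w nz
    ... | a , aw< with P? (gen a ∙ g) i
    ... | no ¬q = subst (λ t → ℓ (t ∙ w) < ℓ w) (ref-unique (gen a) g i (folding a g i p ¬q)) aw<
    ... | yes q = ℕₚ.≤-<-trans (ℕₚ.≤-trans (subst (λ z → ℓ z ≤ suc (ℓ (gen a ∙ (ref g i ∙ w)))) (gg a _) (ℓ-gen∙ a _)) (subst (λ z → ℓ z < ℓ (gen a ∙ w)) eq IH)) aw<
      where
      IH : ℓ (ref (gen a ∙ g) i ∙ (gen a ∙ w)) < ℓ (gen a ∙ w)
      IH = inv-root⇐-rec b (gen a ∙ w) (ℕₚ.<-≤-trans aw< ℓ≤) (gen a ∙ g) i q
        (subst (λ h → ¬ P h i) (sym (trans (cong (_∙ (gen a ∙ g)) (trans (inv-∙ (gen a) w) (cong (w ⁻¹ ∙_) (inv-gen a)))) (trans (assoc _ _ _) (cong (w ⁻¹ ∙_) (gg a g))))) ¬p)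
      eq : ref (gen a ∙ g) i ∙ (gen a ∙ w) ≡ gen a ∙ (ref g i ∙ w)
      eq = trans (ref-∙ (gen a ∙ g) i _) (trans (assoc _ _ _) (cong (gen a ∙_) (trans
        (cong (λ z → g ∙ (gen i ∙ z)) (trans (cong (_∙ (gen a ∙ w)) (trans (inv-∙ (gen a) g) (cong (g ⁻¹ ∙_) (inv-gen a)))) (trans (assoc _ _ _) (cong (g ⁻¹ ∙_) (gg a w)))))
        (sym (ref-∙ g i w)))))

  abstract
    -- A left letter a of w is removed. If a makes the root negative, the reflection is a by
    -- `folding`; otherwise the reflection conjugated by a is an inversion of the shorter element by
    -- induction.
    inv-root⇐ : ∀ w g i → P g i → ¬ P (w ⁻¹ ∙ g) i → Inv w (ref g i)
    inv-root⇐ w g i p ¬p = (g , i , refl) , inv-root⇐-rec (suc (ℓ w)) w ℕₚ.≤-refl g i p ¬p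

  inv-root⇒ : ∀ w g i → P g i → Inv w (ref g i) → ¬ P (w ⁻¹ ∙ g) i
  inv-root⇒ w g i p (_ , tw<) q = ℕₚ.<-asym tw< (subst (λ z → ℓ z < ℓ (t ∙ w)) (trans (sym (assoc t t w)) (trans (cong (_∙ w) (ref² g i)) (idˡ w)))
      (proj₂ (inv-root⇐ (t ∙ w) g i p (subst (λ h → ¬ P h i) (sym eq) (P-flip (w ⁻¹ ∙ g) i q)))))
    where
    t = ref g i
    t⁻¹ : t ⁻¹ ≡ t
    t⁻¹ = sym (inv-unique t t (ref² g i))
    eq : (t ∙ w) ⁻¹ ∙ g ≡ (w ⁻¹ ∙ g) ∙ gen i
    eq = trans (cong (_∙ g) (trans (inv-∙ t w) (cong (w ⁻¹ ∙_) t⁻¹))) (trans (assoc _ _ _) (trans (cong (w ⁻¹ ∙_) (ref-self g i)) (sym (assoc _ _ _))))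

  abstract
    pos-rep : ∀ {t} → IsRef t → ∃[ g ] ∃[ i ] (P g i × t ≡ ref g i)
    pos-rep (g , i , p) with P? g i
    ... | yes q = g , i , q , p
    ... | no ¬q = g ∙ gen i , i , ¬P-flip g i ¬q , trans p (sym (ref-flip g i))

  conj : Fin n → G → G
  conj s t = gen s ∙ t ∙ gen s

  conj² : ∀ s t → conj s (conj s t) ≡ t
  conj² s t = trans (cong (_∙ gen s) (trans (sym (assoc _ _ _)) (cong (_∙ gen s) (gg s t)))) (ggʳ t s)

  conj-ref : ∀ s g i → conj s (ref g i) ≡ ref (gen s ∙ g) i
  conj-ref s g i = ref-unique _ _ _ (trans (assoc _ _ _) (trans (cong ((gen s ∙ ref g i) ∙_) (gg s g)) (trans (assoc _ _ _) (trans (cong (gen s ∙_) (ref-self g i)) (sym (assoc _ _ _))))))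

  conj-self : ∀ s → conj s (gen s) ≡ gen s
  conj-self s = trans (cong (_∙ gen s) (gen² s)) (idˡ _)

  conj-≢ : ∀ {s t} → t ≢ gen s → conj s t ≢ gen s
  conj-≢ {s} {t} ne p = ne (trans (sym (conj² s t)) (trans (cong (conj s) p) (conj-self s)))

  abstract
    -- By `folding`, a positive root that s makes negative belongs to the reflection s.
    P-conj : ∀ s g i → P g i → ref g i ≢ gen s → P (gen s ∙ g) i
    P-conj s g i p ne with P? (gen s ∙ g) i
    ... | yes q = q
    ... | no ¬q = ⊥-elim (ne (sym (ref-unique (gen s) g i (folding s g i p ¬q))))

  private
    inv-shift : ∀ s w g → (gen s ∙ w) ⁻¹ ∙ g ≡ w ⁻¹ ∙ (gen s ∙ g)
    inv-shift s w g = trans (cong (_∙ g) (trans (inv-∙ (gen s) w) (cong (w ⁻¹ ∙_) (inv-gen s)))) (assoc _ _ _)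

  abstract
    Inv-conj⇒ : ∀ s w t → t ≢ gen s → Inv (gen s ∙ w) t → Inv w (conj s t)
    Inv-conj⇒ s w t ne p with pos-rep (proj₁ p)
    ... | g , i , q , refl = subst (Inv w) (sym (conj-ref s g i)) (inv-root⇐ w (gen s ∙ g) i (P-conj s g i q ne)
          (subst (λ h → ¬ P h i) (inv-shift s w g) (inv-root⇒ (gen s ∙ w) g i q p)))

  abstract
    Inv-conj⇐ : ∀ s w t → t ≢ gen s → Inv w (conj s t) → Inv (gen s ∙ w) t
    Inv-conj⇐ s w t ne p = subst (λ z → Inv z t) refl (subst (Inv (gen s ∙ w)) (conj² s t)
      (Inv-conj⇒ s (gen s ∙ w) (conj s t) (conj-≢ ne) (subst (λ z → Inv z (conj s t)) (sym (gg s w)) p)))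

  ℓ-gen∙≢ : ∀ s w → ℓ (gen s ∙ w) ≢ ℓ w
  ℓ-gen∙≢ s w p = ℓ-∙gen≢ (w ⁻¹) s (trans (ℓ-flip s w) (trans p (sym (ℓ-inv w))))

  abstract
    Inv-s⇒ : ∀ s w → ¬ Inv w (gen s) → Inv (gen s ∙ w) (gen s)
    Inv-s⇒ s w ¬p = isRef-gen s , subst (λ z → ℓ z < ℓ (gen s ∙ w)) (sym (gg s w))
      (ℕₚ.≤∧≢⇒< (ℕₚ.≮⇒≥ (λ q → ¬p (isRef-gen s , q))) (λ q → ℓ-gen∙≢ s w (sym q)))

  abstract
    Inv-s⇐ : ∀ s w → Inv w (gen s) → ¬ Inv (gen s ∙ w) (gen s)
    Inv-s⇐ s w (_ , p) (_ , q) = ℕₚ.<-asym p (subst (λ z → ℓ z < ℓ (gen s ∙ w)) (gg s w) q)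

  Inv-e : ∀ t → ¬ Inv e t
  Inv-e t (_ , p) = ℕₚ.n≮0 (subst (ℓ (t ∙ e) <_) ℓ-e p)

  abstract
    left-descent : ∀ w → w ≢ e → ∃[ s ] Inv w (gen s)
    left-descent w ne with left-letter w (λ z → ne (ℓ≡0 w z))
    ... | s , p = s , isRef-gen s , p

  infix 4 _⊑_
  _⊑_ : G → G → Set
  u ⊑ w = ∀ t → Inv u t → Inv w t

  ⊑-trans : ∀ {u v w} → u ⊑ v → v ⊑ w → u ⊑ w
  ⊑-trans p q t x = q t (p t x)

  e⊑ : ∀ w → e ⊑ w
  e⊑ w t p = ⊥-elim (Inv-e t p)

  ⊑-down : ∀ s {u w} → Inv u (gen s) → u ⊑ w → gen s ∙ u ⊑ gen s ∙ w
  ⊑-down s {u} {w} su p t q with t ≟G gen s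
  ... | yes refl = ⊥-elim (Inv-s⇐ s u su q)
  ... | no ne = Inv-conj⇐ s w t ne (p _ (Inv-conj⇒ s u t ne q))

  ⊑-up : ∀ s {u w} → ¬ Inv w (gen s) → u ⊑ w → gen s ∙ u ⊑ gen s ∙ w
  ⊑-up s {u} {w} ¬sw p t q with t ≟G gen s
  ... | yes refl = Inv-s⇒ s w ¬sw
  ... | no ne = Inv-conj⇐ s w t ne (p _ (Inv-conj⇒ s u t ne q))

  ⊑-up′ : ∀ s {u w} → Inv w (gen s) → u ⊑ gen s ∙ w → gen s ∙ u ⊑ w
  ⊑-up′ s {u} {w} sw p = subst (gen s ∙ u ⊑_) (gg s w) (⊑-up s (Inv-s⇐ s w sw) p)

  ⊑-down′ : ∀ s {u w} → ¬ Inv u (gen s) → gen s ∙ u ⊑ w → u ⊑ gen s ∙ w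
  ⊑-down′ s {u} {w} ¬su p = subst (_⊑ gen s ∙ w) (gg s u) (⊑-down s (Inv-s⇒ s u ¬su) p)

  private
    antisym-rec : ∀ b u w → ℓ u < b → u ⊑ w → w ⊑ u → u ≡ w
    antisym-rec (suc b) u w (s≤s ℓ≤) p q with u ≟G e
    ... | yes refl with w ≟G e
    ... | yes r = sym r
    ... | no ne with left-descent w ne
    ... | s , x = ⊥-elim (Inv-e _ (q _ x))
    antisym-rec (suc b) u w (s≤s ℓ≤) p q | no ne with left-descent u ne
    ... | s , x = ∙-injˡ (gen s) (antisym-rec b (gen s ∙ u) (gen s ∙ w) (ℕₚ.<-≤-trans (proj₂ x) ℓ≤) (⊑-down s x p) (⊑-down s (p _ x) q))

  abstract
    ⊑-antisym : ∀ {u w} → u ⊑ w → w ⊑ u → u ≡ w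
    ⊑-antisym {u} {w} = antisym-rec (suc (ℓ u)) u w ℕₚ.≤-refl

  Cov : G → G → Set
  Cov w t = ∃[ q ] (¬ P w q × t ≡ ref w q)

  Cov⇒Inv : ∀ {w t} → Cov w t → Inv w t
  Cov⇒Inv {w} (q , ¬p , refl) = (w , q , refl) , subst (λ z → ℓ z < ℓ w) (sym (ref-self w q)) (¬P⇒< w q ¬p)

  Cov? : ∀ w t → Dec (Cov w t)
  Cov? w t = Finₚ.any? λ q → ¬? (P? w q) ×-dec (t ≟G ref w q)

  private
    right-side : ∀ w q g i → P (w ⁻¹ ∙ g) i → ref g i ≢ ref w q → P ((w ∙ gen q) ⁻¹ ∙ g) i
    right-side w q g i p ne = subst (λ z → P z i) (sym (trans (cong (_∙ g) (trans (inv-∙ w (gen q)) (cong (_∙ w ⁻¹) (inv-gen q)))) (assoc _ _ _)))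
      (P-conj q (w ⁻¹ ∙ g) i p λ r → ne (ref-unique _ w q (trans (ref-∙ g i w) (∙-injˡ (w ⁻¹) (trans (lhs r) (sym (trans (cong (w ⁻¹ ∙_) refl) (cancel⁻ˡ w (gen q)))))))))
      where
      lhs : ref (w ⁻¹ ∙ g) i ≡ gen q → w ⁻¹ ∙ (g ∙ (gen i ∙ (g ⁻¹ ∙ w))) ≡ gen q
      lhs r = trans (sym (trans (assoc _ _ _) (trans (cong ((w ⁻¹ ∙ g) ∙_) (cong (gen i ∙_) (trans (inv-∙ (w ⁻¹) g) (cong (g ⁻¹ ∙_) (inv-inv w))))) (assoc _ _ _)))) r

  abstract
    Inv-right⇒ : ∀ w q t → t ≢ ref w q → Inv (w ∙ gen q) t → Inv w t
    Inv-right⇒ w q t ne p with pos-rep (proj₁ p)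
    ... | g , i , x , refl = inv-root⇐ w g i x λ y → inv-root⇒ (w ∙ gen q) g i x p (right-side w q g i y ne)

  abstract
    Inv-right⇐ : ∀ w q t → t ≢ ref w q → Inv w t → Inv (w ∙ gen q) t
    Inv-right⇐ w q t ne p = Inv-right⇒ (w ∙ gen q) q t (λ r → ne (trans r (ref-flip w q))) (subst (λ z → Inv z t) (sym (ggʳ w q)) p)

  ¬Inv-right : ∀ w q → ¬ P w q → ¬ Inv (w ∙ gen q) (ref w q)
  ¬Inv-right w q ¬p (_ , x) = ℕₚ.<-asym (¬P⇒< w q ¬p) (subst (λ z → ℓ z < ℓ (w ∙ gen q)) (trans (sym (assoc _ _ _)) (trans (cong (_∙ gen q) (ref-self w q)) (ggʳ w q))) x)

  abstract
    drop : ∀ {u w q} → u ⊑ w → ¬ Inv u (ref w q) → u ⊑ w ∙ gen q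
    drop {u} {w} {q} p ¬t t x = Inv-right⇐ w q t (λ { refl → ¬t x }) (p t x)

  ∙gen⊑ : ∀ {w q} → ¬ P w q → w ∙ gen q ⊑ w
  ∙gen⊑ {w} {q} ¬p t x = Inv-right⇒ w q t (λ { refl → ¬Inv-right w q ¬p x }) x

  private
    missing-rec : ∀ b u w → ℓ u < b → u ⊑ w → u ≢ w → ∃[ q ] (¬ P w q × ¬ Inv u (ref w q))
    missing-rec (suc b) u w (s≤s ℓ≤) p ne with u ≟G e
    ... | yes refl with last-letter w (λ z → ne (sym (ℓ≡0 w z)))
    ... | q , ¬p = q , ¬p , Inv-e _
    missing-rec (suc b) u w (s≤s ℓ≤) p ne | no ne′ with left-descent u ne′
    ... | s , x with missing-rec b (gen s ∙ u) (gen s ∙ w) (ℕₚ.<-≤-trans (proj₂ x) ℓ≤) (⊑-down s x p) (λ r → ne (∙-injˡ (gen s) r))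
    ... | q , ¬p , ¬t = q , ¬Pw , ¬t′
      where
      t′≢ : ref (gen s ∙ w) q ≢ gen s
      t′≢ r = Inv-s⇐ s w (p _ x) (subst (Inv (gen s ∙ w)) r (Cov⇒Inv (q , ¬p , refl)))
      ¬t′ : ¬ Inv u (ref w q)
      ¬t′ y = ¬t (Inv-conj⇐ s u _ t′≢ (subst (Inv u) (sym (trans (conj-ref s (gen s ∙ w) q) (cong (λ z → ref z q) (gg s w)))) y))
      ¬Pw : ¬ P w q
      ¬Pw pw = ℕₚ.<-irrefl refl (ℕₚ.<-trans (ℕₚ.<-≤-trans pw (ℕₚ.≤-trans (ℕₚ.≤-reflexive (cong ℓ (trans (cong (_∙ gen q) (sym (gg s w))) (assoc _ _ _)))) (ℕₚ.≤-trans (ℓ-gen∙ s _) (¬P⇒< _ q ¬p)))) (proj₂ (p _ x)))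

  abstract
    -- Left descents of u are peeled off both elements until u is trivial, where any last letter of
    -- w will do. Together with `drop`: whatever lies strictly below w lies below some `w ∙ gen q`
    -- with q a descent.
    missing : ∀ {u w} → u ⊑ w → u ≢ w → ∃[ q ] (¬ P w q × ¬ Inv u (ref w q))
    missing {u} {w} = missing-rec (suc (ℓ u)) u w ℕₚ.≤-refl

  abstract
    missing-cov : ∀ {u w} → u ⊑ w → u ≢ w → ∃[ t ] (Cov w t × ¬ Inv u t)
    missing-cov p ne with missing p ne
    ... | q , a , b = _ , (q , a , refl) , b

  -- Root vectors of a reflection

  -- A reflection has a vector for every presentation by a positive root and every index `k < κ`,
  -- not a unique root. The sign of each of them under `w ⁻¹` decides whether the reflection is an
  -- inversion of `w`, so any one may serve as witness.
  Rv : G → V → Set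
  Rv t v = ∃[ g ] ∃[ i ] ∃[ k ] (k < κ × P g i × t ≡ ref g i × v ≋ g ⋆ α i k)

  Rv-resp : ∀ {t v w} → v ≋ w → Rv t v → Rv t w
  Rv-resp e (g , i , k , k< , p , q , r) = g , i , k , k< , p , q , ≋-trans (≋-sym e) r

  abstract
    Rv-exists : ∀ {t} → IsRef t → ∃[ v ] Rv t v
    Rv-exists r with pos-rep r
    ... | g , i , p , q = _ , g , i , 0 , 0<κ , p , q , ≋-refl

  Rv-isRef : ∀ {t v} → Rv t v → IsRef t
  Rv-isRef (g , i , _ , _ , _ , p , _) = g , i , p

  Rv-NN : ∀ {t v} → Rv t v → NN v
  Rv-NN (g , i , k , k< , p , _ , e) = NN-resp (≋-sym e) (positive g i p k k<)

  Rv-Bd : ∀ {t v} → Rv t v → Bd v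
  Rv-Bd (g , i , k , k< , p , _ , e) j q r = trans (e j q) (⋆-bounded g (α-bounded i k<) j q r)

  abstract
    Rv-≢0 : ∀ {t v} → Rv t v → ¬ (v ≋ 0ᵛ)
    Rv-≢0 {v = v} (g , i , k , k< , p , _ , e) z with trans (sym (trans (αv-at i (unit k) k) (unit-refl k)))
        (trans (sym (⋆-inv g (α-bounded i k<) i k)) (trans (⋆-cong (g ⁻¹) (≋-trans (≋-sym e) z) i k) (⋆-0 (g ⁻¹) i k)))
    ... | ()

  Rv-gen : ∀ s k → k < κ → Rv (gen s) (α s k)
  Rv-gen s k k< = e , s , k , k< , p , sym (ref-e s) , ≋-sym (⋆-e (α-bounded s k<))
    where
    p : P e s
    p = subst (_< ℓ (e ∙ gen s)) (sym ℓ-e) (ℕₚ.n≢0⇒n>0 (λ z → ℓ-∙gen≢ e s (trans z (sym ℓ-e))))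

  Rv-conj : ∀ s {t v} → t ≢ gen s → Rv t v → Rv (conj s t) (s ▷ v)
  Rv-conj s ne (g , i , k , k< , p , refl , e) = gen s ∙ g , i , k , k< , P-conj s g i p ne , conj-ref s g i ,
    ≋-trans (▷-cong s e) (≋-sym (⋆-gen∙ s g (α-bounded i k<)))

  Rv-conj⁻ : ∀ s {t v} → t ≢ gen s → Rv (conj s t) v → Rv t (s ▷ v)
  Rv-conj⁻ s {t} {v} ne r = subst (λ z → Rv z (s ▷ v)) (conj² s t) (Rv-conj s (conj-≢ ne) r)

  Rv-supp : ∀ {s v} → Rv (gen s) v → ∀ j → s ≢ j → v j ≗ 0ʳ
  Rv-supp {s} (g , i , k , k< , p , eq , e) j ne q = trans (e j q) (support s g i p ¬p k k< j q ne)
    where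
    ¬p : ¬ P (gen s ∙ g) i
    ¬p = subst (λ z → ¬ P z i) (sym (trans (cong (_∙ g) eq) (ref-self g i))) (P-flip g i p)

  abstract
    Inv-neg : ∀ {w t v} → Inv w t → Rv t v → NN (neg (w ⁻¹ ⋆ v))
    Inv-neg {w} x (g , i , k , k< , p , refl , e) = NN-resp (λ j q → cong -_ (sym (trans (⋆-cong (w ⁻¹) e j q) (sym (⋆-∙ (w ⁻¹) g (α-bounded i k<) j q)))))
      (negative (w ⁻¹ ∙ g) i (inv-root⇒ w g i p x) k k<)

  abstract
    Inv-pos : ∀ {w t v} → ¬ Inv w t → Rv t v → NN (w ⁻¹ ⋆ v)
    Inv-pos {w} ¬x (g , i , k , k< , p , refl , e) with P? (w ⁻¹ ∙ g) i
    ... | yes q = NN-resp (≋-sym (≋-trans (⋆-cong (w ⁻¹) e) (≋-sym (⋆-∙ (w ⁻¹) g (α-bounded i k<))))) (positive (w ⁻¹ ∙ g) i q k k<)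
    ... | no ¬q = ⊥-elim (¬x (inv-root⇐ w g i p ¬q))

  ⋆-≢0 : ∀ g {v} → Bd v → ¬ (v ≋ 0ᵛ) → ¬ (g ⋆ v ≋ 0ᵛ)
  ⋆-≢0 g bd ne z = ne (≋-trans (≋-sym (⋆-inv g bd)) (≋-trans (⋆-cong (g ⁻¹) z) (⋆-0 (g ⁻¹))))

  abstract
    Inv-by-neg : ∀ {w t v} → Rv t v → NN (neg (w ⁻¹ ⋆ v)) → Inv w t
    Inv-by-neg {w} {t} {v} r p with Inv? w t
    ... | yes x = x
    ... | no ¬x = ⊥-elim (⋆-≢0 (w ⁻¹) (Rv-Bd r) (Rv-≢0 r) (λ j k → squeeze _ (Inv-pos ¬x r j k) (p j k)))

  abstract
    ¬Inv-by-pos : ∀ {w t v} → Rv t v → NN (w ⁻¹ ⋆ v) → ¬ Inv w t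
    ¬Inv-by-pos {w} r p x = ⋆-≢0 (w ⁻¹) (Rv-Bd r) (Rv-≢0 r) (λ j k → squeeze _ (p j k) (Inv-neg x r j k))

  -- Parabolic subgroups

  data Gen (c : List (Fin n)) : G → Set where
    gen-e : Gen c e
    gen-∙ : ∀ {s g} → s ∈ c → Gen c g → Gen c (gen s ∙ g)

  Gen-gen : ∀ {c s} → s ∈ c → Gen c (gen s)
  Gen-gen {c} {s} p = subst (Gen c) (idʳ (gen s)) (gen-∙ p gen-e)

  Gen-mul : ∀ {c g h} → Gen c g → Gen c h → Gen c (g ∙ h)
  Gen-mul {c} {h = h} gen-e q = subst (Gen c) (sym (idˡ h)) q
  Gen-mul {c} {h = h} (gen-∙ {s} {g} p x) q = subst (Gen c) (sym (assoc (gen s) g h)) (gen-∙ p (Gen-mul x q))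

  Gen-inv : ∀ {c g} → Gen c g → Gen c (g ⁻¹)
  Gen-inv {c} gen-e = subst (Gen c) (sym inv-e) gen-e
  Gen-inv {c} (gen-∙ {s} {g} p x) = subst (Gen c) (sym (trans (inv-∙ (gen s) g) (cong (g ⁻¹ ∙_) (inv-gen s)))) (Gen-mul (Gen-inv x) (Gen-gen p))

  Gen-mono : ∀ {c d g} → (∀ s → s ∈ c → s ∈ d) → Gen c g → Gen d g
  Gen-mono f gen-e = gen-e
  Gen-mono f (gen-∙ p x) = gen-∙ (f _ p) (Gen-mono f x)

  Gen-coord : ∀ {c g} → Gen c g → ∀ {v} → Bd v → ∀ j → j ∉ c → (g ⋆ v) j ≗ v j
  Gen-coord gen-e bd j j∉ k = ⋆-e bd j k
  Gen-coord (gen-∙ {s} {g} p x) {v} bd j j∉ k = trans (⋆-gen∙ s g bd j k) (trans (▷-off (g ⋆ v) k (λ { refl → j∉ p })) (Gen-coord x bd j j∉ k))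

  -- t lies in the parabolic subgroup generated by c
  Tin : List (Fin n) → G → Set
  Tin c t = ∀ v → Rv t v → ∀ j → j ∉ c → v j ≗ 0ʳ

  Inv⇒Tin : ∀ {c w t} → Gen c w → Inv w t → Tin c t
  Inv⇒Tin {c} {w} x y v r j j∉ k = squeeze _ (Rv-NN r j k) (subst (λ z → 0ℤ ℤ.≤ - z) (Gen-coord (Gen-inv x) (Rv-Bd r) j j∉ k) (Inv-neg y r j k))

  Tin-mono : ∀ {c d t} → (∀ s → s ∈ c → s ∈ d) → Tin c t → Tin d t
  Tin-mono f p v r j j∉ = p v r j (λ q → j∉ (f j q))

  Tin-gen : ∀ {c s} → s ∈ c → Tin c (gen s)
  Tin-gen p v r j j∉ = Rv-supp r j (λ { refl → j∉ p })

  ¬Tin-gen : ∀ {c s} → s ∉ c → ¬ Tin c (gen s)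
  ¬Tin-gen {c} {s} s∉ x with trans (sym (αv-at s (unit 0) 0)) (x (α s 0) (Rv-gen s 0 0<κ) s s∉ 0)
  ... | ()

  Tin-conj : ∀ {c s t} → s ∈ c → Tin c t → Tin c (conj s t)
  Tin-conj {c} {s} {t} s∈ p v r j j∉ k with t ≟G gen s
  ... | yes refl = subst (Tin c) (sym (conj-self s)) p v r j j∉ k
  ... | no ne = trans (sym (▷-off v k (λ { refl → j∉ s∈ }))) (p (s ▷ v) (Rv-conj⁻ s ne r) j j∉ k)

  abstract
    cone-neg : ∀ {w} c → (∀ s → s ∈ c → Inv w (gen s)) → ∀ v → NN v → Bd v → (∀ j → j ∉ c → v j ≗ 0ʳ) → NN (neg (w ⁻¹ ⋆ v))
    cone-neg {w} c p v nn bd z = Cone.cone (λ v → NN (neg (w ⁻¹ ⋆ v))) (λ e → NN-resp (λ j k → cong -_ (⋆-cong (w ⁻¹) e j k)))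
      (λ j k → ℤₚ.≤-reflexive (sym (cong -_ (⋆-0 (w ⁻¹) j k))))
      (λ {x} {y} a b → NN-resp (λ j k → sym (trans (cong -_ (⋆-⊕ (w ⁻¹) x y j k)) (ℤₚ.neg-distrib-+ ((w ⁻¹ ⋆ x) j k) ((w ⁻¹ ⋆ y) j k)))) (NN-⊕ a b))
      c v z nn bd (λ i i∈ k k< → Inv-neg (p i i∈) (Rv-gen i k k<))

  abstract
    cone-pos : ∀ {w} c → (∀ s → s ∈ c → ¬ Inv w (gen s)) → ∀ v → NN v → Bd v → (∀ j → j ∉ c → v j ≗ 0ʳ) → NN (w ⁻¹ ⋆ v)
    cone-pos {w} c p v nn bd z = Cone.cone (λ v → NN (w ⁻¹ ⋆ v)) (λ e → NN-resp (⋆-cong (w ⁻¹) e))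
      (NN-resp (≋-sym (⋆-0 (w ⁻¹))) (λ _ _ → +≤+ z≤n))
      (λ {x} {y} a b → NN-resp (≋-sym (⋆-⊕ (w ⁻¹) x y)) (NN-⊕ a b))
      c v z nn bd (λ i i∈ k k< → Inv-pos (p i i∈) (Rv-gen i k k<))

  abstract
    -- A root vector of the parabolic subgroup is a nonnegative combination of simple ones with
    -- letters in c, all of which `w ⁻¹` makes negative.
    Inv-all : ∀ {w} c → (∀ s → s ∈ c → Inv w (gen s)) → ∀ t → IsRef t → Tin c t → Inv w t
    Inv-all c p t rt x with Rv-exists rt
    ... | v , r = Inv-by-neg r (cone-neg c p v (Rv-NN r) (Rv-Bd r) (x v r))

  abstract
    Inv-none : ∀ {w} c → (∀ s → s ∈ c → ¬ Inv w (gen s)) → ∀ t → Tin c t → ¬ Inv w t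
    Inv-none c p t x y with Rv-exists (proj₁ y)
    ... | v , r = ¬Inv-by-pos r (cone-pos c p v (Rv-NN r) (Rv-Bd r) (x v r)) y

  record Par (c : List (Fin n)) (w : G) : Set where
    field
      par : G
      par-gen : Gen c par
      par⇒ : ∀ t → Inv par t → Inv w t × Tin c t
      par⇐ : ∀ t → Inv w t → Tin c t → Inv par t

  private
    parabolic-rec : ∀ b c w → ℓ w < b → Par c w
    parabolic-rec (suc b) c w (s≤s ℓ≤) with Any.any? (λ s → Inv? w (gen s)) c
    ... | no ¬p = record { par = e ; par-gen = gen-e ; par⇒ = λ t x → ⊥-elim (Inv-e t x)
                         ; par⇐ = λ t x y → ⊥-elim (Inv-none c (λ s s∈ z → ¬p (lose s∈ z)) t y x) }
    ... | yes p with find p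
    ... | s , s∈ , sw = record { par = gen s ∙ y ; par-gen = gen-∙ s∈ (Par.par-gen R) ; par⇒ = to ; par⇐ = from }
      where
      R = parabolic-rec b c (gen s ∙ w) (ℕₚ.<-≤-trans (proj₂ sw) ℓ≤)
      y = Par.par R
      to : ∀ t → Inv (gen s ∙ y) t → Inv w t × Tin c t
      to t x with t ≟G gen s
      ... | yes refl = sw , Tin-gen s∈
      ... | no ne with Par.par⇒ R _ (Inv-conj⇒ s y t ne x)
      ... | a , b = subst (λ z → Inv z t) (gg s w) (Inv-conj⇐ s (gen s ∙ w) t ne a) , subst (Tin c) (conj² s t) (Tin-conj s∈ b)
      from : ∀ t → Inv w t → Tin c t → Inv (gen s ∙ y) t
      from t x z with t ≟G gen s
      ... | yes refl = Inv-s⇒ s y (λ q → Inv-s⇐ s w sw (proj₁ (Par.par⇒ R _ q)))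
      ... | no ne = Inv-conj⇐ s y t ne (Par.par⇐ R _ (Inv-conj⇒ s (gen s ∙ w) t ne (subst (λ z → Inv z t) (sym (gg s w)) x)) (Tin-conj s∈ z))

  abstract
    -- Left descents of w in c are stripped one at a time; when none is left, `Inv-none` shows that
    -- no inversion in the subgroup is left.
    parabolic : ∀ c w → Par c w
    parabolic c w = parabolic-rec (suc (ℓ w)) c w ℕₚ.≤-refl

  infixl 8 _∣_
  _∣_ : G → List (Fin n) → G
  w ∣ c = Par.par (parabolic c w)

  ∣-gen : ∀ c w → Gen c (w ∣ c)
  ∣-gen c w = Par.par-gen (parabolic c w)

  ∣⇒Inv : ∀ c w {t} → Inv (w ∣ c) t → Inv w t
  ∣⇒Inv c w x = proj₁ (Par.par⇒ (parabolic c w) _ x)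

  ∣⇒Tin : ∀ c w {t} → Inv (w ∣ c) t → Tin c t
  ∣⇒Tin c w x = proj₂ (Par.par⇒ (parabolic c w) _ x)

  ∣⇐ : ∀ c w {t} → Inv w t → Tin c t → Inv (w ∣ c) t
  ∣⇐ c w = Par.par⇐ (parabolic c w) _

  ∣⊑ : ∀ c w → w ∣ c ⊑ w
  ∣⊑ c w t = ∣⇒Inv c w

  ∣-greatest : ∀ c {u w} → (∀ t → Inv u t → Tin c t) → u ⊑ w → u ⊑ w ∣ c
  ∣-greatest c {u} {w} z p t x = ∣⇐ c w (p t x) (z t x)

  ∣-mono : ∀ c {u w} → u ⊑ w → u ∣ c ⊑ w ∣ c
  ∣-mono c {u} {w} p = ∣-greatest c (λ t → ∣⇒Tin c u) (⊑-trans (∣⊑ c u) p)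

  abstract
    -- If `w ∣ c` were strictly below w, it would miss a cover reflection of w, yet it contains
    -- every inversion in the subgroup.
    Cov⊆Tin⇒Gen : ∀ c {w} → (∀ t → Cov w t → Tin c t) → Gen c w
    Cov⊆Tin⇒Gen c {w} z with (w ∣ c) ≟G w
    ... | yes p = subst (Gen c) p (∣-gen c w)
    ... | no ne with missing-cov (∣⊑ c w) ne
    ... | t , x , ¬y = ⊥-elim (¬y (∣⇐ c w (Cov⇒Inv x) (z t x)))

  record Meet (u w : G) : Set where
    field
      meet : G
      meet₁ : meet ⊑ u
      meet₂ : meet ⊑ w
      greatest : ∀ y → y ⊑ u → y ⊑ w → y ⊑ meet

  private
    -- The meet is built on one common left descent s, but a lower bound y may only have another
    -- one, r. It lies below r ν with ν the meet of r u and r w. Both u and w lie above the longest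
    -- element of the subgroup generated by r and s, so r ν contains s too and can take the place of
    -- y.
    meet-rec : ∀ b u w → ℓ u < b → Meet u w
    meet-rec (suc b) u w (s≤s ℓ≤) with Finₚ.any? (λ s → Inv? u (gen s) ×-dec Inv? w (gen s))
    ... | no ¬p = record { meet = e ; meet₁ = e⊑ u ; meet₂ = e⊑ w ; greatest = g }
      where
      g : ∀ y → y ⊑ u → y ⊑ w → y ⊑ e
      g y p q with y ≟G e
      ... | yes refl = λ t x → x
      ... | no ne with left-descent y ne
      ... | s , x = ⊥-elim (¬p (s , p _ x , q _ x))
    ... | yes (s , su , sw) = record { meet = gen s ∙ μ ; meet₁ = ⊑-up′ s su (Meet.meet₁ R) ; meet₂ = ⊑-up′ s sw (Meet.meet₂ R) ; greatest = g }
      where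
      R = meet-rec b (gen s ∙ u) (gen s ∙ w) (ℕₚ.<-≤-trans (proj₂ su) ℓ≤)
      μ = Meet.meet R
      ¬sμ : ¬ Inv μ (gen s)
      ¬sμ x = Inv-s⇐ s u su (Meet.meet₁ R _ x)
      g-s : ∀ y → y ⊑ u → y ⊑ w → Inv y (gen s) → y ⊑ gen s ∙ μ
      g-s y p q sy = subst (_⊑ gen s ∙ μ) (gg s y) (⊑-up s ¬sμ (Meet.greatest R (gen s ∙ y) (⊑-down s sy p) (⊑-down s sy q)))
      g : ∀ y → y ⊑ u → y ⊑ w → y ⊑ gen s ∙ μ
      g y p q with y ≟G e
      ... | yes refl = e⊑ _
      ... | no ne with left-descent y ne
      ... | r , ry = ⊑-trans y⊑ (g-s (gen r ∙ ν) (⊑-up′ r ru (Meet.meet₁ R′)) (⊑-up′ r rw (Meet.meet₂ R′)) s∈)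
        where
        ru = p _ ry
        rw = q _ ry
        R′ = meet-rec b (gen r ∙ u) (gen r ∙ w) (ℕₚ.<-≤-trans (proj₂ ru) ℓ≤)
        ν = Meet.meet R′
        ¬rν : ¬ Inv ν (gen r)
        ¬rν x = Inv-s⇐ r u ru (Meet.meet₁ R′ _ x)
        y⊑ : y ⊑ gen r ∙ ν
        y⊑ = subst (_⊑ gen r ∙ ν) (gg r y) (⊑-up r ¬rν (Meet.greatest R′ (gen r ∙ y) (⊑-down r ry p) (⊑-down r ry q)))
        c = r ∷ s ∷ []
        d = u ∣ c
        rd : Inv d (gen r)
        rd = ∣⇐ c u ru (Tin-gen (here refl))
        d⊑w : d ⊑ w
        d⊑w t x = Inv-all c (λ { _ (here refl) → rw ; _ (there (here refl)) → sw }) t (proj₁ x) (∣⇒Tin c u x)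
        s∈ : Inv (gen r ∙ ν) (gen s)
        s∈ = subst (_⊑ gen r ∙ ν) (gg r d) (⊑-up r ¬rν (Meet.greatest R′ (gen r ∙ d) (⊑-down r rd (∣⊑ c u)) (⊑-down r rd d⊑w)))
               (gen s) (∣⇐ c u su (Tin-gen (there (here refl))))

  abstract
    meets : ∀ u w → Meet u w
    meets u w = meet-rec (suc (ℓ u)) u w ℕₚ.≤-refl

  abstract
    -- Otherwise the meet of x and y is strictly below x and misses a cover reflection of x, though
    -- it lies above every common lower bound.
    ⊑-by-covers : ∀ {x y} → (∀ t → Cov x t → ∃[ z ] (z ⊑ x × z ⊑ y × Inv z t)) → x ⊑ y
    ⊑-by-covers {x} {y} f with Meet.meet (meets x y) ≟G x
    ... | yes p = subst (_⊑ y) p (Meet.meet₂ (meets x y))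
    ... | no ne with missing-cov (Meet.meet₁ (meets x y)) ne
    ... | t , c , ¬i with f t c
    ... | z , a , b , i = ⊥-elim (¬i (Meet.greatest (meets x y) z a b t i))

  -- The longest element

  private
    maximum : ∀ {k} (f : Fin (suc k) → ℕ) → ∃[ i ] (∀ j → f j ≤ f i)
    maximum {zero} f = Fin.zero , λ { Fin.zero → ℕₚ.≤-refl }
    maximum {suc k} f with maximum (λ i → f (Fin.suc i))
    ... | i , p with ℕₚ.≤-total (f Fin.zero) (f (Fin.suc i))
    ... | inj₁ q = Fin.suc i , λ { Fin.zero → q ; (Fin.suc j) → p j }
    ... | inj₂ q = Fin.zero , λ { Fin.zero → ℕₚ.≤-refl ; (Fin.suc j) → ℕₚ.≤-trans (p j) q }

    maximum′ : ∀ {k} → Fin k → (f : Fin k → ℕ) → ∃[ i ] (∀ j → f j ≤ f i)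
    maximum′ {suc k} _ = maximum

  abstract
    longest : ∃[ w₀ ] (∀ t → IsRef t → Inv w₀ t)
    longest = w₀ , λ t r → Inv-all (allFin n) (λ s _ → isRef-gen s , ℕₚ.≤∧≢⇒< (proj₂ mx (gen s ∙ w₀)) (ℓ-gen∙≢ s w₀)) t r
        (λ v x j j∉ → ⊥-elim (j∉ (∈-allFin j)))
      where
      mx : ∃[ i ] (∀ j → ℓ j ≤ ℓ i)
      mx = maximum′ e ℓ
      w₀ : G
      w₀ = proj₁ mx

-- Scalar products of rows.

dot : ℕ → Row → Row → ℤ
dot zero f g = 0ℤ
dot (suc q) f g = dot q f g ℤ.+ f q ℤ.* g q

dot-cong : ∀ q {f f′ g g′} → f ≗ f′ → g ≗ g′ → dot q f g ≡ dot q f′ g′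
dot-cong zero p r = refl
dot-cong (suc q) p r = cong₂ ℤ._+_ (dot-cong q p r) (cong₂ ℤ._*_ (p q) (r q))

dot-⊞ˡ : ∀ q f f′ g → dot q (f ⊞ f′) g ≡ dot q f g ℤ.+ dot q f′ g
dot-⊞ˡ zero f f′ g = refl
dot-⊞ˡ (suc q) f f′ g = trans (cong (ℤ._+ (f q ℤ.+ f′ q) ℤ.* g q) (dot-⊞ˡ q f f′ g)) (h (dot q f g) (dot q f′ g) (f q) (f′ q) (g q))
  where
  h : ∀ a b x y z → a ℤ.+ b ℤ.+ (x ℤ.+ y) ℤ.* z ≡ (a ℤ.+ x ℤ.* z) ℤ.+ (b ℤ.+ y ℤ.* z)
  h = solve-∀

dot-⊖ˡ : ∀ q f g → dot q (⊖ f) g ≡ - dot q f g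
dot-⊖ˡ zero f g = refl
dot-⊖ˡ (suc q) f g = trans (cong (ℤ._+ (- f q) ℤ.* g q) (dot-⊖ˡ q f g)) (h (dot q f g) (f q) (g q))
  where
  h : ∀ a x z → - a ℤ.+ (- x) ℤ.* z ≡ - (a ℤ.+ x ℤ.* z)
  h = solve-∀

dot-comm : ∀ q f g → dot q f g ≡ dot q g f
dot-comm zero f g = refl
dot-comm (suc q) f g = cong₂ ℤ._+_ (dot-comm q f g) (ℤₚ.*-comm (f q) (g q))

dot-⊞ʳ : ∀ q f g g′ → dot q f (g ⊞ g′) ≡ dot q f g ℤ.+ dot q f g′
dot-⊞ʳ q f g g′ = trans (dot-comm q f (g ⊞ g′)) (trans (dot-⊞ˡ q g g′ f) (cong₂ ℤ._+_ (dot-comm q g f) (dot-comm q g′ f)))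

dot-⊖ʳ : ∀ q f g → dot q f (⊖ g) ≡ - dot q f g
dot-⊖ʳ q f g = trans (dot-comm q f (⊖ g)) (trans (dot-⊖ˡ q g f) (cong -_ (dot-comm q g f)))

dot-⊟ʳ : ∀ q f g g′ → dot q f (g ⊟ g′) ≡ dot q f g ℤ.- dot q f g′
dot-⊟ʳ q f g g′ = trans (dot-⊞ʳ q f g (⊖ g′)) (cong (λ z → dot q f g ℤ.+ z) (dot-⊖ʳ q f g′))

dot-⊟ˡ : ∀ q f f′ g → dot q (f ⊟ f′) g ≡ dot q f g ℤ.- dot q f′ g
dot-⊟ˡ q f f′ g = trans (dot-⊞ˡ q f (⊖ f′) g) (cong (λ z → dot q f g ℤ.+ z) (dot-⊖ˡ q f′ g))

dot-0ˡ : ∀ q {f} g → f ≗ 0ʳ → dot q f g ≡ 0ℤ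
dot-0ˡ zero g p = refl
dot-0ˡ (suc q) g p = cong₂ ℤ._+_ (dot-0ˡ q g p) (cong (ℤ._* g q) (p q))

dot-0ʳ : ∀ q f {g} → g ≗ 0ʳ → dot q f g ≡ 0ℤ
dot-0ʳ q f {g} p = trans (dot-comm q f g) (dot-0ˡ q f p)

dot≥0 : ∀ q {f g} → NonNeg f → NonNeg g → 0ℤ ℤ.≤ dot q f g
dot≥0 zero p r = +≤+ z≤n
dot≥0 (suc q) p r = 0≤+ (dot≥0 q p r) (0≤* (p q) (r q))

dot-unit : ∀ q l f → l < q → dot q (unit l) f ≡ f l
dot-unit (suc q) l f l< with l ℕₚ.≟ q
... | yes refl = trans (cong₂ ℤ._+_ (below q ℕₚ.≤-refl) (trans (cong (ℤ._* f q) (unit-refl q)) (ℤₚ.*-identityˡ (f q)))) (ℤₚ.+-identityˡ (f q))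
  where
  below : ∀ r → r ≤ l → dot r (unit l) f ≡ 0ℤ
  below zero _ = refl
  below (suc r) r< = cong₂ ℤ._+_ (below r (ℕₚ.<⇒≤ r<)) (cong (ℤ._* f r) (unit-≢ l r (λ e → ℕₚ.<-irrefl (sym e) r<)))
... | no ne = trans (cong₂ ℤ._+_ (dot-unit q l f (ℕₚ.≤∧≢⇒< (ℕₚ.≤-pred l<) ne)) (cong (ℤ._* f q) (unit-≢ l q ne))) (ℤₚ.+-identityʳ (f l))

-- The difference of the two sides telescopes to a discrete Wronskian, whose boundary terms carry
-- the factors `δ 0` and `δ κ`, both zero.
X-adjoint : ∀ M {κ} → suc M divides κ → ∀ f g → dot κ (Path.X M f) g ≡ dot κ f (Path.X M g)
X-adjoint M {κ} d f g = trans (tele κ) (trans (cong (λ z → dot κ f (X g) ℤ.+ z ℤ.* b κ) (δ-mult d)) (ℤₚ.+-identityʳ _))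
  where
  open Path M
  b : ℕ → ℤ
  b q = f q ℤ.* g (ℕ.pred q) ℤ.- f (ℕ.pred q) ℤ.* g q
  h : ∀ D δ₀ δ₁ f₋ f₀ f₁ g₋ g₀ g₁ → (D ℤ.+ δ₀ ℤ.* (f₀ ℤ.* g₋ ℤ.- f₋ ℤ.* g₀)) ℤ.+ (δ₀ ℤ.* f₋ ℤ.+ δ₁ ℤ.* f₁) ℤ.* g₀
      ≡ (D ℤ.+ f₀ ℤ.* (δ₀ ℤ.* g₋ ℤ.+ δ₁ ℤ.* g₁)) ℤ.+ δ₁ ℤ.* (f₁ ℤ.* g₀ ℤ.- f₀ ℤ.* g₁)
  h = solve-∀
  tele : ∀ q → dot q (X f) g ≡ dot q f (X g) ℤ.+ δ q ℤ.* b q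
  tele zero = sym (trans (ℤₚ.+-identityˡ _) (cong (ℤ._* b 0) (δ-0 0 refl)))
  tele (suc q) = trans (cong (ℤ._+ X f q ℤ.* g q) (tele q)) (h (dot q f (X g)) (δ q) (δ (suc q)) (f (ℕ.pred q)) (f q) (f (suc q)) (g (ℕ.pred q)) (g q) (g (suc q)))

-- The Euler form, its rotation, and its skew part.

module Euler {n : ℕ} (m : Fin n → Fin n → ℕ) (cox : IsCoxeterMatrix m) (T : Words.Table m) where
  open Weak m cox T public
  open IsCoxeterMatrix cox

  Nbc : List (Fin n) → Fin n → V → Row
  Nbc c s v k = sumL c (λ j → X s j (v j) k)

  Supp : List (Fin n) → V → Set
  Supp c v = ∀ j → j ∉ c → v j ≗ 0ʳ

  At : Fin n → V → Set
  At s v = ∀ j → s ≢ j → v j ≗ 0ʳ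

  Nbc-cong : ∀ c s {v w} → (∀ j → j ∈ c → v j ≗ w j) → Nbc c s v ≗ Nbc c s w
  Nbc-cong c s p k = sumL-cong c (λ j j∈ → Path.X-cong (M s j) (p j j∈) k)

  ∉-head : ∀ {c : List (Fin n)} {s} → Unique (s ∷ c) → ∀ j → j ∈ c → s ≢ j
  ∉-head (u ∷ _) j j∈ = All.lookup u j∈

  abstract
    -- The Euler form of the Coxeter word c.
    E : List (Fin n) → V → V → ℤ
    E [] v x = 0ℤ
    E (s ∷ c) v x = dot κ (v s) (x s ⊟ Nbc c s x) ℤ.+ E c v x

    E-cong : ∀ c {v v′ x x′} → (∀ j → j ∈ c → v j ≗ v′ j) → (∀ j → j ∈ c → x j ≗ x′ j) → E c v x ≡ E c v′ x′
    E-cong [] p q = refl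
    E-cong (s ∷ c) {x = x} {x′} p q = cong₂ ℤ._+_
      (dot-cong κ (p s (here refl)) (λ k → cong₂ ℤ._-_ (q s (here refl) k) (Nbc-cong c s {x} {x′} (λ j r → q j (there r)) k)))
      (E-cong c (λ j r → p j (there r)) (λ j r → q j (there r)))

    E-≋ : ∀ c {v v′ x x′} → v ≋ v′ → x ≋ x′ → E c v x ≡ E c v′ x′
    E-≋ c p q = E-cong c (λ j _ → p j) (λ j _ → q j)

    E-⊕ˡ : ∀ c v w x → E c (v ⊕ w) x ≡ E c v x ℤ.+ E c w x
    E-⊕ˡ [] v w x = refl
    E-⊕ˡ (s ∷ c) v w x = trans (cong₂ ℤ._+_ (dot-⊞ˡ κ (v s) (w s) y) (E-⊕ˡ c v w x)) (h (dot κ (v s) y) (dot κ (w s) y) (E c v x) (E c w x))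
      where
      y : Row
      y = x s ⊟ Nbc c s x
      h : ∀ a b c d → (a ℤ.+ b) ℤ.+ (c ℤ.+ d) ≡ (a ℤ.+ c) ℤ.+ (b ℤ.+ d)
      h = solve-∀

    Nbc-⊕ : ∀ c s v w → Nbc c s (v ⊕ w) ≗ Nbc c s v ⊞ Nbc c s w
    Nbc-⊕ c s v w k = trans (sumL-cong c (λ j _ → Path.X-⊞ (M s j) (v j) (w j) k)) (sumL-+ c _ _)

    E-⊕ʳ : ∀ c v x y → E c v (x ⊕ y) ≡ E c v x ℤ.+ E c v y
    E-⊕ʳ [] v x y = refl
    E-⊕ʳ (s ∷ c) v x y = trans (cong₂ ℤ._+_ (trans (dot-cong κ (λ _ → refl) (λ k → trans (cong (λ z → x s k ℤ.+ y s k ℤ.- z) (Nbc-⊕ c s x y k)) (h₁ (x s k) (y s k) (Nbc c s x k) (Nbc c s y k))))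
        (dot-⊞ʳ κ (v s) (x s ⊟ Nbc c s x) (y s ⊟ Nbc c s y))) (E-⊕ʳ c v x y)) (h (dot κ (v s) (x s ⊟ Nbc c s x)) (dot κ (v s) (y s ⊟ Nbc c s y)) (E c v x) (E c v y))
      where
      h : ∀ a b c d → (a ℤ.+ b) ℤ.+ (c ℤ.+ d) ≡ (a ℤ.+ c) ℤ.+ (b ℤ.+ d)
      h = solve-∀
      h₁ : ∀ a b c d → a ℤ.+ b ℤ.- (c ℤ.+ d) ≡ (a ℤ.- c) ℤ.+ (b ℤ.- d)
      h₁ = solve-∀

    E-0ˡ : ∀ c {v} x → (∀ j → j ∈ c → v j ≗ 0ʳ) → E c v x ≡ 0ℤ
    E-0ˡ [] x p = refl
    E-0ˡ (s ∷ c) x p = cong₂ ℤ._+_ (dot-0ˡ κ _ (p s (here refl))) (E-0ˡ c x (λ j q → p j (there q)))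

    Nbc-0 : ∀ c s {x} → (∀ j → j ∈ c → x j ≗ 0ʳ) → Nbc c s x ≗ 0ʳ
    Nbc-0 c s p k = sumL-0 c (λ j j∈ → trans (Path.X-cong (M s j) (p j j∈) k) (Path.X-0 (M s j) k))

    E-0ʳ : ∀ c v {x} → (∀ j → j ∈ c → x j ≗ 0ʳ) → E c v x ≡ 0ℤ
    E-0ʳ [] v p = refl
    E-0ʳ (s ∷ c) v {x} p = cong₂ ℤ._+_ (dot-0ʳ κ (v s) (λ k → cong₂ ℤ._-_ (p s (here refl) k) (Nbc-0 c s {x} (λ j q → p j (there q)) k))) (E-0ʳ c v (λ j q → p j (there q)))

    X-symm : ∀ a s f → X a s f ≗ X s a f
    X-symm a s f k = cong (λ z → Path.X (z ℕ.∸ 2) f k) (symm a s)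

    sumL-++ : ∀ (c : List (Fin n)) d F → sumL (c ++ d) F ≡ sumL c F ℤ.+ sumL d F
    sumL-++ [] d F = sym (ℤₚ.+-identityˡ _)
    sumL-++ (j ∷ c) d F = trans (cong (λ z → F j ℤ.+ z) (sumL-++ c d F)) (sym (ℤₚ.+-assoc (F j) _ _))

    -- By self-adjointness of `X`, the pairings of s with all earlier letters can be collected in
    -- the left argument.
    E-snoc : ∀ c s v x → E (c ++ [ s ]) v x ≡ E c v x ℤ.+ dot κ (v s ⊟ Nbc c s v) (x s)
    E-snoc [] s v x = trans (ℤₚ.+-identityʳ _) (trans (dot-cong κ (λ k → sym (ℤₚ.+-identityʳ (v s k))) (λ k → ℤₚ.+-identityʳ (x s k))) (sym (ℤₚ.+-identityˡ _)))
    E-snoc (a ∷ c) s v x =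
      trans (cong₂ ℤ._+_ (trans (dot-cong κ (λ _ → refl) (λ k → trans (cong (λ z → x a k ℤ.- z) (trans (sumL-++ c [ s ] (λ j → X a j (x j) k)) (cong (λ z → Nbc c a x k ℤ.+ z) (ℤₚ.+-identityʳ _)))) (h₁ (x a k) (Nbc c a x k) (X a s (x s) k))))
                                (dot-⊟ʳ κ (v a) (x a ⊟ Nbc c a x) (X a s (x s)))) (E-snoc c s v x))
      (trans (h₂ (dot κ (v a) (x a ⊟ Nbc c a x)) (dot κ (v a) (X a s (x s))) (E c v x) (dot κ (v s ⊟ Nbc c s v) (x s)))
       (cong (λ z → dot κ (v a) (x a ⊟ Nbc c a x) ℤ.+ E c v x ℤ.+ z)
         (trans (cong (λ z → dot κ (v s ⊟ Nbc c s v) (x s) ℤ.- z) (trans (sym (X-adjoint (M a s) (M∣κ a s) (v a) (x s))) (dot-cong κ (X-symm a s (v a)) (λ _ → refl))))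
         (trans (sym (dot-⊟ˡ κ (v s ⊟ Nbc c s v) (X s a (v a)) (x s))) (dot-cong κ (λ k → h₃ (v s k) (Nbc c s v k) (X s a (v a) k)) (λ _ → refl))))))
      where
      h₁ : ∀ a b c → a ℤ.- (b ℤ.+ c) ≡ (a ℤ.- b) ℤ.- c
      h₁ = solve-∀
      h₂ : ∀ a b c d → (a ℤ.- b) ℤ.+ (c ℤ.+ d) ≡ a ℤ.+ c ℤ.+ (d ℤ.- b)
      h₂ = solve-∀
      h₃ : ∀ a b c → (a ℤ.- b) ℤ.- c ≡ a ℤ.- (c ℤ.+ b)
      h₃ = solve-∀

    Nb-restrict : ∀ {c s v} → Unique (s ∷ c) → Supp (s ∷ c) v → Nb s v ≗ Nbc c s v
    Nb-restrict {c} {s} {v} u z k = trans (sumL-restrict (s ∷ c) u (λ j j∉ → trans (Path.X-cong (M s j) (z j j∉) k) (Path.X-0 (M s j) k)))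
      (trans (cong (ℤ._+ Nbc c s v k) (X-diag s (v s) k)) (ℤₚ.+-identityˡ _))

    -- The reflection turns the term of s as the last letter into its term as the first one, with
    -- both factors negated; the other coordinates do not change.
    E-rotate : ∀ {c s} → Unique (s ∷ c) → ∀ {v x} → Supp (s ∷ c) v → Supp (s ∷ c) x → E (c ++ [ s ]) (s ▷ v) (s ▷ x) ≡ E (s ∷ c) v x
    E-rotate {c} {s} u {v} {x} zv zx =
      trans (E-snoc c s (s ▷ v) (s ▷ x))
      (trans (cong₂ ℤ._+_ (E-cong c (λ j j∈ k → ▷-off v k (∉-head u j j∈)) (λ j j∈ k → ▷-off x k (∉-head u j j∈)))
         (trans (dot-cong κ {g′ = ⊖ (x s ⊟ Nbc c s x)} left right)
           (trans (dot-⊖ʳ κ (⊖ v s) _) (trans (cong -_ (dot-⊖ˡ κ (v s) _)) (ℤₚ.neg-involutive _)))))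
       (ℤₚ.+-comm (E c v x) _))
      where
      h₁ : ∀ a b → (- a) ℤ.+ b ℤ.- b ≡ - a
      h₁ = solve-∀
      h₂ : ∀ a b → (- a) ℤ.+ b ≡ - (a ℤ.- b)
      h₂ = solve-∀
      left : (s ▷ v) s ⊟ Nbc c s (s ▷ v) ≗ ⊖ v s
      left k = trans (cong₂ ℤ._-_ (trans (▷-at s v k) (cong (λ z → (- v s k) ℤ.+ z) (Nb-restrict u zv k)))
                       (Nbc-cong c s {s ▷ v} {v} (λ j j∈ q → ▷-off v q (∉-head u j j∈)) k)) (h₁ (v s k) (Nbc c s v k))
      right : (s ▷ x) s ≗ ⊖ (x s ⊟ Nbc c s x)
      right k = trans (▷-at s x k) (trans (cong (λ z → (- x s k) ℤ.+ z) (Nb-restrict u zx k)) (h₂ (x s k) (Nbc c s x k)))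

    At-zero : ∀ {c s y} → s ∉ c → At s y → ∀ j → j ∈ c → y j ≗ 0ʳ
    At-zero s∉ p j j∈ = p j (λ { refl → s∉ j∈ })

    E-first : ∀ {c s} → s ∉ c → ∀ v {y} → At s y → E (s ∷ c) v y ≡ dot κ (v s) (y s)
    E-first {c} {s} s∉ v {y} p = trans (cong₂ ℤ._+_ (dot-cong κ (λ _ → refl) (λ k → trans (cong (λ z → y s k ℤ.- z) (Nbc-0 c s {y} (At-zero {y = y} s∉ p) k)) (ℤₚ.+-identityʳ _))) (E-0ʳ c v (At-zero {y = y} s∉ p))) (ℤₚ.+-identityʳ _)

    E-first′ : ∀ {c s} → s ∉ c → ∀ {y} x → At s y → E (s ∷ c) y x ≡ dot κ (y s) (x s ⊟ Nbc c s x)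
    E-first′ {c} {s} s∉ {y} x p = trans (cong (λ z → dot κ (y s) (x s ⊟ Nbc c s x) ℤ.+ z) (E-0ˡ c {y} x (At-zero {y = y} s∉ p))) (ℤₚ.+-identityʳ _)

    E-last : ∀ {c s} → s ∉ c → ∀ {y} x → At s y → E (c ++ [ s ]) y x ≡ dot κ (y s) (x s)
    E-last {c} {s} s∉ {y} x p = trans (E-snoc c s y x) (trans (cong₂ ℤ._+_ (E-0ˡ c x (At-zero {y = y} s∉ p)) (dot-cong κ (λ k → trans (cong (λ z → y s k ℤ.- z) (Nbc-0 c s {y} (At-zero {y = y} s∉ p) k)) (ℤₚ.+-identityʳ _)) (λ _ → refl))) (ℤₚ.+-identityˡ _))

    E-last′ : ∀ {c s} → s ∉ c → ∀ v {y} → At s y → E (c ++ [ s ]) v y ≡ dot κ (v s ⊟ Nbc c s v) (y s)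
    E-last′ {c} {s} s∉ v {y} p = trans (E-snoc c s v y) (trans (cong (ℤ._+ dot κ (v s ⊟ Nbc c s v) (y s)) (E-0ʳ c v (At-zero {y = y} s∉ p))) (ℤₚ.+-identityˡ _))

    E-skip : ∀ c s {v} x → v s ≗ 0ʳ → E (s ∷ c) v x ≡ E c v x
    E-skip c s x p = trans (cong (ℤ._+ E c _ x) (dot-0ˡ κ _ p)) (ℤₚ.+-identityˡ _)

    -- The sign is chosen so that pairing the initial simple root with a nonnegative vector gives a
    -- nonnegative value (`ω-first`); for a final letter the simple root has to stand on the right
    -- (`ω-last`).
    ω : List (Fin n) → V → V → ℤ
    ω c v x = E c x v ℤ.- E c v x

    ω-≋ : ∀ c {v v′ x x′} → v ≋ v′ → x ≋ x′ → ω c v x ≡ ω c v′ x′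
    ω-≋ c p q = cong₂ ℤ._-_ (E-≋ c q p) (E-≋ c p q)

    ω-rotate : ∀ {c s} → Unique (s ∷ c) → ∀ {v x} → Supp (s ∷ c) v → Supp (s ∷ c) x → ω (c ++ [ s ]) (s ▷ v) (s ▷ x) ≡ ω (s ∷ c) v x
    ω-rotate u zv zx = cong₂ ℤ._-_ (E-rotate u zx zv) (E-rotate u zv zx)

    ω-skip : ∀ c s {v x} → v s ≗ 0ʳ → x s ≗ 0ʳ → ω (s ∷ c) v x ≡ ω c v x
    ω-skip c s {v} {x} p q = cong₂ ℤ._-_ (E-skip c s v q) (E-skip c s x p)

    ω-first : ∀ {c s} → s ∉ c → ∀ {y} v → At s y → ω (s ∷ c) y v ≡ dot κ (y s) (Nbc c s v)
    ω-first {c} {s} s∉ {y} v p = trans (cong₂ ℤ._-_ (trans (E-first s∉ v p) (dot-comm κ (v s) (y s))) (trans (E-first′ s∉ v p) (dot-⊟ʳ κ (y s) (v s) (Nbc c s v)))) (h (dot κ (y s) (v s)) _)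
      where
      h : ∀ a b → a ℤ.- (a ℤ.- b) ≡ b
      h = solve-∀

    ω-last : ∀ {c s} → s ∉ c → ∀ v {y} → At s y → ω (c ++ [ s ]) v y ≡ dot κ (y s) (Nbc c s v)
    ω-last {c} {s} s∉ v {y} p = trans (cong₂ ℤ._-_ (E-last s∉ v p) (trans (E-last′ s∉ v p) (trans (dot-comm κ _ (y s)) (dot-⊟ʳ κ (y s) (v s) (Nbc c s v))))) (h (dot κ (y s) (v s)) _)
      where
      h : ∀ a b → a ℤ.- (a ℤ.- b) ≡ b
      h = solve-∀

    ω-skew : ∀ c v x → ω c v x ≡ - ω c x v
    ω-skew c v x = h (E c x v) (E c v x)
      where
      h : ∀ a b → a ℤ.- b ≡ - (b ℤ.- a)
      h = solve-∀

    ω-⊕ˡ : ∀ c v w x → ω c (v ⊕ w) x ≡ ω c v x ℤ.+ ω c w x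
    ω-⊕ˡ c v w x = trans (cong₂ ℤ._-_ (E-⊕ʳ c x v w) (E-⊕ˡ c v w x)) (h (E c x v) (E c x w) (E c v x) (E c w x))
      where
      h : ∀ a b c d → (a ℤ.+ b) ℤ.- (c ℤ.+ d) ≡ (a ℤ.- c) ℤ.+ (b ℤ.- d)
      h = solve-∀

    ω-0ˡ : ∀ c {v} x → (∀ j → v j ≗ 0ʳ) → ω c v x ≡ 0ℤ
    ω-0ˡ c x p = cong₂ ℤ._-_ (E-0ʳ c x (λ j _ → p j)) (E-0ˡ c x (λ j _ → p j))

    ω-self : ∀ c v → ω c v v ≡ 0ℤ
    ω-self c v = ℤₚ.+-inverseʳ (E c v v)

    ω-cong-E : ∀ {c d v x} → E c v x ≡ E d v x → E c x v ≡ E d x v → ω c v x ≡ ω d v x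
    ω-cong-E p q = cong₂ ℤ._-_ q p

  Nbc≥0 : ∀ c s {v} → NN v → NonNeg (Nbc c s v)
  Nbc≥0 c s p k = sumL≥0 c (λ j → Path.X≥0 (M s j) (p j) k)

  -- Vectors without a neighbour of s in their support

  Far : Fin n → V → Set
  Far s v = Nb s v ≗ 0ʳ

  abstract
    Far-by-dot : ∀ {c s v} → Unique (s ∷ c) → Supp (s ∷ c) v → Bd v → (∀ k → k < κ → dot κ (unit k) (Nbc c s v) ≡ 0ℤ) → Far s v
    Far-by-dot {c} {s} {v} u z bd p k with k ℕₚ.<? κ
    ... | yes k< = trans (Nb-restrict u z k) (trans (sym (dot-unit κ k (Nbc c s v) k<)) (p k k<))
    ... | no k≥ = Nb-bounded s bd k (ℕₚ.≮⇒≥ k≥)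

  abstract
    -- Without neighbours, s negates the coordinate at s. As t is not s, both v and its image are
    -- nonnegative, so this coordinate is zero.
    Far-fixed : ∀ {s t v} → t ≢ gen s → Rv t v → Far s v → s ▷ v ≋ v
    Far-fixed {s} {t} {v} ne r far j k with s Finₚ.≟ j
    ... | no ne′ = ▷-off v k ne′
    ... | yes refl = trans eq (trans (cong -_ vs) (sym vs))
      where
      eq : (s ▷ v) s k ≡ - v s k
      eq = trans (▷-at s v k) (trans (cong (λ z → (- v s k) ℤ.+ z) (far k)) (ℤₚ.+-identityʳ _))
      vs : v s k ≡ 0ℤ
      vs = squeeze _ (Rv-NN r s k) (subst (0ℤ ℤ.≤_) eq (Rv-NN (Rv-conj s ne r) s k))

  abstract
    -- x = h⁻¹ g carries one simple vector to another, so `gen j ∙ x` makes the first one negative,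
    -- and `folding` conjugates the two simple reflections into each other.
    same-vector : ∀ {t t′ v} → Rv t v → Rv t′ v → t ≡ t′
    same-vector {v = v} (g , i , k , k< , p , refl , ev) (h , j , l , l< , q , refl , ev′) =
      trans (ref-unique _ _ _ refl′) refl
      where
      x : G
      x = h ⁻¹ ∙ g
      xα : x ⋆ α i k ≋ α j l
      xα = ≋-trans (⋆-∙ (h ⁻¹) g (α-bounded i k<)) (≋-trans (⋆-cong (h ⁻¹) (≋-trans (≋-sym ev) ev′)) (⋆-inv h (α-bounded j l<)))
      one : (x ⋆ α i k) j l ≡ 1ℤ
      one = trans (xα j l) (trans (αv-at j (unit l) l) (unit-refl l))
      px : P x i
      px with P? x i
      ... | yes r = r
      ... | no ¬r with subst (λ z → 0ℤ ℤ.≤ - z) one (negative x i ¬r k k< j l)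
      ... | ()
      ¬pjx : ¬ P (gen j ∙ x) i
      ¬pjx r with subst (0ℤ ℤ.≤_) (trans (⋆-gen∙ j x (α-bounded i k<) j l) (trans (▷-cong j xα j l) (trans (▷-αv j (unit l) j l) (cong -_ (trans (αv-at j (unit l) l) (unit-refl l)))))) (positive (gen j ∙ x) i r k k< j l)
      ... | ()
      fo : gen j ∙ x ≡ x ∙ gen i
      fo = folding j x i px ¬pjx
      refl′ : ref g i ∙ h ≡ h ∙ gen j
      refl′ = trans (ref-∙ g i h) (∙-injˡ (h ⁻¹) (trans (trans (sym (assoc _ _ _)) (trans (sym (assoc _ _ _)) (cong₂ _∙_ (sym fo) (sym (trans (inv-∙ (h ⁻¹) g) (cong (g ⁻¹ ∙_) (inv-inv h)))))))
         (trans (cancelʳ (gen j) x) (sym (cancel⁻ˡ h (gen j))))))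

  abstract
    fixed⇒commute : ∀ {s t v} → t ≢ gen s → Rv t v → s ▷ v ≋ v → conj s t ≡ t
    fixed⇒commute {s} ne r p = same-vector (Rv-resp p (Rv-conj s ne r)) r

-- Sortable elements through the recursion and through the skew form.

module Sortable {n : ℕ} (m : Fin n → Fin n → ℕ) (cox : IsCoxeterMatrix m) (T : Words.Table m) where
  open Euler m cox T public

  rot∈ : ∀ {c : List (Fin n)} {s j} → j ∈ c ++ [ s ] → j ∈ s ∷ c
  rot∈ {c} p with ∈-++⁻ c p
  ... | inj₁ q = there q
  ... | inj₂ (here refl) = here refl

  rot∈⁻ : ∀ {c : List (Fin n)} {s j} → j ∈ s ∷ c → j ∈ c ++ [ s ]
  rot∈⁻ {c} (here refl) = ∈-++⁺ʳ c (here refl)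
  rot∈⁻ (there q) = ∈-++⁺ˡ q

  uniq∉ : ∀ {c : List (Fin n)} {s} → Unique (s ∷ c) → s ∉ c
  uniq∉ (u ∷ _) q = All.lookup u q refl

  uniq-tail : ∀ {c : List (Fin n)} {s} → Unique (s ∷ c) → Unique c
  uniq-tail (_ ∷ us) = us

  uniq-rot : ∀ {c : List (Fin n)} {s} → Unique (s ∷ c) → Unique (c ++ [ s ])
  uniq-rot {[]} (_ ∷ _) = [] ∷ []
  uniq-rot {a ∷ c} {s} ((s≢a ∷ u) ∷ (v ∷ w)) = All.tabulate (λ {j} j∈ → ne (∈-++⁻ c j∈)) ∷ uniq-rot (u ∷ w)
    where
    ne : ∀ {j} → j ∈ c ⊎ j ∈ [ s ] → a ≢ j
    ne (inj₁ q) = All.lookup v q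
    ne (inj₂ (here refl)) e = s≢a (sym e)

  -- The recursion serves as the definition here; its agreement with lexicographically first words
  -- is `Sortable⇒` and `Sortable⇐`.
  data S : List (Fin n) → G → Set where
    nil : ∀ {w} → w ≡ e → S [] w
    skip : ∀ {s c w} → ¬ Inv w (gen s) → S c w → S (s ∷ c) w
    take : ∀ {s c w} → Inv w (gen s) → S (c ++ [ s ]) (gen s ∙ w) → S (s ∷ c) w

  S-Gen : ∀ {c w} → S c w → Gen c w
  S-Gen (nil refl) = gen-e
  S-Gen (skip _ x) = Gen-mono (λ _ → there) (S-Gen x)
  S-Gen {s ∷ c} {w} (take _ x) = subst (Gen (s ∷ c)) (gg s w) (gen-∙ (here refl) (Gen-mono (λ _ → rot∈) (S-Gen x)))

  S-Tin : ∀ {c w t} → S c w → Inv w t → Tin c t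
  S-Tin x = Inv⇒Tin (S-Gen x)

  S-take : ∀ {s c w} → S (s ∷ c) w → Inv w (gen s) → S (c ++ [ s ]) (gen s ∙ w)
  S-take (skip ¬p _) p = ⊥-elim (¬p p)
  S-take (take _ x) _ = x

  S-skip : ∀ {s c w} → S (s ∷ c) w → ¬ Inv w (gen s) → S c w
  S-skip (skip _ x) _ = x
  S-skip (take p _) ¬p = ⊥-elim (¬p p)

  Gen⇒¬Inv : ∀ {c w s} → s ∉ c → Gen c w → ¬ Inv w (gen s)
  Gen⇒¬Inv s∉ g p = ¬Tin-gen s∉ (Inv⇒Tin g p)

  S-weaken : ∀ {s c w} → s ∉ c → S c w → S (s ∷ c) w
  S-weaken s∉ x = skip (Gen⇒¬Inv s∉ (S-Gen x)) x

  add⇒ : ∀ {w a t} → Inv (w ∙ gen a) t → t ≡ ref w a ⊎ Inv w t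
  add⇒ {w} {a} {t} x with t ≟G ref w a
  ... | yes p = inj₁ p
  ... | no ne = inj₂ (Inv-right⇒ w a t ne x)

  ¬add-old : ∀ {w a} → P w a → ¬ Inv w (ref w a)
  ¬add-old {w} {a} p (_ , x) = ℕₚ.<-asym p (subst (λ z → ℓ z < ℓ w) (ref-self w a) x)

  add⊑ : ∀ {w a} → P w a → w ⊑ w ∙ gen a
  add⊑ {w} {a} p t x = Inv-right⇐ w a t (λ { refl → ¬add-old p x }) x

  add-new : ∀ {w a} → P w a → Inv (w ∙ gen a) (ref w a)
  add-new {w} {a} p = subst (Inv (w ∙ gen a)) (ref-flip w a) (Cov⇒Inv (a , P-flip w a p , refl))

  Ok : List (Fin n) → G → G → Set
  Ok c t t′ = ∀ v x → Rv t v → Rv t′ x → 0ℤ ℤ.≤ ω c v x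

  -- w has a reduced word whose inversions β₁, β₂, … satisfy ω(βᵢ, βⱼ) ≥ 0 for i < j.
  data Srtd (c : List (Fin n)) : G → Set where
    srt-e : ∀ {w} → w ≡ e → Srtd c w
    srt-∙ : ∀ {w} w₁ a → Srtd c w₁ → a ∈ c → P w₁ a → (∀ t → Inv w₁ t → Ok c t (ref w₁ a)) → w ≡ w₁ ∙ gen a → Srtd c w

  srt-Gen : ∀ {c w} → Srtd c w → Gen c w
  srt-Gen (srt-e refl) = gen-e
  srt-Gen (srt-∙ w₁ a x a∈ _ _ refl) = Gen-mul (srt-Gen x) (Gen-gen a∈)

  srt-map : ∀ {c d w} → (∀ a → a ∈ c → a ∈ d) → (∀ t t′ → Inv w t → Inv w t′ → Ok c t t′ → Ok d t t′) → Srtd c w → Srtd d w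
  srt-map f g (srt-e p) = srt-e p
  srt-map f g (srt-∙ w₁ a x a∈ p ok refl) = srt-∙ w₁ a (srt-map f (λ t t′ i j → g t t′ (add⊑ p t i) (add⊑ p t′ j)) x) (f a a∈) p
    (λ t i → g t _ (add⊑ p t i) (add-new p) (ok t i)) refl

  Supp-Rv : ∀ {c w t v} → Gen c w → Inv w t → Rv t v → Supp c v
  Supp-Rv g i r j j∉ = Inv⇒Tin g i _ r j j∉

  At-Rv : ∀ {s v} → Rv (gen s) v → At s v
  At-Rv r j ne = Rv-supp r j ne

  P-e : ∀ s → P e s
  P-e s = subst (_< ℓ (e ∙ gen s)) (sym ℓ-e) (ℕₚ.n≢0⇒n>0 (λ z → ℓ-∙gen≢ e s (trans z (sym ℓ-e))))

  abstract
    -- Prepending s makes s the first inversion and conjugates the others. Pairs with s have the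
    -- right sign because s is initial, and the remaining pairs by rotation of `ω`.
    srt-cons : ∀ {c s w} → Unique (s ∷ c) → Srtd (c ++ [ s ]) w → ¬ Inv w (gen s) → Srtd (s ∷ c) (gen s ∙ w)
    srt-cons {c} {s} u (srt-e refl) _ = srt-∙ e s (srt-e refl) (here refl) (P-e s) (λ t i → ⊥-elim (Inv-e t i)) (trans (idʳ _) (sym (idˡ _)))
    srt-cons {c} {s} u (srt-∙ w₁ a x a∈ p ok refl) ¬s = srt-∙ (gen s ∙ w₁) a IH (rot∈ a∈) p′ ok′ (sym (assoc _ _ _))
      where
      IH : Srtd (s ∷ c) (gen s ∙ w₁)
      IH = srt-cons u x (λ i → ¬s (add⊑ p _ i))
      t₀ : G
      t₀ = ref w₁ a
      t₀≢ : t₀ ≢ gen s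
      t₀≢ q = ¬s (subst (Inv (w₁ ∙ gen a)) q (add-new p))
      p′ : P (gen s ∙ w₁) a
      p′ = P-conj s w₁ a p t₀≢
      G′ : Gen (s ∷ c) (gen s ∙ w₁ ∙ gen a)
      G′ = Gen-mul (srt-Gen IH) (Gen-gen (rot∈ a∈))
      ok′ : ∀ t → Inv (gen s ∙ w₁) t → Ok (s ∷ c) t (ref (gen s ∙ w₁) a)
      ok′ t i v y rv ry with t ≟G gen s
      ... | yes refl = subst (0ℤ ℤ.≤_) (sym (ω-first (uniq∉ u) y (At-Rv rv))) (dot≥0 κ (Rv-NN rv s) (Nbc≥0 c s (Rv-NN ry)))
      ... | no ne = subst (0ℤ ℤ.≤_) (ω-rotate u (Supp-Rv G′ (add⊑ p′ t i) rv) (Supp-Rv G′ (add-new p′) ry))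
            (ok (conj s t) (Inv-conj⇒ s w₁ t ne i) (s ▷ v) (s ▷ y) (Rv-conj s ne rv)
                (Rv-conj⁻ s t₀≢ (subst (λ z → Rv z y) (sym (conj-ref s w₁ a)) ry)))

  abstract
    -- `Srtd` is a condition on pairs of inversions. Unlike the recursion, it passes visibly to
    -- parabolic subgroups and to words with an appended letter.
    S⇒Srtd : ∀ {c w} → Unique c → S c w → Srtd c w
    S⇒Srtd u (nil p) = srt-e p
    S⇒Srtd {s ∷ c} {w} u (skip _ x) = srt-map (λ _ → there) (λ t t′ i j ok v y rv ry →
        subst (0ℤ ℤ.≤_) (sym (ω-skip c s {v} {y} (Supp-Rv (S-Gen x) i rv s (uniq∉ u)) (Supp-Rv (S-Gen x) j ry s (uniq∉ u)))) (ok v y rv ry))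
      (S⇒Srtd (uniq-tail u) x)
    S⇒Srtd {s ∷ c} {w} u (take i x) = subst (Srtd (s ∷ c)) (gg s w) (srt-cons u (S⇒Srtd (uniq-rot u) x) (Inv-s⇐ s w i))

  private
    zero-by-skew : ∀ {a b} → a ≡ - b → 0ℤ ℤ.≤ a → 0ℤ ℤ.≤ b → b ≡ 0ℤ
    zero-by-skew refl p q = squeeze _ q p

  abstract
    -- `ω` of the initial root with v is nonnegative anyway; by skewness the hypothesis gives the
    -- opposite sign.
    Far-first : ∀ {c s v} → Unique (s ∷ c) → Supp (s ∷ c) v → NN v → Bd v → (∀ k → k < κ → 0ℤ ℤ.≤ ω (s ∷ c) v (α s k)) → Far s v
    Far-first {c} {s} {v} u z nn bd p = Far-by-dot u z bd λ k k< →
      trans (dot-cong κ (λ q → sym (αv-at s (unit k) q)) (λ _ → refl)) (zero-by-skew (trans (ω-skew (s ∷ c) v (α s k)) (cong -_ (ω-first (uniq∉ u) v (At-Rv (Rv-gen s k k<))))) (p k k<)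
        (dot≥0 κ (Rv-NN (Rv-gen s k k<) s) (Nbc≥0 c s nn)))

  abstract
    Far-last : ∀ {c s v} → Unique (s ∷ c) → Supp (s ∷ c) v → NN v → Bd v → (∀ k → k < κ → 0ℤ ℤ.≤ ω (c ++ [ s ]) (α s k) v) → Far s v
    Far-last {c} {s} {v} u z nn bd p = Far-by-dot u z bd λ k k< →
      trans (dot-cong κ (λ q → sym (αv-at s (unit k) q)) (λ _ → refl)) (zero-by-skew (trans (ω-skew (c ++ [ s ]) (α s k) v) (cong -_ (ω-last (uniq∉ u) v (At-Rv (Rv-gen s k k<))))) (p k k<)
        (dot≥0 κ (Rv-NN (Rv-gen s k k<) s) (Nbc≥0 c s nn)))

  -- If s is not the last inversion to enter, rotation preserves the sign conditions. If it is,
  -- every earlier inversion pairs nonnegatively with s from both sides, is far from s and fixed by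
  -- it, so the word without its last letter serves for the rotated Coxeter word too.
  srt-uncons : ∀ {c s w} → Unique (s ∷ c) → Srtd (s ∷ c) w → Inv w (gen s) → Srtd (c ++ [ s ]) (gen s ∙ w)
  srt-uncons u (srt-e refl) i = ⊥-elim (Inv-e _ i)
  srt-uncons {c} {s} u D@(srt-∙ w₁ a x a∈ p ok refl) i with Inv? w₁ (gen s)
  ... | yes i₁ = srt-∙ (gen s ∙ w₁) a (srt-uncons u x i₁) (rot∈⁻ a∈) (P-conj s w₁ a p t₀≢) ok′ (sym (assoc _ _ _))
    where
    t₀≢ : ref w₁ a ≢ gen s
    t₀≢ q = ¬add-old p (subst (Inv w₁) (sym q) i₁)
    ok′ : ∀ t → Inv (gen s ∙ w₁) t → Ok (c ++ [ s ]) t (ref (gen s ∙ w₁) a)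
    ok′ t j v y rv ry = subst (0ℤ ℤ.≤_) (trans (sym (ω-rotate u (Supp-Rv (srt-Gen x) j′ rv′) (Supp-Rv (srt-Gen D) (add-new p) ry′)))
        (ω-≋ (c ++ [ s ]) (▷-involutive s v) (▷-involutive s y))) (ok (conj s t) j′ (s ▷ v) (s ▷ y) rv′ ry′)
      where
      t≢ : t ≢ gen s
      t≢ refl = Inv-s⇐ s w₁ i₁ j
      j′ = Inv-conj⇒ s w₁ t t≢ j
      rv′ = Rv-conj s t≢ rv
      ry′ = Rv-conj⁻ s t₀≢ (subst (λ z → Rv z y) (sym (conj-ref s w₁ a)) ry)
  ... | no ¬i₁ = subst (Srtd (c ++ [ s ])) (sym sw) (srt-map (λ _ → rot∈⁻) conv x)
    where
    s≡ : gen s ≡ ref w₁ a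
    s≡ with add⇒ {w₁} {a} i
    ... | inj₁ q = q
    ... | inj₂ j = ⊥-elim (¬i₁ j)
    sw : gen s ∙ (w₁ ∙ gen a) ≡ w₁
    sw = trans (cong (gen s ∙_) (sym (trans (cong (_∙ w₁) s≡) (ref-self w₁ a)))) (gg s w₁)
    fixed : ∀ t v → Inv w₁ t → Rv t v → s ▷ v ≋ v
    fixed t v j rv = Far-fixed {s} (λ q → ¬i₁ (subst (Inv w₁) q j)) rv (Far-first u (Supp-Rv (srt-Gen x) j rv) (Rv-NN rv) (Rv-Bd rv)
      (λ k k< → ok t j v (α s k) rv (subst (λ z → Rv z (α s k)) s≡ (Rv-gen s k k<))))
    conv : ∀ t t′ → Inv w₁ t → Inv w₁ t′ → Ok (s ∷ c) t t′ → Ok (c ++ [ s ]) t t′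
    conv t t′ j j′ o v y rv ry = subst (0ℤ ℤ.≤_) (trans (sym (ω-rotate u (Supp-Rv (srt-Gen x) j rv) (Supp-Rv (srt-Gen x) j′ ry)))
      (ω-≋ (c ++ [ s ]) (fixed t v j rv) (fixed t′ y j′ ry))) (o v y rv ry)

  0≰-1 : ¬ (0ℤ ℤ.≤ - 1ℤ)
  0≰-1 ()

  -- A test row that detects all coordinates at once: a nonnegative row orthogonal to it vanishes
  -- below `κ` (`dot-ones-0`).
  ones : Row
  ones k with k ℕₚ.<? κ
  ... | yes _ = 1ℤ
  ... | no _ = 0ℤ

  ones-in : ∀ {k} → k < κ → ones k ≡ 1ℤ
  ones-in {k} p with k ℕₚ.<? κ
  ... | yes _ = refl
  ... | no ¬p = ⊥-elim (¬p p)

  ones-bd : Bounded κ ones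
  ones-bd k p with k ℕₚ.<? κ
  ... | yes q = ⊥-elim (ℕₚ.<-irrefl refl (ℕₚ.<-≤-trans q p))
  ... | no _ = refl

  ones≥0 : NonNeg ones
  ones≥0 k with k ℕₚ.<? κ
  ... | yes _ = +≤+ z≤n
  ... | no _ = +≤+ z≤n

  private
    dot-ones-0 : ∀ q {f} → NonNeg f → (∀ k → k < q → ones k ≡ 1ℤ) → dot q ones f ≡ 0ℤ → ∀ k → k < q → f k ≡ 0ℤ
    dot-ones-0 (suc q) {f} nn o p k k< with k ℕₚ.≟ q
    ... | yes refl = trans (sym (ℤₚ.*-identityˡ (f q))) (trans (cong (ℤ._* f q) (sym (o q ℕₚ.≤-refl))) (proj₂ both))
      where
      zs : ∀ {a b} → 0ℤ ℤ.≤ a → 0ℤ ℤ.≤ b → a ℤ.+ b ≡ 0ℤ → a ≡ 0ℤ × b ≡ 0ℤ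
      zs {+ zero} {+ zero} _ _ _ = refl , refl
      zs {+ zero} {+ suc b} _ _ ()
      zs {+ suc a} {+ b} _ _ ()
      both = zs (dot≥0 q ones≥0 nn) (0≤* (ones≥0 q) (nn q)) p
    ... | no ne = dot-ones-0 q nn (λ k r → o k (ℕₚ.≤-trans r (ℕₚ.n≤1+n q))) (proj₁ both) k (ℕₚ.≤∧≢⇒< (ℕₚ.≤-pred k<) ne)
      where
      zs : ∀ {a b} → 0ℤ ℤ.≤ a → 0ℤ ℤ.≤ b → a ℤ.+ b ≡ 0ℤ → a ≡ 0ℤ × b ≡ 0ℤ
      zs {+ zero} {+ zero} _ _ _ = refl , refl
      zs {+ zero} {+ suc b} _ _ ()
      zs {+ suc a} {+ b} _ _ ()
      both = zs (dot≥0 q ones≥0 nn) (0≤* (ones≥0 q) (nn q)) p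

  NN-cone : ∀ g s → (∀ k → k < κ → NN (g ⋆ α s k)) → ∀ y → NonNeg y → Bounded κ y → NN (g ⋆ αv s y)
  NN-cone g = Cone.cone-αv (λ v → NN (g ⋆ v)) (λ e → NN-resp (⋆-cong g e)) (NN-resp (≋-sym (⋆-0 g)) (λ _ _ → +≤+ z≤n))
    (λ {y} {z} a b → NN-resp (≋-sym (⋆-⊕ g y z)) (NN-⊕ a b))

  ω-⊕ʳ : ∀ c v y z → ω c v (y ⊕ z) ≡ ω c v y ℤ.+ ω c v z
  ω-⊕ʳ c v y z = trans (ω-skew c v (y ⊕ z)) (trans (cong -_ (ω-⊕ˡ c y z v)) (trans (ℤₚ.neg-distrib-+ (ω c y v) (ω c z v))
    (cong₂ ℤ._+_ (sym (ω-skew c v y)) (sym (ω-skew c v z)))))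

  ω-coneˡ : ∀ c x g s → (∀ k → k < κ → 0ℤ ℤ.≤ ω c (g ⋆ α s k) x) → ∀ y → NonNeg y → Bounded κ y → 0ℤ ℤ.≤ ω c (g ⋆ αv s y) x
  ω-coneˡ c x g = Cone.cone-αv (λ v → 0ℤ ℤ.≤ ω c (g ⋆ v) x)
    (λ {v} {w} e → subst (0ℤ ℤ.≤_) (ω-≋ c {g ⋆ v} {g ⋆ w} {x} {x} (⋆-cong g e) ≋-refl))
    (ℤₚ.≤-reflexive (sym (ω-0ˡ c x (⋆-0 g))))
    (λ {v} {w} a b → subst (0ℤ ℤ.≤_) (sym (trans (ω-≋ c {g ⋆ (v ⊕ w)} {(g ⋆ v) ⊕ (g ⋆ w)} {x} {x} (⋆-⊕ g v w) ≋-refl) (ω-⊕ˡ c (g ⋆ v) (g ⋆ w) x))) (0≤+ a b))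

  ω-coneʳ : ∀ c v g s → (∀ k → k < κ → 0ℤ ℤ.≤ ω c v (g ⋆ α s k)) → ∀ y → NonNeg y → Bounded κ y → 0ℤ ℤ.≤ ω c v (g ⋆ αv s y)
  ω-coneʳ c v g = Cone.cone-αv (λ x → 0ℤ ℤ.≤ ω c v (g ⋆ x))
    (λ {x} {w} e → subst (0ℤ ℤ.≤_) (ω-≋ c {v} {v} {g ⋆ x} {g ⋆ w} ≋-refl (⋆-cong g e)))
    (ℤₚ.≤-reflexive (sym (trans (ω-skew c v (g ⋆ 0ᵛ)) (cong -_ (ω-0ˡ c v (⋆-0 g))))))
    (λ {x} {w} a b → subst (0ℤ ℤ.≤_) (sym (trans (ω-≋ c {v} {v} {g ⋆ (x ⊕ w)} {(g ⋆ x) ⊕ (g ⋆ w)} ≋-refl (⋆-⊕ g x w)) (ω-⊕ʳ c v (g ⋆ x) (g ⋆ w)))) (0≤+ a b))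

  -- w α_s = α_s + (nonnegative combination of inversions of w), so if those pair
  -- nonnegatively with w α_s then ω(α_s, w α_s) ≤ 0, whereas ω(α_s, w α_s) ≥ 0 since s is initial.
  module NewInitial {c : List (Fin n)} {s : Fin n} {w : G} (u : Unique (s ∷ c)) (D : Srtd c w) (p : P w s)
                    (ok : ∀ t → Inv w t → Ok (s ∷ c) t (ref w s)) where
    A X̄ : V
    A = αv s ones
    X̄ = w ⋆ A

    A-bd : Bd A
    A-bd = αv-bounded s ones-bd

    F : V → ℤ
    F v = ω (s ∷ c) v X̄

    F-NN : ∀ t v → Inv w t → Rv t v → 0ℤ ℤ.≤ F v
    F-NN t v i r = ω-coneʳ (s ∷ c) v w s (λ k k< → ok t i v (w ⋆ α s k) r (w , s , k , k< , p , refl , ≋-refl)) ones ones≥0 ones-bd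

    grow-step : ∀ w₃ b → b ∈ c → P w₃ b → w₃ ∙ gen b ⊑ w → F (w₃ ⋆ A) ℤ.≤ F ((w₃ ∙ gen b) ⋆ A)
    grow-step w₃ b b∈ pb q =
      subst (F (w₃ ⋆ A) ℤ.≤_) (sym (trans (ω-≋ (s ∷ c) {(w₃ ∙ gen b) ⋆ A} {(w₃ ⋆ A) ⊕ (w₃ ⋆ αv b y)} {X̄} {X̄} split ≋-refl) (ω-⊕ˡ (s ∷ c) (w₃ ⋆ A) (w₃ ⋆ αv b y) X̄)))
        (ℤₚ.≤-trans (ℤₚ.≤-reflexive (sym (ℤₚ.+-identityʳ _))) (ℤₚ.+-monoʳ-≤ (F (w₃ ⋆ A)) extra))
      where
      y : Row
      y = X b s ones
      b≢s : s ≢ b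
      b≢s refl = uniq∉ u b∈
      h : ∀ a k z → a ℤ.- k ℤ.* (- z) ≡ a ℤ.+ k ℤ.* z
      h = solve-∀
      fired : b ▷ A ≋ A ⊕ αv b y
      fired j k = trans (cong (λ z → A j k ℤ.- kron b j ℤ.* z) (fire-αv-off b s ones b≢s k)) (h (A j k) (kron b j) (y k))
      split : (w₃ ∙ gen b) ⋆ A ≋ (w₃ ⋆ A) ⊕ (w₃ ⋆ αv b y)
      split = ≋-trans (⋆-∙gen w₃ b A-bd) (≋-trans (⋆-cong w₃ fired) (⋆-⊕ w₃ A (αv b y)))
      extra : 0ℤ ℤ.≤ F (w₃ ⋆ αv b y)
      extra = ω-coneˡ (s ∷ c) X̄ w₃ b (λ k k< → F-NN (ref w₃ b) (w₃ ⋆ α b k) (q _ (add-new pb)) (w₃ , b , k , k< , pb , refl , ≋-refl))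
                y (Path.X≥0 (M b s) ones≥0) (Path.X-bounded (M b s) (M∣κ b s) ones-bd)

    grow : ∀ {w₂} → Srtd c w₂ → w₂ ⊑ w → F A ℤ.≤ F (w₂ ⋆ A)
    grow {w₂} (srt-e refl) q = ℤₚ.≤-reflexive (ω-≋ (s ∷ c) {A} {e ⋆ A} {X̄} {X̄} (≋-sym (⋆-e A-bd)) ≋-refl)
    grow {w₂} (srt-∙ w₃ b x b∈ pb _ refl) q = ℤₚ.≤-trans (grow x (⊑-trans (add⊑ pb) q)) (grow-step w₃ b b∈ pb q)

    X̄-NN : NN X̄
    X̄-NN = NN-cone w s (λ k k< → positive w s p k k<) ones ones≥0 ones-bd

    X̄-s : X̄ s ≗ ones
    X̄-s k = trans (Gen-coord (srt-Gen D) A-bd s (uniq∉ u) k) (αv-at s ones k)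

    X̄-supp : Supp (s ∷ c) X̄
    X̄-supp j j∉ k = trans (Gen-coord (srt-Gen D) A-bd j (λ q → j∉ (there q)) k) (αv-off ones k (λ { refl → j∉ (here refl) }))

    FA : F A ≡ dot κ ones (Nbc c s X̄)
    FA = trans (ω-first (uniq∉ u) {A} X̄ (λ j ne k → αv-off ones k ne)) (dot-cong κ (αv-at s ones) (λ _ → refl))

    zeroed : dot κ ones (Nbc c s X̄) ≡ 0ℤ
    zeroed = squeeze _ (dot≥0 κ ones≥0 (Nbc≥0 c s X̄-NN)) (ℤₚ.neg-mono-≤ (subst (ℤ._≤ 0ℤ) FA (subst (F A ℤ.≤_) (ω-self (s ∷ c) X̄) (grow D (λ _ i → i)))))

    value : ((gen s ∙ w) ⋆ A) s 0 ≡ - 1ℤ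
    value = trans (⋆-gen∙ s w A-bd s 0) (trans (▷-at s X̄ 0) (cong₂ (λ a b → (- a) ℤ.+ b) (trans (X̄-s 0) (ones-in 0<κ))
      (trans (Nb-restrict u X̄-supp 0) (dot-ones-0 κ (Nbc≥0 c s X̄-NN) (λ k → ones-in) zeroed 0 0<κ))))

    ¬p : ¬ P (gen s ∙ w) s
    ¬p q = 0≰-1 (subst (0ℤ ℤ.≤_) value (NN-cone (gen s ∙ w) s (λ k k< → positive (gen s ∙ w) s q k k<) ones ones≥0 ones-bd s 0))

    commutes : gen s ∙ w ≡ w ∙ gen s
    commutes = folding s w s p ¬p

  -- The letter s cannot occur in the word: at its first occurrence `NewInitial` gives s w₁ = w₁ s,
  -- which makes s itself an inversion.
  srt-skip : ∀ {c s w} → Unique (s ∷ c) → Srtd (s ∷ c) w → ¬ Inv w (gen s) → Srtd c w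
  srt-skip u (srt-e q) _ = srt-e q
  srt-skip {c} {s} u (srt-∙ w₁ a x a∈ p ok refl) ¬i = go a∈
    where
    IH : Srtd c w₁
    IH = srt-skip u x (λ i → ¬i (add⊑ p _ i))
    go : a ∈ s ∷ c → Srtd c (w₁ ∙ gen a)
    go (there a∈c) = srt-∙ w₁ a IH a∈c p (λ t i v y rv ry → subst (0ℤ ℤ.≤_)
        (ω-skip c s {v} {y} (Supp-Rv (srt-Gen IH) i rv s (uniq∉ u)) (Supp-Rv (Gen-mul (srt-Gen IH) (Gen-gen a∈c)) (add-new p) ry s (uniq∉ u))) (ok t i v y rv ry)) refl
    go (here refl) = ⊥-elim (¬i (subst (λ z → Inv z (gen s)) (NewInitial.commutes u IH p ok) (Inv-s⇒ s w₁ (λ i → ¬i (add⊑ p _ i)))))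

  private
    Srtd⇒S-rec : ∀ b c w → length c ℕ.+ ℓ w < b → Unique c → Srtd c w → S c w
    Srtd⇒S-rec (suc b) [] w _ u (srt-e p) = nil p
    Srtd⇒S-rec (suc b) [] w _ u (srt-∙ w₁ a x () p ok refl)
    Srtd⇒S-rec (suc b) (s ∷ c) w (s≤s l) u x with Inv? w (gen s)
    ... | yes i = take i (Srtd⇒S-rec b (c ++ [ s ]) (gen s ∙ w) (ℕₚ.<-≤-trans (ℕₚ.≤-trans (ℕₚ.≤-reflexive (cong (λ z → suc (z ℕ.+ ℓ (gen s ∙ w))) (trans (Listₚ.length-++ c) (ℕₚ.+-comm (length c) 1)))) (s≤s (ℕₚ.+-monoʳ-< (length c) (proj₂ i)))) l) (uniq-rot u) (srt-uncons u x i))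
    ... | no ¬i = skip ¬i (Srtd⇒S-rec b c w l (uniq-tail u) (srt-skip u x ¬i))

  abstract
    Srtd⇒S : ∀ {c w} → Unique c → Srtd c w → S c w
    Srtd⇒S {c} {w} = Srtd⇒S-rec (suc (length c ℕ.+ ℓ w)) c w ℕₚ.≤-refl

  -- Restriction to a parabolic subgroup

  abstract
    Gen-descent : ∀ {c w q} → Gen c w → ¬ P w q → q ∈ c
    Gen-descent {c} {w} {q} g ¬p with Any.any? (q Finₚ.≟_) c
    ... | yes r = r
    ... | no q∉ = ⊥-elim (0≰-1 (subst (λ z → 0ℤ ℤ.≤ - z) (trans (Gen-coord g (α-bounded q 0<κ) q q∉ 0) (αv-at q (unit 0) 0)) (negative w q ¬p 0 0<κ q 0)))

  -- Each letter adds one inversion. If it is outside the subgroup, the restriction does not change;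
  -- if it is inside, the restriction gains just this inversion, and `missing` supplies the letter
  -- that realises the step.
  srt-par : ∀ {c d w} → (∀ v x → Supp d v → Supp d x → ω c v x ≡ ω d v x) → Srtd c w → Srtd d (w ∣ d)
  srt-par {d = d} h (srt-e refl) = srt-e (⊑-antisym (∣⊑ d e) (e⊑ _))
  srt-par {c} {d} h (srt-∙ w₁ a x a∈ p ok refl) with Inv? ((w₁ ∙ gen a) ∣ d) (ref w₁ a)
  ... | no ¬i = subst (Srtd d) (sym (⊑-antisym down (∣-mono d (add⊑ p)))) (srt-par h x)
    where
    down : (w₁ ∙ gen a) ∣ d ⊑ w₁ ∣ d
    down t i with add⇒ {w₁} {a} (∣⇒Inv d _ i)
    ... | inj₁ refl = ⊥-elim (¬i i)
    ... | inj₂ j = ∣⇐ d w₁ j (∣⇒Tin d _ i)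
  ... | yes i with missing (∣-mono d (add⊑ p)) (λ q → ¬add-old p (∣⇒Inv d w₁ (subst (λ z → Inv z (ref w₁ a)) (sym q) i)))
  ... | q , ¬Pq , ¬y = srt-∙ y₁ q (srt-par h x) (Gen-descent (∣-gen d _) ¬Pq) (subst (λ z → P z q) yq (¬P-flip y q ¬Pq)) ok′ (sym (trans (cong (_∙ gen q) (sym yq)) (ggʳ y q)))
    where
    y y₁ : G
    y = (w₁ ∙ gen a) ∣ d
    y₁ = w₁ ∣ d
    t₀ : ref y q ≡ ref w₁ a
    t₀ with Cov⇒Inv {y} (q , ¬Pq , refl)
    ... | j with add⇒ {w₁} {a} (∣⇒Inv d _ j)
    ... | inj₁ r = r
    ... | inj₂ j₁ = ⊥-elim (¬y (∣⇐ d w₁ j₁ (∣⇒Tin d _ j)))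
    yq : y ∙ gen q ≡ y₁
    yq = ⊑-antisym down (drop (∣-mono d (add⊑ p)) ¬y)
      where
      down : y ∙ gen q ⊑ y₁
      down t j with t ≟G ref y q
      ... | yes refl = ⊥-elim (¬Inv-right y q ¬Pq j)
      ... | no ne with Inv-right⇒ y q t ne j
      ... | j′ with add⇒ {w₁} {a} (∣⇒Inv d _ j′)
      ... | inj₁ refl = ⊥-elim (ne (sym t₀))
      ... | inj₂ j₁ = ∣⇐ d w₁ j₁ (∣⇒Tin d _ j′)
    ok′ : ∀ t → Inv y₁ t → Ok d t (ref y₁ q)
    ok′ t j v z rv rz = subst (0ℤ ℤ.≤_) (h v z (λ k k∉ → ∣⇒Tin d w₁ j v rv k k∉) (λ k k∉ → ∣⇒Tin d _ i z rz′ k k∉)) (ok t (∣⇒Inv d w₁ j) v z rv rz′)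
      where
      rz′ : Rv (ref w₁ a) z
      rz′ = subst (λ r → Rv r z) (trans (cong (λ r → ref r q) (sym yq)) (trans (ref-flip y q) t₀)) rz

  abstract
    S-par-first : ∀ {c s w} → Unique (s ∷ c) → S (s ∷ c) w → S c (w ∣ c)
    S-par-first {c} {s} u x = Srtd⇒S (uniq-tail u) (srt-par (λ v y zv zy → ω-skip c s {v} {y} (zv s (uniq∉ u)) (zy s (uniq∉ u))) (S⇒Srtd u x))

  abstract
    S-par-last : ∀ {c s w} → Unique (s ∷ c) → S (c ++ [ s ]) w → S c (w ∣ c)
    S-par-last {c} {s} u x = Srtd⇒S (uniq-tail u) (srt-par (λ v y zv zy → ω-cong-E (h v y (zv s (uniq∉ u)) (zy s (uniq∉ u))) (h y v (zy s (uniq∉ u)) (zv s (uniq∉ u)))) (S⇒Srtd (uniq-rot u) x))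
      where
      h : ∀ v y → v s ≗ 0ʳ → y s ≗ 0ʳ → E (c ++ [ s ]) v y ≡ E c v y
      h v y _ q = trans (E-snoc c s v y) (trans (cong (λ z → E c v y ℤ.+ z) (dot-0ʳ κ _ q)) (ℤₚ.+-identityʳ _))

  abstract
    S-append : ∀ {c s w} → Unique (s ∷ c) → S c w → S (c ++ [ s ]) w
    S-append {c} {s} u x = Srtd⇒S (uniq-rot u) (srt-map (λ _ → ∈-++⁺ˡ) (λ t t′ i j ok v y rv ry → subst (0ℤ ℤ.≤_)
        (sym (ω-cong-E (h v y (Supp-Rv (S-Gen x) j ry s (uniq∉ u))) (h y v (Supp-Rv (S-Gen x) i rv s (uniq∉ u))))) (ok v y rv ry)) (S⇒Srtd (uniq-tail u) x))
      where
      h : ∀ v y → y s ≗ 0ʳ → E (c ++ [ s ]) v y ≡ E c v y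
      h v y q = trans (E-snoc c s v y) (trans (cong (λ z → E c v y ℤ.+ z) (dot-0ʳ κ _ q)) (ℤₚ.+-identityʳ _))

  abstract
    -- An inversion that enters after s pairs with s with a nonnegative sign, while s being final
    -- forces the opposite one. It is therefore far from s and commutes with it, so s can be moved
    -- to the end of the word, or removed.
    srt-final : ∀ {c s v} → Unique (s ∷ c) → Srtd (c ++ [ s ]) v → Inv v (gen s) →
                (∃[ q ] (¬ P v q × gen s ∙ v ≡ v ∙ gen q)) × Srtd (c ++ [ s ]) (gen s ∙ v)
    srt-final u (srt-e refl) i = ⊥-elim (Inv-e _ i)
    srt-final {c} {s} u D@(srt-∙ v₁ a x a∈ p ok refl) i with Inv? v₁ (gen s)
    ... | no ¬i₁ = (a , P-flip v₁ a p , trans sv (sym (ggʳ v₁ a))) , subst (Srtd (c ++ [ s ])) (sym sv) x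
      where
      s≡ : gen s ≡ ref v₁ a
      s≡ with add⇒ {v₁} {a} i
      ... | inj₁ q = q
      ... | inj₂ j = ⊥-elim (¬i₁ j)
      sv : gen s ∙ (v₁ ∙ gen a) ≡ v₁
      sv = trans (cong (gen s ∙_) (sym (trans (cong (_∙ v₁) s≡) (ref-self v₁ a)))) (gg s v₁)
    ... | yes i₁ with srt-final u x i₁
    ... | (q , ¬Pq , eq) , y = (q , ¬P , sv) , srt-∙ (gen s ∙ v₁) a y a∈ (P-conj s v₁ a p t₀≢) ok′ (sym (assoc _ _ _))
      where
      t₀ : G
      t₀ = ref v₁ a
      t₀≢ : t₀ ≢ gen s
      t₀≢ r = ¬add-old p (subst (Inv v₁) (sym r) i₁)
      comm : conj s t₀ ≡ t₀
      comm with Rv-exists {t₀} (v₁ , a , refl)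
      ... | z , rz = fixed⇒commute t₀≢ rz (Far-fixed t₀≢ rz (Far-last u (λ j j∉ → Supp-Rv (srt-Gen D) (add-new p) rz j (λ r → j∉ (rot∈ r))) (Rv-NN rz) (Rv-Bd rz)
              (λ k k< → ok (gen s) i₁ (α s k) z (Rv-gen s k k<) rz)))
      st : gen s ∙ t₀ ≡ t₀ ∙ gen s
      st = trans (sym (ggʳ _ s)) (cong (_∙ gen s) comm)
      sv : gen s ∙ (v₁ ∙ gen a) ≡ v₁ ∙ gen a ∙ gen q
      sv = trans (cong (gen s ∙_) (sym (ref-self v₁ a))) (trans (sym (assoc _ _ _)) (trans (cong (_∙ v₁) st) (trans (assoc _ _ _) (trans (cong (t₀ ∙_) eq)
             (trans (sym (assoc _ _ _)) (cong (_∙ gen q) (ref-self v₁ a)))))))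
      ¬P : ¬ P (v₁ ∙ gen a) q
      ¬P r = ℕₚ.<-asym r (subst (λ z → ℓ z < ℓ (v₁ ∙ gen a)) sv (proj₂ i))
      ok′ : ∀ t → Inv (gen s ∙ v₁) t → Ok (c ++ [ s ]) t (ref (gen s ∙ v₁) a)
      ok′ t j v z rv rz = ok t (subst (_⊑ v₁) (sym eq) (∙gen⊑ ¬Pq) t j) v z rv (subst (λ r → Rv r z) (trans (sym (conj-ref s v₁ a)) comm) rz)

  Cov-s : ∀ {v s q} → ¬ P v q → gen s ∙ v ≡ v ∙ gen q → Cov v (gen s)
  Cov-s {v} {s} {q} ¬p eq = q , ¬p , ref-unique (gen s) v q eq

  Cov-s⁻ : ∀ {v s} → Cov v (gen s) → ∃[ q ] (¬ P v q × gen s ∙ v ≡ v ∙ gen q)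
  Cov-s⁻ {v} {s} (q , ¬p , eq) = q , ¬p , trans (cong (_∙ v) eq) (ref-self v q)

  abstract
    S-final : ∀ {c s v} → Unique (s ∷ c) → S (c ++ [ s ]) v → Inv v (gen s) → Cov v (gen s) × S (c ++ [ s ]) (gen s ∙ v) × S (s ∷ c) v
    S-final {c} {s} u x i with srt-final u (S⇒Srtd (uniq-rot u) x) i
    ... | (q , ¬p , eq) , y = Cov-s ¬p eq , Srtd⇒S (uniq-rot u) y , take i (Srtd⇒S (uniq-rot u) y)

  abstract
    -- s v is sortable for the rotated word, and a final letter may always enter last, since every
    -- vector pairs nonnegatively with its root.
    S-final⁻ : ∀ {c s v} → Unique (s ∷ c) → S (s ∷ c) v → Cov v (gen s) → S (c ++ [ s ]) v
    S-final⁻ {c} {s} {v} u x cv with Cov-s⁻ cv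
    ... | q , ¬p , eq = Srtd⇒S (uniq-rot u) (srt-∙ (gen s ∙ v) q (S⇒Srtd (uniq-rot u) y) (rot∈⁻ (Gen-descent (S-Gen x) ¬p))
          (subst (λ z → P z q) (sym eq) (¬P-flip v q ¬p)) ok (sym (trans (cong (_∙ gen q) eq) (ggʳ v q))))
      where
      y : S (c ++ [ s ]) (gen s ∙ v)
      y = S-take x (Cov⇒Inv cv)
      ok : ∀ t → Inv (gen s ∙ v) t → Ok (c ++ [ s ]) t (ref (gen s ∙ v) q)
      ok t i w z rw rz = subst (0ℤ ℤ.≤_) (sym (ω-last (uniq∉ u) w (At-Rv rz′))) (dot≥0 κ (Rv-NN rz′ s) (Nbc≥0 c s (Rv-NN rw)))
        where
        rz′ : Rv (gen s) z
        rz′ = subst (λ r → Rv r z) (trans (cong (λ r → ref r q) eq) (trans (ref-flip v q) (sym (ref-unique (gen s) v q eq)))) rz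

-- Upper labels, cover reflections and the Euler form.

module Labels {n : ℕ} (m : Fin n → Fin n → ℕ) (cox : IsCoxeterMatrix m) (T : Words.Table m) where
  open Sortable m cox T public

  -- Up c w t: the reflection t labels an upper cover of w in the c-Cambrian lattice.
  data Up : List (Fin n) → G → G → Set where
    here : ∀ {s c w t} → ¬ Inv w (gen s) → t ≡ gen s → Up (s ∷ c) w t
    skip : ∀ {s c w t} → ¬ Inv w (gen s) → Up c w t → Up (s ∷ c) w t
    take : ∀ {s c w t} → Inv w (gen s) → t ≢ gen s → Up (c ++ [ s ]) (gen s ∙ w) (conj s t) → Up (s ∷ c) w t

  Up-¬Inv : ∀ {c w t} → Up c w t → ¬ Inv w t
  Up-¬Inv (here ¬i refl) = ¬i
  Up-¬Inv (skip _ y) = Up-¬Inv y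
  Up-¬Inv {w = w} {t} (take {s} i ne y) j = Up-¬Inv y (Inv-conj⇐ s w (conj s t) (conj-≢ ne) (subst (Inv w) (sym (conj² s t)) j))

  Up-Tin : ∀ {c w t} → Up c w t → Tin c t
  Up-Tin (here _ refl) = Tin-gen (here refl)
  Up-Tin (skip _ y) = Tin-mono (λ _ → there) (Up-Tin y)
  Up-Tin {t = t} (take {s} {c} _ _ y) = subst (Tin (s ∷ c)) (conj² s t) (Tin-conj (here refl) (Tin-mono (λ _ → rot∈) (Up-Tin y)))

  Supp-Tin : ∀ {c t v} → Tin c t → Rv t v → Supp c v
  Supp-Tin p r j j∉ = p _ r j j∉

  ▷-At : ∀ {s v} → At s v → s ▷ v ≋ neg v
  ▷-At {s} {v} p = ≋-trans (▷-cong s shape) (≋-trans (▷-αv s (v s)) (λ j k → cong -_ (sym (shape j k))))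
    where
    shape : v ≋ αv s (v s)
    shape j k with s Finₚ.≟ j
    ... | yes refl = sym (αv-at s (v s) k)
    ... | no ne = trans (p j ne k) (sym (αv-off (v s) k ne))

  Supp-▷ : ∀ {c s v} → Supp (s ∷ c) v → Supp (c ++ [ s ]) (s ▷ v)
  Supp-▷ {v = v} z j j∉ k = trans (▷-off v k (λ { refl → j∉ (rot∈⁻ (here refl)) })) (z j (λ q → j∉ (rot∈⁻ q)) k)

  private
    nonpos : ∀ {a b} → a ≡ - b → 0ℤ ℤ.≤ b → a ℤ.≤ 0ℤ
    nonpos refl p = ℤₚ.neg-mono-≤ p

  -- Labels separate w from its complement: Inv w = { t : E(t, γ) ≤ 0 for all upper labels γ }.
  abstract
    Up-≤0 : ∀ {c w t γ v x} → Unique c → S c w → Inv w t → Up c w γ → Rv t v → Rv γ x → E c v x ℤ.≤ 0ℤ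
    Up-≤0 {v = v} {x} u (skip {s} {c} _ y) i (here _ refl) rv rx =
      ℤₚ.≤-reflexive (trans (E-first (uniq∉ u) v (At-Rv rx)) (dot-0ˡ κ _ (S-Tin y i v rv s (uniq∉ u))))
    Up-≤0 {v = v} {x} u (skip {s} {c} _ y) i (skip _ z) rv rx =
      subst (ℤ._≤ 0ℤ) (sym (E-skip c s x (S-Tin y i v rv s (uniq∉ u)))) (Up-≤0 (uniq-tail u) y i z rv rx)
    Up-≤0 u (skip ¬j _) _ (take j _ _) _ _ = ⊥-elim (¬j j)
    Up-≤0 u (take j _) _ (here ¬j _) _ _ = ⊥-elim (¬j j)
    Up-≤0 u (take j _) _ (skip ¬j _) _ _ = ⊥-elim (¬j j)
    Up-≤0 {w = w} {t} {γ} {v} {x} u D@(take {s} {c} j y) i U@(take _ ne z) rv rx with t ≟G gen s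
    ... | yes refl = nonpos (trans (sym (E-rotate u (Supp-Tin (S-Tin D i) rv) (Supp-Tin (Up-Tin U) rx)))
                      (trans (E-last (uniq∉ u) (s ▷ x) (λ k nk q → trans (▷-At (At-Rv rv) k q) (cong -_ (At-Rv rv k nk q))))
                      (trans (dot-cong κ (▷-At (At-Rv rv) s) (λ _ → refl)) (dot-⊖ˡ κ (v s) _))))
                      (dot≥0 κ (Rv-NN rv s) (Rv-NN (Rv-conj s ne rx) s))
    ... | no nt = subst (ℤ._≤ 0ℤ) (E-rotate u (Supp-Tin (S-Tin D i) rv) (Supp-Tin (Up-Tin U) rx))
                    (Up-≤0 (uniq-rot u) y (Inv-conj⇐ s w (conj s t) (conj-≢ nt) (subst (Inv w) (sym (conj² s t)) i)) z (Rv-conj s nt rv) (Rv-conj s ne rx))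

  private
    find-coord : ∀ (f : Row) q → (∃[ k ] (k < q × f k ≢ 0ℤ)) ⊎ (∀ k → k < q → f k ≡ 0ℤ)
    find-coord f zero = inj₂ λ k ()
    find-coord f (suc q) with find-coord f q | f q ℤₚ.≟ 0ℤ
    ... | inj₁ (k , k< , ne) | _ = inj₁ (k , ℕₚ.≤-trans k< (ℕₚ.n≤1+n q) , ne)
    ... | inj₂ z | no ne = inj₁ (q , ℕₚ.≤-refl , ne)
    ... | inj₂ z | yes p = inj₂ λ k k< → h k k< (k ℕₚ.≟ q)
      where
      h : ∀ k → k < suc q → Dec (k ≡ q) → f k ≡ 0ℤ
      h k k< (yes refl) = p
      h k k< (no ne) = z k (ℕₚ.≤∧≢⇒< (ℕₚ.≤-pred k<) ne)

    0<-of : ∀ {a} → 0ℤ ℤ.≤ a → a ≢ 0ℤ → 0ℤ ℤ.< a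
    0<-of p ne = ℤₚ.≤∧≢⇒< p (λ q → ne (sym q))

  abstract
    coordinate-or-0 : ∀ {t v} s → Rv t v → (∃[ k ] (k < κ × 0ℤ ℤ.< v s k)) ⊎ (v s ≗ 0ʳ)
    coordinate-or-0 {v = v} s r with find-coord (v s) κ
    ... | inj₁ (k , k< , ne) = inj₁ (k , k< , 0<-of (Rv-NN r s k) ne)
    ... | inj₂ z = inj₂ λ k → h k (k ℕₚ.<? κ)
      where
      h : ∀ k → Dec (k < κ) → v s k ≡ 0ℤ
      h k (yes k<) = z k k<
      h k (no k≥) = Rv-Bd r s k (ℕₚ.≮⇒≥ k≥)

  E-α : ∀ {c s} → s ∉ c → ∀ v k → k < κ → E (s ∷ c) v (α s k) ≡ v s k
  E-α {c} {s} s∉ v k k< = trans (E-first s∉ v (At-Rv (Rv-gen s k k<))) (trans (dot-comm κ (v s) _) (trans (dot-cong κ (αv-at s (unit k)) (λ _ → refl)) (dot-unit κ k (v s) k<)))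

  abstract
    Up-separates : ∀ {c w t v} → Unique c → S c w → Supp c v → Rv t v → ¬ Inv w t → ∃[ γ ] ∃[ x ] (Up c w γ × Rv γ x × 0ℤ ℤ.< E c v x)
    Up-separates u (nil refl) z r _ = ⊥-elim (Rv-≢0 r (λ j k → z j (λ ()) k))
    Up-separates {v = v} u (skip {s} {c} ¬i y) z r ¬t with coordinate-or-0 s r
    ... | inj₁ (k , k< , p) = gen s , α s k , here ¬i refl , Rv-gen s k k< , subst (0ℤ ℤ.<_) (sym (E-α (uniq∉ u) v k k<)) p
    ... | inj₂ z₀ with Up-separates (uniq-tail u) y (λ j j∉ → h j j∉ (s Finₚ.≟ j)) r ¬t
      where
      h : ∀ j → j ∉ c → Dec (s ≡ j) → v j ≗ 0ʳ
      h j j∉ (yes refl) = z₀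
      h j j∉ (no ne) = z j λ { (here e) → ne (sym e) ; (there q) → j∉ q }
    ... | γ , x , up , rx , p = γ , x , skip ¬i up , rx , subst (0ℤ ℤ.<_) (sym (E-skip c s x z₀)) p
    Up-separates {w = w} {t} {v} u (take {s} {c} i y) z r ¬t
      with Up-separates (uniq-rot u) y (Supp-▷ z) (Rv-conj s t≢ r) (λ j → ¬t (subst (λ q → Inv q t) (gg s w) (Inv-conj⇐ s (gen s ∙ w) t t≢ j)))
      where
      t≢ : t ≢ gen s
      t≢ p = ¬t (subst (Inv w) (sym p) i)
    ... | γ , x , up , rx , p with γ ≟G gen s
    ... | no ne = conj s γ , s ▷ x , take i (conj-≢ ne) (subst (Up (c ++ [ s ]) (gen s ∙ w)) (sym (conj² s γ)) up) , Rv-conj s ne rx ,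
          subst (0ℤ ℤ.<_) (trans (E-≋ (c ++ [ s ]) {s ▷ v} {s ▷ v} ≋-refl (≋-sym (▷-involutive s x))) (E-rotate u z (Supp-Tin (Tin-mono (λ _ → rot∈) (subst (Tin (c ++ [ s ])) refl (Tin-conj (rot∈⁻ (here refl)) (Up-Tin up)))) (Rv-conj s ne rx)))) p
    ... | yes refl = ⊥-elim (ℤₚ.<⇒≱ p (nonpos (trans (E-≋ (c ++ [ s ]) {s ▷ v} {s ▷ v} ≋-refl (≋-sym (▷-involutive s x)))
          (trans (E-rotate u z (λ j j∉ k → trans (▷-At (At-Rv rx) j k) (cong -_ (At-Rv rx j (λ { refl → j∉ (here refl) }) k))))
          (trans (E-first (uniq∉ u) v (λ j ne k → trans (▷-At (At-Rv rx) j k) (cong -_ (At-Rv rx j ne k))))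
          (trans (dot-cong κ (λ _ → refl) (▷-At (At-Rv rx) s)) (dot-⊖ʳ κ (v s) (x s))))))
          (dot≥0 κ (Rv-NN r s) (Rv-NN rx s))))

  abstract
    -- Under the hypothesis conjugation by s preserves the inversions of w, so s is the only
    -- inversion that `gen s ∙ w` can have beyond them.
    stable : ∀ {s w} → ¬ Inv w (gen s) → w ⊑ gen s ∙ w → ∃[ r ] (gen s ∙ w ≡ w ∙ gen r × P w r)
    stable {s} {w} ¬i p with missing p (λ q → ℓ-gen∙≢ s w (cong ℓ (sym q)))
    ... | r , ¬Pr , ¬j = r , eq , subst (λ z → P z r) (sym (trans (sym (ggʳ _ r)) (trans (cong (_∙ gen r) (sym eq)) (cong (_∙ gen r) refl)))) (¬P-flip (gen s ∙ w) r ¬Pr)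
      where
      t₀ : ref (gen s ∙ w) r ≡ gen s
      t₀ with ref (gen s ∙ w) r ≟G gen s
      ... | yes q = q
      ... | no ne = ⊥-elim (¬j (subst (λ z → Inv z (ref (gen s ∙ w) r)) refl (back ne)))
        where
        back : ref (gen s ∙ w) r ≢ gen s → Inv w (ref (gen s ∙ w) r)
        back ne = conj-back (Inv-conj⇒ s w _ ne (Cov⇒Inv {gen s ∙ w} (r , ¬Pr , refl)))
          where
          conj-back : Inv w (conj s (ref (gen s ∙ w) r)) → Inv w (ref (gen s ∙ w) r)
          conj-back j = subst (Inv w) (conj² s _) (Inv-conj⇒ s w _ (conj-≢ ne) (p _ j))
      eq : gen s ∙ w ≡ w ∙ gen r
      eq = trans (sym (ggʳ _ r)) (cong (_∙ gen r) (trans (sym (ref-self (gen s ∙ w) r)) (trans (cong (_∙ (gen s ∙ w)) t₀) (gg s w))))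

  Ok-rot : ∀ {c s t f} → Unique (s ∷ c) → t ≢ gen s → f ≢ gen s → Tin (s ∷ c) t → Tin (s ∷ c) f → Ok (s ∷ c) t f → Ok (c ++ [ s ]) (conj s t) (conj s f)
  Ok-rot {c} {s} u nt nf zt zf ok v y rv ry = subst (0ℤ ℤ.≤_) (trans (sym (ω-rotate u (Supp-Tin zt rv′) (Supp-Tin zf ry′)))
      (ω-≋ (c ++ [ s ]) (▷-involutive s v) (▷-involutive s y))) (ok (s ▷ v) (s ▷ y) rv′ ry′)
    where
    rv′ = Rv-conj⁻ s nt rv
    ry′ = Rv-conj⁻ s nf ry

  Ok-skip : ∀ {c s t f} → s ∉ c → Tin c t → Tin c f → Ok (s ∷ c) t f → Ok c t f
  Ok-skip {c} {s} s∉ zt zf ok v y rv ry = subst (0ℤ ℤ.≤_) (ω-skip c s {v} {y} (zt v rv s s∉) (zf y ry s s∉)) (ok v y rv ry)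

  far⇒below : ∀ {c s w} → Unique (s ∷ c) → S c w → ¬ Inv w (gen s) → (∀ t → Inv w t → Ok (s ∷ c) t (gen s)) → w ⊑ gen s ∙ w
  far⇒below {c} {s} {w} u y ¬i ok t j = go (Rv-exists (proj₁ j))
    where
    t≢ : t ≢ gen s
    t≢ q = ¬i (subst (Inv w) q j)
    go : ∃[ v ] Rv t v → Inv (gen s ∙ w) t
    go (v , r) = Inv-conj⇐ s w t t≢ (subst (Inv w) (sym (fixed⇒commute t≢ r (Far-fixed t≢ r far))) j)
      where
      far : Far s v
      far = Far-first u (λ k k∉ → S-Tin y j v r k (λ q → k∉ (there q))) (Rv-NN r) (Rv-Bd r) (λ k k< → ok t j v (α s k) r (Rv-gen s k k<))

  Ok-unrot : ∀ {c s w f} → Unique (s ∷ c) → S (s ∷ c) w → Inv w (gen s) → f ≢ gen s → Tin (s ∷ c) f →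
             (∀ t → Inv w t → Ok (s ∷ c) t f) → ∀ t → Inv (gen s ∙ w) t → Ok (c ++ [ s ]) t (conj s f)
  Ok-unrot {c} {s} {w} {f} u D i ne z ok t j = subst (λ q → Ok (c ++ [ s ]) q (conj s f)) (conj² s t) (Ok-rot u (conj-≢ t≢) ne (S-Tin D j′) z (ok _ j′))
    where
    t≢ : t ≢ gen s
    t≢ q = Inv-s⇐ s w i (subst (Inv (gen s ∙ w)) q j)
    j′ : Inv w (conj s t)
    j′ = Inv-conj⇒ s w t t≢ j

  private
    unconj : ∀ s f w r → conj s f ∙ (gen s ∙ w) ≡ (gen s ∙ w) ∙ gen r → f ∙ w ≡ w ∙ gen r
    unconj s f w r eq = ∙-injˡ (gen s) (trans (trans (sym (assoc _ _ _)) (trans (cong ((gen s ∙ f) ∙_) (sym (gg s w))) (sym (assoc _ _ _)))) (trans eq (assoc _ _ _)))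

  -- The recursion leads to the stage at which f is the initial letter s. There the sign condition
  -- makes every inversion far from s, so `far⇒below` and `stable` apply. Labels aligned in this way
  -- are thus the ones at which the Cambrian cover is already a cover in the weak order.
  Up⇒stable : ∀ {c w f} → Unique c → S c w → Up c w f → (∀ t → Inv w t → Ok c t f) → ∃[ r ] (f ∙ w ≡ w ∙ gen r)
  Up⇒stable {w = w} u (skip {s} {c} ¬i y) (here _ refl) ok = let (r , eq , _) = stable {s} {w} ¬i (far⇒below u y ¬i ok) in r , eq
  Up⇒stable u (skip {s} {c} ¬i y) (skip _ z) ok = Up⇒stable (uniq-tail u) y z (λ t j → Ok-skip (uniq∉ u) (S-Tin y j) (Up-Tin z) (ok t j))
  Up⇒stable u (skip ¬i _) (take i _ _) ok = ⊥-elim (¬i i)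
  Up⇒stable u (take i _) (here ¬i _) ok = ⊥-elim (¬i i)
  Up⇒stable u (take i _) (skip ¬i _) ok = ⊥-elim (¬i i)
  Up⇒stable {w = w} {f} u D@(take {s} {c} i y) U@(take _ ne z) ok =
    let (r , eq) = Up⇒stable (uniq-rot u) y z (Ok-unrot u D i ne (Up-Tin U) ok) in r , unconj s f w r eq

  stable⇒Up : ∀ {c w f r} → Unique c → S c w → f ≡ ref w r → P w r → Tin c f → (∀ t → Inv w t → Ok c t f) → Up c w f
  stable⇒Up {w = w} {r = r} u (nil refl) refl p z ok with Rv-exists {ref w r} (w , r , refl)
  ... | v , x = ⊥-elim (Rv-≢0 x (λ j k → z v x j (λ ()) k))
  stable⇒Up {w = w} {f} {r} u (skip {s} {c} ¬i y) eq p z ok with f ≟G gen s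
  ... | yes q = here ¬i q
  ... | no ne with s Finₚ.≟ r
  ... | yes refl = ⊥-elim (ne (trans eq (sym (ref-unique (gen s) w s (NewInitial.commutes u (S⇒Srtd (uniq-tail u) y) p (subst (λ q → ∀ t → Inv w t → Ok (s ∷ c) t q) eq ok))))))
  ... | no s≢r = skip ¬i (stable⇒Up (uniq-tail u) y eq p zc (λ t j → Ok-skip (uniq∉ u) (S-Tin y j) zc (ok t j)))
    where
    r∈ : r ∈ c
    r∈ with Any.any? (r Finₚ.≟_) c
    ... | yes q = q
    ... | no r∉ = ⊥-elim (impossible (trans (sym (trans (Gen-coord (S-Gen y) (α-bounded r 0<κ) r r∉ 0) (αv-at r (unit 0) 0)))
          (z (w ⋆ α r 0) (w , r , 0 , 0<κ , p , eq , ≋-refl) r (λ { (here q) → s≢r (sym q) ; (there q) → r∉ q }) 0)))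
      where
      impossible : 1ℤ ≢ 0ℤ
      impossible ()
    zc : Tin c f
    zc = subst (Tin c) (sym eq) (Inv⇒Tin (Gen-mul (S-Gen y) (Gen-gen r∈)) (add-new p))
  stable⇒Up {w = w} {f} {r} u D@(take {s} {c} i y) eq p z ok =
    take i f≢ (stable⇒Up (uniq-rot u) y (trans (cong (conj s) eq) (conj-ref s w r)) (P-conj s w r p (λ q → f≢ (trans eq q))) (Tin-mono (λ _ → rot∈⁻) (Tin-conj (here refl) z)) (Ok-unrot u D i f≢ z ok))
    where
    f≢ : f ≢ gen s
    f≢ q = ¬add-old p (subst (Inv w) (trans (sym q) eq) i)

  abstract
    Ok-last : ∀ {c s} → Unique (s ∷ c) → ∀ t → Ok (c ++ [ s ]) t (gen s)
    Ok-last {c} {s} u t v y rv ry = subst (0ℤ ℤ.≤_) (sym (ω-last (uniq∉ u) v (At-Rv ry))) (dot≥0 κ (Rv-NN ry s) (Nbc≥0 c s (Rv-NN rv)))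

  abstract
    -- A final letter is aligned after every inversion (`Ok-last`). Together with `Cov⇒Up-last` this
    -- shows how rotation acts on labels: the cover reflection s becomes an upper label and no other
    -- label changes sides (`Label-rot`).
    Up-last⇒Cov : ∀ {c s w} → Unique (s ∷ c) → S (c ++ [ s ]) (gen s ∙ w) → Inv w (gen s) → Up (c ++ [ s ]) (gen s ∙ w) (gen s) → Cov w (gen s)
    Up-last⇒Cov {c} {s} {w} u y i up with Up⇒stable (uniq-rot u) y up (λ t _ → Ok-last u t)
    ... | r , eq = r , ¬p , ref-unique _ _ _ sw
      where
      w≡ : w ≡ (gen s ∙ w) ∙ gen r
      w≡ = trans (sym (gg s w)) eq
      sw : gen s ∙ w ≡ w ∙ gen r
      sw = trans (sym (ggʳ _ r)) (cong (_∙ gen r) (sym w≡))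
      ¬p : ¬ P w r
      ¬p q = ℕₚ.<-asym q (subst (λ z → ℓ z < ℓ w) sw (proj₂ i))

  abstract
    Cov⇒Up-last : ∀ {c s w} → Unique (s ∷ c) → S (s ∷ c) w → Cov w (gen s) → Up (c ++ [ s ]) (gen s ∙ w) (gen s)
    Cov⇒Up-last {c} {s} {w} u x cv with Cov-s⁻ cv
    ... | q , ¬p , eq = stable⇒Up {r = q} (uniq-rot u) (S-take x (Cov⇒Inv cv)) (trans (ref-unique (gen s) w q eq) (trans (sym (ref-flip w q)) (cong (λ z → ref z q) (sym eq))))
          (subst (λ z → P z q) (sym eq) (¬P-flip w q ¬p)) (Tin-gen (rot∈⁻ (here refl))) (λ t _ → Ok-last u t)

  Cov-down : ∀ {s w t} → t ≢ gen s → Cov w t → Cov (gen s ∙ w) (conj s t)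
  Cov-down {s} {w} {t} ne (q , ¬p , refl) = q , (λ r → ¬p (subst (λ z → P z q) (gg s w) (P-conj s (gen s ∙ w) q r (λ z → conj-≢ ne (trans (conj-ref s w q) z))))) , conj-ref s w q

  Cov-up : ∀ {s w t} → t ≢ gen s → Cov (gen s ∙ w) (conj s t) → Cov w t
  Cov-up {s} {w} {t} ne x = subst (λ z → Cov z t) (gg s w) (subst (Cov (gen s ∙ (gen s ∙ w))) (conj² s t) (Cov-down (conj-≢ ne) x))

  abstract
    E-negˡ : ∀ c v x → E c (neg v) x ≡ - E c v x
    E-negˡ c v x = h (E c v x) (E c (neg v) x) (trans (sym (E-⊕ˡ c v (neg v) x)) (E-0ˡ c x (λ j _ k → ℤₚ.+-inverseʳ (v j k))))
      where
      h : ∀ a b → a ℤ.+ b ≡ 0ℤ → b ≡ - a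
      h a b p = trans (h₁ a b) (trans (cong (λ z → z ℤ.- a) p) (ℤₚ.+-identityˡ _))
        where
        h₁ : ∀ a b → b ≡ (a ℤ.+ b) ℤ.- a
        h₁ = solve-∀

  abstract
    E-negʳ : ∀ c v x → E c v (neg x) ≡ - E c v x
    E-negʳ c v x = h (E c v x) (E c v (neg x)) (trans (sym (E-⊕ʳ c v x (neg x))) (E-0ʳ c v (λ j _ k → ℤₚ.+-inverseʳ (x j k))))
      where
      h : ∀ a b → a ℤ.+ b ≡ 0ℤ → b ≡ - a
      h a b p = trans (h₁ a b) (trans (cong (λ z → z ℤ.- a) p) (ℤₚ.+-identityˡ _))
        where
        h₁ : ∀ a b → b ≡ (a ℤ.+ b) ℤ.- a
        h₁ = solve-∀

  Orth : List (Fin n) → G → G → Set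
  Orth c t t′ = ∀ v x → Rv t v → Rv t′ x → E c v x ≡ 0ℤ

  Label : List (Fin n) → G → G → Set
  Label c w t = Up c w t ⊎ Cov w t

  Label-Tin : ∀ {c w t} → S c w → Label c w t → Tin c t
  Label-Tin x (inj₁ y) = Up-Tin y
  Label-Tin x (inj₂ y) = S-Tin x (Cov⇒Inv y)

  Label-rot : ∀ {c s w t} → Unique (s ∷ c) → S (s ∷ c) w → Inv w (gen s) → Label (s ∷ c) w t → Label (c ++ [ s ]) (gen s ∙ w) (conj s t)
  Label-rot u x i (inj₁ (here ¬i _)) = ⊥-elim (¬i i)
  Label-rot u x i (inj₁ (skip ¬i _)) = ⊥-elim (¬i i)
  Label-rot u x i (inj₁ (take _ _ y)) = inj₁ y
  Label-rot {s = s} {t = t} u x i (inj₂ y) with t ≟G gen s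
  ... | yes refl = inj₁ (subst (Up _ _) (sym (conj-self s)) (Cov⇒Up-last u x y))
  ... | no ne = inj₂ (Cov-down ne y)

  private
    Rv-▷ : ∀ s t v → Rv t v → Rv (conj s t) (s ▷ v) ⊎ (Rv (conj s t) v × s ▷ v ≋ neg v)
    Rv-▷ s t v r with t ≟G gen s
    ... | no ne = inj₁ (Rv-conj s ne r)
    ... | yes refl = inj₂ (subst (λ z → Rv z v) (sym (conj-self s)) r , ▷-At (At-Rv r))

    neg-0 : ∀ {a b} → a ≡ - b → b ≡ 0ℤ → a ≡ 0ℤ
    neg-0 p refl = p

  Orth-rot : ∀ {c s t t′} → Unique (s ∷ c) → Tin (s ∷ c) t → Tin (s ∷ c) t′ → Orth (c ++ [ s ]) (conj s t) (conj s t′) → Orth (s ∷ c) t t′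
  Orth-rot {c} {s} {t} {t′} u z z′ o v x rv rx = trans (sym (E-rotate u (Supp-Tin z rv) (Supp-Tin z′ rx))) (go (Rv-▷ s t v rv) (Rv-▷ s t′ x rx))
    where
    go : Rv (conj s t) (s ▷ v) ⊎ (Rv (conj s t) v × s ▷ v ≋ neg v) → Rv (conj s t′) (s ▷ x) ⊎ (Rv (conj s t′) x × s ▷ x ≋ neg x) → E (c ++ [ s ]) (s ▷ v) (s ▷ x) ≡ 0ℤ
    go (inj₁ a) (inj₁ b) = o _ _ a b
    go (inj₂ (a , e)) (inj₁ b) = neg-0 (trans (E-≋ (c ++ [ s ]) {x = s ▷ x} e ≋-refl) (E-negˡ (c ++ [ s ]) v (s ▷ x))) (o _ _ a b)
    go (inj₁ a) (inj₂ (b , e)) = neg-0 (trans (E-≋ (c ++ [ s ]) {s ▷ v} ≋-refl e) (E-negʳ (c ++ [ s ]) (s ▷ v) x)) (o _ _ a b)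
    go (inj₂ (a , e)) (inj₂ (b , e′)) = neg-0 (trans (E-≋ (c ++ [ s ]) e e′) (trans (E-negˡ (c ++ [ s ]) v (neg x)) (cong -_ (E-negʳ (c ++ [ s ]) v x)))) (trans (cong -_ (o _ _ a b)) refl)

  -- The labels at w form an exceptional sequence.
  Label-orth : ∀ {c w t t′} → Unique c → S c w → Label c w t → Label c w t′ → t ≢ t′ → Orth c t t′ ⊎ Orth c t′ t
  Label-orth u (nil refl) (inj₂ y) _ _ = ⊥-elim (Inv-e _ (Cov⇒Inv y))
  Label-orth u (nil refl) (inj₁ ()) _ _
  Label-orth {t = t} {t′} u (skip {s} {c} {w} ¬i x) y y′ ne = go (tail y) (tail y′)
    where
    tail : ∀ {t} → Label (s ∷ c) w t → t ≡ gen s ⊎ Label c w t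
    tail (inj₁ (here _ p)) = inj₁ p
    tail (inj₁ (skip _ z)) = inj₂ (inj₁ z)
    tail (inj₁ (take i _ _)) = ⊥-elim (¬i i)
    tail (inj₂ z) = inj₂ (inj₂ z)
    first : ∀ {r} → Label c w r → Orth (s ∷ c) r (gen s)
    first z v a rv ra = trans (E-first (uniq∉ u) v (At-Rv ra)) (dot-0ˡ κ _ (Label-Tin x z v rv s (uniq∉ u)))
    both : ∀ {r r′} → Label c w r → Orth c r r′ → Orth (s ∷ c) r r′
    both z o v a rv ra = trans (E-skip c s a (Label-Tin x z v rv s (uniq∉ u))) (o v a rv ra)
    go : t ≡ gen s ⊎ Label c w t → t′ ≡ gen s ⊎ Label c w t′ → Orth (s ∷ c) t t′ ⊎ Orth (s ∷ c) t′ t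
    go (inj₁ p) (inj₁ q) = ⊥-elim (ne (trans p (sym q)))
    go (inj₁ refl) (inj₂ z) = inj₂ (first z)
    go (inj₂ z) (inj₁ refl) = inj₁ (first z)
    go (inj₂ z) (inj₂ z′) with Label-orth (uniq-tail u) x z z′ ne
    ... | inj₁ o = inj₁ (both z o)
    ... | inj₂ o = inj₂ (both z′ o)
  Label-orth {t = t} {t′} u D@(take {s} {c} i x) y y′ ne with Label-orth (uniq-rot u) x (Label-rot u D i y) (Label-rot u D i y′)
       (λ p → ne (trans (sym (conj² s t)) (trans (cong (conj s) p) (conj² s t′))))
  ... | inj₁ o = inj₁ (Orth-rot u (Label-Tin D y) (Label-Tin D y′) o)
  ... | inj₂ o = inj₂ (Orth-rot u (Label-Tin D y′) (Label-Tin D y) o)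

  -- If s and t ≠ s are cover reflections of w then the form is nonpositive on (α_s, t).
  cover-pair : ∀ {w s t v} → Cov w (gen s) → Cov w t → t ≢ gen s → Rv t v → ∀ k → v s k ℤ.≤ (s ▷ v) s k
  cover-pair {w} {s} {t} {v} cs (q′ , ¬p′ , teq) ne rv@(g , i , l , l< , pg , geq , veq) with Cov-s⁻ cs
  ... | q , ¬p , eq = λ k → subst (v s k ℤ.≤_) (sym (moved s k)) (ℤₚ.≤-trans (ℤₚ.≤-reflexive (sym (ℤₚ.+-identityʳ _))) (ℤₚ.+-monoʳ-≤ (v s k) (extra s k)))
    where
    q≢ : q ≢ q′
    q≢ r = ne (trans teq (trans (cong (ref w) (sym r)) (sym (ref-unique (gen s) w q eq))))
    h : G
    h = w ⁻¹ ∙ g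
    y : V
    y = neg (w ⁻¹ ⋆ v)
    y-bd : Bd y
    y-bd j k r = cong -_ (⋆-bounded (w ⁻¹) (Rv-Bd rv) j k r)
    ¬ph : ¬ P h i
    ¬ph = inv-root⇒ w g i pg (subst (Inv w) geq (Cov⇒Inv (q′ , ¬p′ , teq)))
    y-Rv : Rv (gen q′) y
    y-Rv = h ∙ gen i , i , l , l< , ¬P-flip h i ¬ph , ref-unique _ _ _ req ,
      λ j k → sym (trans (⋆-∙gen h i (α-bounded i l<) j k) (trans (⋆-cong h (▷-αv i (unit l)) j k) (trans (⋆-neg h (α i l) j k) (cong -_ (trans (⋆-∙ (w ⁻¹) g (α-bounded i l<) j k) (⋆-cong (w ⁻¹) (≋-sym veq) j k))))))
      where
      wg : gen q′ ∙ h ≡ h ∙ gen i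
      wg = trans (sym (assoc _ _ _)) (trans (cong (_∙ g) (trans (sym (cancel⁻ˡ w _)) (trans (cong (w ⁻¹ ∙_) (trans (sym (assoc _ _ _)) (trans (cong (_∙ w ⁻¹) (sym (ref-self w q′))) (trans (cancelʳ _ w) (sym teq))))) refl)))
             (trans (assoc _ _ _) (trans (cong (w ⁻¹ ∙_) (trans (cong (_∙ g) geq) (ref-self g i))) (sym (assoc _ _ _)))))
      req : gen q′ ∙ (h ∙ gen i) ≡ h ∙ gen i ∙ gen i
      req = trans (sym (assoc _ _ _)) (cong (_∙ gen i) wg)
    v≋ : v ≋ neg (w ⋆ y)
    v≋ = ≋-trans (≋-sym (≋-trans (≋-sym (⋆-∙ w (w ⁻¹) (Rv-Bd rv))) (subst (λ z → z ⋆ v ≋ v) (sym (invʳ w)) (⋆-e (Rv-Bd rv)))))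
           (λ j k → sym (trans (cong -_ (⋆-neg w (w ⁻¹ ⋆ v) j k)) (ℤₚ.neg-involutive _)))
    z : Row
    z = Nb q y
    fired : q ▷ y ≋ y ⊕ αv q z
    fired j k with q Finₚ.≟ j
    ... | no r = trans (▷-off y k r) (sym (trans (cong (λ a → y j k ℤ.+ a) (αv-off z k r)) (ℤₚ.+-identityʳ _)))
    ... | yes refl = trans (▷-at q y k) (trans (cong (ℤ._+ z k) (trans (cong -_ y0) (sym y0))) (cong (λ a → y q k ℤ.+ a) (sym (αv-at q z k))))
      where
      y0 : y q k ≡ 0ℤ
      y0 = At-Rv y-Rv q (λ r → q≢ (sym r)) k
    moved : s ▷ v ≋ v ⊕ neg (w ⋆ αv q z)
    moved j k = trans (▷-cong s v≋ j k) (trans (▷-neg s (w ⋆ y) j k) (trans (cong -_ (trans (sym (⋆-gen∙ s w y-bd j k)) (trans (cong (λ a → (a ⋆ y) j k) eq) (trans (⋆-∙gen w q y-bd j k) (trans (⋆-cong w fired j k) (⋆-⊕ w y (αv q z) j k))))))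
      (trans (ℤₚ.neg-distrib-+ ((w ⋆ y) j k) ((w ⋆ αv q z) j k)) (cong (ℤ._+ (- (w ⋆ αv q z) j k)) (sym (v≋ j k))))))
    extra : NN (neg (w ⋆ αv q z))
    extra = NN-resp (≋-trans (⋆-∙gen w q (αv-bounded q (Nb-bounded q y-bd))) (≋-trans (⋆-cong w (▷-αv q z)) (⋆-neg w (αv q z))))
      (NN-cone (w ∙ gen q) q (λ k k< → positive (w ∙ gen q) q (¬P-flip w q ¬p) k k<) z (λ k → sumL≥0 (allFin n) (λ j → Path.X≥0 (M q j) (Rv-NN y-Rv j) k)) (Nb-bounded q y-bd))

  -- The labels s and t are orthogonal in one of the two orders. E(t, s) = 0 says directly that t
  -- has no coordinate at s. If E(s, t) = 0, that coordinate equals the sum over its neighbours, and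
  -- `cover-pair` then bounds it above by zero.
  Cov-initial : ∀ {c s w t} → Unique (s ∷ c) → S (s ∷ c) w → Cov w (gen s) → Cov w t → t ≢ gen s → Tin c t
  Cov-initial {c} {s} {w} {t} u x cs ct ne v rv j j∉ with s Finₚ.≟ j
  ... | no s≢j = S-Tin x (Cov⇒Inv ct) v rv j (λ { (here q) → s≢j (sym q) ; (there q) → j∉ q })
  ... | yes refl = λ k → go k (Label-orth u x (inj₂ cs) (inj₂ ct) (λ q → ne (sym q))) (k ℕₚ.<? κ)
    where
    supp : Supp (s ∷ c) v
    supp = Supp-Tin (S-Tin x (Cov⇒Inv ct)) rv
    arith : ∀ a b → a ℤ.- b ≡ 0ℤ → a ℤ.≤ (- a) ℤ.+ b → 0ℤ ℤ.≤ - a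
    arith a b p q = subst (λ z → 0ℤ ℤ.≤ z) (h₁ a b p) (ℤₚ.i≤j⇒0≤j-i q)
      where
      h₂ : ∀ a b → (- a) ℤ.+ b ℤ.- a ≡ (- a) ℤ.- (a ℤ.- b)
      h₂ = solve-∀
      h₁ : ∀ a b → a ℤ.- b ≡ 0ℤ → (- a) ℤ.+ b ℤ.- a ≡ - a
      h₁ a b p = trans (h₂ a b) (trans (cong (λ z → (- a) ℤ.- z) p) (ℤₚ.+-identityʳ _))
    go : ∀ k → Orth (s ∷ c) (gen s) t ⊎ Orth (s ∷ c) t (gen s) → Dec (k < κ) → v s k ≡ 0ℤ
    go k _ (no k≥) = Rv-Bd rv s k (ℕₚ.≮⇒≥ k≥)
    go k (inj₂ o) (yes k<) = trans (sym (E-α (uniq∉ u) v k k<)) (o v (α s k) rv (Rv-gen s k k<))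
    go k (inj₁ o) (yes k<) = squeeze _ (Rv-NN rv s k) (arith (v s k) (Nbc c s v k)
        (trans (sym (dot-unit κ k (v s ⊟ Nbc c s v) k<)) (trans (dot-cong κ (λ q → sym (αv-at s (unit k) q)) (λ _ → refl)) (trans (sym (E-first′ (uniq∉ u) v (At-Rv (Rv-gen s k k<)))) (o (α s k) v (Rv-gen s k k<) rv))))
        (subst (v s k ℤ.≤_) (trans (▷-at s v k) (cong (λ z → (- v s k) ℤ.+ z) (Nb-restrict u supp k))) (cover-pair cs ct ne rv k)))

-- Joins with the initial letter, projections, and elements that avoid cover reflections.

injective⇒surjective : ∀ {k} (f : Fin k → Fin k) → Injective _≡_ _≡_ f → ∀ y → ∃[ x ] f x ≡ y
injective⇒surjective {suc k} f inj y with Finₚ.any? (λ x → f x Finₚ.≟ y)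
... | yes p = p
... | no ¬p = ⊥-elim (ℕₚ.1+n≰n (Finₚ.injective⇒≤ {f = λ x → Fin.punchOut (ne x)} (λ {a} {b} q → inj (Finₚ.punchOut-injective (ne a) (ne b) q))))
  where
  ne : ∀ x → y ≢ f x
  ne x q = ¬p (x , sym q)

module Joins {n : ℕ} (m : Fin n → Fin n → ℕ) (cox : IsCoxeterMatrix m) (T : Words.Table m) where
  open Labels m cox T public

  Inv-gen : ∀ {s t} → Inv (gen s) t → t ≡ gen s
  Inv-gen {s} {t} i with t ≟G gen s
  ... | yes p = p
  ... | no ne = ⊥-elim (Inv-e _ (Inv-conj⇒ s e t ne (subst (λ z → Inv z t) (sym (idʳ (gen s))) i)))

  Inv-gen-self : ∀ s → Inv (gen s) (gen s)
  Inv-gen-self s = subst (λ z → Inv z (gen s)) (idʳ (gen s)) (Inv-s⇒ s e (Inv-e _))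

  gen⊑ : ∀ {s w} → Inv w (gen s) → gen s ⊑ w
  gen⊑ {s} {w} i t j = subst (Inv w) (sym (Inv-gen j)) i

  S-e : ∀ c → S c e
  S-e [] = nil refl
  S-e (a ∷ c) = skip (Inv-e _) (S-e c)

  abstract
    ⊑⇒ℓ-rec : ∀ b u w → ℓ u < b → u ⊑ w → ℓ u ≤ ℓ w
    ⊑⇒ℓ-rec (suc b) u w (s≤s l) p with u ≟G e
    ... | yes refl = subst (_≤ ℓ w) (sym ℓ-e) z≤n
    ... | no ne = step (left-descent u ne)
      where
      step : ∃[ a ] Inv u (gen a) → ℓ u ≤ ℓ w
      step (a , i) = ℕₚ.≤-trans (subst (λ q → ℓ q ≤ suc (ℓ (gen a ∙ u))) (gg a u) (ℓ-gen∙ a (gen a ∙ u)))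
        (ℕₚ.≤-trans (s≤s (⊑⇒ℓ-rec b (gen a ∙ u) (gen a ∙ w) (ℕₚ.<-≤-trans (proj₂ i) l) (⊑-down a i p))) (proj₂ (p _ i)))

    ∣-ℓ : ∀ c y → ℓ (y ∣ c) ≤ ℓ y
    ∣-ℓ c y = ⊑⇒ℓ-rec (suc (ℓ (y ∣ c))) (y ∣ c) y ℕₚ.≤-refl (∣⊑ c y)

    rotate< : ∀ {b} c s {w} → Inv w (gen s) → length c ℕ.+ ℓ w < b → length (c ++ [ s ]) ℕ.+ ℓ (gen s ∙ w) < b
    rotate< c s {w} i l = ℕₚ.≤-<-trans (ℕₚ.≤-trans (ℕₚ.≤-reflexive (cong (ℕ._+ ℓ (gen s ∙ w)) (trans (Listₚ.length-++ c) (ℕₚ.+-comm (length c) 1)))) (ℕₚ.+-monoʳ-< (length c) (proj₂ i))) l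

  private
    S? : ∀ b c w → length c ℕ.+ ℓ w < b → Dec (S c w)
    S? (suc b) [] w _ with w ≟G e
    ... | yes p = yes (nil p)
    ... | no ne = no λ { (nil p) → ne p }
    S? (suc b) (s ∷ c) w (s≤s l) with Inv? w (gen s)
    ... | no ¬i = map′ (skip ¬i) (λ x → S-skip x ¬i) (S? b c w l)
    ... | yes i = map′ (take i) (λ x → S-take x i) (S? b (c ++ [ s ]) (gen s ∙ w) (rotate< c s i l))

  decS : ∀ c w → Dec (S c w)
  decS c w = S? (suc (length c ℕ.+ ℓ w)) c w ℕₚ.≤-refl

  module _ {c : List (Fin n)} {s : Fin n} (u : Unique (s ∷ c)) where

    -- By `Cov-initial` each cover reflection of v is s or lies in the subgroup of c, hence belongs
    -- to `gen s` or to `v ∣ c`. So v is the join of these two.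
    least-above : ∀ {v x} → S (c ++ [ s ]) v → Inv v (gen s) → Inv x (gen s) → v ∣ c ⊑ x → v ⊑ x
    least-above {v} {x} y i ix p = ⊑-by-covers below
      where
      sf = S-final u y i
      below : ∀ t → Cov v t → ∃[ z ] (z ⊑ v × z ⊑ x × Inv z t)
      below t ct with t ≟G gen s
      ... | yes refl = gen s , gen⊑ i , gen⊑ ix , Inv-gen-self s
      ... | no ne = v ∣ c , ∣⊑ c v , p , ∣⇐ c v (Cov⇒Inv ct) (Cov-initial u (proj₂ (proj₂ sf)) (proj₁ sf) ct ne)

    -- Elements above s lose it and the others gain it, so whether s is in the image tells which
    -- case occurred. In the first case `least-above` recovers v from its part in c.
    φ : G → G
    φ v with Inv? v (gen s)
    ... | yes _ = v ∣ c
    ... | no _ = gen s ∙ v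

    φ-yes : ∀ {v} → Inv v (gen s) → φ v ≡ v ∣ c
    φ-yes {v} i with Inv? v (gen s)
    ... | yes _ = refl
    ... | no ¬i = ⊥-elim (¬i i)

    φ-no : ∀ {v} → ¬ Inv v (gen s) → φ v ≡ gen s ∙ v
    φ-no {v} ¬i with Inv? v (gen s)
    ... | yes i = ⊥-elim (¬i i)
    ... | no _ = refl

    ¬s∣ : ∀ v → ¬ Inv (v ∣ c) (gen s)
    ¬s∣ v = Gen⇒¬Inv (uniq∉ u) (∣-gen c v)

    take-s : ∀ {v} → ¬ Inv v (gen s) → S (c ++ [ s ]) v → S (s ∷ c) (gen s ∙ v)
    take-s {v} ¬i x = take (Inv-s⇒ s v ¬i) (subst (S (c ++ [ s ])) (sym (gg s v)) x)

    φ-S : ∀ {v} → S (c ++ [ s ]) v → S (s ∷ c) (φ v)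
    φ-S {v} x with Inv? v (gen s)
    ... | yes i = S-weaken (uniq∉ u) (S-par-last u x)
    ... | no ¬i = take-s ¬i x

    φ-inj : ∀ {v v′} → S (c ++ [ s ]) v → S (c ++ [ s ]) v′ → φ v ≡ φ v′ → v ≡ v′
    φ-inj {v} {v′} x x′ = go (Inv? v (gen s)) (Inv? v′ (gen s))
      where
      go : Dec (Inv v (gen s)) → Dec (Inv v′ (gen s)) → φ v ≡ φ v′ → v ≡ v′
      go (yes i) (yes i′) p = ⊑-antisym (least-above x i i′ (subst (_⊑ v′) (sym q) (∣⊑ c v′))) (least-above x′ i′ i (subst (_⊑ v) q (∣⊑ c v)))
        where
        q : v ∣ c ≡ v′ ∣ c
        q = trans (sym (φ-yes i)) (trans p (φ-yes i′))
      go (no ¬i) (no ¬i′) p = ∙-injˡ (gen s) (trans (sym (φ-no ¬i)) (trans p (φ-no ¬i′)))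
      go (yes i) (no ¬i′) p = ⊥-elim (¬s∣ v (subst (λ z → Inv z (gen s)) (trans (sym (φ-no ¬i′)) (trans (sym p) (φ-yes i))) (Inv-s⇒ s v′ ¬i′)))
      go (no ¬i) (yes i′) p = ⊥-elim (¬s∣ v′ (subst (λ z → Inv z (gen s)) (trans (sym (φ-no ¬i)) (trans p (φ-yes i′))) (Inv-s⇒ s v ¬i)))

  uniq-unrot : ∀ {c : List (Fin n)} {s} → Unique (c ++ [ s ]) → Unique (s ∷ c)
  uniq-unrot {[]} _ = [] ∷ []
  uniq-unrot {a ∷ c} {s} (v ∷ w) with uniq-unrot {c} w
  ... | x ∷ y = ((λ q → All.lookup v (∈-++⁺ʳ c (here refl)) (sym q)) ∷ x) ∷ (All.tabulate (λ j∈ → All.lookup v (∈-++⁺ˡ j∈)) ∷ y)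

  -- Moving the letters of reverse r one after the other to the front.
  private
    split : ∀ (c : List (Fin n)) s r → c ++ reverse (s ∷ r) ≡ (c ++ reverse r) ++ [ s ]
    split c s r = trans (cong (c ++_) (Listₚ.unfold-reverse s r)) (sym (Listₚ.++-assoc c (reverse r) [ s ]))

    unsplit : ∀ (c : List (Fin n)) s r → reverse r ++ (s ∷ c) ≡ reverse (s ∷ r) ++ c
    unsplit c s r = trans (sym (Listₚ.++-assoc (reverse r) [ s ] c)) (cong (_++ c) (sym (Listₚ.unfold-reverse s r)))

    uq : ∀ {c s r} → Unique (c ++ reverse (s ∷ r)) → Unique (s ∷ (c ++ reverse r))
    uq {c} {s} {r} u = uniq-unrot (subst Unique (split c s r) u)

    chain : ∀ r c → Unique (c ++ reverse r) → G → G
    chain [] c u v = v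
    chain (s ∷ r) c u v = chain r (s ∷ c) (uq {c} {s} {r} u) (φ (uq {c} {s} {r} u) v)

    chain-S : ∀ r c u {v} → S (c ++ reverse r) v → S (reverse r ++ c) (chain r c u v)
    chain-S [] c u x = subst (λ d → S d _) (Listₚ.++-identityʳ c) x
    chain-S (s ∷ r) c u {v} x = subst (λ d → S d (chain (s ∷ r) c u v)) (unsplit c s r) (chain-S r (s ∷ c) (uq {c} {s} {r} u) (φ-S (uq {c} {s} {r} u) (subst (λ d → S d v) (split c s r) x)))

    chain-inj : ∀ r c u {v v′} → S (c ++ reverse r) v → S (c ++ reverse r) v′ → chain r c u v ≡ chain r c u v′ → v ≡ v′
    chain-inj [] c u x x′ p = p
    chain-inj (s ∷ r) c u {v} {v′} x x′ p = φ-inj U y y′ (chain-inj r (s ∷ c) U (φ-S U y) (φ-S U y′) p)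
      where
      U : Unique (s ∷ (c ++ reverse r))
      U = uq {c} {s} {r} u
      y : S ((c ++ reverse r) ++ [ s ]) v
      y = subst (λ d → S d v) (split c s r) x
      y′ : S ((c ++ reverse r) ++ [ s ]) v′
      y′ = subst (λ d → S d v′) (split c s r) x′

    onto : ∀ d (f : G → G) → (∀ {v} → S d v → S d (f v)) → (∀ {v v′} → S d v → S d v′ → f v ≡ f v′ → v ≡ v′) →
           ∀ {y} → S d y → ∃[ x ] (S d x × f x ≡ y)
    onto d f f-S f-inj {y} Sy = finish (injective⇒surjective h h-inj y)
      where
      -- Extended by the identity, `f` becomes a self-map of the whole finite group; it stays
      -- injective because `f` does not leave the sortable elements.
      h′ : ∀ v → Dec (S d v) → G
      h′ v (yes _) = f v
      h′ v (no _) = v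
      h : G → G
      h v = h′ v (decS d v)
      inj′ : ∀ {a b} (p : Dec (S d a)) (q : Dec (S d b)) → h′ a p ≡ h′ b q → a ≡ b
      inj′ (yes x) (yes x′) r = f-inj x x′ r
      inj′ (no _) (no _) r = r
      inj′ (yes x) (no ¬x) r = ⊥-elim (¬x (subst (S d) r (f-S x)))
      inj′ (no ¬x) (yes x) r = ⊥-elim (¬x (subst (S d) (sym r) (f-S x)))
      h-inj : Injective _≡_ _≡_ h
      h-inj {a} {b} = inj′ (decS d a) (decS d b)
      finish : ∃[ x ] h x ≡ y → ∃[ x ] (S d x × f x ≡ y)
      finish (x , p) = go (decS d x) p
        where
        go : (q : Dec (S d x)) → h′ x q ≡ y → ∃[ x ] (S d x × f x ≡ y)
        go (yes z) r = x , z , r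
        go (no ¬z) r = ⊥-elim (¬z (subst (S d) (sym r) Sy))

    φ-onto : ∀ {c s} (u : Unique (s ∷ c)) {y} → S (s ∷ c) y → ∃[ x ] (S (c ++ [ s ]) x × φ u x ≡ y)
    φ-onto {c} {s} u {y} Sy = finish (onto (c ++ [ s ]) (λ v → chain r [ s ] u′ (φ u v))
          (λ {v} x → subst (λ d → S (d ++ [ s ]) (chain r [ s ] u′ (φ u v))) rr (chain-S r [ s ] u′ (toʳ (φ-S u x))))
          (λ x x′ p → φ-inj u x x′ (chain-inj r [ s ] u′ (toʳ (φ-S u x)) (toʳ (φ-S u x′)) p))
          (subst (λ d → S (d ++ [ s ]) (chain r [ s ] u′ y)) rr (chain-S r [ s ] u′ (toʳ Sy))))
      where
      r : List (Fin n)
      r = reverse c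
      rr : reverse r ≡ c
      rr = Listₚ.reverse-involutive c
      u′ : Unique ([ s ] ++ reverse r)
      u′ = subst (λ d → Unique (s ∷ d)) (sym rr) u
      toʳ : ∀ {v} → S (s ∷ c) v → S (s ∷ reverse r) v
      toʳ {v} = subst (λ d → S (s ∷ d) v) (sym rr)
      finish : ∃[ x ] (S (c ++ [ s ]) x × chain r [ s ] u′ (φ u x) ≡ chain r [ s ] u′ y) → ∃[ x ] (S (c ++ [ s ]) x × φ u x ≡ y)
      finish (x , z , p) = x , z , chain-inj r [ s ] u′ (toʳ (φ-S u z)) (toʳ Sy) p

  record Join (c : List (Fin n)) (s : Fin n) (a : G) : Set where
    field
      join : G
      last : S (c ++ [ s ]) join
      first : S (s ∷ c) join
      cover : Cov join (gen s)
      part : join ∣ c ≡ a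
      least : ∀ x → Inv x (gen s) → a ⊑ x → join ⊑ x

    s∈ : Inv join (gen s)
    s∈ = Cov⇒Inv cover

    a⊑ : a ⊑ join
    a⊑ = subst (_⊑ join) part (∣⊑ c join)

  -- Rotating through the whole word, φ is an injection of the sortable elements into themselves,
  -- hence each φ is onto, which gives the join of s with any sortable element of the parabolic subgroup.
  abstract
    joins : ∀ {c s a} → Unique (s ∷ c) → S c a → Join c s a
    joins {c} {s} {a} u x = build (φ-onto u (S-weaken (uniq∉ u) x))
      where
      ¬sa : ¬ Inv a (gen s)
      ¬sa = Gen⇒¬Inv (uniq∉ u) (S-Gen x)
      build : ∃[ v ] (S (c ++ [ s ]) v × φ u v ≡ a) → Join c s a
      build (v , y , p) = go (Inv? v (gen s))
        where
        go : Dec (Inv v (gen s)) → Join c s a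
        go (no ¬i) = ⊥-elim (¬sa (subst (λ z → Inv z (gen s)) (trans (sym (φ-no u ¬i)) p) (Inv-s⇒ s v ¬i)))
        go (yes i) = record { join = v ; last = y ; first = proj₂ (proj₂ (S-final u y i)) ; cover = proj₁ (S-final u y i)
                            ; part = q ; least = λ x ix ax → least-above u y i ix (subst (_⊑ x) (sym q) ax) }
          where
          q : v ∣ c ≡ a
          q = trans (sym (φ-yes u i)) p

  join-unique : ∀ {c s v} → Unique (s ∷ c) → S (s ∷ c) v → Cov v (gen s) → (J : Join c s (v ∣ c)) → v ≡ Join.join J
  join-unique {c} {s} {v} u x cv J = ⊑-antisym (least-above u (S-final⁻ u x cv) (Cov⇒Inv cv) (Join.s∈ J) (Join.a⊑ J))
    (Join.least J v (Cov⇒Inv cv) (∣⊑ c v))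

  -- `proj` is the image of `y` under Reading's downward projection. The field `up-outside` rides
  -- along for `co-atom` and `theta`, where y is a complement and its non-inversions are known.
  record Proj (c : List (Fin n)) (y : G) : Set where
    field
      proj : G
      sortable : S c proj
      below : proj ⊑ y
      greatest : ∀ v → S c v → v ⊑ y → v ⊑ proj
      up-outside : ∀ γ → Up c proj γ → ¬ Inv y γ

  private
    project-rec : ∀ b c y → length c ℕ.+ ℓ y < b → Unique c → Proj c y
    project-rec b [] y _ u = record { proj = e ; sortable = nil refl ; below = e⊑ y ; greatest = λ { v (nil refl) _ t i → i } ; up-outside = λ γ () }
    project-rec (suc b) (s ∷ c) y (s≤s l) u = go (Inv? y (gen s))
      where
      go : Dec (Inv y (gen s)) → Proj (s ∷ c) y
      go (yes i) = record { proj = gen s ∙ z ; sortable = take-s u ¬sz (Proj.sortable R) ; below = ⊑-up′ s i (Proj.below R) ; greatest = gr ; up-outside = up }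
        where
        R : Proj (c ++ [ s ]) (gen s ∙ y)
        R = project-rec b (c ++ [ s ]) (gen s ∙ y) (rotate< c s i l) (uniq-rot u)
        z : G
        z = Proj.proj R
        ¬sz : ¬ Inv z (gen s)
        ¬sz j = Inv-s⇐ s y i (Proj.below R _ j)
        gr-s : ∀ v → S (s ∷ c) v → v ⊑ y → Inv v (gen s) → v ⊑ gen s ∙ z
        gr-s v x p j = subst (_⊑ gen s ∙ z) (gg s v) (⊑-up s ¬sz (Proj.greatest R _ (S-take x j) (⊑-down s j p)))
        gr : ∀ v → S (s ∷ c) v → v ⊑ y → v ⊑ gen s ∙ z
        gr v x p with Inv? v (gen s)
        ... | yes j = gr-s v x p j
        -- y contains s, so the join of s and v is still below y and can be compared after rotation,
        -- as v cannot.
        ... | no ¬j = ⊑-trans (Join.a⊑ J) (gr-s (Join.join J) (Join.first J) (Join.least J y i p) (Join.s∈ J))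
          where
          J : Join c s v
          J = joins u (S-skip x ¬j)
        up : ∀ γ → Up (s ∷ c) (gen s ∙ z) γ → ¬ Inv y γ
        up γ (here ¬j _) _ = ¬j (Inv-s⇒ s z ¬sz)
        up γ (skip ¬j _) _ = ¬j (Inv-s⇒ s z ¬sz)
        up γ (take _ ne x) k = Proj.up-outside R (conj s γ) (subst (λ q → Up (c ++ [ s ]) q (conj s γ)) (gg s z) x)
            (Inv-conj⇐ s y (conj s γ) (conj-≢ ne) (subst (Inv y) (sym (conj² s γ)) k))
      go (no ¬i) = record { proj = z ; sortable = S-weaken (uniq∉ u) (Proj.sortable R) ; below = ⊑-trans (Proj.below R) (∣⊑ c y) ; greatest = gr ; up-outside = up }
        where
        R : Proj c (y ∣ c)
        R = project-rec b c (y ∣ c) (ℕₚ.≤-<-trans (ℕₚ.+-monoʳ-≤ (length c) (∣-ℓ c y)) l) (uniq-tail u)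
        z : G
        z = Proj.proj R
        gr : ∀ v → S (s ∷ c) v → v ⊑ y → v ⊑ z
        gr v x p = Proj.greatest R v x′ (∣-greatest c (λ t → S-Tin x′) p)
          where
          x′ : S c v
          x′ = S-skip x (λ j → ¬i (p _ j))
        up : ∀ γ → Up (s ∷ c) z γ → ¬ Inv y γ
        up γ (here _ refl) = ¬i
        up γ (skip _ x) k = Proj.up-outside R γ x (∣⇐ c y k (Up-Tin x))
        up γ (take j _ _) _ = ¬i (∣⇒Inv c y (Proj.below R _ j))

  abstract
    project : ∀ {c} → Unique c → ∀ y → Proj c y
    project {c} u y = project-rec (suc (length c ℕ.+ ℓ y)) c y ℕₚ.≤-refl u

  -- A sortable element is determined from below by its cover reflections. If z lacked the initial
  -- letter s of x, z would lie in the subgroup of c, and with it all cover reflections of x and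
  -- therefore x.
  ⊑-by-Cov : ∀ {c x z} → Unique c → S c x → S c z → (∀ t → Cov x t → Inv z t) → x ⊑ z
  ⊑-by-Cov u (nil refl) _ f = e⊑ _
  ⊑-by-Cov {z = z} u (skip {s} {c} ¬i x) y f = ⊑-trans (⊑-by-Cov (uniq-tail u) x (S-par-first u y) (λ t ct → ∣⇐ c z (f t ct) (S-Tin x (Cov⇒Inv ct)))) (∣⊑ c z)
  ⊑-by-Cov {x = x₀} {z} u (take {s} {c} i x) y f with Inv? z (gen s)
  ... | yes j = subst (_⊑ z) (gg s x₀) (⊑-up′ s j (⊑-by-Cov (uniq-rot u) x (S-take y j) g))
    where
    g : ∀ t → Cov (gen s ∙ x₀) t → Inv (gen s ∙ z) t
    g t ct = Inv-conj⇐ s z t t≢ (f _ (Cov-up (conj-≢ t≢) (subst (Cov (gen s ∙ x₀)) (sym (conj² s t)) ct)))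
      where
      t≢ : t ≢ gen s
      t≢ p = Inv-s⇐ s x₀ i (subst (Inv (gen s ∙ x₀)) p (Cov⇒Inv ct))
  ... | no ¬j = ⊥-elim (Gen⇒¬Inv (uniq∉ u) (Cov⊆Tin⇒Gen c (λ t ct → S-Tin (S-skip y ¬j) (f t ct))) i)

  private
    ≤0-first : ∀ {c s γ v x} → Unique (s ∷ c) → γ ≢ gen s → Tin (s ∷ c) γ → Rv (gen s) v → Rv γ x → E (s ∷ c) v x ℤ.≤ 0ℤ
    ≤0-first {c} {s} {γ} {v} {x} u ne z rv rx = subst (ℤ._≤ 0ℤ) (sym (trans (sym (E-rotate u (Supp-Tin (Tin-gen (here refl)) rv) (Supp-Tin z rx)))
       (trans (E-last (uniq∉ u) (s ▷ x) (λ k nk q → trans (▷-At (At-Rv rv) k q) (cong -_ (At-Rv rv k nk q))))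
                    (trans (dot-cong κ (▷-At (At-Rv rv) s) (λ _ → refl)) (dot-⊖ˡ κ (v s) _))))) (ℤₚ.neg-mono-≤ (dot≥0 κ (Rv-NN rv s) (Rv-NN (Rv-conj s ne rx) s)))

  -- The counterpart of `Up-≤0` with a cover reflection of w in place of an upper label. If v lacks
  -- s and γ is not s, v is replaced by its join with s, which remains below the lower cover of w
  -- that loses γ.
  Cov-≤0 : ∀ {c w v γ t y x} → Unique c → S c w → S c v → v ⊑ w → Cov w γ → ¬ Inv v γ → Inv v t → Rv t y → Rv γ x → E c y x ℤ.≤ 0ℤ
  Cov-≤0 u (nil refl) _ _ cγ _ _ _ _ = ⊥-elim (Inv-e _ (Cov⇒Inv cγ))
  Cov-≤0 {y = y} {x} u (skip {s} {c} ¬i D) Sv p cγ ¬γ i ry rx =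
    subst (ℤ._≤ 0ℤ) (sym (E-skip c s x (S-Tin Sv′ i y ry s (uniq∉ u)))) (Cov-≤0 (uniq-tail u) D Sv′ p cγ ¬γ i ry rx)
    where Sv′ = S-skip Sv (λ j → ¬i (p _ j))
  Cov-≤0 {w = w} {v} {γ} {t} {y} {x} u W@(take {s} {c} iw D) Sv p cγ ¬γ i ry rx with γ ≟G gen s
  ... | yes refl = ℤₚ.≤-reflexive (trans (E-first (uniq∉ u) y (At-Rv rx)) (dot-0ˡ κ _ (S-Tin (S-skip Sv ¬γ) i y ry s (uniq∉ u))))
  ... | no ne = go (Inv? v (gen s))
    where
    with-s : ∀ {v} → S (s ∷ c) v → v ⊑ w → ¬ Inv v γ → Inv v t → Inv v (gen s) → E (s ∷ c) y x ℤ.≤ 0ℤ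
    with-s {v} Sv p ¬γ i j with t ≟G gen s
    ... | yes refl = ≤0-first u ne (S-Tin W (Cov⇒Inv cγ)) ry rx
    ... | no nt = subst (ℤ._≤ 0ℤ) (E-rotate u (Supp-Tin (S-Tin Sv i) ry) (Supp-Tin (S-Tin W (Cov⇒Inv cγ)) rx))
          (Cov-≤0 (uniq-rot u) D (S-take Sv j) (⊑-down s j p) (Cov-down ne cγ)
            (λ k → ¬γ (subst (λ q → Inv q γ) (gg s v) (Inv-conj⇐ s (gen s ∙ v) γ ne k)))
            (Inv-conj⇐ s v (conj s t) (conj-≢ nt) (subst (Inv v) (sym (conj² s t)) i)) (Rv-conj s nt ry) (Rv-conj s ne rx))
    go : Dec (Inv v (gen s)) → E (s ∷ c) y x ℤ.≤ 0ℤ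
    go (yes j) = with-s Sv p ¬γ i j
    go (no ¬j) = with-s (Join.first J) (⊑-trans e⊑wq (∙gen⊑ ¬q)) (λ k → ¬Inv-right w q ¬q (e⊑wq _ (subst (Inv (Join.join J)) γ≡ k))) (Join.a⊑ J t i) (Join.s∈ J)
      where
      J : Join c s v
      J = joins u (S-skip Sv ¬j)
      q : Fin n
      q = proj₁ cγ
      ¬q : ¬ P w q
      ¬q = proj₁ (proj₂ cγ)
      γ≡ : γ ≡ ref w q
      γ≡ = proj₂ (proj₂ cγ)
      e⊑wq : Join.join J ⊑ w ∙ gen q
      e⊑wq = Join.least J _ (Inv-right⇐ w q (gen s) (λ r → ne (trans γ≡ (sym r))) iw) (drop p (λ k → ¬γ (subst (Inv v) (sym γ≡) k)))

  -- Restricting the lower cover of w that loses t removes only t from `w ∣ c`, so t has to be the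
  -- cover reflection that `missing-cov` finds.
  Cov-∣ : ∀ {c w t} → Cov w t → Tin c t → Cov (w ∣ c) t
  Cov-∣ {c} {w} {t} (q , ¬p , refl) z = go (missing-cov (∣-mono c (∙gen⊑ ¬p)) (λ r → ¬Inv-right w q ¬p (∣⇒Inv c _ (subst (λ k → Inv k (ref w q)) (sym r) (∣⇐ c w (Cov⇒Inv (q , ¬p , refl)) z)))))
    where
    go : ∃[ t′ ] (Cov (w ∣ c) t′ × ¬ Inv ((w ∙ gen q) ∣ c) t′) → Cov (w ∣ c) (ref w q)
    go (t′ , ct , ¬j) with t′ ≟G ref w q
    ... | yes refl = ct
    ... | no ne = ⊥-elim (¬j (∣⇐ c _ (Inv-right⇐ w q t′ ne (∣⇒Inv c w (Cov⇒Inv ct))) (∣⇒Tin c w (Cov⇒Inv ct))))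

  -- With a single cover reflection in `F` this is a lower cover of w in the Cambrian lattice; with
  -- all of them it is pop w.
  record Avoids (c : List (Fin n)) (w : G) (F : G → Set) (z : G) : Set where
    constructor avoids
    field
      sortable : S c z
      below : z ⊑ w
      avoid : ∀ t → F t → ¬ Inv z t
      greatest : ∀ v → S c v → v ⊑ w → (∀ t → F t → ¬ Inv v t) → v ⊑ z

  Avoids-skip : ∀ {c s w F z} → s ∉ c → ¬ Inv w (gen s) → Avoids (s ∷ c) w F z → Avoids c w F z
  Avoids-skip s∉ ¬i (avoids x p a g) = avoids (S-skip x (λ j → ¬i (p _ j))) p a (λ v y q f → g v (S-weaken s∉ y) q f)

  Avoids-initial : ∀ {c s w F z} → Unique (s ∷ c) → F (gen s) → Avoids (s ∷ c) w F z → Avoids c (w ∣ c) (λ t → F t × t ≢ gen s) z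
  Avoids-initial {c} {s} {w} {F} {z} u fs (avoids x p a g) = avoids x′ (∣-greatest c (λ t → S-Tin x′) p) (λ t f → a t (proj₁ f))
      (λ v y q f → g v (S-weaken (uniq∉ u) y) (⊑-trans q (∣⊑ c w)) (av v y f))
    where
    x′ : S c z
    x′ = S-skip x (a _ fs)
    av : ∀ v → S c v → (∀ t → F t × t ≢ gen s → ¬ Inv v t) → ∀ t → F t → ¬ Inv v t
    av v y f t ft with t ≟G gen s
    ... | yes refl = Gen⇒¬Inv (uniq∉ u) (S-Gen y)
    ... | no ne = f t (ft , ne)

  S-gen : ∀ {c s} → Unique (s ∷ c) → S (s ∷ c) (gen s)
  S-gen {c} {s} u = subst (S (s ∷ c)) (idʳ (gen s)) (take-s u (Inv-e _) (S-e (c ++ [ s ])))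

  Avoids-s : ∀ {c s w F z} → Unique (s ∷ c) → Inv w (gen s) → ¬ F (gen s) → Avoids (s ∷ c) w F z → Inv z (gen s)
  Avoids-s {s = s} {F = F} u i ¬fs (avoids x p a g) = g (gen s) (S-gen u) (gen⊑ i) (λ t f j → ¬fs (subst F (Inv-gen j) f)) (gen s) (Inv-gen-self s)

  Avoids-rotate : ∀ {c s w F z} → Unique (s ∷ c) → Inv w (gen s) → ¬ F (gen s) → Avoids (s ∷ c) w F z → Avoids (c ++ [ s ]) (gen s ∙ w) (λ t → F (conj s t)) (gen s ∙ z)
  Avoids-rotate {c} {s} {w} {F} {z} u i ¬fs A@(avoids x p a g) = avoids (S-take x sz) (⊑-down s sz p) av gr
    where
    sz : Inv z (gen s)
    sz = Avoids-s u i ¬fs A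
    av : ∀ t → F (conj s t) → ¬ Inv (gen s ∙ z) t
    av t f j = a _ f (Inv-conj⇒ s z t (λ r → ¬fs (subst F (trans (cong (conj s) r) (conj-self s)) f)) j)
    gr : ∀ v → S (c ++ [ s ]) v → v ⊑ gen s ∙ w → (∀ t → F (conj s t) → ¬ Inv v t) → v ⊑ gen s ∙ z
    gr v y q f = ⊑-down′ s ¬sv (g (gen s ∙ v) (take-s u ¬sv y) (⊑-up′ s i q) f′)
      where
      ¬sv : ¬ Inv v (gen s)
      ¬sv j = Inv-s⇐ s w i (q _ j)
      f′ : ∀ t → F t → ¬ Inv (gen s ∙ v) t
      f′ t ft j = f (conj s t) (subst F (sym (conj² s t)) ft) (Inv-conj⇒ s v t (λ r → ¬fs (subst F r ft)) j)

  Cov-rotate : ∀ {s w} {F : G → Set} → ¬ F (gen s) → (∀ t → F t → Cov w t) → ∀ t → F (conj s t) → Cov (gen s ∙ w) t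
  Cov-rotate {s} {w} {F} ¬fs F⊆ t f = subst (Cov (gen s ∙ w)) (conj² s t) (Cov-down (conj-≢ λ r → ¬fs (subst F (trans (cong (conj s) r) (conj-self s)) f)) (F⊆ _ f))

  private
    keep-rec : ∀ b {c w z} {F : G → Set} → length c ℕ.+ ℓ w < b → Unique c → S c w → (∀ t → Dec (F t)) → (∀ t → F t → Cov w t) → Avoids c w F z →
               ∀ t → Cov w t → ¬ F t → Inv z t
    keep-rec b l u (nil refl) F? F⊆ A t ct ¬f = ⊥-elim (Inv-e _ (Cov⇒Inv ct))
    keep-rec (suc b) (s≤s l) u (skip ¬i D) F? F⊆ A t ct ¬f = keep-rec b l (uniq-tail u) D F? F⊆ (Avoids-skip (uniq∉ u) ¬i A) t ct ¬f
    keep-rec (suc b) {w = w} {z} {F} (s≤s l) u W@(take {s} {c} i D) F? F⊆ A t ct ¬f = go (F? (gen s)) (t ≟G gen s)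
      where
      go : Dec (F (gen s)) → Dec (t ≡ gen s) → Inv z t
      go (yes fs) _ = keep-rec b (ℕₚ.≤-<-trans (ℕₚ.+-monoʳ-≤ (length c) (∣-ℓ c w)) l) (uniq-tail u) (S-par-first u W)
            (λ t → F? t ×-dec ¬? (t ≟G gen s)) (λ t f → Cov-∣ (F⊆ t (proj₁ f)) (Cov-initial u W (F⊆ _ fs) (F⊆ t (proj₁ f)) (proj₂ f)))
            (Avoids-initial u fs A) t (Cov-∣ ct (Cov-initial u W (F⊆ _ fs) ct (λ r → ¬f (subst F (sym r) fs)))) (λ f → ¬f (proj₁ f))
      go (no ¬fs) (yes p) = subst (Inv z) (sym p) (Avoids-s u i ¬fs A)
      go (no ¬fs) (no ne) = subst (λ k → Inv k t) (gg s z) (Inv-conj⇐ s (gen s ∙ z) t ne (keep-rec b (rotate< c s i l) (uniq-rot u) D (λ t → F? (conj s t))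
            (Cov-rotate ¬fs F⊆) (Avoids-rotate u i ¬fs A) (conj s t) (Cov-down ne ct) (λ f → ¬f (subst F (conj² s t) f))))

  abstract
    -- Avoiding some cover reflections costs no others. If s is avoided, the rest takes place in the
    -- subgroup of c by `Cov-initial`; if not, z contains s and everything rotates.
    keeps : ∀ {c w z} {F : G → Set} → Unique c → S c w → (∀ t → Dec (F t)) → (∀ t → F t → Cov w t) → Avoids c w F z → ∀ t → Cov w t → ¬ F t → Inv z t
    keeps {c} {w} u x F? F⊆ A = keep-rec (suc (length c ℕ.+ ℓ w)) ℕₚ.≤-refl u x F? F⊆ A

  private
    avoiding-element : ∀ (w : G) (F : G → Set) → (∀ t → Dec (F t)) → (∀ t → F t → Cov w t) → ∀ L →
       ∃[ y ] (y ⊑ w × (∀ q → q ∈ L → F (ref w q) → ¬ Inv y (ref w q)) × (∀ v → v ⊑ w → (∀ t → F t → ¬ Inv v t) → v ⊑ y))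
    avoiding-element w F F? F⊆ [] = w , (λ _ i → i) , (λ _ ()) , (λ v p _ → p)
    avoiding-element w F F? F⊆ (q ∷ L) = extend (avoiding-element w F F? F⊆ L) (F? (ref w q)) (P? w q)
      where
      Goal = ∃[ y ] (y ⊑ w × (∀ r → r ∈ q ∷ L → F (ref w r) → ¬ Inv y (ref w r)) × (∀ v → v ⊑ w → (∀ t → F t → ¬ Inv v t) → v ⊑ y))
      extend : ∃[ y ] (y ⊑ w × (∀ r → r ∈ L → F (ref w r) → ¬ Inv y (ref w r)) × (∀ v → v ⊑ w → (∀ t → F t → ¬ Inv v t) → v ⊑ y)) → Dec (F (ref w q)) → Dec (P w q) → Goal
      extend (y , a , b , d) (no ¬f) _ = y , a , (λ { r (here refl) f → ⊥-elim (¬f f) ; r (there k) f → b r k f }) , d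
      extend (y , a , b , d) (yes f) (yes p) = ⊥-elim (¬add-old p (Cov⇒Inv (F⊆ _ f)))
      extend (y , a , b , d) (yes f) (no ¬p) = Meet.meet μ , ⊑-trans (Meet.meet₁ μ) a ,
          (λ { r (here refl) _ j → ¬Inv-right w q ¬p (Meet.meet₂ μ _ j) ; r (there k) f j → b r k f (Meet.meet₁ μ _ j) }) ,
          (λ v p g → Meet.greatest μ v (d v p g) (drop p (g _ f)))
        where
        μ : Meet y (w ∙ gen q)
        μ = meets y (w ∙ gen q)

  abstract
    -- The meet of the weak-order lower covers of w that lose one element of F each, projected to
    -- the sortable elements.
    avoiding : ∀ {c w} {F : G → Set} → Unique c → (∀ t → Dec (F t)) → (∀ t → F t → Cov w t) → ∃[ z ] Avoids c w F z
    avoiding {c} {w} {F} u F? F⊆ = build (avoiding-element w F F? F⊆ (allFin n))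
      where
      build : ∃[ y ] (y ⊑ w × (∀ q → q ∈ allFin n → F (ref w q) → ¬ Inv y (ref w q)) × (∀ v → v ⊑ w → (∀ t → F t → ¬ Inv v t) → v ⊑ y)) → ∃[ z ] Avoids c w F z
      build (y , a , b , d) = Proj.proj R , avoids (Proj.sortable R) (⊑-trans (Proj.below R) a)
          (λ t f j → av t f (F⊆ t f) (Proj.below R t j)) (λ v x p g → Proj.greatest R v x (d v p g))
        where
        R : Proj c y
        R = project u y
        av : ∀ t → F t → Cov w t → ¬ Inv y t
        av t f (q , _ , refl) = b q (∈-allFin q) f

  -- Let b be the lower cover of a that avoids t. Its join with s is strictly below that of a,
  -- because the parts in c differ, so it misses a cover reflection. That one is neither s nor
  -- another cover reflection of a, as b keeps those; hence it is t.
  Cov-join : ∀ {c s a t} → Unique (s ∷ c) → S c a → (J : Join c s a) → Cov a t → Cov (Join.join J) t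
  Cov-join {c} {s} {a} {t} u x J ct = go (avoiding {c} {a} {λ r → r ≡ t} (uniq-tail u) (λ r → r ≟G t) (λ { r refl → ct }))
    where
    e′ : G
    e′ = Join.join J
    go : ∃[ z ] Avoids c a (λ r → r ≡ t) z → Cov e′ t
    go (b , A) = finish (missing-cov b∨⊑ ne)
      where
      K : Join c s b
      K = joins u (Avoids.sortable A)
      b∨⊑ : Join.join K ⊑ e′
      b∨⊑ = Join.least K e′ (Join.s∈ J) (⊑-trans (Avoids.below A) (Join.a⊑ J))
      ne : Join.join K ≢ e′
      ne r = Avoids.avoid A t refl (subst (λ k → Inv k t) (trans (sym (Join.part J)) (trans (cong (_∣ c) (sym r)) (Join.part K))) (Cov⇒Inv ct))
      finish : ∃[ t′ ] (Cov e′ t′ × ¬ Inv (Join.join K) t′) → Cov e′ t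
      finish (t′ , ct′ , ¬j) with t′ ≟G gen s
      ... | yes refl = ⊥-elim (¬j (Join.s∈ K))
      ... | no ne′ with t′ ≟G t
      ... | yes refl = ct′
      ... | no t′≢t = ⊥-elim (¬j (Join.a⊑ K t′ (keeps (uniq-tail u) x (λ r → r ≟G t) (λ { r refl → ct }) A t′
              (subst (λ k → Cov k t′) (Join.part J) (Cov-∣ ct′ (Cov-initial u (Join.first J) (Join.cover J) ct′ ne′))) t′≢t)))

  Cov-join⁻ : ∀ {c s a t} → Unique (s ∷ c) → (J : Join c s a) → Cov (Join.join J) t → t ≢ gen s → Cov a t
  Cov-join⁻ {c} {t = t} u J ct ne = subst (λ k → Cov k t) (Join.part J) (Cov-∣ ct (Cov-initial u (Join.first J) (Join.cover J) ct ne))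

-- Roofs and the image of pop.

module Popping {n : ℕ} (m : Fin n → Fin n → ℕ) (cox : IsCoxeterMatrix m) (T : Words.Table m) where
  open Joins m cox T public

  Cov-part⇐ : ∀ {c s z t} → Unique (s ∷ c) → S (s ∷ c) z → Cov z (gen s) → Cov z t → t ≢ gen s → Cov (z ∣ c) t
  Cov-part⇐ u x cs ct ne = Cov-∣ ct (Cov-initial u x cs ct ne)

  abstract
    Cov-part⇒ : ∀ {c s z t} → Unique (s ∷ c) → S (s ∷ c) z → Cov z (gen s) → Cov (z ∣ c) t → Cov z t
    Cov-part⇒ {c} {s} {z} {t} u x cs ct = subst (λ k → Cov k t) (sym (join-unique u x cs J)) (Cov-join u (S-par-first u x) J ct)
      where
      J : Join c s (z ∣ c)
      J = joins u (S-par-first u x)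

  Cov-Gen-≢ : ∀ {c s w t} → s ∉ c → Gen c w → Cov w t → t ≢ gen s
  Cov-Gen-≢ {w = w} s∉ g ct refl = Gen⇒¬Inv s∉ g (Cov⇒Inv ct)

  -- Deletes s from the set of cover reflections, which by `Cov-part⇒` amounts to passing to the
  -- part in c. The field `shape` records whether anything had to be done, as this decides whether
  -- the roof can lie above an element containing s.
  record StripFirst (c : List (Fin n)) (s : Fin n) (z : G) : Set where
    field
      strip : G
      sortable : S (s ∷ c) strip
      cov⇒ : ∀ t → Cov strip t → Cov z t × t ≢ gen s
      cov⇐ : ∀ t → Cov z t → t ≢ gen s → Cov strip t
      shape : strip ≡ z ⊎ Gen c strip

  strip-first : ∀ {c s z} → Unique (s ∷ c) → S (s ∷ c) z → StripFirst c s z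
  strip-first {c} {s} {z} u x with Cov? z (gen s)
  ... | no ¬c = record { strip = z ; sortable = x ; cov⇒ = λ t ct → ct , (λ { refl → ¬c ct }) ; cov⇐ = λ t ct _ → ct ; shape = inj₁ refl }
  ... | yes cs = record { strip = z ∣ c ; sortable = S-weaken (uniq∉ u) (S-par-first u x)
                        ; cov⇒ = λ t ct → Cov-part⇒ u x cs ct , Cov-Gen-≢ (uniq∉ u) (∣-gen c z) ct
                        ; cov⇐ = λ t ct ne → Cov-part⇐ u x cs ct ne ; shape = inj₂ (∣-gen c z) }

  record StripLast (c : List (Fin n)) (s : Fin n) (z : G) : Set where
    field
      strip : G
      sortable : S (c ++ [ s ]) strip
      below : strip ⊑ z
      ¬s : ¬ Inv strip (gen s)
      cov⇒ : ∀ t → Cov strip t → Cov z t × t ≢ gen s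
      cov⇐ : ∀ t → Cov z t → t ≢ gen s → Cov strip t
      inside : Cov z (gen s) → Gen c strip
      greatest : ∀ v → v ⊑ z → (Cov z (gen s) → Gen c v) → v ⊑ strip

  strip-last : ∀ {c s z} → Unique (s ∷ c) → S (c ++ [ s ]) z → StripLast c s z
  strip-last {c} {s} {z} u x with Inv? z (gen s)
  ... | no ¬i = record { strip = z ; sortable = x ; below = λ t i → i ; ¬s = ¬i ; cov⇒ = λ t ct → ct , (λ { refl → ¬i (Cov⇒Inv ct) })
                       ; cov⇐ = λ t ct _ → ct ; inside = λ cs → ⊥-elim (¬i (Cov⇒Inv cs)) ; greatest = λ v p _ → p }
  ... | yes i = record { strip = z ∣ c ; sortable = S-append u (S-par-last u x) ; below = ∣⊑ c z ; ¬s = ¬s∣ u z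
                       ; cov⇒ = λ t ct → Cov-part⇒ u y cs ct , Cov-Gen-≢ (uniq∉ u) (∣-gen c z) ct
                       ; cov⇐ = λ t ct ne → Cov-part⇐ u y cs ct ne ; inside = λ _ → ∣-gen c z
                       ; greatest = λ v p g → ∣-greatest c (λ t → Inv⇒Tin (g cs)) p }
    where
    y : S (s ∷ c) z
    y = proj₂ (proj₂ (S-final u x i))
    cs : Cov z (gen s)
    cs = proj₁ (S-final u x i)

  -- w is in the image of pop exactly when it lies below its roof.
  record Roof (c : List (Fin n)) (w : G) : Set where
    field
      top : G
      sortable : S c top
      cov⇒ : ∀ t → Cov top t → Up c w t
      cov⇐ : ∀ t → Up c w t → Cov top t

  -- The labels of w are the conjugates of those of s w other than s. So s is stripped from the old
  -- roof before multiplying by s, and stripped again afterwards, since the product may acquire s as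
  -- a cover reflection.
  module RoofTake {c : List (Fin n)} {s : Fin n} {w : G} (u : Unique (s ∷ c)) (i : Inv w (gen s)) (R : Roof (c ++ [ s ]) (gen s ∙ w)) where
    L : StripLast c s (Roof.top R)
    L = strip-last u (Roof.sortable R)
    a : G
    a = StripLast.strip L
    z : G
    z = gen s ∙ a
    F : StripFirst c s z
    F = strip-first u (take-s u (StripLast.¬s L) (StripLast.sortable L))

    roof-take : Roof (s ∷ c) w
    roof-take = record { top = StripFirst.strip F ; sortable = StripFirst.sortable F ; cov⇒ = to ; cov⇐ = from }
      where
      to : ∀ t → Cov (StripFirst.strip F) t → Up (s ∷ c) w t
      to t ct = take i ne (Roof.cov⇒ R _ (proj₁ (StripLast.cov⇒ L _ (subst (λ k → Cov k (conj s t)) (gg s a) (Cov-down ne (proj₁ (StripFirst.cov⇒ F t ct)))))))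
        where
        ne : t ≢ gen s
        ne = proj₂ (StripFirst.cov⇒ F t ct)
      from : ∀ t → Up (s ∷ c) w t → Cov (StripFirst.strip F) t
      from t (here ¬i _) = ⊥-elim (¬i i)
      from t (skip ¬i _) = ⊥-elim (¬i i)
      from t (take _ ne y) = StripFirst.cov⇐ F t (Cov-up ne (subst (λ k → Cov k (conj s t)) (sym (gg s a)) (StripLast.cov⇐ L _ (Roof.cov⇐ R _ y) (conj-≢ ne)))) ne

    below⇒ : w ⊑ Roof.top roof-take → gen s ∙ w ⊑ a
    below⇒ p = go (StripFirst.shape F)
      where
      go : StripFirst.strip F ≡ z ⊎ Gen c (StripFirst.strip F) → gen s ∙ w ⊑ a
      go (inj₁ q) = subst (gen s ∙ w ⊑_) (gg s a) (⊑-down s i (subst (w ⊑_) q p))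
      go (inj₂ g) = ⊥-elim (Gen⇒¬Inv (uniq∉ u) g (p _ i))

    below⇐ : gen s ∙ w ⊑ a → ¬ Gen c (Roof.top roof-take) → w ⊑ Roof.top roof-take
    below⇐ p ¬g = go (StripFirst.shape F)
      where
      go : StripFirst.strip F ≡ z ⊎ Gen c (StripFirst.strip F) → w ⊑ StripFirst.strip F
      go (inj₁ q) = subst (w ⊑_) (sym q) (subst (_⊑ z) (gg s w) (⊑-up s (StripLast.¬s L) p))
      go (inj₂ g) = ⊥-elim (¬g g)

  module RoofSkip {c : List (Fin n)} {s : Fin n} {w : G} (u : Unique (s ∷ c)) (¬i : ¬ Inv w (gen s)) (R : Roof c w) where
    J : Join c s (Roof.top R)
    J = joins u (Roof.sortable R)

    roof-skip : Roof (s ∷ c) w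
    roof-skip = record { top = Join.join J ; sortable = Join.first J ; cov⇒ = to ; cov⇐ = from }
      where
      to : ∀ t → Cov (Join.join J) t → Up (s ∷ c) w t
      to t ct with t ≟G gen s
      ... | yes p = here ¬i p
      ... | no ne = skip ¬i (Roof.cov⇒ R t (Cov-join⁻ u J ct ne))
      from : ∀ t → Up (s ∷ c) w t → Cov (Join.join J) t
      from t (here _ refl) = Join.cover J
      from t (skip _ y) = Cov-join u (Roof.sortable R) J (Roof.cov⇐ R t y)
      from t (take i _ _) = ⊥-elim (¬i i)

    below⇒ : S c w → w ⊑ Roof.top roof-skip → w ⊑ Roof.top R
    below⇒ x p = subst (w ⊑_) (Join.part J) (∣-greatest c (λ t → S-Tin x) p)

    below⇐ : w ⊑ Roof.top R → w ⊑ Roof.top roof-skip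
    below⇐ p = ⊑-trans p (Join.a⊑ J)

  roof : ∀ {c w} → Unique c → S c w → Roof c w
  roof u (nil refl) = record { top = e ; sortable = nil refl ; cov⇒ = λ t ct → ⊥-elim (Inv-e t (Cov⇒Inv ct)) ; cov⇐ = λ t () }
  roof u (skip ¬i x) = RoofSkip.roof-skip u ¬i (roof (uniq-tail u) x)
  roof u (take i x) = RoofTake.roof-take u i (roof (uniq-rot u) x)

  private
    avoids⇒Up-rec : ∀ b {c w z} {F : G → Set} → length c ℕ.+ ℓ w < b → Unique c → S c w → (∀ t → Dec (F t)) → (∀ t → F t → Cov w t) → Avoids c w F z →
               ∀ t → F t → Up c z t
    avoids⇒Up-rec b l u (nil refl) F? F⊆ A t f = ⊥-elim (Inv-e _ (Cov⇒Inv (F⊆ t f)))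
    avoids⇒Up-rec (suc b) (s≤s l) u (skip ¬i D) F? F⊆ A t f = skip (λ j → ¬i (Avoids.below A _ j)) (avoids⇒Up-rec b l (uniq-tail u) D F? F⊆ (Avoids-skip (uniq∉ u) ¬i A) t f)
    avoids⇒Up-rec (suc b) {w = w} {z} {F} (s≤s l) u W@(take {s} {c} i D) F? F⊆ A t f = go (F? (gen s)) (t ≟G gen s)
      where
      go : Dec (F (gen s)) → Dec (t ≡ gen s) → Up (s ∷ c) z t
      go (yes fs) (yes p) = here (Avoids.avoid A _ fs) p
      go (yes fs) (no ne) = skip (Avoids.avoid A _ fs) (avoids⇒Up-rec b (ℕₚ.≤-<-trans (ℕₚ.+-monoʳ-≤ (length c) (∣-ℓ c w)) l) (uniq-tail u) (S-par-first u W)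
            (λ t → F? t ×-dec ¬? (t ≟G gen s)) (λ t f → Cov-part⇐ u W (F⊆ _ fs) (F⊆ t (proj₁ f)) (proj₂ f)) (Avoids-initial u fs A) t (f , ne))
      go (no ¬fs) (yes refl) = ⊥-elim (¬fs f)
      go (no ¬fs) (no ne) = take (Avoids-s u i ¬fs A) ne (avoids⇒Up-rec b (rotate< c s i l) (uniq-rot u) D (λ t → F? (conj s t))
            (Cov-rotate ¬fs F⊆) (Avoids-rotate u i ¬fs A) (conj s t) (subst F (sym (conj² s t)) f))

  abstract
    -- The dual of `keeps`: the cover reflections that are given up reappear as upper labels.
    avoids⇒Up : ∀ {c w z} {F : G → Set} → Unique c → S c w → (∀ t → Dec (F t)) → (∀ t → F t → Cov w t) → Avoids c w F z → ∀ t → F t → Up c z t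
    avoids⇒Up {c} {w} u x F? F⊆ A = avoids⇒Up-rec (suc (length c ℕ.+ ℓ w)) ℕₚ.≤-refl u x F? F⊆ A

  Pop : List (Fin n) → G → G → Set
  Pop c x z = Avoids c x (Cov x) z

  -- The cover reflections of x are all given up in w, so they are labels of w and cover reflections
  -- of the roof; x itself is then below the roof.
  pop⇒below : ∀ {c w x} → Unique c → S c x → Pop c x w → (R : Roof c w) → w ⊑ Roof.top R
  pop⇒below {x = x} u Sx A R = ⊑-trans (Avoids.below A) (⊑-by-Cov u Sx (Roof.sortable R) (λ t ct → Cov⇒Inv (Roof.cov⇐ R t (avoids⇒Up u Sx (Cov? x) (λ _ k → k) A t ct))))

  -- The roof is the preimage. For maximality, an inversion of v outside w would be separated from w
  -- by a label γ with a positive form value, whereas γ is a cover reflection of the roof avoided by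
  -- v, so `Cov-≤0` gives the opposite sign.
  below⇒pop : ∀ {c w} → Unique c → S c w → (R : Roof c w) → w ⊑ Roof.top R → Pop c (Roof.top R) w
  below⇒pop {c} {w} u Sw R p = avoids Sw p (λ t ct → Up-¬Inv (Roof.cov⇒ R t ct)) greatest
    where
    greatest : ∀ v → S c v → v ⊑ Roof.top R → (∀ t → Cov (Roof.top R) t → ¬ Inv v t) → v ⊑ w
    greatest v Sv q f t j = go (Inv? w t)
      where
      go : Dec (Inv w t) → Inv w t
      go (yes k) = k
      go (no ¬k) = step (Rv-exists (proj₁ j))
        where
        step : ∃[ y ] Rv t y → Inv w t
        step (y , ry) = clash (Up-separates u Sw (Supp-Tin (S-Tin Sv j) ry) ry ¬k)
          where
          clash : ∃[ γ ] ∃[ x ] (Up c w γ × Rv γ x × 0ℤ ℤ.< E c y x) → Inv w t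
          clash (γ , x , up , rx , pos) = ⊥-elim (ℤₚ.<⇒≱ pos (Cov-≤0 u (Roof.sortable R) Sv q (Roof.cov⇐ R γ up) (f γ (Roof.cov⇐ R γ up)) j ry rx))

-- Commuting cover reflections and the inversions of c⁻¹.

module Commuting {n : ℕ} (m : Fin n → Fin n → ℕ) (cox : IsCoxeterMatrix m) (T : Words.Table m) where
  open Popping m cox T public

  Commute : G → G → Set
  Commute t t′ = t ∙ t′ ≡ t′ ∙ t

  conj-∙ : ∀ s t t′ → conj s t ∙ conj s t′ ≡ conj s (t ∙ t′)
  conj-∙ s t t′ = trans (sym (assoc _ _ _)) (cong (_∙ gen s) (trans (sym (assoc _ _ _)) (trans (cong (_∙ t′) (ggʳ (gen s ∙ t) s)) (assoc _ _ _))))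

  conj-commute : ∀ {s t t′} → Commute (conj s t) (conj s t′) → Commute t t′
  conj-commute {s} {t} {t′} p = trans (sym (conj² s _)) (trans (cong (conj s) (trans (sym (conj-∙ s t t′)) (trans p (conj-∙ s t′ t)))) (conj² s _))

  fixed⇒commute-gen : ∀ {s t} → conj s t ≡ t → Commute (gen s) t
  fixed⇒commute-gen {s} {t} p = trans (sym (ggʳ (gen s ∙ t) s)) (cong (_∙ gen s) p)

  commute-gen⇒fixed : ∀ {s t} → Commute (gen s) t → conj s t ≡ t
  commute-gen⇒fixed {s} {t} p = trans (cong (_∙ gen s) p) (ggʳ t s)

  both-inside : ∀ {c s t} → s ∉ c → IsRef t → t ≢ gen s → Tin c t → Tin c (conj s t) → conj s t ≡ t
  both-inside {c} {s} {t} s∉ rt ne z z′ = go (Rv-exists rt)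
    where
    go : ∃[ v ] Rv t v → conj s t ≡ t
    go (v , r) = fixed⇒commute ne r same
      where
      same : s ▷ v ≋ v
      same j k with s Finₚ.≟ j
      ... | yes refl = trans (z′ (s ▷ v) (Rv-conj s ne r) s s∉ k) (sym (z v r s s∉ k))
      ... | no s≢j = ▷-off v k s≢j

  -- Let s and t be cover reflections of w. Then s is a cover reflection of the roof of s w, whose
  -- stripped form lies in the subgroup of c and above s w. So both t (by `Cov-initial`) and s t s
  -- lie in this subgroup, which forces them to be equal.
  below⇒commute : ∀ {c w} (u : Unique c) (x : S c w) → w ⊑ Roof.top (roof u x) → ∀ t t′ → Cov w t → Cov w t′ → Commute t t′
  below⇒commute u (nil refl) p t t′ ct = ⊥-elim (Inv-e _ (Cov⇒Inv ct))
  below⇒commute u (skip ¬i x) p = below⇒commute (uniq-tail u) x (RoofSkip.below⇒ u ¬i (roof (uniq-tail u) x) x p)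
  below⇒commute {w = w} u W@(take {s} {c} i x) p t t′ ct ct′ = go (t ≟G gen s) (t′ ≟G gen s)
    where
    R : Roof (c ++ [ s ]) (gen s ∙ w)
    R = roof (uniq-rot u) x
    L : StripLast c s (Roof.top R)
    L = RoofTake.L u i R
    q : gen s ∙ w ⊑ StripLast.strip L
    q = RoofTake.below⇒ u i R p
    with-s : ∀ t → Cov w (gen s) → Cov w t → t ≢ gen s → Commute (gen s) t
    with-s t cs ct ne = fixed⇒commute-gen (both-inside (uniq∉ u) (proj₁ (Cov⇒Inv ct)) ne (Cov-initial u W cs ct ne)
      (Inv⇒Tin (StripLast.inside L (Roof.cov⇐ R _ (Cov⇒Up-last u W cs))) (q _ (Cov⇒Inv (Cov-down ne ct)))))
    go : Dec (t ≡ gen s) → Dec (t′ ≡ gen s) → Commute t t′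
    go (yes refl) (yes refl) = refl
    go (yes refl) (no ne′) = with-s t′ ct ct′ ne′
    go (no ne) (yes refl) = sym (with-s t ct′ ct ne)
    go (no ne) (no ne′) = conj-commute (below⇒commute (uniq-rot u) x (⊑-trans q (StripLast.below L)) _ _ (Cov-down ne ct) (Cov-down ne′ ct′))

  -- A cover reflection of s w is s t s with t a cover reflection of w, hence is t, which lies in
  -- the subgroup by `Cov-initial`.
  commuting⇒Gen : ∀ {c s w} → Unique (s ∷ c) → S (s ∷ c) w → Cov w (gen s) → (∀ t t′ → Cov w t → Cov w t′ → Commute t t′) → Gen c (gen s ∙ w)
  commuting⇒Gen {c} {s} {w} u x cs h = Cov⊆Tin⇒Gen c inside
    where
    inside : ∀ t → Cov (gen s ∙ w) t → Tin c t
    inside t ct = subst (Tin c) (trans (sym (commute-gen⇒fixed (h _ _ cs ct′))) (conj² s t)) (Cov-initial u x cs ct′ ne′)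
      where
      ne′ : conj s t ≢ gen s
      ne′ = conj-≢ λ { refl → Inv-s⇐ s w (Cov⇒Inv cs) (Cov⇒Inv ct) }
      ct′ : Cov w (conj s t)
      ct′ = Cov-up ne′ (subst (Cov (gen s ∙ w)) (sym (conj² s t)) ct)

  commuting⇒Tin : ∀ {c s w} → Unique (s ∷ c) → S (s ∷ c) w → Cov w (gen s) → (∀ t t′ → Cov w t → Cov w t′ → Commute t t′) → ∀ t → Inv w t → t ≢ gen s → Tin c t
  commuting⇒Tin {c} {s} {w} u x cs h t i ne = go (Cov-s⁻ cs)
    where
    go : ∃[ q ] (¬ P w q × gen s ∙ w ≡ w ∙ gen q) → Tin c t
    go (q , ¬p , eq) = Inv⇒Tin (commuting⇒Gen u x cs h) (subst (λ k → Inv k t) (sym eq) (Inv-right⇐ w q t (λ r → ne (trans r (sym (ref-unique (gen s) w q eq)))) i))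

  commuting-rotate : ∀ {s w} → Inv w (gen s) → (∀ t t′ → Cov w t → Cov w t′ → Commute t t′) → ∀ t t′ → Cov (gen s ∙ w) t → Cov (gen s ∙ w) t′ → Commute t t′
  commuting-rotate {s} {w} i h t t′ ct ct′ = conj-commute {s} (h _ _ (up t ct) (up t′ ct′))
    where
    up : ∀ t → Cov (gen s ∙ w) t → Cov w (conj s t)
    up t ct = Cov-up (conj-≢ λ { refl → Inv-s⇐ s w i (Cov⇒Inv ct) }) (subst (Cov (gen s ∙ w)) (sym (conj² s t)) ct)

  conjs : G → List (Fin n) → G
  conjs t [] = t
  conjs t (j ∷ d) = conjs (conj j t) d

  -- For c = … s d, the inversion d⁻¹ s d of c⁻¹; its root represents the coordinate at s under E.
  data Final : List (Fin n) → Fin n → G → Set where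
    here : ∀ {s d t} → t ≡ conjs (gen s) d → Final (s ∷ d) s t
    there : ∀ {a s d t} → Final d s t → Final (a ∷ d) s t

  private
    moves : V → List (Fin n) → V
    moves v [] = v
    moves v (j ∷ d) = moves (j ▷ v) d

    uniq-++ˡ : ∀ (c : List (Fin n)) {d} → Unique (c ++ d) → Unique c
    uniq-++ˡ [] _ = []
    uniq-++ˡ (a ∷ c) (p ∷ q) = All.tabulate (λ j∈ → All.lookup p (∈-++⁺ˡ j∈)) ∷ uniq-++ˡ c q

    -- Before j acts, v has no coordinate at j. Afterwards this coordinate equals the sum over the
    -- earlier neighbours, so the term that j adds to the form as last letter is zero. The
    -- coordinate 1 at s also excludes that the reflection is j itself.
    spread : ∀ d c {t v s k} → Unique (c ++ d) → Supp c v → Rv t v → s ∈ c → v s k ≡ 1ℤ →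
      Rv (conjs t d) (moves v d) × Supp (c ++ d) (moves v d) × moves v d s k ≡ 1ℤ × (∀ x → E (c ++ d) (moves v d) x ≡ E c v x)
    spread [] c {v = v} u z r s∈ p = r , (λ j j∉ → z j (λ q → j∉ (∈-++⁺ˡ q))) , p , λ x → cong (λ q → E q v x) (Listₚ.++-identityʳ c)
    spread (j ∷ d) c {t} {v} {s} {k} u z r s∈ p = step (spread d (c ++ [ j ]) u′ z′ (Rv-conj j t≢ r) (∈-++⁺ˡ s∈) (trans (▷-off v k j≢s) p))
      where
      u′ : Unique ((c ++ [ j ]) ++ d)
      u′ = subst Unique (sym (Listₚ.++-assoc c [ j ] d)) u
      uj : Unique (j ∷ c)
      uj = uniq-unrot (uniq-++ˡ (c ++ [ j ]) u′)
      j≢s : j ≢ s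
      j≢s refl = uniq∉ uj s∈
      z′ : Supp (c ++ [ j ]) (j ▷ v)
      z′ i i∉ l = trans (▷-off v l (λ { refl → i∉ (∈-++⁺ʳ c (here refl)) })) (z i (λ q → i∉ (∈-++⁺ˡ q)) l)
      1≢0 : 1ℤ ≢ 0ℤ
      1≢0 ()
      t≢ : t ≢ gen j
      t≢ refl = 1≢0 (trans (sym p) (At-Rv r s j≢s k))
      vanish : (j ▷ v) j ⊟ Nbc c j (j ▷ v) ≗ 0ʳ
      vanish l = trans (cong₂ ℤ._-_ {u = Nbc c j (j ▷ v) l} {Nbc c j v l} at-j nb) (ℤₚ.+-inverseʳ (Nbc c j v l))
        where
        at-j : (j ▷ v) j l ≡ Nbc c j v l
        at-j = trans (▷-at j v l) (trans (cong₂ ℤ._+_ (cong -_ (z j (uniq∉ uj) l)) (Nb-restrict uj (λ i i∉ → z i (λ q → i∉ (there q))) l)) (ℤₚ.+-identityˡ _))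
        nb : Nbc c j (j ▷ v) l ≡ Nbc c j v l
        nb = Nbc-cong c j {j ▷ v} {v} (λ i i∈ q → ▷-off v q (λ { refl → uniq∉ uj i∈ })) l
      step : Rv (conjs (conj j t) d) (moves (j ▷ v) d) × Supp ((c ++ [ j ]) ++ d) (moves (j ▷ v) d) × moves (j ▷ v) d s k ≡ 1ℤ × (∀ x → E ((c ++ [ j ]) ++ d) (moves (j ▷ v) d) x ≡ E (c ++ [ j ]) (j ▷ v) x)
           → Rv (conjs (conj j t) d) (moves (j ▷ v) d) × Supp (c ++ j ∷ d) (moves (j ▷ v) d) × moves (j ▷ v) d s k ≡ 1ℤ × (∀ x → E (c ++ j ∷ d) (moves (j ▷ v) d) x ≡ E c v x)
      step (a , b , e , f) = a , subst (λ q → Supp q (moves (j ▷ v) d)) (Listₚ.++-assoc c [ j ] d) b , e ,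
        λ x → trans (cong (λ q → E q (moves (j ▷ v) d) x) (sym (Listₚ.++-assoc c [ j ] d))) (trans (f x) (trans (E-snoc c j (j ▷ v) x)
          (trans (cong₂ ℤ._+_ (E-cong c (λ i i∈ l → ▷-off v l (λ { refl → uniq∉ uj i∈ })) (λ _ _ _ → refl)) (dot-0ˡ κ (x j) vanish)) (ℤₚ.+-identityʳ _))))

  record FinalRoot (c : List (Fin n)) (s : Fin n) (t : G) (k : ℕ) : Set where
    field
      root : V
      isRoot : Rv t root
      supp : Supp c root
      at-s : root s k ≡ 1ℤ
      represents : ∀ x → E c root x ≡ x s k

  abstract
    final-root : ∀ {c s t} → Unique c → Final c s t → ∀ k → k < κ → FinalRoot c s t k
    final-root {s ∷ d} u (here refl) k k< = build (spread d [ s ] {gen s} {α s k} {s} {k} u (λ j j∉ l → αv-off (unit k) l (λ { refl → j∉ (here refl) })) (Rv-gen s k k<) (here refl) one)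
      where
      one : α s k s k ≡ 1ℤ
      one = trans (αv-at s (unit k) k) (unit-refl k)
      build : Rv (conjs (gen s) d) (moves (α s k) d) × Supp (s ∷ d) (moves (α s k) d) × moves (α s k) d s k ≡ 1ℤ × (∀ x → E (s ∷ d) (moves (α s k) d) x ≡ E [ s ] (α s k) x) → FinalRoot (s ∷ d) s (conjs (gen s) d) k
      build (a , b , e , f) = record { root = moves (α s k) d ; isRoot = a ; supp = b ; at-s = e
        ; represents = λ x → trans (f x) (trans (E-last {[]} (λ ()) x (At-Rv (Rv-gen s k k<))) (trans (dot-cong κ (αv-at s (unit k)) (λ _ → refl)) (dot-unit κ k (x s) k<))) }
    final-root {a ∷ d} u (there f) k k< = record { root = root ; isRoot = isRoot ; supp = λ j j∉ → supp j (λ q → j∉ (there q)) ; at-s = at-s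
        ; represents = λ x → trans (E-skip d a x (supp a (uniq∉ u))) (represents x) }
      where open FinalRoot (final-root (uniq-tail u) f k k<)

  others : Fin n → List (Fin n)
  others s = filter (λ j → ¬? (s Finₚ.≟ j)) (allFin n)

  ∉-others : ∀ {s j} → j ∉ others s → s ≡ j
  ∉-others {s} {j} j∉ with s Finₚ.≟ j
  ... | yes p = p
  ... | no ne = ⊥-elim (j∉ (∈-filter⁺ (λ j → ¬? (s Finₚ.≟ j)) (∈-allFin j) ne))

  s∉others : ∀ s → s ∉ others s
  s∉others s q = proj₂ (∈-filter⁻ (λ j → ¬? (s Finₚ.≟ j)) {xs = allFin n} q) refl

  abstract
    -- E(t, γ) is the coordinate of γ at s, and it is at most zero because t is an inversion and γ a
    -- label of w.
    final-up : ∀ {c w s t γ} → Unique c → S c w → Final c s t → Inv w t → Up c w γ → Tin (others s) γ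
    final-up {c} {w} {s} {t} u x f i up v rv j j∉ k = subst (λ j → v j k ≡ 0ℤ) (∉-others {s} {j} j∉) (go (k ℕₚ.<? κ))
      where
      go : Dec (k < κ) → v s k ≡ 0ℤ
      go (no k≥) = Rv-Bd rv s k (ℕₚ.≮⇒≥ k≥)
      go (yes k<) = ℤₚ.≤-antisym (subst (ℤ._≤ 0ℤ) (FinalRoot.represents F v) (Up-≤0 u x i up (FinalRoot.isRoot F) rv)) (Rv-NN rv s k)
        where
        F : FinalRoot c s t k
        F = final-root u f k k<

  final-¬Tin : ∀ {c s t} → Unique c → Final c s t → ¬ Tin (others s) t
  final-¬Tin {c} {s} {t} u f z = absurd (trans (sym (FinalRoot.at-s F)) (z _ (FinalRoot.isRoot F) s (s∉others s) 0))
    where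
    F : FinalRoot c s t 0
    F = final-root u f 0 0<κ
    absurd : 1ℤ ≡ 0ℤ → ⊥
    absurd ()

  -- By `final-up` all cover reflections of the roof avoid s, so the roof and all below it lie in
  -- the subgroup without s; t does not.
  below⇒¬final : ∀ {c w} → Unique c → S c w → (R : Roof c w) → w ⊑ Roof.top R → ∀ s t → Final c s t → ¬ Inv w t
  below⇒¬final u x R p s t f i = final-¬Tin u f (Inv⇒Tin (Cov⊆Tin⇒Gen (others s) (λ γ ct → final-up u x f i (Roof.cov⇒ R γ ct))) (p t i))

  Final-rotate : ∀ {c s j t} → Final (c ++ [ s ]) j t → t ≡ gen s ⊎ Final c j (conj s t)
  Final-rotate {[]} (here p) = inj₁ p
  Final-rotate {a ∷ c} {s} {t = t} (here p) = inj₂ (here (trans (cong (conj s) (trans p (snoc (gen a) c))) (conj² s _)))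
    where
    snoc : ∀ t c → conjs t (c ++ [ s ]) ≡ conj s (conjs t c)
    snoc t [] = refl
    snoc t (b ∷ c) = snoc (conj b t) c
  Final-rotate {a ∷ c} (there f) with Final-rotate {c} f
  ... | inj₁ p = inj₁ p
  ... | inj₂ q = inj₂ (there q)

  -- Commutation keeps s w below the old roof after s is stripped from it, through `commuting⇒Gen`.
  -- The absence of inversions of c⁻¹ ensures that the new roof is not confined to the subgroup of
  -- c.
  ¬final⇒below : ∀ {c w} (u : Unique c) (x : S c w) → (∀ t t′ → Cov w t → Cov w t′ → Commute t t′) → (∀ s t → Final c s t → ¬ Inv w t) → w ⊑ Roof.top (roof u x)
  ¬final⇒below u (nil refl) h f = e⊑ _
  ¬final⇒below u (skip ¬i x) h f = RoofSkip.below⇐ u ¬i (roof (uniq-tail u) x) (¬final⇒below (uniq-tail u) x h (λ s t q → f s t (there q)))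
  ¬final⇒below {w = w} u W@(take {s} {c} i x) h f = RoofTake.below⇐ u i R
      (StripLast.greatest L _ (¬final⇒below (uniq-rot u) x (commuting-rotate i h) f′)
        (λ cx → commuting⇒Gen u W (Up-last⇒Cov u x i (Roof.cov⇒ R _ cx)) h)) outside
    where
    R : Roof (c ++ [ s ]) (gen s ∙ w)
    R = roof (uniq-rot u) x
    L : StripLast c s (Roof.top R)
    L = RoofTake.L u i R
    f′ : ∀ j t → Final (c ++ [ s ]) j t → ¬ Inv (gen s ∙ w) t
    f′ j t q k = go (Final-rotate q) (t ≟G gen s)
      where
      go : t ≡ gen s ⊎ Final c j (conj s t) → Dec (t ≡ gen s) → ⊥
      go _ (yes refl) = Inv-s⇐ s w i k
      go (inj₁ p) (no ne) = ne p
      go (inj₂ q) (no ne) = f j (conj s t) (there q) (Inv-conj⇒ s w t ne k)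
    t₀ : G
    t₀ = conjs (gen s) c
    -- The inversion of c⁻¹ attached to s is not in w, so some label separates it, which means that
    -- this label has a positive coordinate at s.
    outside : ¬ Gen c (Roof.top (RoofTake.roof-take u i R))
    outside g = clash (Up-separates u W (FinalRoot.supp F) (FinalRoot.isRoot F) (f s t₀ (here refl)))
      where
      F : FinalRoot (s ∷ c) s t₀ 0
      F = final-root u (here refl) 0 0<κ
      clash : ∃[ γ ] ∃[ y ] (Up (s ∷ c) w γ × Rv γ y × 0ℤ ℤ.< E (s ∷ c) (FinalRoot.root F) y) → ⊥
      clash (γ , y , up , ry , pos) = ℤₚ.<-irrefl (sym (trans (FinalRoot.represents F y) (Inv⇒Tin g (Cov⇒Inv (Roof.cov⇐ (RoofTake.roof-take u i R) γ up)) y ry s (uniq∉ u) 0))) pos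

-- Complements, the elements p_i, and Boolean intervals.

comprehension : ∀ {k} (Q : Fin k → Set) → (∀ i → Dec (Q i)) → ∃[ A ] (∀ i → i Subset.∈ A ⇔ Q i)
comprehension {zero} Q Q? = Vec.[] , λ ()
comprehension {suc k} Q Q? with comprehension (λ i → Q (Fin.suc i)) (λ i → Q? (Fin.suc i)) | Q? Fin.zero
... | A , h | yes q = Subset.inside Vec.∷ A , λ { Fin.zero → mk⇔ (λ _ → q) (λ _ → Vec.here)
                                      ; (Fin.suc i) → mk⇔ (λ { (Vec.there p) → Equivalence.to (h i) p }) (λ p → Vec.there (Equivalence.from (h i) p)) }
... | A , h | no ¬q = Subset.outside Vec.∷ A , λ { Fin.zero → mk⇔ (λ ()) (λ q → ⊥-elim (¬q q))
                                        ; (Fin.suc i) → mk⇔ (λ { (Vec.there p) → Equivalence.to (h i) p }) (λ p → Vec.there (Equivalence.from (h i) p)) }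

module Intervals {n : ℕ} (m : Fin n → Fin n → ℕ) (cox : IsCoxeterMatrix m) (T : Words.Table m) where
  open Commuting m cox T public

  private
    w₀ : G
    w₀ = proj₁ longest

    ¬P-w₀ : ∀ h i → P h i → ¬ P (w₀ ⁻¹ ∙ h) i
    ¬P-w₀ h i p = inv-root⇒ w₀ h i p (proj₂ longest (ref h i) (h , i , refl))

    regroup : ∀ u g → (u ∙ w₀) ⁻¹ ∙ g ≡ w₀ ⁻¹ ∙ (u ⁻¹ ∙ g)
    regroup u g = trans (cong (_∙ g) (inv-∙ u w₀)) (assoc _ _ _)

  complement : G → G
  complement u = u ∙ w₀

  abstract
    complement⇐ : ∀ u t → IsRef t → ¬ Inv u t → Inv (complement u) t
    complement⇐ u t rt ¬i = go (pos-rep rt)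
      where
      go : ∃[ g ] ∃[ i ] (P g i × t ≡ ref g i) → Inv (complement u) t
      go (g , i , p , refl) = inv-root⇐ (u ∙ w₀) g i p (subst (λ h → ¬ P h i) (sym (regroup u g)) (¬P-w₀ (u ⁻¹ ∙ g) i (positive′ (P? (u ⁻¹ ∙ g) i))))
        where
        positive′ : Dec (P (u ⁻¹ ∙ g) i) → P (u ⁻¹ ∙ g) i
        positive′ (yes q) = q
        positive′ (no ¬q) = ⊥-elim (¬i (inv-root⇐ u g i p ¬q))

    complement⇒ : ∀ u t → Inv (complement u) t → ¬ Inv u t
    complement⇒ u t j k = go (pos-rep (proj₁ j))
      where
      go : ∃[ g ] ∃[ i ] (P g i × t ≡ ref g i) → ⊥
      go (g , i , p , refl) = subst (λ z → ¬ P z i) (regroup u g) (inv-root⇒ (u ∙ w₀) g i p j)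
          (subst (λ z → P z i) (ggʳ _ i) (¬P-flip ((w₀ ⁻¹ ∙ h) ∙ gen i) i (subst (λ z → ¬ P z i) (sym (assoc _ _ _)) (¬P-w₀ (h ∙ gen i) i (¬P-flip h i (inv-root⇒ u g i p k))))))
        where
        h : G
        h = u ⁻¹ ∙ g

  gen-injective : ∀ {a b} → gen a ≡ gen b → a ≡ b
  gen-injective {a} {b} p with b Finₚ.≟ a
  ... | yes q = sym q
  ... | no ne = ⊥-elim (Gen⇒¬Inv {c = [ b ]} (λ { (here q) → ne (sym q) }) (Gen-gen (here refl)) (subst (Inv (gen b)) (sym p) (Inv-gen-self b)))

  ¬Inv-gen : ∀ {i j} → j ≢ i → ¬ Inv (gen i) (gen j)
  ¬Inv-gen ne k = ne (gen-injective (Inv-gen k))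

  S-letter : ∀ {c i} → Unique c → i ∈ c → S c (gen i)
  S-letter u (here refl) = S-gen u
  S-letter u (there q) = S-weaken (uniq∉ u) (S-letter (uniq-tail u) q)

  E-cone : ∀ c d v → (∀ j → j ∈ d → ∀ k → k < κ → E c v (α j k) ℤ.≤ 0ℤ) → ∀ x → NN x → Bd x → (∀ j → j ∉ d → x j ≗ 0ʳ) → E c v x ℤ.≤ 0ℤ
  E-cone c d v h x nn bd z = Cone.cone (λ x → E c v x ℤ.≤ 0ℤ) (λ {x} {y} e → subst (ℤ._≤ 0ℤ) (E-≋ c {v} {v} {x} {y} ≋-refl e))
    (ℤₚ.≤-reflexive (E-0ʳ c v (λ _ _ _ → refl))) (λ {x} {y} a b → subst (ℤ._≤ 0ℤ) (sym (E-⊕ʳ c v x y)) (ℤₚ.+-mono-≤ a b)) d x z nn bd h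

  record Theta (c : List (Fin n)) (i : Fin n) : Set where
    field
      top : G
      sortable : S c top
      above : Inv top (gen i)
      only : ∀ j → j ≢ i → ¬ Inv top (gen j)
      greatest : ∀ v → S c v → (∀ j → j ≢ i → ¬ Inv v (gen j)) → v ⊑ top
      final⇐ : ∀ w t → S c w → Final c i t → Inv w t → top ⊑ w
      final⇒ : ∀ t → Final c i t → Inv top t

  module _ {c : List (Fin n)} (u : Unique c) (full : ∀ j → j ∈ c) where
    full-Supp : ∀ v → Supp c v
    full-Supp v j j∉ = ⊥-elim (j∉ (full j))

    -- π(j w₀) has j as its only upper label.
    co-atom : ∀ j v t y → S c v → ¬ Inv v (gen j) → Inv v t → Rv t y → ∀ k → k < κ → E c y (α j k) ℤ.≤ 0ℤ
    co-atom j v t y Sv ¬j i ry k k< = Up-≤0 u (Proj.sortable Z) (Proj.greatest Z v Sv v⊑ t i) (label (Up-separates u (Proj.sortable Z) (full-Supp (α j 0)) (Rv-gen j 0 0<κ) ¬jz)) ry (Rv-gen j k k<)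
      where
      Z : Proj c (complement (gen j))
      Z = project u _
      v⊑ : v ⊑ complement (gen j)
      v⊑ t i = complement⇐ (gen j) t (proj₁ i) (λ k → ¬j (subst (Inv v) (Inv-gen k) i))
      ¬jz : ¬ Inv (Proj.proj Z) (gen j)
      ¬jz k = complement⇒ (gen j) (gen j) (Proj.below Z _ k) (Inv-gen-self j)
      label : ∃[ γ ] ∃[ x ] (Up c (Proj.proj Z) γ × Rv γ x × 0ℤ ℤ.< E c (α j 0) x) → Up c (Proj.proj Z) (gen j)
      label (γ , x , up , rx , _) = go (γ ≟G gen j)
        where
        go : Dec (γ ≡ gen j) → Up c (Proj.proj Z) (gen j)
        go (yes p) = subst (Up c (Proj.proj Z)) p up
        go (no ne) = ⊥-elim (Proj.up-outside Z γ up (complement⇐ (gen j) γ (Rv-isRef rx) (λ k → ne (Inv-gen k))))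

    -- The inversions of y are the reflections outside the subgroup generated by the letters other
    -- than i. Its projection is therefore the largest sortable element above none of these letters;
    -- it contains i, so it is the maximum of Θ_i.
    theta : ∀ i → Theta c i
    theta i = record { top = top ; sortable = Proj.sortable R ; above = gr (gen i) (S-letter u (full i)) (λ j ne → ¬Inv-gen ne) (gen i) (Inv-gen-self i)
                     ; only = only ; greatest = gr ; final⇐ = final⇐ ; final⇒ = final⇒ }
      where
      d : List (Fin n)
      d = others i
      y : G
      y = complement (w₀ ∣ d)
      y⇒ : ∀ t → Inv y t → ¬ Tin d t
      y⇒ t k z = complement⇒ _ t k (∣⇐ d w₀ (proj₂ longest t (proj₁ k)) z)
      R : Proj c y
      R = project u y
      top : G
      top = Proj.proj R
      other : ∀ j → j ≢ i → j ∈ d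
      other j ne = ∈-filter⁺ (λ j → ¬? (i Finₚ.≟ j)) (∈-allFin j) (λ p → ne (sym p))
      only : ∀ j → j ≢ i → ¬ Inv top (gen j)
      only j ne k = y⇒ _ (Proj.below R _ k) (Tin-gen (other j ne))
      gr : ∀ v → S c v → (∀ j → j ≢ i → ¬ Inv v (gen j)) → v ⊑ top
      gr v Sv f = Proj.greatest R v Sv λ t k → complement⇐ _ t (proj₁ k) (λ q → Inv-none d (λ j j∈ → f j (λ { refl → s∉others i j∈ })) t (∣⇒Tin d w₀ q) k)
      final⇒ : ∀ t → Final c i t → Inv top t
      final⇒ t f = go (Inv? top t)
        where
        F : FinalRoot c i t 0
        F = final-root u f 0 0<κ
        go : Dec (Inv top t) → Inv top t
        go (yes k) = k
        go (no ¬k) = ⊥-elim (clash (Up-separates u (Proj.sortable R) (FinalRoot.supp F) (FinalRoot.isRoot F) ¬k))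
          where
          clash : ∃[ γ ] ∃[ x ] (Up c top γ × Rv γ x × 0ℤ ℤ.< E c (FinalRoot.root F) x) → ⊥
          -- The separating label has a positive coordinate at i, so it lies outside the subgroup
          -- without i and is an inversion of y, against `up-outside`.
          clash (γ , x , up , rx , pos) = Proj.up-outside R γ up (complement⇐ _ γ (Rv-isRef rx) (λ k → ℤₚ.<-irrefl (sym (trans (FinalRoot.represents F x) (∣⇒Tin d w₀ k x rx i (s∉others i) 0))) pos))
      final⇐ : ∀ w t → S c w → Final c i t → Inv w t → top ⊑ w
      final⇐ w t Sw f k r j = go (Inv? w r)
        where
        go : Dec (Inv w r) → Inv w r
        go (yes q) = q
        go (no ¬q) = ⊥-elim (step (Rv-exists (proj₁ j)))
          where
          step : ∃[ v ] Rv r v → ⊥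
          step (v , rv) = clash (Up-separates u Sw (full-Supp v) rv ¬q)
            where
            clash : ∃[ γ ] ∃[ x ] (Up c w γ × Rv γ x × 0ℤ ℤ.< E c v x) → ⊥
            -- By `final-up` the root of γ is a nonnegative combination of simple roots other than
            -- α_i. Each of them pairs nonpositively with r by `co-atom`, as `top` contains none of
            -- the corresponding letters.
            clash (γ , x , up , rx , pos) = ℤₚ.<⇒≱ pos (E-cone c d v (λ j′ j∈ → co-atom j′ top r v (Proj.sortable R) (only j′ (λ { refl → s∉others i j∈ })) j rv)
              x (Rv-NN rx) (Rv-Bd rx) (λ j j∉ → final-up u Sw f k up x rx j j∉))

  -- Boolean intervals

  Avoids-resp : ∀ {c w z} {F F′ : G → Set} → (∀ t → F t → F′ t) → (∀ t → F′ t → F t) → Avoids c w F z → Avoids c w F′ z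
  Avoids-resp f g (avoids x p a h) = avoids x p (λ t k → a t (g t k)) (λ v y q k → h v y q (λ t r → k t (f t r)))

  Cov-unrotate : ∀ {s w t} → Inv w (gen s) → Cov (gen s ∙ w) t → Cov w (conj s t)
  Cov-unrotate {s} {w} {t} i ct = Cov-up (conj-≢ λ { refl → Inv-s⇐ s w i (Cov⇒Inv ct) }) (subst (Cov (gen s ∙ w)) (sym (conj² s t)) ct)

  private
    -- An element of [pop w, w] is recovered from the cover reflections of w that it contains. If s
    -- is not a cover reflection, pop w contains it and everything rotates. If s is one and x lacks
    -- it, both elements lie in the subgroup of c. If x contains s, commutation puts every other
    -- inversion of w into the subgroup (`commuting⇒Tin`), so the parts in c decide.
    interval-rec : ∀ b {c w x p z} → length c ℕ.+ ℓ w < b → Unique c → S c w → (∀ t t′ → Cov w t → Cov w t′ → Commute t t′) →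
      S c x → x ⊑ w → Pop c w p → p ⊑ x → Avoids c w (λ t → Cov w t × ¬ Inv x t) z → z ⊑ x
    interval-rec b l u (nil refl) h Sx x⊑ B p⊑ A t i = ⊥-elim (Inv-e t (Avoids.below A t i))
    interval-rec (suc b) (s≤s l) u (skip ¬i D) h Sx x⊑ B p⊑ A =
      interval-rec b l (uniq-tail u) D h (S-skip Sx (λ j → ¬i (x⊑ _ j))) x⊑ (Avoids-skip (uniq∉ u) ¬i B) p⊑ (Avoids-skip (uniq∉ u) ¬i A)
    interval-rec (suc b) {w = w} {x} {p} {z} (s≤s l) u W@(take {s} {c} i D) h Sx x⊑ B p⊑ A = go (Cov? w (gen s)) (Inv? x (gen s))
      where
      go : Dec (Cov w (gen s)) → Dec (Inv x (gen s)) → z ⊑ x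
      go (no ¬cs) _ = subst (_⊑ x) (gg s z) (⊑-up′ s sx (interval-rec b (rotate< c s i l) (uniq-rot u) D (commuting-rotate i h) (S-take Sx sx) (⊑-down s sx x⊑)
          (Avoids-resp (Cov-rotate ¬cs (λ _ k → k)) (λ t → Cov-unrotate i) (Avoids-rotate u i ¬cs B)) (⊑-down s sp p⊑)
          (Avoids-resp (λ t f → Cov-rotate ¬cs (λ _ k → k) t (proj₁ f) , λ k → proj₂ f (Inv-conj⇒ s x t (ne t (proj₁ f)) k))
                       (λ t f → Cov-unrotate i (proj₁ f) , λ k → proj₂ f (Inv-conj⇐ s x t (ne t (Cov-unrotate i (proj₁ f))) k))
                       (Avoids-rotate u i (λ f → ¬cs (proj₁ f)) A))))
        where
        ne : ∀ t → Cov w (conj s t) → t ≢ gen s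
        ne t ct refl = ¬cs (subst (Cov w) (conj-self s) ct)
        sp : Inv p (gen s)
        sp = Avoids-s u i ¬cs B
        sx : Inv x (gen s)
        sx = p⊑ _ sp
      go (yes cs) sx? = split sx?
        where
        h′ : ∀ t t′ → Cov (w ∣ c) t → Cov (w ∣ c) t′ → Commute t t′
        h′ t t′ ct ct′ = h t t′ (Cov-part⇒ u W cs ct) (Cov-part⇒ u W cs ct′)
        l′ : length c ℕ.+ ℓ (w ∣ c) < b
        l′ = ℕₚ.≤-<-trans (ℕₚ.+-monoʳ-≤ (length c) (∣-ℓ c w)) l
        ne : ∀ t → Cov (w ∣ c) t → t ≢ gen s
        ne t = Cov-Gen-≢ (uniq∉ u) (∣-gen c w)
        B′ : Pop c (w ∣ c) p
        B′ = Avoids-resp (λ t f → Cov-part⇐ u W cs (proj₁ f) (proj₂ f)) (λ t ct → Cov-part⇒ u W cs ct , ne t ct) (Avoids-initial u cs B)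
        split : Dec (Inv x (gen s)) → z ⊑ x
        split (no ¬sx) = interval-rec b l′ (uniq-tail u) (S-par-first u W) h′ Sx′ (∣-greatest c (λ t → S-Tin Sx′) x⊑) B′ p⊑
            (Avoids-resp (λ t f → Cov-part⇐ u W cs (proj₁ (proj₁ f)) (proj₂ f) , proj₂ (proj₁ f)) (λ t f → (Cov-part⇒ u W cs (proj₁ f) , proj₂ f) , ne t (proj₁ f))
              (Avoids-initial u (cs , ¬sx) A))
          where
          Sx′ : S c x
          Sx′ = S-skip Sx ¬sx
        split (yes sx) t k = lift (t ≟G gen s)
          where
          A′ : Avoids c (w ∣ c) (λ t → Cov (w ∣ c) t × ¬ Inv (x ∣ c) t) (z ∣ c)
          A′ = avoids (S-par-first u (Avoids.sortable A)) (∣-mono c (Avoids.below A))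
            (λ t f k → Avoids.avoid A t (Cov-part⇒ u W cs (proj₁ f) , λ q → proj₂ f (∣⇐ c x q (∣⇒Tin c z k))) (∣⇒Inv c z k))
            (λ v Sv v⊑ f → ∣-greatest c (λ t → S-Tin Sv) (Avoids.greatest A v (S-weaken (uniq∉ u) Sv) (⊑-trans v⊑ (∣⊑ c w))
              (λ t g → f t (Cov-part⇐ u W cs (proj₁ g) (λ { refl → proj₂ g sx }) , λ q → proj₂ g (∣⇒Inv c x q)))))
          inner : z ∣ c ⊑ x ∣ c
          inner = interval-rec b l′ (uniq-tail u) (S-par-first u W) h′ (S-par-first u Sx) (∣-mono c x⊑) B′ (∣-greatest c (λ t → S-Tin (Avoids.sortable B′)) p⊑) A′
          lift : Dec (t ≡ gen s) → Inv x t
          lift (yes refl) = sx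
          lift (no ne) = ∣⇒Inv c x (inner t (∣⇐ c z k (commuting⇒Tin u W cs h t (Avoids.below A t k) ne)))

  abstract
    interval : ∀ {c w x p z} → Unique c → S c w → (∀ t t′ → Cov w t → Cov w t′ → Commute t t′) →
      S c x → x ⊑ w → Pop c w p → p ⊑ x → Avoids c w (λ t → Cov w t × ¬ Inv x t) z → z ⊑ x
    interval {c} {w} = interval-rec (suc (length c ℕ.+ ℓ w)) ℕₚ.≤-refl

  Boolean : List (Fin n) → G → G → Set
  Boolean c z w = ∃[ k ] Σ (Subset k → G) λ f → (∀ A → S c (f A) × z ⊑ f A × f A ⊑ w) × (∀ x → S c x → z ⊑ x → x ⊑ w → ∃[ A ] f A ≡ x) × (∀ A B → (f A ⊑ f B) ⇔ (A ⊆ B))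

  lookup-injective : ∀ {d : List (Fin n)} → Unique d → ∀ {i j} → lookup d i ≡ lookup d j → i ≡ j
  lookup-injective (_ ∷ _) {Fin.zero} {Fin.zero} _ = refl
  lookup-injective {_ ∷ d} (p ∷ _) {Fin.zero} {Fin.suc j} q = ⊥-elim (All.lookup p (∈-lookup {xs = d} j) q)
  lookup-injective {_ ∷ d} (p ∷ _) {Fin.suc i} {Fin.zero} q = ⊥-elim (All.lookup p (∈-lookup {xs = d} i) (sym q))
  lookup-injective (_ ∷ u) {Fin.suc i} {Fin.suc j} q = cong Fin.suc (lookup-injective u q)

  -- A set A of cover reflections is sent to the largest element that avoids the others; by `keeps`
  -- it contains those of A. Commutation enters only in surjectivity, through `interval`.
  commuting⇒Boolean : ∀ {c w p} → Unique c → S c w → (∀ t t′ → Cov w t → Cov w t′ → Commute t t′) → Pop c w p → Boolean c p w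
  commuting⇒Boolean {c} {w} {p} u Sw h B = length d , f , (λ A → Avoids.sortable (avoids-f A) , p⊑ A , Avoids.below (avoids-f A)) , onto′ , λ A B → mk⇔ (reflects A B) (preserves A B)
    where
    d : List (Fin n)
    d = filter (λ q → ¬? (P? w q)) (allFin n)
    descents : ∀ {q} → q ∈ d → ¬ P w q
    descents q∈ = proj₂ (∈-filter⁻ (λ q → ¬? (P? w q)) {xs = allFin n} q∈)
    t : Fin (length d) → G
    t i = ref w (lookup d i)
    t-cov : ∀ i → Cov w (t i)
    t-cov i = lookup d i , descents (∈-lookup i) , refl
    t-inj : ∀ {i j} → t i ≡ t j → i ≡ j
    t-inj {i} {j} q = lookup-injective (Uniqueₚ.filter⁺ (λ q → ¬? (P? w q)) (Uniqueₚ.allFin⁺ n)) (gen-injective (∙-injˡ w (trans (sym (ref-self w _)) (trans (cong (_∙ w) q) (ref-self w _)))))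
    t-onto : ∀ r → Cov w r → ∃[ i ] r ≡ t i
    t-onto r (q , ¬p , refl) = Any.index q∈ , cong (ref w) (Anyₚ.lookup-index q∈)
      where
      q∈ : q ∈ d
      q∈ = ∈-filter⁺ (λ q → ¬? (P? w q)) (∈-allFin q) ¬p
    F : Subset (length d) → G → Set
    F A r = ∃[ i ] (r ≡ t i × i Subset.∉ A)
    F? : ∀ A r → Dec (F A r)
    F? A r = Finₚ.any? λ i → (r ≟G t i) ×-dec ¬? (i Subsetₚ.∈? A)
    F⊆ : ∀ A r → F A r → Cov w r
    F⊆ A r (i , refl , _) = t-cov i
    f : Subset (length d) → G
    f A = proj₁ (avoiding u (F? A) (F⊆ A))
    avoids-f : ∀ A → Avoids c w (F A) (f A)
    avoids-f A = proj₂ (avoiding u (F? A) (F⊆ A))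
    p⊑ : ∀ A → p ⊑ f A
    p⊑ A = Avoids.greatest (avoids-f A) p (Avoids.sortable B) (Avoids.below B) (λ r k → Avoids.avoid B r (F⊆ A r k))
    contains : ∀ A i → i Subset.∈ A → Inv (f A) (t i)
    contains A i i∈ = keeps u Sw (F? A) (F⊆ A) (avoids-f A) (t i) (t-cov i) λ { (j , q , j∉) → j∉ (subst (Subset._∈ A) (t-inj q) i∈) }
    reflects : ∀ A B → f A ⊑ f B → A ⊆ B
    reflects A B q {i} i∈ with i Subsetₚ.∈? B
    ... | yes k = k
    ... | no ¬k = ⊥-elim (Avoids.avoid (avoids-f B) (t i) (i , refl , ¬k) (q _ (contains A i i∈)))
    preserves : ∀ A B → A ⊆ B → f A ⊑ f B
    preserves A B q = Avoids.greatest (avoids-f B) (f A) (Avoids.sortable (avoids-f A)) (Avoids.below (avoids-f A))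
      λ { r (i , refl , i∉) → Avoids.avoid (avoids-f A) (t i) (i , refl , λ k → i∉ (q k)) }
    onto′ : ∀ x → S c x → p ⊑ x → x ⊑ w → ∃[ A ] f A ≡ x
    onto′ x Sx px xw = build (comprehension (λ i → Inv x (t i)) (λ i → Inv? x (t i)))
      where
      build : ∃[ A ] (∀ i → i Subset.∈ A ⇔ Inv x (t i)) → ∃[ A ] f A ≡ x
      build (A , k) = A , ⊑-antisym (interval u Sw h Sx xw B px (Avoids-resp to from (avoids-f A))) (Avoids.greatest (avoids-f A) x Sx xw (λ r q → proj₂ (to r q)))
        where
        to : ∀ r → F A r → Cov w r × ¬ Inv x r
        to r (i , refl , i∉) = t-cov i , λ q → i∉ (Equivalence.from (k i) q)
        from : ∀ r → Cov w r × ¬ Inv x r → F A r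
        from r (cr , ¬i) with t-onto r cr
        ... | i , refl = i , refl , λ q → ¬i (Equivalence.to (k i) q)

  -- In a Boolean interval only four elements lie above the meet of two lower covers; x is a fifth.
  record Fifth (c : List (Fin n)) (w t t′ : G) : Set where
    field
      x : G
      sortable : S c x
      below : x ⊑ w
      t∈ : Inv x t
      t′∉ : ¬ Inv x t′
      above : ∀ y → Avoids c w (λ r → r ≡ t ⊎ r ≡ t′) y → y ⊑ x
      z : G
      z-sortable : S c z
      z-below : z ⊑ w
      z-avoids : ¬ Inv z t′
      z⋢x : ¬ z ⊑ x

  private
    fifth-skip : ∀ {c s w t t′} → Unique (s ∷ c) → ¬ Inv w (gen s) → Fifth c w t t′ → Fifth (s ∷ c) w t t′
    fifth-skip u ¬i Φ = record { x = x ; sortable = S-weaken (uniq∉ u) sortable ; below = below ; t∈ = t∈ ; t′∉ = t′∉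
        ; above = λ y A → above y (Avoids-skip (uniq∉ u) ¬i A) ; z = z ; z-sortable = S-weaken (uniq∉ u) z-sortable ; z-below = z-below ; z-avoids = z-avoids ; z⋢x = z⋢x }
      where open Fifth Φ

    fifth-rotate : ∀ {c s w t t′} → Unique (s ∷ c) → Inv w (gen s) → t ≢ gen s → t′ ≢ gen s → Fifth (c ++ [ s ]) (gen s ∙ w) (conj s t) (conj s t′) → Fifth (s ∷ c) w t t′
    fifth-rotate {c} {s} {w} {t} {t′} u i ne ne′ Φ = record { x = gen s ∙ x ; sortable = take-s u ¬sx sortable ; below = ⊑-up′ s i below
        ; t∈ = Inv-conj⇐ s x t ne t∈ ; t′∉ = λ k → t′∉ (Inv-conj⇒ s x t′ ne′ k) ; above = up
        ; z = gen s ∙ z ; z-sortable = take-s u ¬sz z-sortable ; z-below = ⊑-up′ s i z-below ; z-avoids = λ k → z-avoids (Inv-conj⇒ s z t′ ne′ k)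
        ; z⋢x = λ q → z⋢x (subst (_⊑ x) (gg s z) (subst (gen s ∙ (gen s ∙ z) ⊑_) (gg s x) (⊑-down s (Inv-s⇒ s z ¬sz) q))) }
      where
      open Fifth Φ
      ¬sx : ¬ Inv x (gen s)
      ¬sx k = Inv-s⇐ s w i (below _ k)
      ¬sz : ¬ Inv z (gen s)
      ¬sz k = Inv-s⇐ s w i (z-below _ k)
      swap : ∀ r q → conj s r ≡ q → r ≡ conj s q
      swap r q k = trans (sym (conj² s r)) (cong (conj s) k)
      up : ∀ y → Avoids (s ∷ c) w (λ r → r ≡ t ⊎ r ≡ t′) y → y ⊑ gen s ∙ x
      up y A = subst (_⊑ gen s ∙ x) (gg s y) (⊑-up s ¬sx (above (gen s ∙ y) (Avoids-resp to from (Avoids-rotate u i (λ { (inj₁ q) → ne (sym q) ; (inj₂ q) → ne′ (sym q) }) A))))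
        where
        to : ∀ r → conj s r ≡ t ⊎ conj s r ≡ t′ → r ≡ conj s t ⊎ r ≡ conj s t′
        to r (inj₁ q) = inj₁ (swap r t q)
        to r (inj₂ q) = inj₂ (swap r t′ q)
        from : ∀ r → r ≡ conj s t ⊎ r ≡ conj s t′ → conj s r ≡ t ⊎ conj s r ≡ t′
        from r (inj₁ q) = inj₁ (trans (cong (conj s) q) (conj² s t))
        from r (inj₂ q) = inj₂ (trans (cong (conj s) q) (conj² s t′))

    two? : ∀ t t′ r → Dec (r ≡ t ⊎ r ≡ t′)
    two? t t′ r with r ≟G t | r ≟G t′
    ... | yes p | _ = yes (inj₁ p)
    ... | no _ | yes p = yes (inj₂ p)
    ... | no p | no q = no λ { (inj₁ k) → p k ; (inj₂ k) → q k }

    two⊆ : ∀ {w t t′} → Cov w t → Cov w t′ → ∀ r → r ≡ t ⊎ r ≡ t′ → Cov w r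
    two⊆ ct ct′ r (inj₁ refl) = ct
    two⊆ ct ct′ r (inj₂ refl) = ct′

    -- x is the join of s with the element that avoids both s and t. If it were the lower cover z
    -- that avoids t, then s would be a cover reflection and t an upper label of z, so the roof of s
    -- z would have both s and s t s as cover reflections. By `Cov-initial` s t s would lie in the
    -- subgroup of c like t, and s and t would commute.
    fifth-initial : ∀ {c s w t} → Unique (s ∷ c) → S (s ∷ c) w → Cov w (gen s) → Cov w t → t ≢ gen s → ¬ Commute (gen s) t → Fifth (s ∷ c) w (gen s) t
    fifth-initial {c} {s} {w} {t} u W cs ct ne ¬com = build (avoiding u (two? (gen s) t) (two⊆ cs ct)) (avoiding u (λ r → r ≟G t) (λ { r refl → ct }))
      where
      build : ∃[ y ] Avoids (s ∷ c) w (λ r → r ≡ gen s ⊎ r ≡ t) y → ∃[ z ] Avoids (s ∷ c) w (λ r → r ≡ t) z → Fifth (s ∷ c) w (gen s) t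
      build (y , A) (z , A′) = record { x = x ; sortable = Join.first J ; below = x⊑w ; t∈ = Join.s∈ J ; t′∉ = t∉x
          ; above = λ y′ B → ⊑-trans (Avoids.greatest A y′ (Avoids.sortable B) (Avoids.below B) (Avoids.avoid B)) (Join.a⊑ J)
          ; z = z ; z-sortable = Avoids.sortable A′ ; z-below = Avoids.below A′ ; z-avoids = Avoids.avoid A′ t refl ; z⋢x = no-eq }
        where
        Sy : S c y
        Sy = Avoids.sortable (Avoids-initial u (inj₁ refl) A)
        J : Join c s y
        J = joins u Sy
        x : G
        x = Join.join J
        x⊑w : x ⊑ w
        x⊑w = Join.least J w (Cov⇒Inv cs) (Avoids.below A)
        t-in : Tin c t
        t-in = Cov-initial u W cs ct ne
        t∉x : ¬ Inv x t
        t∉x k = Avoids.avoid A t (inj₂ refl) (subst (λ q → Inv q t) (Join.part J) (∣⇐ c x k t-in))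
        no-eq : ¬ z ⊑ x
        no-eq q = ¬com (fixed⇒commute-gen (both-inside (uniq∉ u) (proj₁ (Cov⇒Inv ct)) ne t-in (Cov-initial u (proj₂ (proj₂ fin)) (proj₁ fin) top-t (conj-≢ ne))))
          where
          eq : x ≡ z
          eq = ⊑-antisym (Avoids.greatest A′ x (Join.first J) x⊑w (λ { r refl → t∉x })) q
          cz : Cov z (gen s)
          cz = subst (λ k → Cov k (gen s)) eq (Join.cover J)
          Sz : S (s ∷ c) z
          Sz = Avoids.sortable A′
          R : Roof (c ++ [ s ]) (gen s ∙ z)
          R = roof (uniq-rot u) (S-take Sz (Cov⇒Inv cz))
          label : Up (s ∷ c) z t → Up (c ++ [ s ]) (gen s ∙ z) (conj s t)
          label (here _ p) = ⊥-elim (ne p)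
          label (skip ¬i _) = ⊥-elim (¬i (Cov⇒Inv cz))
          label (take _ _ k) = k
          top-t : Cov (Roof.top R) (conj s t)
          top-t = Roof.cov⇐ R _ (label (avoids⇒Up u W (λ r → r ≟G t) (λ { r refl → ct }) A′ t refl))
          fin : Cov (Roof.top R) (gen s) × S (c ++ [ s ]) (gen s ∙ Roof.top R) × S (s ∷ c) (Roof.top R)
          fin = S-final u (Roof.sortable R) (Cov⇒Inv (Roof.cov⇐ R _ (Cov⇒Up-last u Sz cz)))

  fifth : ∀ {c w t t′} → Unique c → S c w → Cov w t → Cov w t′ → ¬ Commute t t′ → Fifth c w t t′ ⊎ Fifth c w t′ t
  fifth u (nil refl) ct ct′ ¬com = ⊥-elim (Inv-e _ (Cov⇒Inv ct))
  fifth {w = w} {t} {t′} u (skip {s} {c} ¬i x) ct ct′ ¬com = both (fifth (uniq-tail u) x ct ct′ ¬com)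
    where
    both : Fifth c w t t′ ⊎ Fifth c w t′ t → Fifth (s ∷ c) w t t′ ⊎ Fifth (s ∷ c) w t′ t
    both (inj₁ Φ) = inj₁ (fifth-skip u ¬i Φ)
    both (inj₂ Φ) = inj₂ (fifth-skip u ¬i Φ)
  fifth {w = w} {t} {t′} u W@(take {s} {c} i x) ct ct′ ¬com = go (t ≟G gen s) (t′ ≟G gen s)
    where
    go : Dec (t ≡ gen s) → Dec (t′ ≡ gen s) → Fifth (s ∷ c) w t t′ ⊎ Fifth (s ∷ c) w t′ t
    go (yes refl) (yes refl) = ⊥-elim (¬com refl)
    go (yes refl) (no ne′) = inj₁ (fifth-initial u W ct ct′ ne′ ¬com)
    go (no ne) (yes refl) = inj₂ (fifth-initial u W ct′ ct ne (λ k → ¬com (sym k)))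
    go (no ne) (no ne′) = both (fifth (uniq-rot u) x (Cov-down ne ct) (Cov-down ne′ ct′) (λ k → ¬com (conj-commute k)))
      where
      both : Fifth (c ++ [ s ]) (gen s ∙ w) (conj s t) (conj s t′) ⊎ Fifth (c ++ [ s ]) (gen s ∙ w) (conj s t′) (conj s t) → Fifth (s ∷ c) w t t′ ⊎ Fifth (s ∷ c) w t′ t
      both (inj₁ Φ) = inj₁ (fifth-rotate u i ne ne′ Φ)
      both (inj₂ Φ) = inj₂ (fifth-rotate u i ne′ ne Φ)

  -- Distributivity: the union of the codes of y and x gives an element above w, as it contains t
  -- through x and the other cover reflections through y. The codes of y and y′ intersect inside
  -- that of y″, hence inside that of x. So the code of y′ is contained in that of x, and z ⊑ y′ ⊑
  -- x.
  no-fifth : ∀ {c w p t t′} → Unique c → S c w → Pop c w p → Boolean c p w → Cov w t → Cov w t′ → ¬ Fifth c w t t′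
  no-fifth {c} {w} {p} {t} {t′} u Sw B (k , f , bounds , code , order) ct ct′ Φ =
      clash (avoiding u (λ r → r ≟G t) (λ { r refl → ct })) (avoiding u (λ r → r ≟G t′) (λ { r refl → ct′ })) (avoiding u (two? t t′) (two⊆ ct ct′))
    where
    open Fifth Φ
    clash : ∃[ y ] Avoids c w (λ r → r ≡ t) y → ∃[ y ] Avoids c w (λ r → r ≡ t′) y → ∃[ y ] Avoids c w (λ r → r ≡ t ⊎ r ≡ t′) y → ⊥
    clash (y , Ay) (y′ , Ay′) (y″ , Ay″) = codes (code′ Ay (λ { r refl → ct })) (code′ Ay′ (λ { r refl → ct′ })) (code′ Ay″ (two⊆ ct ct′))
          (code x sortable (⊑-trans (p⊑ Ay″ (two⊆ ct ct′)) (above y″ Ay″)) below)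
      where
      p⊑ : ∀ {F v} → Avoids c w F v → (∀ r → F r → Cov w r) → p ⊑ v
      p⊑ A F⊆ = Avoids.greatest A p (Avoids.sortable B) (Avoids.below B) (λ r q → Avoids.avoid B r (F⊆ r q))
      code′ : ∀ {F v} → Avoids c w F v → (∀ r → F r → Cov w r) → ∃[ A ] f A ≡ v
      code′ {v = v} A F⊆ = code v (Avoids.sortable A) (p⊑ A F⊆) (Avoids.below A)
      codes : ∃[ A ] f A ≡ y → ∃[ A ] f A ≡ y′ → ∃[ A ] f A ≡ y″ → ∃[ A ] f A ≡ x → ⊥
      codes (Y , qy) (Y′ , qy′) (Y″ , qy″) (X′ , qx) = decide (Inv? g t)
        where
        g : G
        g = f (Y ∪ X′)
        mono : ∀ {A A′} → A ⊆ A′ → f A ⊑ f A′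
        mono {A} {A′} = Equivalence.from (order A A′)
        y⊑g : y ⊑ g
        y⊑g = subst (_⊑ g) qy (mono (Subsetₚ.p⊆p∪q X′))
        x⊑g : x ⊑ g
        x⊑g = subst (_⊑ g) qx (mono (Subsetₚ.q⊆p∪q Y X′))
        covers : Inv g t → ∀ r → Cov w r → Inv g r
        covers tg r cr with r ≟G t
        ... | yes refl = tg
        ... | no ne = y⊑g r (keeps u Sw (λ r → r ≟G t) (λ { r refl → ct }) Ay r cr ne)
        decide : Dec (Inv g t) → ⊥
        decide (no ¬tg) = ¬tg (x⊑g t t∈)
        decide (yes tg) = z⋢x (⊑-trans (Avoids.greatest Ay′ z z-sortable z-below (λ { r refl → z-avoids })) (subst (y′ ⊑_) qx (subst (_⊑ f X′) qy′ (mono Y′⊆))))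
          where
          w⊑g : w ⊑ g
          w⊑g = ⊑-by-Cov u Sw (proj₁ (bounds (Y ∪ X′))) (covers tg)
          Y′⊆∪ : Y′ ⊆ Y ∪ X′
          Y′⊆∪ = Equivalence.to (order Y′ (Y ∪ X′)) (subst (_⊑ g) (sym qy′) (⊑-trans (Avoids.below Ay′) w⊑g))
          Y″⊆ : Y″ ⊆ X′
          Y″⊆ = Equivalence.to (order Y″ X′) (subst (f Y″ ⊑_) (sym qx) (subst (_⊑ x) (sym qy″) (above y″ Ay″)))
          meet : G
          meet = f (Y ∩ Y′)
          meet-avoids : ∀ r → r ≡ t ⊎ r ≡ t′ → ¬ Inv meet r
          meet-avoids r (inj₁ refl) q = Avoids.avoid Ay t refl (subst (meet ⊑_) qy (mono (Subsetₚ.p∩q⊆p Y Y′)) t q)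
          meet-avoids r (inj₂ refl) q = Avoids.avoid Ay′ t′ refl (subst (meet ⊑_) qy′ (mono (Subsetₚ.p∩q⊆q Y Y′)) t′ q)
          ∩⊆ : Y ∩ Y′ ⊆ Y″
          ∩⊆ = Equivalence.to (order (Y ∩ Y′) Y″) (subst (meet ⊑_) (sym qy″) (Avoids.greatest Ay″ meet (proj₁ (bounds _)) (proj₂ (proj₂ (bounds _))) meet-avoids))
          Y′⊆ : Y′ ⊆ X′
          Y′⊆ b∈ = pick (Subsetₚ.x∈p∪q⁻ Y X′ (Y′⊆∪ b∈))
            where
            pick : _ ⊎ _ → _
            pick (inj₁ b∈Y) = Y″⊆ (∩⊆ (Subsetₚ.x∈p∩q⁺ (b∈Y , b∈)))
            pick (inj₂ b∈X) = b∈X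

  Boolean⇒commuting : ∀ {c w p} → Unique c → S c w → Pop c w p → Boolean c p w → ∀ t t′ → Cov w t → Cov w t′ → Commute t t′
  Boolean⇒commuting {c} {w} u Sw B L t t′ ct ct′ with (t ∙ t′) ≟G (t′ ∙ t)
  ... | yes p = p
  ... | no ¬p = ⊥-elim (refute (fifth u Sw ct ct′ ¬p))
    where
    refute : Fifth c w t t′ ⊎ Fifth c w t′ t → ⊥
    refute (inj₁ Φ) = no-fifth u Sw B L ct ct′ Φ
    refute (inj₂ Φ) = no-fifth u Sw B L ct′ ct Φ

-- From words to group elements, and sorting words.

module Translation {n : ℕ} (m : Fin n → Fin n → ℕ) (cox : IsCoxeterMatrix m) (T : Words.Table m) where
  open Intervals m cox T public
  open Coxeter m

  Len⇒ : ∀ {w k} → Len w k → ℓ (ψ w) ≡ k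
  Len⇒ {w} {k} ((u , u≈ , refl) , least) = ℕₚ.≤-antisym (subst (λ g → ℓ g ≤ length u) (ψ-resp u≈) (ℓ-min u)) (go (ℓ-word (ψ w)))
    where
    go : Reach (ℓ (ψ w)) (ψ w) → length u ≤ ℓ (ψ w)
    go (v , q , r) = subst (length u ≤_) q (least v (ψ⇒≈ r))

  Len⇐ : ∀ w → Len w (ℓ (ψ w))
  Len⇐ w = go (ℓ-word (ψ w))
    where
    go : Reach (ℓ (ψ w)) (ψ w) → Len w (ℓ (ψ w))
    go (v , q , r) = (v , ψ⇒≈ r , q) , λ u u≈ → subst (λ g → ℓ g ≤ length u) (ψ-resp u≈) (ℓ-min u)

  LenLt⇒ : ∀ {a b} → LenLt a b → ℓ (ψ a) < ℓ (ψ b)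
  LenLt⇒ (_ , _ , x , y , p) = subst (_< _) (sym (Len⇒ x)) (subst (_ <_) (sym (Len⇒ y)) p)

  LenLt⇐ : ∀ {a b} → ℓ (ψ a) < ℓ (ψ b) → LenLt a b
  LenLt⇐ {a} {b} p = _ , _ , Len⇐ a , Len⇐ b , p

  IsReduced : Word → Set
  IsReduced u = ℓ (ψ u) ≡ length u

  Reduced⇐ : ∀ {u} → IsReduced u → Reduced u
  Reduced⇐ {u} p = subst (Len u) p (Len⇐ u)

  private
    ψ-conj : ∀ u s → ψ (u ++ [ s ] ++ reverse u) ≡ ref (ψ u) s
    ψ-conj u s = ref-unique _ _ _ (trans (cong (_∙ ψ u) (trans (ψ-++ u _) (cong (ψ u ∙_) (trans (ψ-∷ s (reverse u)) (cong (gen s ∙_) (ψ-reverse u))))))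
      (trans (assoc _ _ _) (cong (ψ u ∙_) (cancel⁻ʳ (gen s) (ψ u)))))

  Reflection⇒ : ∀ {t} → Reflection t → IsRef (ψ t)
  Reflection⇒ (u , s , p) = ψ u , s , trans (ψ-resp p) (ψ-conj u s)

  Reflection⇐ : ∀ {t} → IsRef (ψ t) → Reflection t
  Reflection⇐ (g , s , p) = word g , s , ψ⇒≈ (trans p (trans (cong (λ z → ref z s) (sym (ψ-word g))) (sym (ψ-conj (word g) s))))

  LeftInv⇒ : ∀ {t w} → LeftInv t w → Inv (ψ w) (ψ t)
  LeftInv⇒ {t} {w} (r , p) = Reflection⇒ r , subst (λ g → ℓ g < ℓ (ψ w)) (ψ-++ t w) (LenLt⇒ p)

  LeftInv⇐ : ∀ {t w} → Inv (ψ w) (ψ t) → LeftInv t w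
  LeftInv⇐ {t} {w} (r , p) = Reflection⇐ r , LenLt⇐ (subst (λ g → ℓ g < ℓ (ψ w)) (sym (ψ-++ t w)) p)

  ≤W⇒ : ∀ {u v} → u ≤W v → ψ u ⊑ ψ v
  ≤W⇒ {u} {v} p t i = subst (Inv (ψ v)) (ψ-word t) (LeftInv⇒ {word t} {v} (p (word t) (LeftInv⇐ {word t} {u} (subst (Inv (ψ u)) (sym (ψ-word t)) i))))

  ≤W⇐ : ∀ {u v} → ψ u ⊑ ψ v → u ≤W v
  ≤W⇐ {u} {v} p t i = LeftInv⇐ {t} {v} (p (ψ t) (LeftInv⇒ {t} {u} i))

  letter≤W⇒ : ∀ {i w} → [ i ] ≤W w → Inv (ψ w) (gen i)
  letter≤W⇒ {i} {w} p = subst (_⊑ ψ w) ψ-[ i ] (≤W⇒ {[ i ]} {w} p) (gen i) (Inv-gen-self i)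

  letter≤W⇐ : ∀ {i w} → Inv (ψ w) (gen i) → [ i ] ≤W w
  letter≤W⇐ {i} {w} p = ≤W⇐ {[ i ]} {w} (subst (_⊑ ψ w) (sym ψ-[ i ]) (gen⊑ p))

  Descent⇒ : ∀ {s w} → Descent s w → ¬ P (ψ w) s
  Descent⇒ {s} {w} p q = ℕₚ.<-asym q (subst (λ g → ℓ g < ℓ (ψ w)) (ψ-∷ʳ w s) (LenLt⇒ p))

  Descent⇐ : ∀ {s w} → ¬ P (ψ w) s → Descent s w
  Descent⇐ {s} {w} p = LenLt⇐ (subst (λ g → ℓ g < ℓ (ψ w)) (sym (ψ-∷ʳ w s)) (¬P⇒< (ψ w) s p))

  reduced-tail : ∀ {a u} → IsReduced (a ∷ u) → IsReduced u
  reduced-tail {a} {u} p = ℕₚ.≤-antisym (ℓ-min u) (ℕₚ.≤-pred (ℕₚ.≤-trans (ℕₚ.≤-reflexive (trans (sym p) (cong ℓ (ψ-∷ a u)))) (ℓ-gen∙ a (ψ u))))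

  reduced-head : ∀ {a u} → IsReduced (a ∷ u) → Inv (ψ (a ∷ u)) (gen a)
  reduced-head {a} {u} p = isRef-gen a , subst (λ k → ℓ (gen a ∙ ψ (a ∷ u)) < k) (sym p)
    (s≤s (ℕₚ.≤-reflexive (trans (cong ℓ (trans (cong (gen a ∙_) (ψ-∷ a u)) (gg a (ψ u)))) (reduced-tail {a} {u} p))))

  reduced-∷ : ∀ {a u} → ¬ Inv (ψ u) (gen a) → IsReduced u → IsReduced (a ∷ u)
  reduced-∷ {a} {u} ¬i p = ℕₚ.≤-antisym (ℓ-min (a ∷ u)) (subst (_< ℓ (ψ (a ∷ u))) p
    (subst (λ g → ℓ (ψ u) < ℓ g) (sym (ψ-∷ a u)) (subst (λ g → ℓ g < ℓ (gen a ∙ ψ u)) (gg a (ψ u)) (proj₂ (Inv-s⇒ a (ψ u) ¬i)))))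

  ψ-tail : ∀ {a u w} → ψ (a ∷ u) ≡ w → ψ u ≡ gen a ∙ w
  ψ-tail {a} {u} p = trans (sym (gg a (ψ u))) (cong (gen a ∙_) (trans (sym (ψ-∷ a u)) p))

  Gen-ψ : ∀ {c} u → (∀ a → a ∈ u → a ∈ c) → Gen c (ψ u)
  Gen-ψ {c} [] h = subst (Gen c) (sym ψ-[]) gen-e
  Gen-ψ {c} (a ∷ u) h = subst (Gen c) (sym (ψ-∷ a u)) (gen-∙ (h a (here refl)) (Gen-ψ u (λ b q → h b (there q))))

  letters : ∀ {c} u → IsReduced u → Gen c (ψ u) → ∀ a → a ∈ u → a ∈ c
  letters {c} (b ∷ u) p g = all
    where
    b∈ : b ∈ c
    b∈ with Any.any? (b Finₚ.≟_) c
    ... | yes q = q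
    ... | no b∉ = ⊥-elim (Gen⇒¬Inv b∉ g (reduced-head {b} {u} p))
    all : ∀ a → a ∈ b ∷ u → a ∈ c
    all a (here refl) = b∈
    all a (there q) = letters u (reduced-tail {b} {u} p) (subst (Gen c) (sym (ψ-tail {b} {u} refl)) (gen-∙ b∈ g)) a q

  private
    conjs-ref : ∀ d g s → conjs (ref g s) d ≡ ref (ψ (reverse d) ∙ g) s
    conjs-ref [] g s = cong (λ z → ref z s) (sym (trans (cong (_∙ g) ψ-[]) (idˡ g)))
    conjs-ref (j ∷ d) g s = trans (cong (λ z → conjs z d) (conj-ref j g s)) (trans (conjs-ref d (gen j ∙ g) s) (cong (λ z → ref z s)
      (sym (trans (cong (_∙ g) (trans (cong ψ (Listₚ.unfold-reverse j d)) (ψ-∷ʳ (reverse d) j))) (assoc _ _ _)))))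

    final-ref : ∀ s d → conjs (gen s) d ≡ ref (ψ (reverse d)) s
    final-ref s d = trans (cong (λ z → conjs z d) (sym (ref-e s))) (trans (conjs-ref d e s) (cong (λ z → ref z s) (idʳ _)))

    ψ-rev-∷ : ∀ s d → ψ (reverse (s ∷ d)) ≡ ψ (reverse d) ∙ gen s
    ψ-rev-∷ s d = trans (cong ψ (Listₚ.unfold-reverse s d)) (ψ-∷ʳ (reverse d) s)

    ∈-reverse : ∀ {j : Fin n} (d : List (Fin n)) → j ∈ reverse d → j ∈ d
    ∈-reverse {j} (a ∷ d) q with ∈-++⁻ (reverse d) (subst (j ∈_) (Listₚ.unfold-reverse a d) q)
    ... | inj₁ k = there (∈-reverse d k)
    ... | inj₂ (here p) = here p

  Inv⇒Final : ∀ c {t} → Inv (ψ (reverse c)) t → ∃[ s ] Final c s t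
  Inv⇒Final [] {t} i = ⊥-elim (Inv-e t (subst (λ g → Inv g t) ψ-[] i))
  Inv⇒Final (s ∷ c) {t} i with add⇒ (subst (λ g → Inv g t) (ψ-rev-∷ s c) i)
  ... | inj₁ p = s , here (trans p (sym (final-ref s c)))
  ... | inj₂ j with Inv⇒Final c j
  ... | r , f = r , there f

  Final⇒Inv : ∀ {c s t} → Unique c → Final c s t → Inv (ψ (reverse c)) t
  Final⇒Inv {s ∷ c} {t = t} u f = subst (λ g → Inv g t) (sym (ψ-rev-∷ s c)) (go f)
    where
    p : P (ψ (reverse c)) s
    p with P? (ψ (reverse c)) s
    ... | yes q = q
    ... | no ¬q = ⊥-elim (uniq∉ u (Gen-descent (Gen-ψ (reverse c) (λ a → ∈-reverse c)) ¬q))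
    go : ∀ {r} → Final (s ∷ c) r t → Inv (ψ (reverse c) ∙ gen s) t
    go (here q) = subst (Inv (ψ (reverse c) ∙ gen s)) (sym (trans q (final-ref s c))) (add-new p)
    go (there f) = add⊑ p t (Final⇒Inv (uniq-tail u) f)

  final-exists : ∀ {c s} → s ∈ c → ∃[ t ] Final c s t
  final-exists {s ∷ d} (here refl) = conjs (gen s) d , here refl
  final-exists (there q) with final-exists q
  ... | t , f = t , there f

  -- Sorting words

  module Sorting (σ : Fin n → Fin n) where
    open Cambrian σ

    <P-trans : ∀ {p q r} → p <P q → q <P r → p <P r
    <P-trans (inj₁ a) (inj₁ b) = inj₁ (ℕₚ.<-trans a b)
    <P-trans (inj₁ a) (inj₂ (refl , _)) = inj₁ a
    <P-trans (inj₂ (refl , _)) (inj₁ b) = inj₁ b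
    <P-trans (inj₂ (refl , a)) (inj₂ (refl , b)) = inj₂ (refl , ℕₚ.<-trans a b)

    <P-irrefl : ∀ {p} → ¬ p <P p
    <P-irrefl (inj₁ a) = ℕₚ.<-irrefl refl a
    <P-irrefl (inj₂ (_ , a)) = ℕₚ.<-irrefl refl a

    next : Pos → Pos
    next (k , j) = suc k , j

    next-mono : ∀ {p q} → p <P q → next p <P next q
    next-mono (inj₁ a) = inj₁ (s≤s a)
    next-mono (inj₂ (refl , a)) = inj₂ (refl , a)

    <next : ∀ p → p <P next p
    <next (k , j) = inj₁ ℕₚ.≤-refl

    -- D lists the next usable position of each letter still in play; these positions fill one period of c^∞.
    Window : List Pos → Set
    Window [] = ⊤
    Window (p ∷ D) = All (_<P next p) D

    State : List Pos → Set
    State D = AllPairs _<P_ D × Window D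

    state-skip : ∀ {p D} → State (p ∷ D) → State D
    state-skip {D = []} _ = [] , _
    state-skip {D = q ∷ D} ((p<q ∷ _) ∷ s , _ ∷ w) = s , All.map (λ r → <P-trans r (next-mono p<q)) w

    state-take : ∀ {p D} → State (p ∷ D) → State (D ++ [ next p ])
    state-take {p} {D} (p< ∷ s , w) = AllPairsₚ.++⁺ s ([] ∷ []) (All.map (λ r → r ∷ []) w) , window D p< w
      where
      window : ∀ D → All (p <P_) D → All (_<P next p) D → Window (D ++ [ next p ])
      window [] _ _ = []
      window (q ∷ D) (p<q ∷ _) (_ ∷ w) = Allₚ.++⁺ (All.map (λ r → <P-trans r (next-mono p<q)) w) (next-mono p<q ∷ [])

    -- Each letter is used only from its next usable copy on; this describes the subwords of the
    -- rest of c^∞ that remain available midway through the recursion.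
    Compatible : List Pos → List Pos → Set
    Compatible D qs = ∀ k j → (k , j) ∈ qs → ∃[ k₀ ] (k₀ ≤ k × (k₀ , j) ∈ D)

    head-least : ∀ {p D k j} → State (p ∷ D) → ∃[ k₀ ] (k₀ ≤ k × (k₀ , j) ∈ p ∷ D) → p ≡ (k , j) ⊎ p <P (k , j)
    head-least {k = k} ((_ ∷ _) , _) (k₀ , l , here refl) with ℕₚ.m≤n⇒m<n∨m≡n l
    ... | inj₁ a = inj₂ (inj₁ a)
    ... | inj₂ refl = inj₁ refl
    head-least {k = k} ((p< ∷ _) , _) (k₀ , l , there q) with ℕₚ.m≤n⇒m<n∨m≡n l
    ... | inj₁ a = inj₂ (<P-trans (All.lookup p< q) (inj₁ a))
    ... | inj₂ refl = inj₂ (All.lookup p< q)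

    after-head : ∀ {p D k j} → State (p ∷ D) → ∃[ k₀ ] (k₀ ≤ k × (k₀ , j) ∈ D ++ [ next p ]) → p <P (k , j)
    after-head {p} {D} {k} {j} (p< ∷ _ , _) (k₀ , l , q) = up (ℕₚ.m≤n⇒m<n∨m≡n l) (low (∈-++⁻ D q))
      where
      low : (k₀ , j) ∈ D ⊎ (k₀ , j) ∈ [ next p ] → p <P (k₀ , j)
      low (inj₁ r) = All.lookup p< r
      low (inj₂ (here refl)) = <next p
      up : k₀ < k ⊎ k₀ ≡ k → p <P (k₀ , j) → p <P (k , j)
      up (inj₁ a) r = <P-trans r (inj₁ a)
      up (inj₂ refl) r = r

    -- ps is the lexicographically first reduced subword for w among the positions still in play.
    record Sorted (D ps : List Pos) (w : G) : Set where
      field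
        increasing : AllPairs _<P_ ps
        compatible : Compatible D ps
        reduced : IsReduced (subword ps)
        value : ψ (subword ps) ≡ w
        -- The second alternative exempts the first usable position of a letter, whose predecessor
        -- is no longer in play.
        nested : ∀ k j → (suc k , j) ∈ ps → (k , j) ∈ ps ⊎ (suc k , j) ∈ D
        first : ∀ qs → AllPairs _<P_ qs → Compatible D qs → IsReduced (subword qs) → ψ (subword qs) ≡ w → LexLe ps qs

    ∈-letterAt : ∀ {p ps} → p ∈ ps → letterAt p ∈ subword ps
    ∈-letterAt = ∈-map⁺ letterAt

    compatible-letters : ∀ {D qs} → Compatible D qs → ∀ a → a ∈ subword qs → a ∈ subword D
    compatible-letters h a q with ∈-map⁻ letterAt q
    ... | (k , j) , r , refl with h k j r
    ... | k₀ , _ , r₀ = ∈-letterAt r₀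

    private
      step-compatible : ∀ {p D qs} → All (p <P_) qs → Compatible (p ∷ D) qs → Compatible (D ++ [ next p ]) qs
      step-compatible {p} {D} p< h k j q = go (h k j q) (All.lookup p< q)
        where
        go : ∃[ k₀ ] (k₀ ≤ k × (k₀ , j) ∈ p ∷ D) → p <P (k , j) → ∃[ k₀ ] (k₀ ≤ k × (k₀ , j) ∈ D ++ [ next p ])
        go (k₀ , l , there r) _ = k₀ , l , ∈-++⁺ˡ r
        go (k₀ , l , here refl) (inj₁ a) = suc k₀ , a , ∈-++⁺ʳ D (here refl)
        go (k₀ , l , here refl) (inj₂ (_ , a)) = ⊥-elim (ℕₚ.<-irrefl refl a)

      unstep-compatible : ∀ {p D qs} → Compatible (D ++ [ next p ]) qs → Compatible (p ∷ D) (p ∷ qs)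
      unstep-compatible {p} {D} h k j (here refl) = k , ℕₚ.≤-refl , here refl
      unstep-compatible {p} {D} h k j (there q) = go (h k j q)
        where
        split : ∀ {k₀} → k₀ ≤ k → (k₀ , j) ∈ D ⊎ (k₀ , j) ∈ [ next p ] → ∃[ k₀ ] (k₀ ≤ k × (k₀ , j) ∈ p ∷ D)
        split l (inj₁ r) = _ , l , there r
        split l (inj₂ (here refl)) = proj₁ p , ℕₚ.≤-trans (ℕₚ.n≤1+n _) l , here refl
        go : ∃[ k₀ ] (k₀ ≤ k × (k₀ , j) ∈ D ++ [ next p ]) → ∃[ k₀ ] (k₀ ≤ k × (k₀ , j) ∈ p ∷ D)
        go (k₀ , l , r) = split l (∈-++⁻ D r)

      after : ∀ {p D qs} → State (p ∷ D) → Compatible (D ++ [ next p ]) qs → All (p <P_) qs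
      after st h = All.tabulate λ {q} q∈ → after-head st (h (proj₁ q) (proj₂ q) q∈)

      drop-compatible : ∀ {p D qs c w} → letterAt p ∉ c → Gen c w → IsReduced (subword qs) → ψ (subword qs) ≡ w → Compatible (p ∷ D) qs → Compatible D qs
      drop-compatible {qs = qs} {c} p∉ g r v h k j q with h k j q
      ... | k₀ , l , there z = k₀ , l , z
      ... | k₀ , l , here refl = ⊥-elim (p∉ (letters (subword qs) r (subst (Gen c) (sym v) g) _ (∈-letterAt q)))

      S⇒Sorted-rec : ∀ {d w} → Unique d → S d w → ∀ D → d ≡ subword D → State D → ∃[ ps ] Sorted D ps w
      S⇒Sorted-rec u (nil refl) [] refl st = [] , record { increasing = [] ; compatible = λ _ _ () ; reduced = trans (cong ℓ ψ-[]) ℓ-e ; value = ψ-[] ; nested = λ _ _ () ; first = λ _ _ _ _ _ → nil }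
      S⇒Sorted-rec {w = w} u (skip ¬i x) (p ∷ D) refl st = build (S⇒Sorted-rec (uniq-tail u) x D refl (state-skip st))
        where
        build : ∃[ ps ] Sorted D ps w → ∃[ ps ] Sorted (p ∷ D) ps w
        build (ps , R) = ps , record { increasing = increasing ; compatible = λ k j q → weaken (compatible k j q) ; reduced = reduced ; value = value
            ; nested = λ k j q → weaken′ (nested k j q) ; first = λ qs a b r v → first qs a (drop-compatible (uniq∉ u) (S-Gen x) r v b) r v }
          where
          open Sorted R
          weaken : ∀ {k j} → ∃[ k₀ ] (k₀ ≤ k × (k₀ , j) ∈ D) → ∃[ k₀ ] (k₀ ≤ k × (k₀ , j) ∈ p ∷ D)
          weaken (k₀ , l , q) = k₀ , l , there q
          weaken′ : ∀ {k j} → (k , j) ∈ ps ⊎ (suc k , j) ∈ D → (k , j) ∈ ps ⊎ (suc k , j) ∈ p ∷ D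
          weaken′ (inj₁ q) = inj₁ q
          weaken′ (inj₂ q) = inj₂ (there q)
      S⇒Sorted-rec {w = w} u (take {s} i x) (p ∷ D) refl st = build (S⇒Sorted-rec (uniq-rot u) x (D ++ [ next p ]) (sym (Listₚ.map-++ letterAt D [ next p ])) (state-take st))
        where
        build : ∃[ ps ] Sorted (D ++ [ next p ]) ps (gen s ∙ w) → ∃[ ps ] Sorted (p ∷ D) ps w
        build (ps , R) = p ∷ ps , record { increasing = after st compatible ∷ increasing ; compatible = unstep-compatible compatible
            ; reduced = reduced-∷ {s} {subword ps} (subst (λ g → ¬ Inv g (gen s)) (sym value) (Inv-s⇐ s w i)) reduced
            ; value = trans (ψ-∷ s (subword ps)) (trans (cong (gen s ∙_) value) (gg s w)) ; nested = nest ; first = fst′ }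
          where
          open Sorted R
          nest : ∀ k j → (suc k , j) ∈ p ∷ ps → (k , j) ∈ p ∷ ps ⊎ (suc k , j) ∈ p ∷ D
          nest k j (here q) = inj₂ (here q)
          nest k j (there q) = go (nested k j q)
            where
            split : (suc k , j) ∈ D ⊎ (suc k , j) ∈ [ next p ] → (k , j) ∈ p ∷ ps ⊎ (suc k , j) ∈ p ∷ D
            split (inj₁ r) = inj₂ (there r)
            split (inj₂ (here refl)) = inj₁ (here refl)
            go : (k , j) ∈ ps ⊎ (suc k , j) ∈ D ++ [ next p ] → (k , j) ∈ p ∷ ps ⊎ (suc k , j) ∈ p ∷ D
            go (inj₁ r) = inj₁ (there r)
            go (inj₂ r) = split (∈-++⁻ D r)
          fst′ : ∀ qs → AllPairs _<P_ qs → Compatible (p ∷ D) qs → IsReduced (subword qs) → ψ (subword qs) ≡ w → LexLe (p ∷ ps) qs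
          fst′ [] a b r v = ⊥-elim (Inv-e (gen s) (subst (λ g → Inv g (gen s)) (trans (sym v) ψ-[]) i))
          fst′ (q ∷ qs) (q< ∷ a) b r v = go (head-least st (b (proj₁ q) (proj₂ q) (here refl)))
            where
            go : p ≡ q ⊎ p <P q → LexLe (p ∷ ps) (q ∷ qs)
            go (inj₂ l) = less l
            go (inj₁ refl) = same (first qs a (step-compatible q< (λ k j z → b k j (there z))) (reduced-tail {s} {subword qs} r) (ψ-tail {s} {subword qs} v))

    S⇒Sorted : ∀ {D w} → Unique (subword D) → State D → S (subword D) w → ∃[ ps ] Sorted D ps w
    S⇒Sorted {D} u st x = S⇒Sorted-rec u x D refl st

    private
      -- Spends one copy of c per letter of v. The result is no sorting word, only a competitor that
      -- lexicographic minimality can be tested against.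
      place : ∀ E K v → (∀ k j → (k , j) ∈ E → k ≤ K) → (∀ a → a ∈ v → a ∈ subword E) →
        ∃[ qs ] (subword qs ≡ v × AllPairs _<P_ qs × All (λ q → K ≤ proj₁ q) qs × Compatible E qs)
      place E K [] h l = [] , refl , [] , [] , λ _ _ ()
      place E K (a ∷ v) h l with ∈-map⁻ letterAt (l a (here refl)) | place E (suc K) v (λ k j q → ℕₚ.≤-trans (h k j q) (ℕₚ.n≤1+n K)) (λ b q → l b (there q))
      ... | (k₀ , j₀) , r , refl | qs , refl , inc , low , com = (K , j₀) ∷ qs , refl , All.map inj₁ low ∷ inc , ℕₚ.≤-refl ∷ All.map (ℕₚ.≤-trans (ℕₚ.n≤1+n K)) low ,
          λ { k j (here refl) → k₀ , h k₀ j₀ r , r ; k j (there q) → com k j q }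

      Sorted⇒S-rec : ∀ b D ps {w} → length D ℕ.+ length ps < b → Unique (subword D) → State D → Sorted D ps w → S (subword D) w
      Sorted⇒S-rec b [] [] l u st R = nil (trans (sym (Sorted.value R)) ψ-[])
      Sorted⇒S-rec b [] ((k , j) ∷ ps) l u st R with Sorted.compatible R k j (here refl)
      ... | _ , _ , ()
      Sorted⇒S-rec (suc b) (p ∷ D) ps {w} (s≤s l) u st R = go (Inv? w (gen s))
        where
        open Sorted R
        s : Fin n
        s = letterAt p
        go : Dec (Inv w (gen s)) → S (subword (p ∷ D)) w
        go (no ¬i) = skip ¬i (Sorted⇒S-rec b D ps l (uniq-tail u) (state-skip st) (record { increasing = increasing ; compatible = compatible′ ; reduced = reduced ; value = value
              ; nested = λ k j q → nested′ k j q (nested k j q)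
              ; first = λ qs a c r v → first qs a (λ k j q → weaken (c k j q)) r v }))
          where
          weaken : ∀ {k j} → ∃[ k₀ ] (k₀ ≤ k × (k₀ , j) ∈ D) → ∃[ k₀ ] (k₀ ≤ k × (k₀ , j) ∈ p ∷ D)
          weaken (k₀ , l , q) = k₀ , l , there q
          not-head : ∀ qs → AllPairs _<P_ qs → Compatible (p ∷ D) qs → IsReduced (subword qs) → ψ (subword qs) ≡ w → p ∉ qs
          not-head (q ∷ qs) _ c r v (here refl) = ¬i (subst (λ g → Inv g (gen s)) v (reduced-head {s} {subword qs} r))
          not-head (q ∷ qs) (q< ∷ _) c r v (there z) = clash (head-least st (c (proj₁ q) (proj₂ q) (here refl))) (All.lookup q< z)
            where
            clash : p ≡ q ⊎ p <P q → q <P p → ⊥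
            clash (inj₁ refl) y = <P-irrefl y
            clash (inj₂ x) y = <P-irrefl (<P-trans x y)
          p∉ : p ∉ ps
          p∉ = not-head ps increasing compatible reduced value
          not-later : ∀ {k} → proj₁ p < k → (k , proj₂ p) ∉ p ∷ D
          not-later a (here refl) = ℕₚ.<-irrefl refl a
          not-later {k} a (there q) = late (All.lookup (proj₂ st) q)
            where
            late : (k , proj₂ p) <P next p → ⊥
            late (inj₁ z) = ℕₚ.<⇒≱ a (ℕₚ.≤-pred z)
            late (inj₂ (_ , z)) = ℕₚ.<-irrefl refl z
          unused : ∀ k → (k , proj₂ p) ∉ ps
          -- A later copy of the letter of p would, by nestedness, bring in the copy before it, and
          -- so on down to p itself.
          unused k q = descend k q (head-least st (compatible k (proj₂ p) q))
            where
            descend : ∀ k → (k , proj₂ p) ∈ ps → p ≡ (k , proj₂ p) ⊎ p <P (k , proj₂ p) → ⊥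
            descend k q (inj₁ z) = p∉ (subst (_∈ ps) (sym z) q)
            descend k q (inj₂ (inj₂ (_ , z))) = ℕₚ.<-irrefl refl z
            descend (suc k) q (inj₂ (inj₁ z)) = down (nested k (proj₂ p) q)
              where
              down : (k , proj₂ p) ∈ ps ⊎ (suc k , proj₂ p) ∈ p ∷ D → ⊥
              down (inj₁ y) = descend k y (head-least st (compatible k (proj₂ p) y))
              down (inj₂ y) = not-later z y
          compatible′ : Compatible D ps
          compatible′ k j q = pick (compatible k j q)
            where
            pick : ∃[ k₀ ] (k₀ ≤ k × (k₀ , j) ∈ p ∷ D) → ∃[ k₀ ] (k₀ ≤ k × (k₀ , j) ∈ D)
            pick (k₀ , l , there z) = k₀ , l , z
            pick (k₀ , l , here refl) = ⊥-elim (unused k q)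
          nested′ : ∀ k j → (suc k , j) ∈ ps → (k , j) ∈ ps ⊎ (suc k , j) ∈ p ∷ D → (k , j) ∈ ps ⊎ (suc k , j) ∈ D
          nested′ k j q (inj₁ z) = inj₁ z
          nested′ k j q (inj₂ (there z)) = inj₂ z
          nested′ k j q (inj₂ (here refl)) = ⊥-elim (p∉ q)
        go (yes i) = embed (ℓ-word (gen s ∙ w))
          where
          g : Gen (subword (p ∷ D)) w
          g = subst (Gen (subword (p ∷ D))) value (Gen-ψ (subword ps) (compatible-letters compatible))
          copies : ∀ k j → (k , j) ∈ p ∷ D → k ≤ suc (proj₁ p)
          copies k j (here refl) = ℕₚ.n≤1+n _
          copies k j (there q) = bound (All.lookup (proj₂ st) q)
            where
            bound : (k , j) <P next p → k ≤ suc (proj₁ p)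
            bound (inj₁ z) = ℕₚ.<⇒≤ z
            bound (inj₂ (z , _)) = ℕₚ.≤-reflexive z
          continue : ∀ ps′ → ps ≡ p ∷ ps′ → S (subword (p ∷ D)) w
          continue ps′ refl = take i (subst (λ d → S d (gen s ∙ w)) (Listₚ.map-++ letterAt D [ next p ]) (Sorted⇒S-rec b (D ++ [ next p ]) ps′ shorter
                (subst Unique (sym (Listₚ.map-++ letterAt D [ next p ])) (uniq-rot u)) (state-take st) R′))
            where
            shorter : length (D ++ [ next p ]) ℕ.+ length ps′ < b
            shorter = subst (_< b) (sym (trans (cong (ℕ._+ length ps′) (Listₚ.length-++ D)) (ℕₚ.+-assoc (length D) 1 (length ps′)))) l
            p< : AllPairs _<P_ (p ∷ ps′) → All (p <P_) ps′
            p< (z ∷ _) = z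
            rest : AllPairs _<P_ (p ∷ ps′) → AllPairs _<P_ ps′
            rest (_ ∷ z) = z
            R′ : Sorted (D ++ [ next p ]) ps′ (gen s ∙ w)
            R′ = record { increasing = rest increasing ; compatible = step-compatible (p< increasing) (λ k j q → compatible k j (there q))
                        ; reduced = reduced-tail {s} {subword ps′} reduced ; value = ψ-tail {s} {subword ps′} value
                        ; nested = λ k j q → nest k j q (nested k j (there q))
                        ; first = λ qs a c r v → uncons (first (p ∷ qs) (after st c ∷ a) (unstep-compatible c)
                              (reduced-∷ {s} {subword qs} (subst (λ h → ¬ Inv h (gen s)) (sym v) (Inv-s⇐ s w i)) r) (trans (ψ-∷ s (subword qs)) (trans (cong (gen s ∙_) v) (gg s w)))) }
              where
              uncons : ∀ {qs} → LexLe (p ∷ ps′) (p ∷ qs) → LexLe ps′ qs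
              uncons (less z) = ⊥-elim (<P-irrefl z)
              uncons (same z) = z
              nest : ∀ k j → (suc k , j) ∈ ps′ → (k , j) ∈ p ∷ ps′ ⊎ (suc k , j) ∈ p ∷ D → (k , j) ∈ ps′ ⊎ (suc k , j) ∈ D ++ [ next p ]
              nest k j q (inj₁ (here refl)) = inj₂ (∈-++⁺ʳ D (here refl))
              nest k j q (inj₁ (there z)) = inj₁ z
              nest k j q (inj₂ (here refl)) = ⊥-elim (<P-irrefl (All.lookup (p< increasing) q))
              nest k j q (inj₂ (there z)) = inj₂ (∈-++⁺ˡ z)
          leads : ∀ ps {qs} → Compatible (p ∷ D) ps → ψ (subword ps) ≡ w → LexLe ps (p ∷ qs) → ∃[ ps′ ] ps ≡ p ∷ ps′
          leads [] c v nil = ⊥-elim (Inv-e (gen s) (subst (λ h → Inv h (gen s)) (trans (sym v) ψ-[]) i))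
          leads (q ∷ ps) c v (less z) = clash (head-least st (c (proj₁ q) (proj₂ q) (here refl)))
            where
            clash : p ≡ q ⊎ p <P q → _
            clash (inj₁ refl) = ⊥-elim (<P-irrefl z)
            clash (inj₂ y) = ⊥-elim (<P-irrefl (<P-trans y z))
          leads (q ∷ ps) c v (same _) = ps , refl
          embed : Reach (ℓ (gen s ∙ w)) (gen s ∙ w) → S (subword (p ∷ D)) w
          embed (v , lv , ψv) = build (place (p ∷ D) (suc (proj₁ p)) v copies
                (letters v (trans (cong ℓ ψv) (sym lv)) (subst (Gen (subword (p ∷ D))) (sym ψv) (gen-∙ (here refl) g))))
            where
            build : ∃[ qs ] (subword qs ≡ v × AllPairs _<P_ qs × All (λ q → suc (proj₁ p) ≤ proj₁ q) qs × Compatible (p ∷ D) qs) → S (subword (p ∷ D)) w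
            build (qs , refl , inc , low , com) = let ps′ , eq = leads ps compatible value lex in continue ps′ eq
              where
              com′ : Compatible (p ∷ D) (p ∷ qs)
              com′ k j (here refl) = k , ℕₚ.≤-refl , here refl
              com′ k j (there q) = com k j q
              lex : LexLe ps (p ∷ qs)
              lex = first (p ∷ qs) (All.map inj₁ low ∷ inc) com′
                (reduced-∷ {s} {subword qs} (subst (λ h → ¬ Inv h (gen s)) (sym ψv) (Inv-s⇐ s w i)) (trans (cong ℓ ψv) (sym lv))) (trans (ψ-∷ s (subword qs)) (trans (cong (gen s ∙_) ψv) (gg s w)))

    Sorted⇒S : ∀ {D ps w} → Unique (subword D) → State D → Sorted D ps w → S (subword D) w
    Sorted⇒S {D} {ps} = Sorted⇒S-rec (suc (length D ℕ.+ length ps)) D ps ℕₚ.≤-refl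

    start : List Pos
    start = map (0 ,_) (allFin n)

    start-cw : subword start ≡ cw
    start-cw = sym (Listₚ.map-∘ (allFin n))

    start-state : State start
    start-state = AllPairsₚ.map⁺ (AllPairsₚ.tabulate⁺-< (λ l → inj₂ (refl , l))) , window (allFin n)
      where
      window : ∀ (js : List (Fin n)) → Window (map (0 ,_) js)
      window [] = _
      window (j ∷ js) = Allₚ.map⁺ (All.tabulate (λ _ → inj₁ (s≤s z≤n)))

    start-compatible : ∀ qs → Compatible start qs
    start-compatible qs k j _ = 0 , z≤n , ∈-map⁺ (0 ,_) (∈-allFin j)

    module _ (u : Unique cw) where
      private
        u′ : Unique (subword start)
        u′ = subst Unique (sym start-cw) u

      Sortable⇒ : ∀ {w} → Sortable w → S cw (ψ w)
      Sortable⇒ {w} (ps , ((inc , red , val) , fst) , nest) = subst (λ d → S d (ψ w)) start-cw (Sorted⇒S u′ start-state record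
        { increasing = Linkedₚ.Linked⇒AllPairs (λ {p} {q} {r} → <P-trans {p} {q} {r}) inc ; compatible = start-compatible ps ; reduced = Len⇒ red ; value = ψ-resp val
        ; nested = λ k j q → inj₁ (nest k j q)
        ; first = λ qs a _ r v → fst qs (Linkedₚ.AllPairs⇒Linked a , Reduced⇐ {subword qs} r , ψ⇒≈ v) })

      Sortable⇐ : ∀ {w} → S cw (ψ w) → Sortable w
      Sortable⇐ {w} x = build (S⇒Sorted u′ start-state (subst (λ d → S d (ψ w)) (sym start-cw) x))
        where
        build : ∃[ ps ] Sorted start ps (ψ w) → Sortable w
        build (ps , R) = ps , ((Linkedₚ.AllPairs⇒Linked increasing , Reduced⇐ {subword ps} reduced , ψ⇒≈ value) ,
            λ { qs (a , r , v) → first qs (Linkedₚ.Linked⇒AllPairs (λ {p} {q} {r} → <P-trans {p} {q} {r}) a) (start-compatible qs) (Len⇒ r) (ψ-resp v) }) , λ k j q → nest k j (nested k j q)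
          where
          open Sorted R
          nest : ∀ k j → (k , j) ∈ ps ⊎ (suc k , j) ∈ start → (k , j) ∈ ps
          nest k j (inj₁ q) = q
          nest k j (inj₂ q) with ∈-map⁻ (0 ,_) q
          ... | _ , _ , ()

-- The equivalences for words.

module Main {n : ℕ} (m : Fin n → Fin n → ℕ) (cox : IsCoxeterMatrix m) (T : Words.Table m) (σ : Fin n → Fin n) (σ-inj : Injective _≡_ _≡_ σ) where
  open Translation m cox T
  open Sorting σ
  open Coxeter m
  open Cambrian σ

  u : Unique cw
  u = Uniqueₚ.map⁺ σ-inj (Uniqueₚ.allFin⁺ n)

  full : ∀ j → j ∈ cw
  full j with injective⇒surjective σ σ-inj j
  ... | i , refl = ∈-map⁺ σ (∈-allFin i)

  word-sortable : ∀ {g} → S cw g → Sortable (word g)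
  word-sortable {g} x = Sortable⇐ u {word g} (subst (S cw) (sym (ψ-word g)) x)

  ≤W-word : ∀ {u g} → ψ u ⊑ g → u ≤W word g
  ≤W-word {u} {g} p = ≤W⇐ {u} {word g} (subst (ψ u ⊑_) (sym (ψ-word g)) p)

  word-≤W : ∀ {g u} → g ⊑ ψ u → word g ≤W u
  word-≤W {g} {u} p = ≤W⇐ {word g} {u} (subst (_⊑ ψ u) (sym (ψ-word g)) p)

  ≤W-word⁻ : ∀ {u g} → u ≤W word g → ψ u ⊑ g
  ≤W-word⁻ {u} {g} p = subst (ψ u ⊑_) (ψ-word g) (≤W⇒ {u} {word g} p)

  word-≤W⁻ : ∀ {g u} → word g ≤W u → g ⊑ ψ u
  word-≤W⁻ {g} {u} p = subst (_⊑ ψ u) (ψ-word g) (≤W⇒ {word g} {u} p)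

  -- The lower covers of x are the largest sortable elements avoiding one cover reflection.
  cover : ∀ {x t y} → Sortable x → Cov (ψ x) t → Avoids cw (ψ x) (_≡ t) y → CoverC (word y) x
  cover {x} {t} {y} Sx ct A = word-sortable sortable , Sx , word-≤W {u = x} below , (λ p → avoid t refl (≤W-word⁻ {x} p t (Cov⇒Inv ct))) , between
    where
    open Avoids A
    between : ∀ z → Sortable z → word y ≤W z → z ≤W x → z ≤W word y ⊎ x ≤W z
    between z Sz yz zx = go (Inv? (ψ z) t)
      where
      go : Dec (Inv (ψ z) t) → z ≤W word y ⊎ x ≤W z
      go (no ¬i) = inj₁ (≤W-word {z} (greatest (ψ z) (Sortable⇒ u {z} Sz) (≤W⇒ {z} {x} zx) (λ { r refl → ¬i })))
      -- z then contains t, and through y all other cover reflections of x, so it lies above x.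
      go (yes i) = inj₂ (≤W⇐ {x} {z} (⊑-by-Cov u (Sortable⇒ u {x} Sx) (Sortable⇒ u {z} Sz) covers))
        where
        covers : ∀ r → Cov (ψ x) r → Inv (ψ z) r
        covers r cr with r ≟G t
        ... | yes refl = i
        ... | no ne = word-≤W⁻ {y} {z} yz r (keeps u (Sortable⇒ u {x} Sx) (λ r → r ≟G t) (λ { r refl → ct }) A r cr ne)

  below-covers⇒avoids : ∀ {x v} → Sortable x → (∀ y → CoverC y x → v ≤W y) → ∀ t → Cov (ψ x) t → ¬ Inv (ψ v) t
  below-covers⇒avoids {x} {v} Sx h t ct i = go (avoiding u (λ r → r ≟G t) (λ { r refl → ct }))
    where
    go : ∃[ y ] Avoids cw (ψ x) (_≡ t) y → ⊥
    go (y , A) = Avoids.avoid A t refl (≤W-word⁻ {v} (h (word y) (cover {x} Sx ct A)) t i)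

  -- A lower cover y of x misses some cover reflection t, so it is below the largest sortable
  -- element z that avoids t. Nothing lies strictly between y and x, and z is not above x, so y is z
  -- up to equivalence and v lies below it.
  avoids⇒below-covers : ∀ {x v} → Sortable x → Sortable v → v ≤W x → (∀ t → Cov (ψ x) t → ¬ Inv (ψ v) t) → ∀ y → CoverC y x → v ≤W y
  avoids⇒below-covers {x} {v} Sx Sv vx h y (Sy , _ , yx , x≰y , gap) = go (missing-cov (≤W⇒ {y} {x} yx) (λ p → x≰y (≤W⇐ {x} {y} (λ t i → subst (λ g → Inv g t) (sym p) i))))
    where
    go : ∃[ t ] (Cov (ψ x) t × ¬ Inv (ψ y) t) → v ≤W y
    go (t , ct , ¬i) = largest (avoiding u (λ r → r ≟G t) (λ { r refl → ct }))
      where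
      largest : ∃[ z ] Avoids cw (ψ x) (_≡ t) z → v ≤W y
      largest (z , A) = pick (gap (word z) (word-sortable (Avoids.sortable A)) (≤W-word {y} (Avoids.greatest A (ψ y) (Sortable⇒ u {y} Sy) (≤W⇒ {y} {x} yx) (λ { r refl → ¬i }))) (word-≤W {u = x} (Avoids.below A)))
        where
        pick : word z ≤W y ⊎ x ≤W word z → v ≤W y
        pick (inj₁ p) = ≤W⇐ {v} {y} (⊑-trans (Avoids.greatest A (ψ v) (Sortable⇒ u {v} Sv) (≤W⇒ {v} {x} vx) (λ { r refl → h t ct })) (word-≤W⁻ {z} {y} p))
        pick (inj₂ p) = ⊥-elim (Avoids.avoid A t refl (≤W-word⁻ {x} p t (Cov⇒Inv ct)))

  PopDown⇒ : ∀ {x z} → Sortable x → PopDown x z → Pop cw (ψ x) (ψ z)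
  PopDown⇒ {x} {z} Sx (Sz , zx , h , gr) = avoids (Sortable⇒ u {z} Sz) (≤W⇒ {z} {x} zx) (below-covers⇒avoids {x} {z} Sx h) greatest
    where
    greatest : ∀ v → S cw v → v ⊑ ψ x → (∀ t → Cov (ψ x) t → ¬ Inv v t) → v ⊑ ψ z
    greatest v Sv vx f = word-≤W⁻ {v} {z} (gr (word v) (word-sortable Sv) (word-≤W {u = x} vx)
      (avoids⇒below-covers {x} {word v} Sx (word-sortable Sv) (word-≤W {u = x} vx) (λ t ct i → f t ct (subst (λ g → Inv g t) (ψ-word v) i))))

  PopDown⇐ : ∀ {x z} → Sortable x → Pop cw (ψ x) (ψ z) → PopDown x z
  PopDown⇐ {x} {z} Sx (avoids Sz zx h gr) = Sz′ , zx′ , avoids⇒below-covers {x} {z} Sx Sz′ zx′ h ,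
      λ v Sv vx f → ≤W⇐ {v} {z} (gr (ψ v) (Sortable⇒ u {v} Sv) (≤W⇒ {v} {x} vx) (below-covers⇒avoids {x} {v} Sx f))
    where
    Sz′ : Sortable z
    Sz′ = Sortable⇐ u {z} Sz
    zx′ : z ≤W x
    zx′ = ≤W⇐ {z} {x} zx

  BooleanInterval⇒ : ∀ {z w} → BooleanInterval z w → Boolean cw (ψ z) (ψ w)
  BooleanInterval⇒ {z} {w} (k , f , bounds , code , order) = k , (λ A → ψ (f A)) , bounds′ , code′ , order′
    where
    bounds′ : ∀ A → S cw (ψ (f A)) × ψ z ⊑ ψ (f A) × ψ (f A) ⊑ ψ w
    bounds′ A = let x , p , q = bounds A in Sortable⇒ u {f A} x , ≤W⇒ {z} {f A} p , ≤W⇒ {f A} {w} q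
    code′ : ∀ x → S cw x → ψ z ⊑ x → x ⊑ ψ w → ∃[ A ] ψ (f A) ≡ x
    code′ x Sx p q = let A , r = code (word x) (word-sortable Sx) (≤W-word {z} p) (word-≤W {u = w} q) in A , trans (ψ-resp r) (ψ-word x)
    preserves : ∀ A B → A ⊆ B → ψ (f A) ⊑ ψ (f B)
    preserves A B p = ≤W⇒ {f A} {f B} (Equivalence.from (order A B) p)
    reflects : ∀ A B → ψ (f A) ⊑ ψ (f B) → A ⊆ B
    reflects A B p = Equivalence.to (order A B) (≤W⇐ {f A} {f B} p)
    order′ : ∀ A B → (ψ (f A) ⊑ ψ (f B)) ⇔ (A ⊆ B)
    order′ A B = mk⇔ (reflects A B) (preserves A B)

  BooleanInterval⇐ : ∀ {z w} → Boolean cw (ψ z) (ψ w) → BooleanInterval z w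
  BooleanInterval⇐ {z} {w} (k , f , bounds , code , order) = k , (λ A → word (f A)) , bounds′ , code′ , order′
    where
    bounds′ : ∀ A → Sortable (word (f A)) × z ≤W word (f A) × word (f A) ≤W w
    bounds′ A = let x , p , q = bounds A in word-sortable x , ≤W-word {z} p , word-≤W {u = w} q
    code′ : ∀ x → Sortable x → z ≤W x → x ≤W w → ∃[ A ] word (f A) ≈ x
    code′ x Sx p q = let A , r = code (ψ x) (Sortable⇒ u {x} Sx) (≤W⇒ {z} {x} p) (≤W⇒ {x} {w} q) in A , ψ⇒≈ (trans (ψ-word (f A)) r)
    preserves : ∀ A B → A ⊆ B → word (f A) ≤W word (f B)
    preserves A B p = ≤W-word {word (f A)} (subst (_⊑ f B) (sym (ψ-word (f A))) (Equivalence.from (order A B) p))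
    reflects : ∀ A B → word (f A) ≤W word (f B) → A ⊆ B
    reflects A B p = Equivalence.to (order A B) (subst (_⊑ f B) (ψ-word (f A)) (≤W-word⁻ {word (f A)} p))
    order′ : ∀ A B → (word (f A) ≤W word (f B)) ⇔ (A ⊆ B)
    order′ A B = mk⇔ (reflects A B) (preserves A B)

  private
    ref-∙-ref : ∀ g a b → ref g a ∙ (ref g b ∙ g) ≡ g ∙ (gen a ∙ gen b)
    ref-∙-ref g a b = trans (cong (ref g a ∙_) (ref-self g b)) (trans (sym (assoc _ _ _)) (trans (cong (_∙ gen b) (ref-self g a)) (assoc _ _ _)))

  ref-commute⇒ : ∀ {g a b} → Commute (ref g a) (ref g b) → gen a ∙ gen b ≡ gen b ∙ gen a
  ref-commute⇒ {g} {a} {b} p = ∙-injˡ g (trans (sym (ref-∙-ref g a b)) (trans (sym (assoc _ _ _)) (trans (cong (_∙ g) p) (trans (assoc _ _ _) (ref-∙-ref g b a)))))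

  ref-commute⇐ : ∀ {g a b} → gen a ∙ gen b ≡ gen b ∙ gen a → Commute (ref g a) (ref g b)
  ref-commute⇐ {g} {a} {b} p = ∙-injʳ g (trans (assoc _ _ _) (trans (ref-∙-ref g a b) (trans (cong (g ∙_) p) (trans (sym (ref-∙-ref g b a)) (sym (assoc _ _ _))))))

  ψ-two : ∀ a b → ψ (a ∷ b ∷ []) ≡ gen a ∙ gen b
  ψ-two a b = trans (ψ-∷ a [ b ]) (cong (gen a ∙_) ψ-[ b ])

  module _ (w : Word) (Sw : Sortable w) where
    Sw′ : S cw (ψ w)
    Sw′ = Sortable⇒ u {w} Sw

    R : Roof cw (ψ w)
    R = roof u Sw′

    DescentsCommute NoCommonInversion JoinsNotBelow : Set
    DescentsCommute = ∀ s t → Descent s w → Descent t w → s ∷ t ∷ [] ≈ t ∷ s ∷ []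
    NoCommonInversion = ∀ t → ¬ (LeftInv t w × LeftInv t cinv)
    JoinsNotBelow = ∀ i p → IsJoinC (Θ i) p → ¬ (p ≤W w)

    Popped : Set
    Popped = ∃[ x ] (Sortable x × PopDown x w)

    popped⇒ : Popped → ψ w ⊑ Roof.top R
    popped⇒ (x , Sx , p) = pop⇒below u (Sortable⇒ u {x} Sx) (PopDown⇒ {x} {w} Sx p) R

    popped⇐ : ψ w ⊑ Roof.top R → Popped
    popped⇐ p = word (Roof.top R) , Sx , PopDown⇐ {word (Roof.top R)} {w} Sx (subst (λ g → Pop cw g (ψ w)) (sym (ψ-word _)) (below⇒pop u Sw′ R p))
      where
      Sx : Sortable (word (Roof.top R))
      Sx = word-sortable (Roof.sortable R)

    commute⇒ : DescentsCommute → ∀ t t′ → Cov (ψ w) t → Cov (ψ w) t′ → Commute t t′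
    commute⇒ h t t′ (a , ¬p , refl) (b , ¬q , refl) = ref-commute⇐ (trans (sym (ψ-two a b)) (trans (ψ-resp (h a b (Descent⇐ {a} {w} ¬p) (Descent⇐ {b} {w} ¬q))) (ψ-two b a)))

    commute⇐ : (∀ t t′ → Cov (ψ w) t → Cov (ψ w) t′ → Commute t t′) → DescentsCommute
    commute⇐ h a b p q = ψ⇒≈ (trans (ψ-two a b) (trans (ref-commute⇒ (h _ _ (a , Descent⇒ {a} {w} p , refl) (b , Descent⇒ {b} {w} q , refl))) (sym (ψ-two b a))))

    final⇒ : NoCommonInversion → ∀ s t → Final cw s t → ¬ Inv (ψ w) t
    final⇒ h s t f i = h (word t) (LeftInv⇐ {word t} {w} (subst (Inv (ψ w)) (sym (ψ-word t)) i) , LeftInv⇐ {word t} {cinv} (subst (Inv (ψ cinv)) (sym (ψ-word t)) (Final⇒Inv u f)))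

    final⇐ : (∀ s t → Final cw s t → ¬ Inv (ψ w) t) → NoCommonInversion
    final⇐ h t (i , j) = let s , f = Inv⇒Final cw (LeftInv⇒ {t} {cinv} j) in h s (ψ t) f (LeftInv⇒ {t} {w} i)

    joins⇒ : JoinsNotBelow → ∀ s t → Final cw s t → ¬ Inv (ψ w) t
    joins⇒ h i t f k = h i (word top) join′ (word-≤W {u = w} (final⇐′ (ψ w) t Sw′ f k))
      where
      -- `top` is itself a member of Θ_i and not only an upper bound, so it is the join at which the
      -- hypothesis is to be evaluated.
      open Theta (theta u full i) renaming (final⇐ to final⇐′)
      in-Θ : Θ i (word top)
      in-Θ = letter≤W⇐ {i} {word top} (subst (λ g → Inv g (gen i)) (sym (ψ-word top)) above) ,
        λ j ne p → only j ne (subst (λ g → Inv g (gen j)) (ψ-word top) (letter≤W⇒ {j} {word top} p))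
      join′ : IsJoinC (Θ i) (word top)
      join′ = word-sortable sortable ,
        (λ x Sx θ → ≤W-word {x} (greatest (ψ x) (Sortable⇒ u {x} Sx) (λ j ne k → proj₂ θ j ne (letter≤W⇐ {j} {x} k)))) ,
        (λ q Sq up → up (word top) (word-sortable sortable) in-Θ)

    joins⇐ : (∀ s t → Final cw s t → ¬ Inv (ψ w) t) → JoinsNotBelow
    joins⇐ h i p (Sp , up , _) p≤w = let t , f = final-exists (full i) in
        h i t f (≤W⇒ {p} {w} p≤w t (word-≤W⁻ {top} {p} (up (word top) (word-sortable sortable) in-Θ) t (final⇒′ t f)))
      where
      open Theta (theta u full i) renaming (final⇒ to final⇒′)
      in-Θ : Θ i (word top)
      in-Θ = letter≤W⇐ {i} {word top} (subst (λ g → Inv g (gen i)) (sym (ψ-word top)) above) ,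
        λ j ne p → only j ne (subst (λ g → Inv g (gen j)) (ψ-word top) (letter≤W⇒ {j} {word top} p))

    boolean⇒ : (∃[ z ] (PopDown w z × BooleanInterval z w)) → ∀ t t′ → Cov (ψ w) t → Cov (ψ w) t′ → Commute t t′
    boolean⇒ (z , p , b) = Boolean⇒commuting u Sw′ (PopDown⇒ {w} {z} Sw p) (BooleanInterval⇒ {z} {w} b)

    boolean⇐ : (∀ t t′ → Cov (ψ w) t → Cov (ψ w) t′ → Commute t t′) → ∃[ z ] (PopDown w z × BooleanInterval z w)
    boolean⇐ h = build (avoiding u (Cov? (ψ w)) (λ _ k → k))
      where
      build : ∃[ z ] Pop cw (ψ w) z → ∃[ z ] (PopDown w z × BooleanInterval z w)
      build (z , A) = word z , PopDown⇐ {w} {word z} Sw A′ , BooleanInterval⇐ {word z} {w} (commuting⇒Boolean u Sw′ h A′)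
        where
        A′ : Pop cw (ψ w) (ψ (word z))
        A′ = subst (Pop cw (ψ w)) (sym (ψ-word z)) A

    equivalences : (Popped ⇔ (DescentsCommute × NoCommonInversion)) × (Popped ⇔ ((∃[ z ] (PopDown w z × BooleanInterval z w)) × JoinsNotBelow))
    equivalences = mk⇔ (λ x → commute⇐ (com (popped⇒ x)) , final⇐ (fin (popped⇒ x))) (λ x → popped⇐ (¬final⇒below u Sw′ (commute⇒ (proj₁ x)) (final⇒ (proj₂ x))))
                 , mk⇔ (λ x → boolean⇐ (com (popped⇒ x)) , joins⇐ (fin (popped⇒ x))) (λ x → popped⇐ (¬final⇒below u Sw′ (boolean⇒ (proj₁ x)) (joins⇒ (proj₂ x))))
      where
      com : ψ w ⊑ Roof.top R → ∀ t t′ → Cov (ψ w) t → Cov (ψ w) t′ → Commute t t′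
      com = below⇒commute u Sw′
      fin : ψ w ⊑ Roof.top R → ∀ s t → Final cw s t → ¬ Inv (ψ w) t
      fin = below⇒¬final u Sw′ R

theorem7p8 : (n : ℕ) (m : Fin n → Fin n → ℕ) → IsCoxeterMatrix m →
    let open Coxeter m in
    Finite → Irreducible →
    (σ : Fin n → Fin n) → Injective _≡_ _≡_ σ →
    let open Cambrian σ in
    (w : Word) → Sortable w →
      ((∃[ x ] (Sortable x × PopDown x w))
        ⇔ ((∀ s t → Descent s w → Descent t w → s ∷ t ∷ [] ≈ t ∷ s ∷ [])
           × (∀ t → ¬ (LeftInv t w × LeftInv t cinv))))
    × ((∃[ x ] (Sortable x × PopDown x w))
        ⇔ ((∃[ z ] (PopDown w z × BooleanInterval z w))
           × (∀ i p → IsJoinC (Θ i) p → ¬ (p ≤W w))))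
theorem7p8 n m cox fin _ σ σ-inj w Sw = Main.equivalences m cox (Words.finite⇒table m fin) σ σ-inj w Sw
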